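{- For every integer $n\ge 0$, the following congruences hold: \begin{align*} c\phi_{9}(9n+3) &\equiv 0 \pmod{3^2}, & c\phi_{9}(9n+6) &\equiv 0 \pmod{3^3},\\ c\phi_{9}(27n+15) &\equiv 0 \pmod{3^5}, & c\phi_{9}(27n+24) &\equiv 0 \pmod{3^7},\\ c\phi_{9}(81n+51) &\equiv 0 \pmod{3^8}, & c\phi_{9}(81n+78) &\equiv 0 \pmod{3^9},\\ c\phi_{9}(243n+132) &\equiv 0 \pmod{3^{10}}, & c\phi_{9}(243n+213) &\equiv 0 \pmod{3^{12}},\\ c\phi_{9}(729n+456)&\equiv 0 \pmod{3^{13}}, & c\phi_{9}(729n+699)&\equiv 0 \pmod{3^{14}}. \end{align*}
   Context: For a positive integer $k$, color each nonnegative integer with each of $k$ colors $1,\dots,k$, writing $a_c$ for $a$ with color $c$, and order colored integers by $0_1\prec 0_2\prec\cdots\prec 0_k\prec 1_1\prec\cdots\prec 1_k\prec 2_1\prec\cdots$. A $k$-colored generalized Frobenius partition of $n$ is a two-row array $\begin{pmatrix} a_1,\dots,a_r\\ b_1,\dots,b_r\end{pmatrix}$ of colored integers with $a_r\prec a_{r-1}\prec\cdots\prec a_1$ and $b_r\prec\cdots\prec b_1$ and $n=r+\sum_{i=1}^r(a_i+b_i)$ (the sum using the underlying integers). $c\phi_k(n)$ denotes the number of $k$-colored generalized Frobenius partitions of $n$. Equivalently, $\sum_{n\ge0}c\phi_k(n)q^n=\frac{1}{(q;q)_\infty^k}\sum_{m_1,\dots,m_{k-1}\in\mathbb{Z}}q^{\sum_i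 m_i^2+\sum_{i<j}m_im_j}$, where $(q;q)_\infty=\prod_{n\ge1}(1-q^n)$. -}

module Defs where

open import Data.Nat using (ℕ; zero; suc; _+_; _*_; _<_; _≟_; _<?_)
open import Data.Fin using (Fin; toℕ)
open import Data.Product using (_×_; _,_; proj₁)
open import Data.Sum using (_⊎_)
open import Data.List using (List; []; _∷_; _++_; map; concatMap; length; filter; allFin; upTo; reverse)
open import Data.List.Relation.Unary.Linked using (Linked)
open import Data.Nat.ListAction using (sum)
open import Relation.Binary.PropositionalEquality using (_≡_)
open import Relation.Nullary using (Dec; yes; no)
open import Relation.Nullary.Decidable using (_×-dec_; _⊎-dec_)

ColInt : ℕ → Set
ColInt k = ℕ × Fin k

_≺_ : ∀ {k} → ColInt k → ColInt k → Set
(a , c) ≺ (b , d) = (a < b) ⊎ ((a ≡ b) × (toℕ c < toℕ d))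

_≺?_ : ∀ {k} (x y : ColInt k) → Dec (x ≺ y)
(a , c) ≺? (b , d) = (a <? b) ⊎-dec ((a ≟ b) ×-dec (toℕ c <? toℕ d))

Decreasing : ∀ {k} → List (ColInt k) → Set
Decreasing = Linked (λ x y → y ≺ x)

weight : ∀ {k} → List (ColInt k) → ℕ
weight xs = sum (map proj₁ xs)

-- A k-colored generalized Frobenius partition of n: two rows of equal length r,
-- both strictly decreasing, with n = r + Σ (a_i + b_i).
IsCGFP : (k n : ℕ) → List (ColInt k) → List (ColInt k) → Set
IsCGFP k n as bs =
  Decreasing as × Decreasing bs × (length as ≡ length bs) × (n ≡ length as + (weight as + weight bs))

sublists : ∀ {A : Set} → List A → List (List A)
sublists [] = [] ∷ []
sublists (x ∷ xs) = let s = sublists xs in map (x ∷_) s ++ s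

-- All colored integers with underlying integer ≤ n (any row entry of a partition of n
-- has underlying integer ≤ n), listed in ≺-decreasing order.
colored≤ : (k n : ℕ) → List (ColInt k)
colored≤ k n = reverse (concatMap (λ a → map (a ,_) (allFin k)) (upTo (suc n)))

-- Candidate rows: every row of a k-colored GFP of n occurs in this list (exactly once).
candidates : (k n : ℕ) → List (List (ColInt k))
candidates k n = sublists (colored≤ k n)

candidatePairs : (k n : ℕ) → List (List (ColInt k) × List (ColInt k))
candidatePairs k n = concatMap (λ as → map (as ,_) (candidates k n)) (candidates k n)

isCGFP? : (k n : ℕ) (p : List (ColInt k) × List (ColInt k)) → Dec (IsCGFP k n (Data.Product.proj₁ p) (Data.Product.proj₂ p))
isCGFP? k n (as , bs) =
  Data.List.Relation.Unary.Linked.linked? (λ x y → y ≺? x) as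
  ×-dec (Data.List.Relation.Unary.Linked.linked? (λ x y → y ≺? x) bs
  ×-dec ((length as ≟ length bs) ×-dec (n ≟ length as + (weight as + weight bs))))

cφ : ℕ → ℕ → ℕ
cφ k n = length (filter (isCGFP? k n) (candidatePairs k n))

{-# OPTIONS --safe #-}
module Submission where

-- Put E_k = ∏ (1 - q^{k n}), t = E₁³, e = E₃, g = E₉³. By Jacobi's triple product the generating series C of
-- cφ₉(n) is the constant term of θ(z)⁹ / E₁⁹, where θ(z) = Σ z^m q^{m² / 2}. Sorting the vectors of ℤ³ by their
-- coordinate sum modulo 3 expresses θ³ by theta series of the form a² + a b + b². The multiplicative norm of
-- R[C₃] over R, applied to θ(ζ z) and to E₁(ζ q), and the triple product for the three residue classes of θ turn
-- these into eta quotients. The result is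
--   e⁴ C = t (1 + 84 s + 1458 s² + 8748 s³ + 19683 s⁴),   s = q g / t,   s³ = w (1 + 9 s + 27 s²)
-- with w = q³ E₉¹² / E₃¹² a series in q³. So extracting the coefficients in a residue class modulo 3 is an operation
-- on polynomials in s reduced by the cubic equation, and five successive extractions, computed modulo 3¹⁴, show the
-- required powers of 3 as contents of the resulting polynomials.

open import Defs using (ColInt; _≺_; Decreasing; weight; IsCGFP; isCGFP?; sublists; colored≤; candidates; candidatePairs; cφ)
open import Algebra.Bundles using (CommutativeRing)
open import Level using (0ℓ)
open import Data.Empty using (⊥; ⊥-elim)
open import Data.Fin as Fin using (Fin)
open import Data.Fin.Patterns using (0F; 1F; 2F)
import Data.Fin.Properties as Finₚ
open import Data.Integer as ℤ using (ℤ; +_; -[1+_]; _⊖_)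
import Data.Integer.Properties as ℤₚ
import Data.Integer.Solver
import Algebra.Properties.AbelianGroup ℤₚ.+-0-abelianGroup as ℤGroup
open import Data.List using (List; []; _∷_; _++_; map; upTo; cartesianProduct; concatMap; reverse; length; filter; allFin)
import Data.List.Properties as Listₚ
open import Data.List.Membership.Propositional using (_∈_; _∉_; find)
open import Data.List.Membership.Propositional.Properties
  using (∈-∃++; ∈-map⁺; ∈-map⁻; ∈-cartesianProduct⁺; ∈-++⁺ˡ; ∈-++⁺ʳ; ∈-++⁻; ∈-upTo⁺; ∈-concatMap⁻)
import Data.List.Membership.DecPropositional as DecMembership
open import Data.List.Relation.Binary.Permutation.Propositional using (_↭_)
import Data.List.Relation.Binary.Permutation.Propositional as Perm
import Data.List.Relation.Binary.Permutation.Propositional.Properties as Permₚ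
open import Data.List.Relation.Unary.All using (All; []; _∷_)
import Data.List.Relation.Unary.All as All
import Data.List.Relation.Unary.All.Properties as Allₚ
open import Data.List.Relation.Unary.AllPairs using (AllPairs; []; _∷_)
import Data.List.Relation.Unary.AllPairs.Properties as AllPairsₚ
open import Data.List.Relation.Unary.Any using (here; there)
import Data.List.Relation.Unary.Any.Properties as Anyₚ
import Data.List.Relation.Unary.Linked.Properties as Linkedₚ
open import Data.List.Relation.Unary.Unique.Propositional using (Unique)
import Data.List.Relation.Unary.Unique.Propositional.Properties as Uniqueₚ
open import Data.Maybe using (Maybe; just; nothing)
open import Data.Nat as ℕ using (ℕ; zero; suc; z≤n; s≤s)
open import Data.Nat.Divisibility using (_∣_; divides)
import Data.Nat.DivMod as DivMod
import Data.Nat.Properties as ℕₚ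
import Data.Nat.Solver
open import Data.Product using (_×_; _,_; proj₁; proj₂; ∃)
open import Data.Product.Properties using (≡-dec)
open import Data.Sum using (_⊎_; inj₁; inj₂)
open import Data.Unit using (⊤; tt)
open import Data.Vec using (Vec; []; _∷_)
open import Relation.Binary using (DecidableEquality; Tri; tri<; tri≈; tri>)
import Relation.Binary.PropositionalEquality as ≡
open ≡ using (_≡_)
open import Relation.Nullary using (Dec; yes; no; ¬_)

-- Rings, power series, finitely supported sums

Ring₀ : Set₁
Ring₀ = CommutativeRing 0ℓ 0ℓ

module Integers (R : Ring₀) where
  open CommutativeRing R
  open import Relation.Binary.Reasoning.Setoid setoid
  open import Algebra.Properties.Ring ring
    using (-0#≈0#; -‿involutive; -‿+-comm; -‿distribˡ-*; -‿distribʳ-*)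

  fromℕ : ℕ → Carrier
  fromℕ 0 = 0#
  fromℕ 1 = 1#
  fromℕ (suc (suc n)) = 1# + fromℕ (suc n)

  fromℤ : ℤ → Carrier
  fromℤ (+ n) = fromℕ n
  fromℤ -[1+ n ] = - fromℕ (suc n)

  fromℕ-suc : ∀ n → fromℕ (suc n) ≈ 1# + fromℕ n
  fromℕ-suc zero = sym (+-identityʳ 1#)
  fromℕ-suc (suc n) = refl

  fromℕ-+ : ∀ m n → fromℕ (m ℕ.+ n) ≈ fromℕ m + fromℕ n
  fromℕ-+ zero n = sym (+-identityˡ _)
  fromℕ-+ (suc m) n = begin
    fromℕ (suc (m ℕ.+ n))  ≈⟨ fromℕ-suc (m ℕ.+ n) ⟩
    1# + fromℕ (m ℕ.+ n)  ≈⟨ +-congˡ (fromℕ-+ m n) ⟩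
    1# + (fromℕ m + fromℕ n) ≈⟨ +-assoc _ _ _ ⟨
    1# + fromℕ m + fromℕ n  ≈⟨ +-congʳ (fromℕ-suc m) ⟨
    fromℕ (suc m) + fromℕ n  ∎

  fromℕ-* : ∀ m n → fromℕ (m ℕ.* n) ≈ fromℕ m * fromℕ n
  fromℕ-* zero n = sym (zeroˡ _)
  fromℕ-* (suc m) n = begin
    fromℕ (n ℕ.+ m ℕ.* n)  ≈⟨ fromℕ-+ n (m ℕ.* n) ⟩
    fromℕ n + fromℕ (m ℕ.* n)  ≈⟨ +-cong (sym (*-identityˡ _)) (fromℕ-* m n) ⟩
    1# * fromℕ n + fromℕ m * fromℕ n  ≈⟨ distribʳ _ _ _ ⟨
    (1# + fromℕ m) * fromℕ n  ≈⟨ *-congʳ (fromℕ-suc m) ⟨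
    fromℕ (suc m) * fromℕ n  ∎

  fromℤ-neg : ∀ k → fromℤ (ℤ.- k) ≈ - fromℤ k
  fromℤ-neg (+ zero) = sym -0#≈0#
  fromℤ-neg (+ suc n) = refl
  fromℤ-neg -[1+ n ] = sym (-‿involutive _)

  fromℤ-⊖ : ∀ m n → fromℤ (m ⊖ n) ≈ fromℕ m + - fromℕ n
  fromℤ-⊖ m zero = sym (trans (+-congˡ -0#≈0#) (+-identityʳ _))
  fromℤ-⊖ zero (suc n) = sym (+-identityˡ _)
  fromℤ-⊖ (suc m) (suc n) = begin
    fromℤ (suc m ⊖ suc n)  ≡⟨ ≡.cong fromℤ (ℤₚ.[1+m]⊖[1+n]≡m⊖n m n) ⟩
    fromℤ (m ⊖ n)  ≈⟨ fromℤ-⊖ m n ⟩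
    fromℕ m + - fromℕ n  ≈⟨ +-congʳ (+-identityʳ _) ⟨
    fromℕ m + 0# + - fromℕ n  ≈⟨ +-congʳ (+-congˡ (-‿inverseʳ 1#)) ⟨
    fromℕ m + (1# + - 1#) + - fromℕ n  ≈⟨ +-congʳ (+-assoc _ _ _) ⟨
    fromℕ m + 1# + - 1# + - fromℕ n  ≈⟨ +-assoc _ _ _ ⟩
    fromℕ m + 1# + (- 1# + - fromℕ n)  ≈⟨ +-cong (+-comm _ _) (-‿+-comm _ _) ⟩
    1# + fromℕ m + - (1# + fromℕ n)  ≈⟨ +-cong (fromℕ-suc m) (-‿cong (fromℕ-suc n)) ⟨
    fromℕ (suc m) + - fromℕ (suc n)  ∎

  fromℤ-+ : ∀ j k → fromℤ (j ℤ.+ k) ≈ fromℤ j + fromℤ k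
  fromℤ-+ (+ m) (+ n) = fromℕ-+ m n
  fromℤ-+ (+ m) -[1+ n ] = fromℤ-⊖ m (suc n)
  fromℤ-+ -[1+ m ] (+ n) = trans (fromℤ-⊖ n (suc m)) (+-comm _ _)
  fromℤ-+ -[1+ m ] -[1+ n ] = begin
    - fromℕ (suc (suc (m ℕ.+ n)))  ≡⟨ ≡.cong (λ k → - fromℕ (suc k)) (≡.sym (ℕₚ.+-suc m n)) ⟩
    - fromℕ (suc m ℕ.+ suc n)  ≈⟨ -‿cong (fromℕ-+ (suc m) (suc n)) ⟩
    - (fromℕ (suc m) + fromℕ (suc n)) ≈⟨ -‿+-comm _ _ ⟨
    - fromℕ (suc m) + - fromℕ (suc n) ∎

  fromℤ-*+ : ∀ m k → fromℤ (+ m ℤ.* k) ≈ fromℕ m * fromℤ k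
  fromℤ-*+ m (+ n) = trans (reflexive (≡.cong fromℤ (≡.sym (ℤₚ.pos-* m n)))) (fromℕ-* m n)
  fromℤ-*+ m -[1+ n ] = begin
    fromℤ (+ m ℤ.* (ℤ.- + suc n))  ≡⟨ ≡.cong fromℤ (≡.sym (ℤₚ.neg-distribʳ-* (+ m) (+ suc n))) ⟩
    fromℤ (ℤ.- (+ m ℤ.* + suc n))  ≈⟨ fromℤ-neg (+ m ℤ.* + suc n) ⟩
    - fromℤ (+ m ℤ.* + suc n)  ≈⟨ -‿cong (fromℤ-*+ m (+ suc n)) ⟩
    - (fromℕ m * fromℕ (suc n))  ≈⟨ -‿distribʳ-* _ _ ⟩
    fromℕ m * - fromℕ (suc n)  ∎

  fromℤ-* : ∀ j k → fromℤ (j ℤ.* k) ≈ fromℤ j * fromℤ k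
  fromℤ-* (+ m) k = fromℤ-*+ m k
  fromℤ-* -[1+ m ] k = begin
    fromℤ ((ℤ.- + suc m) ℤ.* k) ≡⟨ ≡.cong fromℤ (≡.sym (ℤₚ.neg-distribˡ-* (+ suc m) k)) ⟩
    fromℤ (ℤ.- (+ suc m ℤ.* k)) ≈⟨ fromℤ-neg (+ suc m ℤ.* k) ⟩
    - fromℤ (+ suc m ℤ.* k)  ≈⟨ -‿cong (fromℤ-*+ (suc m) k) ⟩
    - (fromℕ (suc m) * fromℤ k) ≈⟨ -‿distribˡ-* _ _ ⟩
    - fromℕ (suc m) * fromℤ k  ∎

module Solver (R : Ring₀) where
  open CommutativeRing R using (refl; reflexive; _≈_)
  open Integers R
  open import Algebra.Solver.Ring.AlmostCommutativeRing

  private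
    _coeff≟_ : ∀ j k → Maybe (fromℤ j ≈ fromℤ k)
    j coeff≟ k with j ℤ.≟ k
    ... | yes j≡k = just (reflexive (≡.cong fromℤ j≡k))
    ... | no _ = nothing

    fromℤ-morphism : ℤ.+-*-rawRing -Raw-AlmostCommutative⟶ fromCommutativeRing R
    fromℤ-morphism = record
      { ⟦_⟧ = fromℤ ; +-homo = fromℤ-+ ; *-homo = fromℤ-* ; -‿homo = fromℤ-neg ; 0-homo = refl ; 1-homo = refl }

  open import Algebra.Solver.Ring ℤ.+-*-rawRing (fromCommutativeRing R) fromℤ-morphism _coeff≟_
    public using (solve; con; _:+_; _:*_; _:-_; _:=_; :-_; _:^_)

-- Valid singles out the coefficients that equality compares: all of them, or those below a bound.
module PowerSeries (R : Ring₀) (Valid : ℕ → Set) (down : ∀ n → Valid (suc n) → Valid n) where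
  private module R = CommutativeRing R
  open R using () renaming (_+_ to _⊕_; _*_ to _⊛_; _≈_ to _∼_)
  open Solver R
  open import Relation.Binary.Reasoning.Setoid R.setoid

  PS : Set
  PS = ℕ → R.Carrier

  tail : PS → PS
  tail f n = f (suc n)

  zeroS oneS X : PS
  zeroS _ = R.0#
  oneS zero = R.1#
  oneS (suc _) = R.0#
  X zero = R.0#
  X (suc n) = oneS n

  add mul : PS → PS → PS
  add f g n = f n ⊕ g n
  mul f g zero = f zero ⊛ g zero
  mul f g (suc n) = f zero ⊛ g (suc n) ⊕ mul (tail f) g n

  neg : PS → PS
  neg f n = R.- f n

  infix 4 _≋_
  record _≋_ (f g : PS) : Set where
    constructor mk
    field at : ∀ n → Valid n → f n ∼ g n
  open _≋_ public

  valid-≤ : ∀ {m n} → m ℕ.≤ n → Valid n → Valid m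
  valid-≤ m≤n v = go (ℕₚ.≤⇒≤′ m≤n) v
    where
    go : ∀ {m n} → m ℕ.≤′ n → Valid n → Valid m
    go ℕ.≤′-refl v = v
    go (ℕ.≤′-step p) v = go p (down _ v)

  mul-local : ∀ n {f f′ g g′} → (∀ i → i ℕ.≤ n → f i ∼ f′ i) → (∀ i → i ℕ.≤ n → g i ∼ g′ i) →
              mul f g n ∼ mul f′ g′ n
  mul-local zero p q = R.*-cong (p 0 z≤n) (q 0 z≤n)
  mul-local (suc n) p q = R.+-cong (R.*-cong (p 0 z≤n) (q (suc n) ℕₚ.≤-refl))
    (mul-local n (λ i i≤n → p (suc i) (s≤s i≤n)) (λ i i≤n → q i (ℕₚ.m≤n⇒m≤1+n i≤n)))

  mul-cong : ∀ {f f′ g g′} → f ≋ f′ → g ≋ g′ → mul f g ≋ mul f′ g′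
  mul-cong p q = mk λ n v → mul-local n (λ i i≤n → at p i (valid-≤ i≤n v)) (λ i i≤n → at q i (valid-≤ i≤n v))

  mul-zeroˡ : ∀ g n → mul zeroS g n ∼ R.0#
  mul-zeroˡ g zero = R.zeroˡ _
  mul-zeroˡ g (suc n) = R.trans (R.+-cong (R.zeroˡ _) (mul-zeroˡ g n)) (R.+-identityʳ _)

  mul-oneˡ : ∀ g n → mul oneS g n ∼ g n
  mul-oneˡ g zero = R.*-identityˡ _
  mul-oneˡ g (suc n) = R.trans (R.+-cong (R.*-identityˡ _) (mul-zeroˡ g n)) (R.+-identityʳ _)

  mul-Xˡ : ∀ g n → mul X g (suc n) ∼ g n
  mul-Xˡ g n = R.trans (R.+-cong (R.zeroˡ _) (mul-oneˡ g n)) (R.+-identityˡ _)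

  mul-X-zero : ∀ g → mul X g 0 ∼ R.0#
  mul-X-zero g = R.zeroˡ _

  mul-sucʳ : ∀ f g n → mul f g (suc n) ∼ mul f (tail g) n ⊕ f (suc n) ⊛ g zero
  mul-sucʳ f g zero = R.refl
  mul-sucʳ f g (suc n) = R.trans (R.+-congˡ (mul-sucʳ (tail f) g n)) (R.sym (R.+-assoc _ _ _))

  mul-comm : ∀ f g n → mul f g n ∼ mul g f n
  mul-comm f g zero = R.*-comm _ _
  mul-comm f g (suc n) = begin
    mul f g (suc n)  ≈⟨ mul-sucʳ f g n ⟩
    mul f (tail g) n ⊕ f (suc n) ⊛ g zero  ≈⟨ R.+-cong (mul-comm f (tail g) n) (R.*-comm _ _) ⟩
    mul (tail g) f n ⊕ g zero ⊛ f (suc n)  ≈⟨ R.+-comm _ _ ⟩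
    g zero ⊛ f (suc n) ⊕ mul (tail g) f n  ∎

  mul-distribʳ : ∀ h f g n → mul (add f g) h n ∼ mul f h n ⊕ mul g h n
  mul-distribʳ h f g zero = R.distribʳ _ _ _
  mul-distribʳ h f g (suc n) = R.trans (R.+-congˡ (mul-distribʳ h (tail f) (tail g) n))
    (solve 5 (λ a b c d e → (a :+ b) :* c :+ (d :+ e) := a :* c :+ d :+ (b :* c :+ e)) R.refl
      (f 0) (g 0) (h (suc n)) (mul (tail f) h n) (mul (tail g) h n))

  mul-scaleˡ : ∀ c f g n → mul (λ i → c ⊛ f i) g n ∼ c ⊛ mul f g n
  mul-scaleˡ c f g zero = R.*-assoc _ _ _
  mul-scaleˡ c f g (suc n) = R.trans (R.+-congˡ (mul-scaleˡ c (tail f) g n))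
    (solve 4 (λ c a b d → c :* a :* b :+ c :* d := c :* (a :* b :+ d)) R.refl c (f 0) (g (suc n)) (mul (tail f) g n))

  mul-assoc : ∀ f g h n → mul (mul f g) h n ∼ mul f (mul g h) n
  mul-assoc f g h zero = R.*-assoc _ _ _
  mul-assoc f g h (suc n) = begin
    f 0 ⊛ g 0 ⊛ h (suc n) ⊕ mul (add (λ i → f 0 ⊛ tail g i) (mul (tail f) g)) h n
      ≈⟨ R.+-congˡ (mul-distribʳ h (λ i → f 0 ⊛ tail g i) (mul (tail f) g) n) ⟩
    f 0 ⊛ g 0 ⊛ h (suc n) ⊕ (mul (λ i → f 0 ⊛ tail g i) h n ⊕ mul (mul (tail f) g) h n)
      ≈⟨ R.+-congˡ (R.+-cong (mul-scaleˡ (f 0) (tail g) h n) (mul-assoc (tail f) g h n)) ⟩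
    f 0 ⊛ g 0 ⊛ h (suc n) ⊕ (f 0 ⊛ mul (tail g) h n ⊕ mul (tail f) (mul g h) n)
      ≈⟨ solve 5 (λ a b c d e → a :* b :* c :+ (a :* d :+ e) := a :* (b :* c :+ d) :+ e) R.refl
           (f 0) (g 0) (h (suc n)) (mul (tail g) h n) (mul (tail f) (mul g h) n) ⟩
    f 0 ⊛ (g 0 ⊛ h (suc n) ⊕ mul (tail g) h n) ⊕ mul (tail f) (mul g h) n ∎

  psRing : Ring₀
  psRing = record
    { Carrier = PS ; _≈_ = _≋_ ; _+_ = add ; _*_ = mul ; -_ = neg ; 0# = zeroS ; 1# = oneS
    ; isCommutativeRing = record
      { isRing = record
        { +-isAbelianGroup = record
          { isGroup = record
            { isMonoid = record
              { isSemigroup = record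
                { isMagma = record
                  { isEquivalence = record
                    { refl = mk λ n _ → R.refl
                    ; sym = λ p → mk λ n v → R.sym (at p n v)
                    ; trans = λ p q → mk λ n v → R.trans (at p n v) (at q n v) }
                  ; ∙-cong = λ p q → mk λ n v → R.+-cong (at p n v) (at q n v) }
                ; assoc = λ f g h → mk λ n _ → R.+-assoc (f n) (g n) (h n) }
              ; identity = (λ f → mk λ n _ → R.+-identityˡ (f n)) , (λ f → mk λ n _ → R.+-identityʳ (f n)) }
            ; inverse = (λ f → mk λ n _ → R.-‿inverseˡ (f n)) , (λ f → mk λ n _ → R.-‿inverseʳ (f n))
            ; ⁻¹-cong = λ p → mk λ n v → R.-‿cong (at p n v) }
          ; comm = λ f g → mk λ n _ → R.+-comm (f n) (g n) }
        ; *-cong = mul-cong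
        ; *-assoc = λ f g h → mk λ n _ → mul-assoc f g h n
        ; *-identity = (λ f → mk λ n _ → mul-oneˡ f n)
                     , (λ f → mk λ n _ → R.trans (mul-comm f oneS n) (mul-oneˡ f n))
        ; distrib = (λ h f g → mk λ n _ → R.trans (mul-comm h (add f g) n)
                       (R.trans (mul-distribʳ h f g n) (R.+-cong (mul-comm f h n) (mul-comm g h n))))
                  , (λ h f g → mk λ n _ → mul-distribʳ h f g n) }
      ; *-comm = λ f g → mk λ n _ → mul-comm f g n } }

-- The group ring R[C₃] = R[ζ]/(ζ³ - 1), in the basis 1, ζ, ζ².
module GroupRing (R : Ring₀) where
  private module R = CommutativeRing R
  open R using () renaming (_+_ to _⊕_; _*_ to _⊛_; _≈_ to _∼_)
  open Solver R

  record K : Set where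
    no-eta-equality
    pattern
    constructor ⟨_,_,_⟩
    field c₀ c₁ c₂ : R.Carrier
  open K public

  infix 4 _≈₃_
  record _≈₃_ (x y : K) : Set where
    constructor eq
    field
      eq₀ : c₀ x ∼ c₀ y
      eq₁ : c₁ x ∼ c₁ y
      eq₂ : c₂ x ∼ c₂ y
  open _≈₃_ public

  addK mulK : K → K → K
  addK ⟨ a , b , c ⟩ ⟨ x , y , z ⟩ = ⟨ a ⊕ x , b ⊕ y , c ⊕ z ⟩
  mulK ⟨ a , b , c ⟩ ⟨ x , y , z ⟩ =
    ⟨ a ⊛ x ⊕ (b ⊛ z ⊕ c ⊛ y) , a ⊛ y ⊕ (b ⊛ x ⊕ c ⊛ z) , a ⊛ z ⊕ (b ⊛ y ⊕ c ⊛ x) ⟩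

  negK : K → K
  negK ⟨ a , b , c ⟩ = ⟨ R.- a , R.- b , R.- c ⟩

  ι : R.Carrier → K
  ι a = ⟨ a , R.0# , R.0# ⟩

  ζ : K
  ζ = ⟨ R.0# , R.1# , R.0# ⟩

  private
    mulK-cong : ∀ {x x′ y y′} → x ≈₃ x′ → y ≈₃ y′ → mulK x y ≈₃ mulK x′ y′
    mulK-cong {⟨ _ , _ , _ ⟩} {⟨ _ , _ , _ ⟩} {⟨ _ , _ , _ ⟩} {⟨ _ , _ , _ ⟩} (eq p q r) (eq s t u) = eq
      (R.+-cong (R.*-cong p s) (R.+-cong (R.*-cong q u) (R.*-cong r t)))
      (R.+-cong (R.*-cong p t) (R.+-cong (R.*-cong q s) (R.*-cong r u)))
      (R.+-cong (R.*-cong p u) (R.+-cong (R.*-cong q t) (R.*-cong r s)))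

    mulK-comm : ∀ x y → mulK x y ≈₃ mulK y x
    mulK-comm ⟨ a , b , c ⟩ ⟨ x , y , z ⟩ = eq
      (solve 6 (λ a b c x y z → a :* x :+ (b :* z :+ c :* y) := x :* a :+ (y :* c :+ z :* b)) R.refl a b c x y z)
      (solve 6 (λ a b c x y z → a :* y :+ (b :* x :+ c :* z) := x :* b :+ (y :* a :+ z :* c)) R.refl a b c x y z)
      (solve 6 (λ a b c x y z → a :* z :+ (b :* y :+ c :* x) := x :* c :+ (y :* b :+ z :* a)) R.refl a b c x y z)

    assoc-identity : ∀ a b c x y z p q r →
      (a ⊛ x ⊕ (b ⊛ z ⊕ c ⊛ y)) ⊛ p ⊕ ((a ⊛ y ⊕ (b ⊛ x ⊕ c ⊛ z)) ⊛ r ⊕ (a ⊛ z ⊕ (b ⊛ y ⊕ c ⊛ x)) ⊛ q) ∼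
      a ⊛ (x ⊛ p ⊕ (y ⊛ r ⊕ z ⊛ q)) ⊕ (b ⊛ (x ⊛ r ⊕ (y ⊛ q ⊕ z ⊛ p)) ⊕ c ⊛ (x ⊛ q ⊕ (y ⊛ p ⊕ z ⊛ r)))
    assoc-identity = solve 9 (λ a b c x y z p q r →
      (a :* x :+ (b :* z :+ c :* y)) :* p :+ ((a :* y :+ (b :* x :+ c :* z)) :* r :+ (a :* z :+ (b :* y :+ c :* x)) :* q) :=
      a :* (x :* p :+ (y :* r :+ z :* q)) :+ (b :* (x :* r :+ (y :* q :+ z :* p)) :+ c :* (x :* q :+ (y :* p :+ z :* r)))) R.refl

    mulK-assoc : ∀ x y z → mulK (mulK x y) z ≈₃ mulK x (mulK y z)
    mulK-assoc ⟨ a , b , c ⟩ ⟨ x , y , z ⟩ ⟨ p , q , r ⟩ = eq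
      (assoc-identity a b c x y z p q r)
      (solve 9 (λ a b c x y z p q r →
        (a :* x :+ (b :* z :+ c :* y)) :* q :+ ((a :* y :+ (b :* x :+ c :* z)) :* p :+ (a :* z :+ (b :* y :+ c :* x)) :* r) :=
        a :* (x :* q :+ (y :* p :+ z :* r)) :+ (b :* (x :* p :+ (y :* r :+ z :* q)) :+ c :* (x :* r :+ (y :* q :+ z :* p)))) R.refl
        a b c x y z p q r)
      (solve 9 (λ a b c x y z p q r →
        (a :* x :+ (b :* z :+ c :* y)) :* r :+ ((a :* y :+ (b :* x :+ c :* z)) :* q :+ (a :* z :+ (b :* y :+ c :* x)) :* p) :=
        a :* (x :* r :+ (y :* q :+ z :* p)) :+ (b :* (x :* q :+ (y :* p :+ z :* r)) :+ c :* (x :* p :+ (y :* r :+ z :* q)))) R.refl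
        a b c x y z p q r)

    mulK-oneˡ : ∀ x → mulK (ι R.1#) x ≈₃ x
    mulK-oneˡ ⟨ x , y , z ⟩ = eq
      (solve 3 (λ x y z → con (+ 1) :* x :+ (con (+ 0) :* z :+ con (+ 0) :* y) := x) R.refl x y z)
      (solve 3 (λ x y z → con (+ 1) :* y :+ (con (+ 0) :* x :+ con (+ 0) :* z) := y) R.refl x y z)
      (solve 3 (λ x y z → con (+ 1) :* z :+ (con (+ 0) :* y :+ con (+ 0) :* x) := z) R.refl x y z)

    mulK-distribʳ : ∀ w x y → mulK (addK x y) w ≈₃ addK (mulK x w) (mulK y w)
    mulK-distribʳ ⟨ p , q , r ⟩ ⟨ a , b , c ⟩ ⟨ x , y , z ⟩ = eq (lemma a b c x y z p q r) (lemma a b c x y z q r p)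
      (lemma a b c x y z r p q)
      where
      lemma : ∀ a b c x y z p q r → (a ⊕ x) ⊛ p ⊕ ((b ⊕ y) ⊛ r ⊕ (c ⊕ z) ⊛ q) ∼
              a ⊛ p ⊕ (b ⊛ r ⊕ c ⊛ q) ⊕ (x ⊛ p ⊕ (y ⊛ r ⊕ z ⊛ q))
      lemma = solve 9 (λ a b c x y z p q r → (a :+ x) :* p :+ ((b :+ y) :* r :+ (c :+ z) :* q) :=
              a :* p :+ (b :* r :+ c :* q) :+ (x :* p :+ (y :* r :+ z :* q))) R.refl

    sym₃ : ∀ {x y} → x ≈₃ y → y ≈₃ x
    sym₃ (eq p q r) = eq (R.sym p) (R.sym q) (R.sym r)

    trans₃ : ∀ {x y z} → x ≈₃ y → y ≈₃ z → x ≈₃ z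
    trans₃ (eq p q r) (eq s t u) = eq (R.trans p s) (R.trans q t) (R.trans r u)

    addK-cong : ∀ {x x′ y y′} → x ≈₃ x′ → y ≈₃ y′ → addK x y ≈₃ addK x′ y′
    addK-cong {⟨ _ , _ , _ ⟩} {⟨ _ , _ , _ ⟩} {⟨ _ , _ , _ ⟩} {⟨ _ , _ , _ ⟩} (eq p q r) (eq s t u) = eq (R.+-cong p s) (R.+-cong q t) (R.+-cong r u)

  groupRing : Ring₀
  groupRing = record
    { Carrier = K ; _≈_ = _≈₃_ ; _+_ = addK ; _*_ = mulK ; -_ = negK ; 0# = ι R.0# ; 1# = ι R.1#
    ; isCommutativeRing = record
      { isRing = record
        { +-isAbelianGroup = record
          { isGroup = record
            { isMonoid = record
              { isSemigroup = record
                { isMagma = record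
                  { isEquivalence = record { refl = eq R.refl R.refl R.refl ; sym = sym₃ ; trans = trans₃ }
                  ; ∙-cong = addK-cong }
                ; assoc = λ { ⟨ _ , _ , _ ⟩ ⟨ _ , _ , _ ⟩ ⟨ _ , _ , _ ⟩ → eq (R.+-assoc _ _ _) (R.+-assoc _ _ _) (R.+-assoc _ _ _) } }
              ; identity = (λ { ⟨ _ , _ , _ ⟩ → eq (R.+-identityˡ _) (R.+-identityˡ _) (R.+-identityˡ _) })
                         , (λ { ⟨ _ , _ , _ ⟩ → eq (R.+-identityʳ _) (R.+-identityʳ _) (R.+-identityʳ _) }) }
            ; inverse = (λ { ⟨ _ , _ , _ ⟩ → eq (R.-‿inverseˡ _) (R.-‿inverseˡ _) (R.-‿inverseˡ _) })
                      , (λ { ⟨ _ , _ , _ ⟩ → eq (R.-‿inverseʳ _) (R.-‿inverseʳ _) (R.-‿inverseʳ _) })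
            ; ⁻¹-cong = λ { {⟨ _ , _ , _ ⟩} {⟨ _ , _ , _ ⟩} (eq p q r) → eq (R.-‿cong p) (R.-‿cong q) (R.-‿cong r) } }
          ; comm = λ { ⟨ _ , _ , _ ⟩ ⟨ _ , _ , _ ⟩ → eq (R.+-comm _ _) (R.+-comm _ _) (R.+-comm _ _) } }
        ; *-cong = mulK-cong
        ; *-assoc = mulK-assoc
        ; *-identity = mulK-oneˡ , (λ x → trans₃ (mulK-comm x (ι R.1#)) (mulK-oneˡ x))
        ; distrib = (λ w x y → trans₃ (mulK-comm w (addK x y)) (trans₃ (mulK-distribʳ w x y)
                       (addK-cong (mulK-comm x w) (mulK-comm y w))))
                  , mulK-distribʳ }
      ; *-comm = mulK-comm } }

  norm : K → R.Carrier
  norm ⟨ a , b , c ⟩ = a ⊛ a ⊛ a ⊕ b ⊛ b ⊛ b ⊕ c ⊛ c ⊛ c R.- Integers.fromℤ R (+ 3) ⊛ (a ⊛ b ⊛ c)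

  norm-* : ∀ x y → norm (mulK x y) ∼ norm x ⊛ norm y
  norm-* ⟨ a , b , c ⟩ ⟨ x , y , z ⟩ = solve 6 (λ a b c x y z →
     let N = λ a b c → a :* a :* a :+ b :* b :* b :+ c :* c :* c :- con (+ 3) :* (a :* b :* c) in
     N (a :* x :+ (b :* z :+ c :* y)) (a :* y :+ (b :* x :+ c :* z)) (a :* z :+ (b :* y :+ c :* x)) := N a b c :* N x y z)
     R.refl a b c x y z

  norm-cong : ∀ {x y} → x ≈₃ y → norm x ∼ norm y
  norm-cong {⟨ _ , _ , _ ⟩} {⟨ _ , _ , _ ⟩} (eq p q r) = R.+-cong (R.+-cong (R.+-cong (cube p) (cube q)) (cube r))
                                  (R.-‿cong (R.*-congˡ (R.*-cong (R.*-cong p q) r)))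
    where
    cube : ∀ {a b} → a ∼ b → a ⊛ a ⊛ a ∼ b ⊛ b ⊛ b
    cube p = R.*-cong (R.*-cong p p) p

interval : ℕ → List ℤ
interval B = map +_ (upTo B) ++ map -[1+_] (upTo B)

module Sums (R : Ring₀) where
  open CommutativeRing R
  open Solver R
  open import Relation.Binary.Reasoning.Setoid setoid

  sumOver : ∀ {I : Set} → List I → (I → Carrier) → Carrier
  sumOver [] f = 0#
  sumOver (i ∷ is) f = f i + sumOver is f

  module _ {I : Set} where
    sum-cong : ∀ xs {f g : I → Carrier} → (∀ i → f i ≈ g i) → sumOver xs f ≈ sumOver xs g
    sum-cong [] p = refl
    sum-cong (x ∷ xs) p = +-cong (p x) (sum-cong xs p)

    sum-++ : ∀ xs ys (f : I → Carrier) → sumOver (xs ++ ys) f ≈ sumOver xs f + sumOver ys f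
    sum-++ [] ys f = sym (+-identityˡ _)
    sum-++ (x ∷ xs) ys f = trans (+-congˡ (sum-++ xs ys f)) (sym (+-assoc _ _ _))

    sum-*ˡ : ∀ c xs (f : I → Carrier) → c * sumOver xs f ≈ sumOver xs (λ i → c * f i)
    sum-*ˡ c [] f = zeroʳ c
    sum-*ˡ c (x ∷ xs) f = trans (distribˡ _ _ _) (+-congˡ (sum-*ˡ c xs f))

    sum-vanish : ∀ xs {f : I → Carrier} → (∀ i → i ∈ xs → f i ≈ 0#) → sumOver xs f ≈ 0#
    sum-vanish [] p = refl
    sum-vanish (x ∷ xs) p =
      trans (+-cong (p x (here ≡.refl)) (sum-vanish xs (λ i i∈ → p i (there i∈)))) (+-identityʳ _)

    sum-↭ : ∀ {xs ys} (f : I → Carrier) → xs ↭ ys → sumOver xs f ≈ sumOver ys f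
    sum-↭ f Perm.refl = refl
    sum-↭ f (Perm.prep x p) = +-congˡ (sum-↭ f p)
    sum-↭ f (Perm.swap x y p) = trans (+-congˡ (+-congˡ (sum-↭ f p)))
      (solve 3 (λ a b c → a :+ (b :+ c) := b :+ (a :+ c)) refl (f x) (f y) _)
    sum-↭ f (Perm.trans p q) = trans (sum-↭ f p) (sum-↭ f q)

    unique-↭ : ∀ {xs ys : List I} → xs ↭ ys → Unique xs → Unique ys
    unique-↭ Perm.refl u = u
    unique-↭ (Perm.prep x p) (a ∷ u) = Permₚ.All-resp-↭ p a ∷ unique-↭ p u
    unique-↭ (Perm.swap x y p) ((x≢y ∷ a) ∷ (b ∷ u)) =
      ((λ y≡x → x≢y (≡.sym y≡x)) ∷ Permₚ.All-resp-↭ p b) ∷ (Permₚ.All-resp-↭ p a ∷ unique-↭ p u)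
    unique-↭ (Perm.trans p q) u = unique-↭ q (unique-↭ p u)

    sum-support : DecidableEquality I → (f : I → Carrier) → ∀ xs ys → Unique xs → Unique ys →
                  (∀ i → i ∉ xs → i ∈ ys → f i ≈ 0#) → (∀ i → i ∈ xs → i ∉ ys → f i ≈ 0#) →
                  sumOver xs f ≈ sumOver ys f
    sum-support _≟_ f [] ys u v p q = sym (sum-vanish ys (λ i i∈ → p i (λ ()) i∈))
    sum-support _≟_ f (x ∷ xs) ys (x∉ ∷ u) v p q with DecMembership._∈?_ _≟_ x ys
    ... | no x∉ys = trans (+-cong (q x (here ≡.refl) x∉ys) (sum-support _≟_ f xs ys u v
            (λ i i∉ i∈ → p i (λ { (here ≡.refl) → x∉ys i∈ ; (there i∈xs) → i∉ i∈xs }) i∈)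
            (λ i i∈ i∉ → q i (there i∈) i∉))) (+-identityˡ _)
    ... | yes x∈ys with ∈-∃++ x∈ys
    ...   | as , bs , ≡.refl with Permₚ.shift x as bs
    ...     | perm with unique-↭ perm v
    ...       | x∉ys′ ∷ v′ = trans (+-congˡ (sum-support _≟_ f xs (as ++ bs) u v′
            (λ i i∉ i∈ → p i (λ { (here ≡.refl) → All.lookup x∉ys′ i∈ ≡.refl ; (there i∈xs) → i∉ i∈xs })
                             (Permₚ.∈-resp-↭ (Perm.↭-sym perm) (there i∈)))
            (λ i i∈ i∉ → q i (there i∈) (λ i∈ys → case i i∈ i∉ (Permₚ.∈-resp-↭ perm i∈ys)))))
            (sym (sum-↭ f perm))
      where
      case : ∀ i → i ∈ xs → i ∉ as ++ bs → i ∈ x ∷ as ++ bs → ⊥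
      case i i∈ i∉ (here ≡.refl) = All.lookup x∉ i∈ ≡.refl
      case i i∈ i∉ (there i∈′) = i∉ i∈′

  sum-map : ∀ {I J : Set} (h : I → J) xs (f : J → Carrier) → sumOver (map h xs) f ≡ sumOver xs (λ i → f (h i))
  sum-map h [] f = ≡.refl
  sum-map h (x ∷ xs) f = ≡.cong (λ s → f (h x) + s) (sum-map h xs f)

  sum-cartesian : ∀ {I J : Set} xs ys (f : I → Carrier) (g : J → Carrier) →
                  sumOver (cartesianProduct xs ys) (λ (i , j) → f i * g j) ≈ sumOver xs f * sumOver ys g
  sum-cartesian [] ys f g = sym (zeroˡ _)
  sum-cartesian (x ∷ xs) ys f g = begin
    sumOver (map (x ,_) ys ++ cartesianProduct xs ys) (λ (i , j) → f i * g j)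
      ≈⟨ sum-++ (map (x ,_) ys) _ _ ⟩
    sumOver (map (x ,_) ys) (λ (i , j) → f i * g j) + sumOver (cartesianProduct xs ys) (λ (i , j) → f i * g j)
      ≈⟨ +-cong (reflexive (sum-map (x ,_) ys _)) (sum-cartesian xs ys f g) ⟩
    sumOver ys (λ j → f x * g j) + sumOver xs f * sumOver ys g
      ≈⟨ +-congʳ (sum-*ˡ (f x) ys g) ⟨
    f x * sumOver ys g + sumOver xs f * sumOver ys g
      ≈⟨ distribʳ _ _ _ ⟨
    (f x + sumOver xs f) * sumOver ys g ∎

  -- Sums of finitely supported families over an arbitrary index type: the list may be any finite set
  -- containing the support.
  record HasSum {I : Set} (f : I → Carrier) (x : Carrier) : Set where
    constructor hasSum
    field
      support : List I
      unique  : Unique support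
      outside : ∀ i → i ∉ support → f i ≈ 0#
      total   : sumOver support f ≈ x
  open HasSum public

  hasSum-unique : ∀ {I : Set} {f : I → Carrier} {x y} → DecidableEquality I → HasSum f x → HasSum f y → x ≈ y
  hasSum-unique _≟_ (hasSum xs u o t) (hasSum ys v o′ t′) =
    trans (sym t) (trans (sum-support _≟_ _ xs ys u v (λ i i∉ _ → o i i∉) (λ i _ i∉ → o′ i i∉)) t′)

  hasSum-cong : ∀ {I : Set} {f g : I → Carrier} {x y} → (∀ i → f i ≈ g i) → x ≈ y → HasSum f x → HasSum g y
  hasSum-cong p q (hasSum xs u o t) =
    hasSum xs u (λ i i∉ → trans (sym (p i)) (o i i∉)) (trans (sum-cong xs (λ i → sym (p i))) (trans t q))

  hasSum-*ˡ : ∀ {I : Set} {f : I → Carrier} {x} c → HasSum f x → HasSum (λ i → c * f i) (c * x)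
  hasSum-*ˡ c (hasSum xs u o t) = hasSum xs u (λ i i∉ → trans (*-congˡ (o i i∉)) (zeroʳ c))
    (trans (sym (sum-*ˡ c xs _)) (*-congˡ t))

  hasSum-reindex : ∀ {I J : Set} {f : I → Carrier} {x} (to : J → I) (from : I → J) →
                   (∀ i → to (from i) ≡ i) → (∀ j → from (to j) ≡ j) →
                   HasSum f x → HasSum (λ j → f (to j)) x
  hasSum-reindex {f = f} to from to∘from from∘to (hasSum xs u o t) = hasSum (map from xs)
    (Uniqueₚ.map⁺ (λ {i} {j} p → ≡.trans (≡.sym (to∘from i)) (≡.trans (≡.cong to p) (to∘from j))) u)
    (λ j j∉ → o (to j) (λ to∈ → j∉ (≡.subst (_∈ map from xs) (from∘to j) (∈-map⁺ from to∈))))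
    (trans (reflexive (sum-map from xs _)) (trans (sum-cong xs (λ i → reflexive (≡.cong f (to∘from i)))) t))

  hasSum-× : ∀ {I J : Set} {f : I → Carrier} {g : J → Carrier} {x y} → DecidableEquality I →
             HasSum f x → HasSum g y → HasSum (λ (i , j) → f i * g j) (x * y)
  hasSum-× {f = f} {g} _≟_ (hasSum xs u o t) (hasSum ys v o′ t′) =
    hasSum (cartesianProduct xs ys) (Uniqueₚ.cartesianProduct⁺ u v) out
      (trans (sum-cartesian xs ys f g) (*-cong t t′))
    where
    out : ∀ ij → ij ∉ cartesianProduct xs ys → f (proj₁ ij) * g (proj₂ ij) ≈ 0#
    out (i , j) ij∉ with DecMembership._∈?_ _≟_ i xs
    ... | yes i∈ = trans (*-congˡ (o′ j (λ j∈ → ij∉ (∈-cartesianProduct⁺ i∈ j∈)))) (zeroʳ _)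
    ... | no i∉ = trans (*-congʳ (o i i∉)) (zeroˡ _)

  hasSum-Fin3 : ∀ {J : Set} {f : Fin 3 × J → Carrier} {x y z} →
                HasSum (λ j → f (0F , j)) x → HasSum (λ j → f (1F , j)) y → HasSum (λ j → f (2F , j)) z →
                HasSum f (x + (y + z))
  hasSum-Fin3 {J} {f} (hasSum xs u o t) (hasSum ys v o′ t′) (hasSum zs w o″ t″) =
    hasSum (map (0F ,_) xs ++ (map (1F ,_) ys ++ map (2F ,_) zs))
      (Uniqueₚ.++⁺ (tagged u) (Uniqueₚ.++⁺ (tagged v) (tagged w) (disjoint (λ ())))
        (λ (p , q) → disjoint′ p q))
      out
      (trans (sum-++ (map (0F ,_) xs) _ f) (+-cong (trans (reflexive (sum-map _ xs f)) t)
        (trans (sum-++ (map (1F ,_) ys) _ f) (+-cong (trans (reflexive (sum-map _ ys f)) t′)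
           (trans (reflexive (sum-map _ zs f)) t″)))))
    where
    tagged : ∀ {r : Fin 3} {xs : List J} → Unique xs → Unique (map (r ,_) xs)
    tagged = Uniqueₚ.map⁺ (λ { ≡.refl → ≡.refl })
    disjoint : ∀ {r s : Fin 3} {xs ys : List J} → ¬ r ≡ s → ∀ {p} → ¬ (p ∈ map (r ,_) xs × p ∈ map (s ,_) ys)
    disjoint r≢s (p , q) with ∈-map⁻ _ p | ∈-map⁻ _ q
    ... | _ , _ , ≡.refl | _ , _ , ≡.refl = r≢s ≡.refl
    disjoint′ : ∀ {p} → p ∈ map (0F ,_) xs → p ∈ map (1F ,_) ys ++ map (2F ,_) zs → ⊥
    disjoint′ p q with ∈-++⁻ (map (1F ,_) ys) q
    ... | inj₁ q₁ = disjoint {xs = xs} {ys} (λ ()) (p , q₁)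
    ... | inj₂ q₂ = disjoint {xs = xs} {zs} (λ ()) (p , q₂)
    out : ∀ rj → rj ∉ map (0F ,_) xs ++ (map (1F ,_) ys ++ map (2F ,_) zs) → f rj ≈ 0#
    out (0F , j) ∉ = o j (λ j∈ → ∉ (∈-++⁺ˡ (∈-map⁺ _ j∈)))
    out (1F , j) ∉ = o′ j (λ j∈ → ∉ (∈-++⁺ʳ (map (0F ,_) xs) (∈-++⁺ˡ (∈-map⁺ _ j∈))))
    out (2F , j) ∉ = o″ j (λ j∈ → ∉ (∈-++⁺ʳ (map (0F ,_) xs) (∈-++⁺ʳ (map (1F ,_) ys) (∈-map⁺ _ j∈))))

  hasSum-empty : ∀ {I : Set} {f : I → Carrier} → (∀ i → f i ≈ 0#) → HasSum f 0#
  hasSum-empty p = hasSum [] [] (λ i _ → p i) refl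

  hasSum-single : ∀ {I : Set} {f : I → Carrier} i → (∀ j → ¬ j ≡ i → f j ≈ 0#) → HasSum f (f i)
  hasSum-single i p = hasSum (i ∷ []) ([] ∷ []) (λ j j∉ → p j (λ { ≡.refl → j∉ (here ≡.refl) })) (+-identityʳ _)

  hasSum-interval : ∀ B {f : ℤ → Carrier} → (∀ n → B ℕ.≤ n → f (+ n) ≈ 0#) → (∀ n → B ℕ.≤ n → f -[1+ n ] ≈ 0#) →
                    HasSum f (sumOver (interval B) f)
  hasSum-interval B {f} p q = hasSum (interval B)
    (Uniqueₚ.++⁺ (Uniqueₚ.map⁺ ℤₚ.+-injective (Uniqueₚ.upTo⁺ B))
                 (Uniqueₚ.map⁺ ℤₚ.-[1+-injective (Uniqueₚ.upTo⁺ B)) disjoint)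
    out refl
    where
    disjoint : ∀ {k} → ¬ (k ∈ map +_ (upTo B) × k ∈ map -[1+_] (upTo B))
    disjoint (r , s) with ∈-map⁻ +_ r | ∈-map⁻ -[1+_] s
    ... | _ , _ , ≡.refl | _ , _ , ()
    out : ∀ k → k ∉ interval B → f k ≈ 0#
    out (+ n) ∉ with n ℕ.<? B
    ... | yes n<B = ⊥-elim (∉ (∈-++⁺ˡ (∈-map⁺ +_ (∈-upTo⁺ n<B))))
    ... | no n≮B = p n (ℕₚ.≮⇒≥ n≮B)
    out -[1+ n ] ∉ with n ℕ.<? B
    ... | yes n<B = ⊥-elim (∉ (∈-++⁺ʳ (map +_ (upTo B)) (∈-map⁺ -[1+_] (∈-upTo⁺ n<B))))
    ... | no n≮B = q n (ℕₚ.≮⇒≥ n≮B)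

 

-- Exponents of theta series

tri : ℕ → ℕ
tri zero = zero
tri (suc n) = suc n ℕ.+ tri n

-- T m = m (m + 1) / 2, so that T m - T (- m) = m and T m + T (- m) = m².
T : ℤ → ℕ
T (+ n) = tri n
T -[1+ n ] = tri n

n≤tri : ∀ n → n ℕ.≤ tri n
n≤tri zero = z≤n
n≤tri (suc n) = ℕₚ.m≤m+n (suc n) (tri n)

module ℤSolver = Data.Integer.Solver.+-*-Solver

2*tri : ∀ n → + 2 ℤ.* + tri n ≡ + n ℤ.* + n ℤ.+ + n
2*tri zero = ≡.refl
2*tri (suc n) = begin
  + 2 ℤ.* (+ suc n ℤ.+ + tri n)  ≡⟨ ℤₚ.*-distribˡ-+ (+ 2) (+ suc n) (+ tri n) ⟩
  + 2 ℤ.* + suc n ℤ.+ + 2 ℤ.* + tri n  ≡⟨ ≡.cong (λ k → + 2 ℤ.* + suc n ℤ.+ k) (2*tri n) ⟩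
  + 2 ℤ.* (+ 1 ℤ.+ + n) ℤ.+ (+ n ℤ.* + n ℤ.+ + n)
    ≡⟨ solve 1 (λ n → con (+ 2) :* (con (+ 1) :+ n) :+ (n :* n :+ n) := (con (+ 1) :+ n) :* (con (+ 1) :+ n) :+ (con (+ 1) :+ n))
         ≡.refl (+ n) ⟩
  + suc n ℤ.* + suc n ℤ.+ + suc n ∎
  where
  open ≡.≡-Reasoning
  open ℤSolver

2*T : ∀ m → + 2 ℤ.* + T m ≡ m ℤ.* m ℤ.+ m
2*T (+ n) = 2*tri n
2*T -[1+ n ] = ≡.trans (2*tri n)
  (solve 1 (λ n → n :* n :+ n := (:- (con (+ 1) :+ n)) :* (:- (con (+ 1) :+ n)) :+ (:- (con (+ 1) :+ n))) ≡.refl (+ n))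
  where open ℤSolver

-- Identities between ℕ-combinations of triangular numbers hold as soon as they hold for the doubled
-- polynomials m² + m over ℤ.
module Triangular where
  open ℤSolver public using (Polynomial; var; con; _:+_; _:*_; _:-_; :-_; prove)
  open ℤSolver using (⟦_⟧; ⟦_⟧↓)

  infixl 6 _⊞_
  infixl 7 _⊠_

  data Exponent (n : ℕ) : Set where
    tr  : Polynomial n → Exponent n
    #_  : ℕ → Exponent n
    _⊞_ : Exponent n → Exponent n → Exponent n
    _⊠_ : ℕ → Exponent n → Exponent n

  value : ∀ {n} → Exponent n → Vec ℤ n → ℕ
  value (tr p) ρ = T (⟦ p ⟧ ρ)
  value (# k) ρ = k
  value (e ⊞ f) ρ = value e ρ ℕ.+ value f ρ
  value (k ⊠ e) ρ = k ℕ.* value e ρ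

  doubled : ∀ {n} → Exponent n → Polynomial n
  doubled (tr p) = p :* p :+ p
  doubled (# k) = con (+ 2 ℤ.* + k)
  doubled (e ⊞ f) = doubled e :+ doubled f
  doubled (k ⊠ e) = con (+ k) :* doubled e

  doubled-value : ∀ {n} (e : Exponent n) ρ → + 2 ℤ.* + value e ρ ≡ ⟦ doubled e ⟧ ρ
  doubled-value (tr p) ρ = 2*T (⟦ p ⟧ ρ)
  doubled-value (# k) ρ = ≡.refl
  doubled-value (e ⊞ f) ρ = ≡.trans (ℤₚ.*-distribˡ-+ (+ 2) (+ value e ρ) (+ value f ρ))
    (≡.cong₂ ℤ._+_ (doubled-value e ρ) (doubled-value f ρ))
  doubled-value (k ⊠ e) ρ = begin
    + 2 ℤ.* + (k ℕ.* value e ρ)  ≡⟨ ≡.cong (+ 2 ℤ.*_) (ℤₚ.pos-* k (value e ρ)) ⟩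
    + 2 ℤ.* (+ k ℤ.* + value e ρ)  ≡⟨ solve 3 (λ a b c → a :* (b :* c) := b :* (a :* c)) ≡.refl (+ 2) (+ k) (+ value e ρ) ⟩
    + k ℤ.* (+ 2 ℤ.* + value e ρ)  ≡⟨ ≡.cong (+ k ℤ.*_) (doubled-value e ρ) ⟩
    + k ℤ.* ⟦ doubled e ⟧ ρ  ∎
    where
    open ≡.≡-Reasoning
    open ℤSolver using (solve; _:=_)

  exponents : ∀ {n} (ρ : Vec ℤ n) (e f : Exponent n) → ⟦ doubled e ⟧↓ ρ ≡ ⟦ doubled f ⟧↓ ρ → value e ρ ≡ value f ρ
  exponents ρ e f p = ℤₚ.+-injective (ℤₚ.*-cancelˡ-≡ (+ 2) (+ value e ρ) (+ value f ρ)
    (≡.trans (doubled-value e ρ) (≡.trans (prove ρ (doubled e) (doubled f) p) (≡.sym (doubled-value f ρ)))))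

-- Balanced division by 3: the residues 0, 1, 2 stand for 0, 1, -1.
module BalancedDivision where
  open ℤSolver using (solve; _:=_; con; _:+_; _:*_; _:-_)

  bal : Fin 3 → ℤ
  bal 0F = + 0
  bal 1F = + 1
  bal 2F = -[1+ 0 ]

  join₃ : Fin 3 × ℤ → ℤ
  join₃ (r , t) = + 3 ℤ.* t ℤ.+ bal r

  private
    up dn : Fin 3 × ℤ → Fin 3 × ℤ
    up (0F , t) = 1F , t
    up (1F , t) = 2F , t ℤ.+ + 1
    up (2F , t) = 0F , t
    dn (0F , t) = 2F , t
    dn (1F , t) = 0F , t
    dn (2F , t) = 1F , t ℤ.- + 1

  split₃ : ℤ → Fin 3 × ℤ
  split₃ (+ zero) = 0F , + 0
  split₃ (+ suc n) = up (split₃ (+ n))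
  split₃ -[1+ zero ] = dn (0F , + 0)
  split₃ -[1+ suc n ] = dn (split₃ -[1+ n ])

  private
    join-up : ∀ p → join₃ (up p) ≡ join₃ p ℤ.+ + 1
    join-up (0F , t) = solve 1 (λ t → con (+ 3) :* t :+ con (+ 1) := con (+ 3) :* t :+ con (+ 0) :+ con (+ 1)) ≡.refl t
    join-up (1F , t) = solve 1 (λ t → con (+ 3) :* (t :+ con (+ 1)) :+ con -[1+ 0 ] := con (+ 3) :* t :+ con (+ 1) :+ con (+ 1)) ≡.refl t
    join-up (2F , t) = solve 1 (λ t → con (+ 3) :* t :+ con (+ 0) := con (+ 3) :* t :+ con -[1+ 0 ] :+ con (+ 1)) ≡.refl t

    join-dn : ∀ p → join₃ (dn p) ≡ join₃ p ℤ.- + 1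
    join-dn (0F , t) = solve 1 (λ t → con (+ 3) :* t :+ con -[1+ 0 ] := con (+ 3) :* t :+ con (+ 0) :- con (+ 1)) ≡.refl t
    join-dn (1F , t) = solve 1 (λ t → con (+ 3) :* t :+ con (+ 0) := con (+ 3) :* t :+ con (+ 1) :- con (+ 1)) ≡.refl t
    join-dn (2F , t) = solve 1 (λ t → con (+ 3) :* (t :- con (+ 1)) :+ con (+ 1) := con (+ 3) :* t :+ con -[1+ 0 ] :- con (+ 1)) ≡.refl t

  join₃-split₃ : ∀ m → join₃ (split₃ m) ≡ m
  join₃-split₃ (+ zero) = ≡.refl
  join₃-split₃ (+ suc n) = ≡.trans (join-up (split₃ (+ n)))
    (≡.trans (≡.cong (ℤ._+ + 1) (join₃-split₃ (+ n))) (≡.cong +_ (ℕₚ.+-comm n 1)))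
  join₃-split₃ -[1+ zero ] = ≡.refl
  join₃-split₃ -[1+ suc n ] = ≡.trans (join-dn (split₃ -[1+ n ]))
    (≡.trans (≡.cong (ℤ._- + 1) (join₃-split₃ -[1+ n ])) (≡.cong (λ k → -[1+ suc k ]) (ℕₚ.+-identityʳ n)))

  private
    multiple-of-3 : ∀ t s d → + 3 ℤ.* t ≡ + 3 ℤ.* s ℤ.+ + suc d → d ℕ.< 2 → ⊥
    multiple-of-3 t s d p d<2 = go (t ℤ.- s) d d<2
      (≡.trans (solve 2 (λ t s → con (+ 3) :* (t :- s) := con (+ 3) :* t :- con (+ 3) :* s) ≡.refl t s)
        (≡.trans (≡.cong (ℤ._- + 3 ℤ.* s) p)
          (solve 2 (λ s d → con (+ 3) :* s :+ d :- con (+ 3) :* s := d) ≡.refl s (+ suc d))))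
      where
      go : ∀ u d → d ℕ.< 2 → + 3 ℤ.* u ≡ + suc d → ⊥
      go (+ zero) d _ ()
      go (+ suc n) 0 _ q with ≡.trans (≡.sym (ℕₚ.*-suc 3 n)) (ℤₚ.+-injective q)
      ... | ()
      go (+ suc n) 1 _ q with ≡.trans (≡.sym (ℕₚ.*-suc 3 n)) (ℤₚ.+-injective q)
      ... | ()
      go (+ suc n) (suc (suc d)) (s≤s (s≤s ())) q
      go -[1+ n ] d _ ()

    residue-clash : ∀ {t s} d → d ℕ.< 2 → ∀ x y → (+ 3 ℤ.* t ℤ.+ x) ≡ (+ 3 ℤ.* s ℤ.+ y) → y ℤ.- x ≡ + suc d → ⊥
    residue-clash {t} {s} d d<2 x y p q = multiple-of-3 t s d
      (≡.trans (solve 2 (λ t x → t := t :+ x :- x) ≡.refl (+ 3 ℤ.* t) x)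
        (≡.trans (≡.cong (ℤ._- x) p) (≡.trans (ℤₚ.+-assoc (+ 3 ℤ.* s) y (ℤ.- x)) (≡.cong (λ k → + 3 ℤ.* s ℤ.+ k) q)))) d<2

    join₃-injective : ∀ p q → join₃ p ≡ join₃ q → p ≡ q
    join₃-injective (r , t) (r′ , s) e = go r r′ e
      where
      same : ∀ {r} → join₃ (r , t) ≡ join₃ (r , s) → _≡_ {A = Fin 3 × ℤ} (r , t) (r , s)
      same {r} e = ≡.cong (r ,_) (ℤₚ.*-cancelˡ-≡ (+ 3) t s (ℤGroup.∙-cancelʳ (bal r) (+ 3 ℤ.* t) (+ 3 ℤ.* s) e))
      go : ∀ r r′ → join₃ (r , t) ≡ join₃ (r′ , s) → _≡_ {A = Fin 3 × ℤ} (r , t) (r′ , s)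
      go 0F 0F e = same e
      go 1F 1F e = same e
      go 2F 2F e = same e
      go 0F 1F e = ⊥-elim (residue-clash {t} {s} 0 (s≤s z≤n) (+ 0) (+ 1) e ≡.refl)
      go 0F 2F e = ⊥-elim (residue-clash {s} {t} 0 (s≤s z≤n) -[1+ 0 ] (+ 0) (≡.sym e) ≡.refl)
      go 1F 0F e = ⊥-elim (residue-clash {s} {t} 0 (s≤s z≤n) (+ 0) (+ 1) (≡.sym e) ≡.refl)
      go 1F 2F e = ⊥-elim (residue-clash {s} {t} 1 (s≤s (s≤s z≤n)) -[1+ 0 ] (+ 1) (≡.sym e) ≡.refl)
      go 2F 0F e = ⊥-elim (residue-clash {t} {s} 0 (s≤s z≤n) -[1+ 0 ] (+ 0) e ≡.refl)
      go 2F 1F e = ⊥-elim (residue-clash {t} {s} 1 (s≤s (s≤s z≤n)) -[1+ 0 ] (+ 1) e ≡.refl)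

  split₃-join₃ : ∀ p → split₃ (join₃ p) ≡ p
  split₃-join₃ p = join₃-injective _ p (join₃-split₃ (join₃ p))

open BalancedDivision public

-- Jacobi's triple product

module Products (R : Ring₀) where
  open CommutativeRing R
  open Solver R
  open import Relation.Binary.Reasoning.Setoid setoid
  open import Algebra.Properties.Semiring.Exp semiring public
    using (_^_; ^-congˡ; ^-homo-*; ^-assocʳ)
  open import Algebra.Properties.CommutativeSemiring.Exp commutativeSemiring public using (^-distrib-*)
  open import Algebra.Properties.Ring ring using (-0#≈0#)

  prod : ℕ → (ℕ → Carrier) → Carrier
  prod zero f = 1#
  prod (suc n) f = prod n f * f n

  prod-cong : ∀ n {f g} → (∀ i → f i ≈ g i) → prod n f ≈ prod n g
  prod-cong zero p = refl
  prod-cong (suc n) p = *-cong (prod-cong n p) (p n)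

  prod-* : ∀ n f g → prod n (λ i → f i * g i) ≈ prod n f * prod n g
  prod-* zero f g = sym (*-identityˡ 1#)
  prod-* (suc n) f g = trans (*-congʳ (prod-* n f g))
    (solve 4 (λ a b c d → a :* b :* (c :* d) := a :* c :* (b :* d)) refl _ _ (f n) (g n))

  prod-stable : ∀ {m n} {f} → m ℕ.≤ n → (∀ i → m ℕ.≤ i → f i ≈ 1#) → prod n f ≈ prod m f
  prod-stable {m} m≤n p = go (ℕₚ.≤⇒≤′ m≤n)
    where
    go : ∀ {n} → m ℕ.≤′ n → _
    go ℕ.≤′-refl = refl
    go (ℕ.≤′-step m≤′n) = trans (*-cong (go m≤′n) (p _ (ℕₚ.≤′⇒≤ m≤′n))) (*-identityʳ _)

  prod-triple : ∀ n f → prod (n ℕ.* 3) f ≈ prod n (λ i → f (i ℕ.* 3)) *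
    (prod n (λ i → f (1 ℕ.+ i ℕ.* 3)) * prod n (λ i → f (2 ℕ.+ i ℕ.* 3)))
  prod-triple zero f = solve 0 (con (+ 1) := con (+ 1) :* (con (+ 1) :* con (+ 1))) refl
  prod-triple (suc n) f = trans (*-congʳ (*-congʳ (*-congʳ (prod-triple n f))))
    (solve 6 (λ a b c x y z → a :* (b :* c) :* x :* y :* z := a :* x :* (b :* y :* (c :* z))) refl _ _ _ _ _ _)

  ^-vanish : ∀ {x} {m n} → x ^ m ≈ 0# → m ℕ.≤ n → x ^ n ≈ 0#
  ^-vanish {x} {m} {n} p m≤n = begin
    x ^ n  ≡⟨ ≡.cong (x ^_) (≡.sym (ℕₚ.m+[n∸m]≡n m≤n)) ⟩
    x ^ (m ℕ.+ (n ℕ.∸ m))  ≈⟨ ^-homo-* x m _ ⟩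
    x ^ m * x ^ (n ℕ.∸ m)  ≈⟨ *-congʳ p ⟩
    0# * x ^ (n ℕ.∸ m)  ≈⟨ zeroˡ _ ⟩
    0#  ∎

  1-vanishing : ∀ {x} → x ≈ 0# → 1# - x ≈ 1#
  1-vanishing p = trans (+-congˡ (trans (-‿cong p) -0#≈0#)) (+-identityʳ 1#)

  1+vanishing : ∀ {x} → x ≈ 0# → 1# + x ≈ 1#
  1+vanishing p = trans (+-congˡ p) (+-identityʳ 1#)

  -- The Euler product (p; p)_n.
  euler : ℕ → Carrier → Carrier
  euler n p = prod n (λ i → 1# - p ^ suc i)

  euler-cong : ∀ n {p q} → p ≈ q → euler n p ≈ euler n q
  euler-cong n p≈q = prod-cong n (λ i → +-congˡ (-‿cong (^-congˡ (suc i) p≈q)))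

  euler-stable : ∀ {m n p} → p ^ m ≈ 0# → m ℕ.≤ n → euler n p ≈ euler m p
  euler-stable pᵐ m≤n = prod-stable m≤n (λ i m≤i → 1-vanishing (^-vanish pᵐ (ℕₚ.m≤n⇒m≤1+n m≤i)))

  euler-1-p*h : ∀ n p → ∃ λ h → euler n p ≈ 1# - p * h
  euler-1-p*h zero p = 0# , solve 1 (λ p → con (+ 1) := con (+ 1) :- p :* con (+ 0)) refl p
  euler-1-p*h (suc n) p with euler-1-p*h n p
  ... | h , e = h + p ^ n - p * p ^ n * h , trans (*-congʳ e)
    (solve 3 (λ p h k → (con (+ 1) :- p :* h) :* (con (+ 1) :- p :* k) := con (+ 1) :- p :* (h :+ k :- p :* k :* h)) refl p h (p ^ n))

  geometric : ℕ → Carrier → Carrier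
  geometric zero x = 0#
  geometric (suc n) x = 1# + x * geometric n x

  geometric-sum : ∀ n x → (1# - x) * geometric n x ≈ 1# - x ^ n
  geometric-sum zero x = solve 1 (λ x → (con (+ 1) :- x) :* con (+ 0) := con (+ 1) :- con (+ 1)) refl x
  geometric-sum (suc n) x = begin
    (1# - x) * (1# + x * geometric n x)  ≈⟨ solve 2 (λ x g → (con (+ 1) :- x) :* (con (+ 1) :+ x :* g) :=
                                                  con (+ 1) :- x :+ x :* ((con (+ 1) :- x) :* g)) refl x (geometric n x) ⟩
    1# - x + x * ((1# - x) * geometric n x)  ≈⟨ +-congˡ (*-congˡ (geometric-sum n x)) ⟩
    1# - x + x * (1# - x ^ n)  ≈⟨ solve 2 (λ x y → con (+ 1) :- x :+ x :* (con (+ 1) :- y) := con (+ 1) :- x :* y) refl x (x ^ n) ⟩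
    1# - x * x ^ n  ∎

  Unit : Carrier → Set
  Unit x = ∃ λ y → x * y ≈ 1#

  unit-cancel : ∀ {x y z} → Unit x → x * y ≈ x * z → y ≈ z
  unit-cancel {x} {y} {z} (x′ , xx′≈1) p = begin
    y  ≈⟨ *-identityˡ y ⟨
    1# * y  ≈⟨ *-congʳ xx′≈1 ⟨
    x * x′ * y  ≈⟨ solve 3 (λ x x′ y → x :* x′ :* y := x′ :* (x :* y)) refl x x′ y ⟩
    x′ * (x * y)  ≈⟨ *-congˡ p ⟩
    x′ * (x * z)  ≈⟨ solve 3 (λ x x′ y → x :* x′ :* y := x′ :* (x :* y)) refl x x′ z ⟨
    x * x′ * z  ≈⟨ *-congʳ xx′≈1 ⟩
    1# * z  ≈⟨ *-identityˡ z ⟩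
    z  ∎

  euler-unit : ∀ n {D p} → p ^ D ≈ 0# → Unit (euler n p)
  euler-unit n {D} {p} pᴰ with euler-1-p*h n p
  ... | h , e = geometric D (p * h) , (begin
    euler n p * geometric D (p * h)  ≈⟨ *-congʳ e ⟩
    (1# - p * h) * geometric D (p * h)  ≈⟨ geometric-sum D (p * h) ⟩
    1# - (p * h) ^ D  ≈⟨ 1-vanishing (trans (^-distrib-* p h D) (trans (*-congʳ pᴰ) (zeroˡ _))) ⟩
    1#  ∎)

-- Jacobi's triple product for x, y with x y nilpotent, as a limit of a finite identity whose
-- coefficients are Gaussian binomials in p = x y.
module TripleProduct (R : Ring₀) where
  open CommutativeRing R
  open Solver R
  open Sums R
  open Products R
  open import Relation.Binary.Reasoning.Setoid setoid

  mono : Carrier → Carrier → ℤ → Carrier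
  mono x y m = x ^ T m * y ^ T (ℤ.- m)

  antidiagonal : ℕ → (ℕ → ℕ → Carrier) → Carrier
  antidiagonal zero G = G 0 0
  antidiagonal (suc n) G = G 0 (suc n) + antidiagonal n (λ a b → G (suc a) b)

  antidiagonal-cong : ∀ n {G H} → (∀ a b → a ℕ.+ b ≡ n → G a b ≈ H a b) → antidiagonal n G ≈ antidiagonal n H
  antidiagonal-cong zero p = p 0 0 ≡.refl
  antidiagonal-cong (suc n) p = +-cong (p 0 (suc n) ≡.refl) (antidiagonal-cong n (λ a b e → p (suc a) b (≡.cong suc e)))

  antidiagonal-sucʳ : ∀ n G → antidiagonal (suc n) G ≈ antidiagonal n (λ a b → G a (suc b)) + G (suc n) 0
  antidiagonal-sucʳ zero G = refl
  antidiagonal-sucʳ (suc n) G = trans (+-congˡ (antidiagonal-sucʳ n (λ a b → G (suc a) b))) (sym (+-assoc _ _ _))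

  antidiagonal-+ : ∀ n G H → antidiagonal n (λ a b → G a b + H a b) ≈ antidiagonal n G + antidiagonal n H
  antidiagonal-+ zero G H = refl
  antidiagonal-+ (suc n) G H = trans (+-congˡ (antidiagonal-+ n _ _))
    (solve 4 (λ a b c d → a :+ b :+ (c :+ d) := a :+ c :+ (b :+ d)) refl _ _ _ _)

  antidiagonal-*ʳ : ∀ n G c → antidiagonal n G * c ≈ antidiagonal n (λ a b → G a b * c)
  antidiagonal-*ʳ zero G c = refl
  antidiagonal-*ʳ (suc n) G c = trans (distribʳ _ _ _) (+-congˡ (antidiagonal-*ʳ n _ c))

  antidiagonal-pascal : ∀ n G F H → (∀ b → G 0 (suc b) ≈ H 0 b) → (∀ a → G (suc a) 0 ≈ F a 0) →
    (∀ a b → G (suc a) (suc b) ≈ F a (suc b) + H (suc a) b) →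
    antidiagonal (suc n) G ≈ antidiagonal n F + antidiagonal n H
  antidiagonal-pascal n G F H p q r = begin
    antidiagonal (suc n) G  ≈⟨ antidiagonal-cong (suc n) split ⟩
    antidiagonal (suc n) (λ a b → F⁺ a b + H⁺ a b)  ≈⟨ antidiagonal-+ (suc n) F⁺ H⁺ ⟩
    antidiagonal (suc n) F⁺ + antidiagonal (suc n) H⁺  ≈⟨ +-cong (+-identityˡ _) (trans (antidiagonal-sucʳ n H⁺) (+-identityʳ _)) ⟩
    antidiagonal n F + antidiagonal n H  ∎
    where
    F⁺ H⁺ : ℕ → ℕ → Carrier
    F⁺ zero b = 0#
    F⁺ (suc a) b = F a b
    H⁺ a zero = 0#
    H⁺ a (suc b) = H a b
    split : ∀ a b → a ℕ.+ b ≡ suc n → G a b ≈ F⁺ a b + H⁺ a b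
    split zero (suc b) _ = trans (p b) (sym (+-identityˡ _))
    split (suc a) zero _ = trans (q a) (sym (+-identityʳ _))
    split (suc a) (suc b) _ = r a b

  antidiagonal-upTo : ∀ n g → antidiagonal n (λ _ b → g b) ≈ sumOver (upTo (suc n)) g
  antidiagonal-upTo zero g = sym (+-identityʳ _)
  antidiagonal-upTo (suc n) g = begin
    antidiagonal (suc n) (λ _ b → g b)  ≈⟨ antidiagonal-sucʳ n (λ _ b → g b) ⟩
    antidiagonal n (λ _ b → g (suc b)) + g 0  ≈⟨ +-comm _ _ ⟩
    g 0 + antidiagonal n (λ _ b → g (suc b))  ≈⟨ +-congˡ (antidiagonal-upTo n (λ b → g (suc b))) ⟩
    g 0 + sumOver (upTo (suc n)) (λ b → g (suc b))  ≡⟨ ≡.cong (λ s → g 0 + s) (≡.sym (sum-map suc (upTo (suc n)) g)) ⟩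
    g 0 + sumOver (map suc (upTo (suc n))) g  ≡⟨ ≡.cong (λ l → g 0 + sumOver l g) (Listₚ.map-upTo suc (suc n)) ⟩
    sumOver (upTo (suc (suc n))) g  ∎

  gauss : Carrier → ℕ → ℕ → Carrier
  gauss p zero b = 1#
  gauss p (suc a) zero = 1#
  gauss p (suc a) (suc b) = gauss p a (suc b) + p ^ suc a * gauss p (suc a) b

  gauss-0ʳ : ∀ p a → gauss p a 0 ≈ 1#
  gauss-0ʳ p zero = refl
  gauss-0ʳ p (suc a) = refl

  gauss-pascal : ∀ p a b → gauss p (suc a) (suc b) ≈ gauss p (suc a) b + p ^ suc b * gauss p a (suc b)
  gauss-pascal p zero zero = solve 1 (λ p → con (+ 1) :+ p :* con (+ 1) := con (+ 1) :+ p :* con (+ 1)) refl (p ^ 1)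
  gauss-pascal p zero (suc b) = begin
    1# + p ^ 1 * gauss p 1 (suc b)  ≈⟨ +-congˡ (*-congˡ (gauss-pascal p 0 b)) ⟩
    1# + p ^ 1 * (gauss p 1 b + p ^ suc b * 1#)  ≈⟨ solve 3 (λ p g k → con (+ 1) :+ p :* con (+ 1) :* (g :+ k :* con (+ 1)) :=
                                                             con (+ 1) :+ p :* con (+ 1) :* g :+ p :* k :* con (+ 1)) refl p (gauss p 1 b) (p ^ suc b) ⟩
    1# + p ^ 1 * gauss p 1 b + p ^ suc (suc b) * 1#  ∎
  gauss-pascal p (suc a) zero = begin
    gauss p (suc a) 1 + p ^ suc (suc a) * 1#  ≈⟨ +-congʳ (gauss-pascal p a 0) ⟩
    1# + p ^ 1 * gauss p a 1 + p ^ suc (suc a) * 1#  ≈⟨ solve 3 (λ p g k → con (+ 1) :+ p :* con (+ 1) :* g :+ p :* k :* con (+ 1) :=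
                                                             con (+ 1) :+ p :* con (+ 1) :* (g :+ k :* con (+ 1))) refl p (gauss p a 1) (p ^ suc a) ⟩
    1# + p ^ 1 * (gauss p a 1 + p ^ suc a * 1#)  ∎
  gauss-pascal p (suc a) (suc b) = begin
    gauss p (suc a) (2 ℕ.+ b) + p ^ (2 ℕ.+ a) * gauss p (2 ℕ.+ a) (suc b)
      ≈⟨ +-cong (gauss-pascal p a (suc b)) (*-congˡ (gauss-pascal p (suc a) b)) ⟩
    gauss p (suc a) (suc b) + p ^ (2 ℕ.+ b) * gauss p a (2 ℕ.+ b) +
      p ^ (2 ℕ.+ a) * (gauss p (2 ℕ.+ a) b + p ^ suc b * gauss p (suc a) (suc b))
      ≈⟨ solve 6 (λ p A B g h k →
           g :+ p :* (p :* B) :* h :+ p :* (p :* A) :* (k :+ p :* B :* g) :=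
           g :+ p :* (p :* A) :* k :+ p :* (p :* B) :* (h :+ p :* A :* g)) refl
           p (p ^ a) (p ^ b) (gauss p (suc a) (suc b)) (gauss p a (2 ℕ.+ b)) (gauss p (2 ℕ.+ a) b) ⟩
    gauss p (suc a) (suc b) + p ^ (2 ℕ.+ a) * gauss p (2 ℕ.+ a) b +
      p ^ (2 ℕ.+ b) * (gauss p a (2 ℕ.+ b) + p ^ suc a * gauss p (suc a) (suc b)) ∎

  gauss-euler : ∀ p a b → gauss p a b * (euler a p * euler b p) ≈ euler (a ℕ.+ b) p
  gauss-euler p zero b = solve 1 (λ e → con (+ 1) :* (con (+ 1) :* e) := e) refl (euler b p)
  gauss-euler p (suc a) zero = trans (solve 1 (λ e → con (+ 1) :* (e :* con (+ 1)) := e) refl (euler (suc a) p))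
    (reflexive (≡.cong (λ k → euler (suc k) p) (≡.sym (ℕₚ.+-identityʳ a))))
  gauss-euler p (suc a) (suc b) = begin
    (gauss p a (suc b) + p ^ suc a * gauss p (suc a) b) * (euler a p * (1# - p ^ suc a) * (euler b p * (1# - p ^ suc b)))
      ≈⟨ solve 6 (λ g h A B x y →
           (g :+ A :* h) :* (x :* (con (+ 1) :- A) :* (y :* (con (+ 1) :- B))) :=
           g :* (x :* (y :* (con (+ 1) :- B))) :* (con (+ 1) :- A) :+ A :* (con (+ 1) :- B) :* (h :* (x :* (con (+ 1) :- A) :* y))) refl
           (gauss p a (suc b)) (gauss p (suc a) b) (p ^ suc a) (p ^ suc b) (euler a p) (euler b p) ⟩
    gauss p a (suc b) * (euler a p * euler (suc b) p) * (1# - p ^ suc a) +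
      p ^ suc a * (1# - p ^ suc b) * (gauss p (suc a) b * (euler (suc a) p * euler b p))
      ≈⟨ +-cong (*-congʳ (gauss-euler p a (suc b))) (*-congˡ (gauss-euler p (suc a) b)) ⟩
    euler (a ℕ.+ suc b) p * (1# - p ^ suc a) + p ^ suc a * (1# - p ^ suc b) * euler (suc a ℕ.+ b) p
      ≡⟨ ≡.cong (λ k → euler (a ℕ.+ suc b) p * (1# - p ^ suc a) + p ^ suc a * (1# - p ^ suc b) * euler k p) (≡.sym (ℕₚ.+-suc a b)) ⟩
    euler (a ℕ.+ suc b) p * (1# - p ^ suc a) + p ^ suc a * (1# - p ^ suc b) * euler (a ℕ.+ suc b) p
      ≈⟨ solve 3 (λ e A B → e :* (con (+ 1) :- A) :+ A :* (con (+ 1) :- B) :* e := e :* (con (+ 1) :- A :* B)) refl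
           (euler (a ℕ.+ suc b) p) (p ^ suc a) (p ^ suc b) ⟩
    euler (a ℕ.+ suc b) p * (1# - p ^ suc a * p ^ suc b)
      ≈⟨ *-congˡ (+-congˡ (-‿cong (^-homo-* p (suc a) (suc b)))) ⟨
    euler (suc a ℕ.+ suc b) p ∎

  module _ (x y : Carrier) where
    private
      p : Carrier
      p = x * y

    halfˣ halfʸ : ℕ → Carrier
    halfˣ n = prod n (λ i → 1# + x * p ^ i)
    halfʸ n = prod n (λ i → 1# + y * p ^ i)

    mono-neg : ∀ a → mono x y (ℤ.- + a) * (y * p ^ a) ≈ mono x y (ℤ.- + suc a)
    mono-neg zero = solve 1 (λ y → con (+ 1) :* con (+ 1) :* (y :* con (+ 1)) := con (+ 1) :* (y :* con (+ 1))) refl y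
    mono-neg (suc a) = begin
      x ^ tri a * y ^ tri (suc a) * (y * p ^ suc a)
        ≈⟨ *-congˡ (*-congˡ (^-distrib-* x y (suc a))) ⟩
      x ^ tri a * y ^ tri (suc a) * (y * (x ^ suc a * y ^ suc a))
        ≈⟨ solve 5 (λ s t y u v → s :* t :* (y :* (u :* v)) := u :* s :* (y :* v :* t)) refl
             (x ^ tri a) (y ^ tri (suc a)) y (x ^ suc a) (y ^ suc a) ⟩
      x ^ suc a * x ^ tri a * (y ^ suc (suc a) * y ^ tri (suc a))
        ≈⟨ *-cong (^-homo-* x (suc a) (tri a)) (^-homo-* y (2 ℕ.+ a) (tri (suc a))) ⟨
      x ^ tri (suc a) * y ^ tri (suc (suc a)) ∎

    mono-pos : ∀ b → mono x y (+ b) * (x * p ^ b) ≈ mono x y (+ suc b)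
    mono-pos zero = solve 1 (λ x → con (+ 1) :* con (+ 1) :* (x :* con (+ 1)) := x :* con (+ 1) :* con (+ 1)) refl x
    mono-pos (suc b) = begin
      x ^ tri (suc b) * y ^ tri b * (x * p ^ suc b)
        ≈⟨ *-congˡ (*-congˡ (^-distrib-* x y (suc b))) ⟩
      x ^ tri (suc b) * y ^ tri b * (x * (x ^ suc b * y ^ suc b))
        ≈⟨ solve 5 (λ s t x u v → s :* t :* (x :* (u :* v)) := x :* u :* s :* (v :* t)) refl
             (x ^ tri (suc b)) (y ^ tri b) x (x ^ suc b) (y ^ suc b) ⟩
      x ^ suc (suc b) * x ^ tri (suc b) * (y ^ suc b * y ^ tri b)
        ≈⟨ *-cong (^-homo-* x (2 ℕ.+ b) (tri (suc b))) (^-homo-* y (suc b) (tri b)) ⟨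
      x ^ tri (suc (suc b)) * y ^ tri (suc b) ∎

    mono-neg-suc : ∀ n → mono x y -[1+ n ] * x ≈ p ^ suc n * mono x y (ℤ.- + n)
    mono-neg-suc zero = solve 2 (λ x y → con (+ 1) :* (y :* con (+ 1)) :* x := x :* y :* con (+ 1) :* (con (+ 1) :* con (+ 1))) refl x y
    mono-neg-suc (suc n) = begin
      x ^ tri (suc n) * y ^ tri (2 ℕ.+ n) * x
        ≈⟨ *-congʳ (*-cong (^-homo-* x (suc n) (tri n)) (^-homo-* y (2 ℕ.+ n) (tri (suc n)))) ⟩
      x ^ suc n * x ^ tri n * (y ^ (2 ℕ.+ n) * y ^ tri (suc n)) * x
        ≈⟨ solve 5 (λ a s b t x → a :* s :* (b :* t) :* x := x :* a :* b :* (s :* t)) refl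
             (x ^ suc n) (x ^ tri n) (y ^ (2 ℕ.+ n)) (y ^ tri (suc n)) x ⟩
      x ^ (2 ℕ.+ n) * y ^ (2 ℕ.+ n) * (x ^ tri n * y ^ tri (suc n))
        ≈⟨ *-congʳ (^-distrib-* x y (2 ℕ.+ n)) ⟨
      p ^ (2 ℕ.+ n) * (x ^ tri n * y ^ tri (suc n)) ∎

    euler-binomial : ∀ N → antidiagonal N (λ a b → gauss p a b * mono x y (ℤ.- + a)) ≈ halfʸ N
    euler-binomial zero = solve 0 (con (+ 1) :* (con (+ 1) :* con (+ 1)) := con (+ 1)) refl
    euler-binomial (suc N) = begin
      antidiagonal (suc N) (λ a b → gauss p a b * mono x y (ℤ.- + a))
        ≈⟨ antidiagonal-pascal N (λ a b → gauss p a b * mono x y (ℤ.- + a))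
             (λ a b → p ^ b * gauss p a b * mono x y (ℤ.- + suc a)) (λ a b → gauss p a b * mono x y (ℤ.- + a))
             (λ b → refl)
             (λ a → *-congʳ (sym (trans (*-identityˡ _) (gauss-0ʳ p a))))
             (λ a b → trans (*-congʳ (gauss-pascal p a b))
               (trans (distribʳ _ _ _) (+-comm _ _))) ⟩
      antidiagonal N (λ a b → p ^ b * gauss p a b * mono x y (ℤ.- + suc a)) +
        antidiagonal N (λ a b → gauss p a b * mono x y (ℤ.- + a))
        ≈⟨ +-congʳ (trans (antidiagonal-cong N shift) (sym (antidiagonal-*ʳ N _ (y * p ^ N)))) ⟩
      antidiagonal N (λ a b → gauss p a b * mono x y (ℤ.- + a)) * (y * p ^ N) +
        antidiagonal N (λ a b → gauss p a b * mono x y (ℤ.- + a))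
        ≈⟨ +-cong (*-congʳ (euler-binomial N)) (euler-binomial N) ⟩
      halfʸ N * (y * p ^ N) + halfʸ N
        ≈⟨ solve 2 (λ h z → h :* z :+ h := h :* (con (+ 1) :+ z)) refl (halfʸ N) (y * p ^ N) ⟩
      halfʸ (suc N) ∎
      where
      shift : ∀ a b → a ℕ.+ b ≡ N →
              p ^ b * gauss p a b * mono x y (ℤ.- + suc a) ≈ gauss p a b * mono x y (ℤ.- + a) * (y * p ^ N)
      shift a b ≡.refl = begin
        p ^ b * gauss p a b * mono x y (ℤ.- + suc a)  ≈⟨ *-congˡ (mono-neg a) ⟨
        p ^ b * gauss p a b * (mono x y (ℤ.- + a) * (y * p ^ a))  ≈⟨ solve 5 (λ B g m y A → B :* g :* (m :* (y :* A)) := g :* m :* (y :* (A :* B))) refl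
                                                                       (p ^ b) (gauss p a b) (mono x y (ℤ.- + a)) y (p ^ a) ⟩
        gauss p a b * mono x y (ℤ.- + a) * (y * (p ^ a * p ^ b))  ≈⟨ *-congˡ (*-congˡ (^-homo-* p a b)) ⟨
        gauss p a b * mono x y (ℤ.- + a) * (y * p ^ (a ℕ.+ b))  ∎

    private
      mono-step : ∀ a b M N → a ℕ.+ b ≡ M ℕ.+ N →
                  p ^ a * mono x y (suc b ⊖ N) ≈ mono x y (b ⊖ N) * (x * p ^ M)
      mono-step a b M N e with N ℕ.≤? b
      ... | yes N≤b with ℕₚ.m≤n⇒∃[o]m+o≡n N≤b
      ...   | k , ≡.refl = begin
        p ^ a * mono x y (suc (N ℕ.+ k) ⊖ N)  ≡⟨ ≡.cong (λ j → p ^ a * mono x y j)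
                                                        (≡.trans (ℤₚ.⊖-≥ (ℕₚ.m≤n⇒m≤1+n (ℕₚ.m≤m+n N k))) (≡.cong +_
                                                          (≡.trans (≡.cong (ℕ._∸ N) (≡.sym (ℕₚ.+-suc N k))) (ℕₚ.m+n∸m≡n N (suc k))))) ⟩
        p ^ a * mono x y (+ suc k)  ≈⟨ *-congˡ (mono-pos k) ⟨
        p ^ a * (mono x y (+ k) * (x * p ^ k))  ≈⟨ solve 4 (λ A m x K → A :* (m :* (x :* K)) := m :* (x :* (A :* K))) refl
                                                        (p ^ a) (mono x y (+ k)) x (p ^ k) ⟩
        mono x y (+ k) * (x * (p ^ a * p ^ k))  ≈⟨ *-congˡ (*-congˡ (^-homo-* p a k)) ⟨
        mono x y (+ k) * (x * p ^ (a ℕ.+ k))  ≡⟨ ≡.cong₂ (λ j l → mono x y j * (x * p ^ l))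
                                                        (≡.sym (≡.trans (ℤₚ.⊖-≥ (ℕₚ.m≤m+n N k)) (≡.cong +_ (ℕₚ.m+n∸m≡n N k))))
                                                        (ℕₚ.+-cancelʳ-≡ N (a ℕ.+ k) M (≡.trans (ℕₚ.+-assoc a k N)
                                                          (≡.trans (≡.cong (a ℕ.+_) (ℕₚ.+-comm k N)) e))) ⟩
        mono x y ((N ℕ.+ k) ⊖ N) * (x * p ^ M)  ∎
      mono-step a b M N e | no N≰b with ℕₚ.m≤n⇒∃[o]m+o≡n (ℕₚ.≰⇒> N≰b)
      ...   | k , ≡.refl = begin
        p ^ a * mono x y (suc b ⊖ (suc b ℕ.+ k))  ≡⟨ ≡.cong₂ (λ i j → p ^ i * mono x y j) a≡
                                                             (≡.trans (ℤₚ.⊖-≤ (ℕₚ.m≤m+n (suc b) k)) (≡.cong (λ j → ℤ.- + j) (ℕₚ.m+n∸m≡n b k))) ⟩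
        p ^ (M ℕ.+ suc k) * mono x y (ℤ.- + k)  ≈⟨ *-congʳ (^-homo-* p M (suc k)) ⟩
        p ^ M * p ^ suc k * mono x y (ℤ.- + k)  ≈⟨ *-assoc _ _ _ ⟩
        p ^ M * (p ^ suc k * mono x y (ℤ.- + k))  ≈⟨ *-congˡ (mono-neg-suc k) ⟨
        p ^ M * (mono x y -[1+ k ] * x)  ≈⟨ solve 3 (λ P m x → P :* (m :* x) := m :* (x :* P)) refl (p ^ M) (mono x y -[1+ k ]) x ⟩
        mono x y -[1+ k ] * (x * p ^ M)  ≡⟨ ≡.cong (λ j → mono x y j * (x * p ^ M)) (≡.sym
                                                             (≡.trans (ℤₚ.⊖-≤ (ℕₚ.m≤n⇒m≤1+n (ℕₚ.m≤m+n b k))) (≡.cong (λ j → ℤ.- + j)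
                                                               (≡.trans (≡.cong (ℕ._∸ b) (≡.sym (ℕₚ.+-suc b k))) (ℕₚ.m+n∸m≡n b (suc k)))))) ⟩
        mono x y (b ⊖ (suc b ℕ.+ k)) * (x * p ^ M)  ∎
        where
        a≡ : a ≡ M ℕ.+ suc k
        a≡ = ℕₚ.+-cancelʳ-≡ b a (M ℕ.+ suc k) (≡.trans e (≡.trans (≡.cong (M ℕ.+_)
          (≡.trans (≡.cong suc (ℕₚ.+-comm b k)) ≡.refl)) (≡.sym (ℕₚ.+-assoc M (suc k) b))))

    finite-triple-product : ∀ M N →
      antidiagonal (M ℕ.+ N) (λ a b → gauss p a b * mono x y (b ⊖ N)) ≈ halfˣ M * halfʸ N
    finite-triple-product zero N = begin
      antidiagonal N (λ a b → gauss p a b * mono x y (b ⊖ N))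
        ≈⟨ antidiagonal-cong N (λ { a b ≡.refl → *-congˡ (reflexive (≡.cong (mono x y)
             (≡.trans (ℤₚ.⊖-≤ (ℕₚ.m≤n+m b a)) (≡.cong (λ j → ℤ.- + j) (ℕₚ.m+n∸n≡m a b))))) }) ⟩
      antidiagonal N (λ a b → gauss p a b * mono x y (ℤ.- + a)) ≈⟨ euler-binomial N ⟩
      halfʸ N  ≈⟨ *-identityˡ _ ⟨
      1# * halfʸ N  ∎
    finite-triple-product (suc M) N = begin
      antidiagonal (suc (M ℕ.+ N)) G
        ≈⟨ antidiagonal-pascal (M ℕ.+ N) G G (λ a b → gauss p a b * (p ^ a * mono x y (suc b ⊖ N)))
             (λ b → *-congˡ (sym (*-identityˡ _)))
             (λ a → *-congʳ (sym (gauss-0ʳ p a)))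
             (λ a b → solve 4 (λ g A h m → (g :+ A :* h) :* m := g :* m :+ h :* (A :* m)) refl
                        (gauss p a (suc b)) (p ^ suc a) (gauss p (suc a) b) (mono x y (suc b ⊖ N))) ⟩
      antidiagonal (M ℕ.+ N) G + antidiagonal (M ℕ.+ N) (λ a b → gauss p a b * (p ^ a * mono x y (suc b ⊖ N)))
        ≈⟨ +-congˡ (antidiagonal-cong (M ℕ.+ N) (λ a b e → trans (*-congˡ (mono-step a b M N e)) (sym (*-assoc _ _ _)))) ⟩
      antidiagonal (M ℕ.+ N) G + antidiagonal (M ℕ.+ N) (λ a b → G a b * (x * p ^ M))
        ≈⟨ +-congˡ (antidiagonal-*ʳ (M ℕ.+ N) G (x * p ^ M)) ⟨
      antidiagonal (M ℕ.+ N) G + antidiagonal (M ℕ.+ N) G * (x * p ^ M)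
        ≈⟨ +-cong (finite-triple-product M N) (*-congʳ (finite-triple-product M N)) ⟩
      halfˣ M * halfʸ N + halfˣ M * halfʸ N * (x * p ^ M)
        ≈⟨ solve 3 (λ a b z → a :* b :+ a :* b :* z := a :* (con (+ 1) :+ z) :* b) refl (halfˣ M) (halfʸ N) (x * p ^ M) ⟩
      halfˣ (suc M) * halfʸ N ∎
      where
      G : ℕ → ℕ → Carrier
      G a b = gauss p a b * mono x y (b ⊖ N)

    jacobi : ℕ → Carrier
    jacobi n = halfˣ n * halfʸ n

    theta : ℕ → Carrier
    theta D = sumOver (interval (suc D)) (mono x y)

    module _ {D : ℕ} (nilpotent : p ^ D ≈ 0#) where
      mono-vanish⁺ : ∀ n → suc D ℕ.≤ n → mono x y (+ n) ≈ 0#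
      mono-vanish⁺ (suc n) (s≤s D≤n) = begin
        x ^ tri (suc n) * y ^ tri n  ≈⟨ *-congʳ (^-homo-* x (suc n) (tri n)) ⟩
        x ^ suc n * x ^ tri n * y ^ tri n  ≈⟨ *-assoc _ _ _ ⟩
        x ^ suc n * (x ^ tri n * y ^ tri n)  ≈⟨ *-congˡ (^-distrib-* x y (tri n)) ⟨
        x ^ suc n * p ^ tri n  ≈⟨ *-congˡ (^-vanish nilpotent (ℕₚ.≤-trans D≤n (n≤tri n))) ⟩
        x ^ suc n * 0#  ≈⟨ zeroʳ _ ⟩
        0#  ∎

      mono-vanish⁻ : ∀ n → D ℕ.≤ n → mono x y -[1+ n ] ≈ 0#
      mono-vanish⁻ n D≤n = begin
        x ^ tri n * y ^ tri (suc n)  ≈⟨ *-congˡ (^-homo-* y (suc n) (tri n)) ⟩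
        x ^ tri n * (y ^ suc n * y ^ tri n)  ≈⟨ solve 3 (λ a b c → a :* (b :* c) := b :* (a :* c)) refl _ _ _ ⟩
        y ^ suc n * (x ^ tri n * y ^ tri n)  ≈⟨ *-congˡ (^-distrib-* x y (tri n)) ⟨
        y ^ suc n * p ^ tri n  ≈⟨ *-congˡ (^-vanish nilpotent (ℕₚ.≤-trans D≤n (n≤tri n))) ⟩
        y ^ suc n * 0#  ≈⟨ zeroʳ _ ⟩
        0#  ∎

      theta-sum : HasSum (mono x y) (theta D)
      theta-sum = hasSum-interval (suc D) mono-vanish⁺ (λ n n≥ → mono-vanish⁻ n (ℕₚ.≤-trans (ℕₚ.n≤1+n D) n≥))

      jacobi-stable : ∀ {n} → D ℕ.≤ n → jacobi n ≈ jacobi D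
      jacobi-stable D≤n = *-cong (prod-stable D≤n (trivial x)) (prod-stable D≤n (trivial y))
        where
        trivial : ∀ z i → D ℕ.≤ i → 1# + z * p ^ i ≈ 1#
        trivial z i D≤i = 1+vanishing (trans (*-congˡ (^-vanish nilpotent D≤i)) (zeroʳ z))

      private
        N = suc (D ℕ.+ D)

        euler-gauss : ∀ a b → D ℕ.≤ a → D ℕ.≤ b → euler D p * gauss p a b ≈ 1#
        euler-gauss a b D≤a D≤b = unit-cancel (euler-unit D {D} nilpotent) (begin
          euler D p * (euler D p * gauss p a b)  ≈⟨ solve 2 (λ e g → e :* (e :* g) := g :* (e :* e)) refl _ _ ⟩
          gauss p a b * (euler D p * euler D p)  ≈⟨ *-congˡ (*-cong (euler-stable nilpotent D≤a) (euler-stable nilpotent D≤b)) ⟨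
          gauss p a b * (euler a p * euler b p)  ≈⟨ gauss-euler p a b ⟩
          euler (a ℕ.+ b) p  ≈⟨ euler-stable nilpotent (ℕₚ.≤-trans D≤a (ℕₚ.m≤m+n a b)) ⟩
          euler D p  ≈⟨ *-identityʳ _ ⟨
          euler D p * 1#  ∎)

        -- If a or b is small then the index b - N is so large that the monomial vanishes.
        term : ∀ a b → a ℕ.+ b ≡ N ℕ.+ N →
               euler D p * (gauss p a b * mono x y (b ⊖ N)) ≈ mono x y (b ⊖ N)
        term a b e with D ℕ.≤? a | D ℕ.≤? b
        ... | yes D≤a | yes D≤b = trans (sym (*-assoc _ _ _)) (trans (*-congʳ (euler-gauss a b D≤a D≤b)) (*-identityˡ _))
        ... | no D≰a | _ = kill (trans (reflexive (≡.cong (mono x y) (ℤₚ.⊖-≥ N≤b))) (mono-vanish⁺ _ (ℕₚ.m+n≤o⇒m≤o∸n (suc D) big)))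
          where
          kill : ∀ {c m} → m ≈ 0# → euler D p * (c * m) ≈ m
          kill {c} {m} m≈0 = trans (trans (*-congˡ (trans (*-congˡ m≈0) (zeroʳ c))) (zeroʳ _)) (sym m≈0)
          big : suc D ℕ.+ N ℕ.≤ b
          big = ℕₚ.+-cancelˡ-≤ a (suc D ℕ.+ N) b (ℕₚ.≤-trans (ℕₚ.≤-trans (ℕₚ.≤-reflexive (≡.sym (ℕₚ.+-assoc a (suc D) N)))
            (ℕₚ.+-monoˡ-≤ N (ℕₚ.≤-trans (ℕₚ.≤-reflexive (ℕₚ.+-suc a D)) (s≤s (ℕₚ.+-monoˡ-≤ D (ℕₚ.<⇒≤ (ℕₚ.≰⇒> D≰a)))))))
            (ℕₚ.≤-reflexive (≡.sym e)))
          N≤b : N ℕ.≤ b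
          N≤b = ℕₚ.≤-trans (ℕₚ.m≤n+m N (suc D)) big
        ... | yes _ | no D≰b = kill (trans (reflexive (≡.cong (mono x y) b⊖N)) (mono-vanish⁻ (D ℕ.+ (D ℕ.∸ b)) (ℕₚ.m≤m+n D _)))
          where
          kill : ∀ {c m} → m ≈ 0# → euler D p * (c * m) ≈ m
          kill {c} {m} m≈0 = trans (trans (*-congˡ (trans (*-congˡ m≈0) (zeroʳ c))) (zeroʳ _)) (sym m≈0)
          b≤D : b ℕ.≤ D
          b≤D = ℕₚ.<⇒≤ (ℕₚ.≰⇒> D≰b)
          b⊖N : b ⊖ N ≡ -[1+ D ℕ.+ (D ℕ.∸ b) ]
          b⊖N = ≡.trans (ℤₚ.⊖-< (s≤s (ℕₚ.≤-trans b≤D (ℕₚ.m≤m+n D D))))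
            (≡.cong (λ k → ℤ.- + k) (≡.trans (ℕₚ.+-∸-assoc 1 (ℕₚ.≤-trans b≤D (ℕₚ.m≤m+n D D)))
              (≡.cong suc (ℕₚ.+-∸-assoc D b≤D))))

      triple-product : euler D p * jacobi D ≈ theta D
      triple-product = hasSum-unique ℤ._≟_ (hasSum indices
        (Uniqueₚ.map⁺ (λ {i} {j} e → ℤₚ.+-injective (ℤGroup.∙-cancelʳ (ℤ.- + N) (+ i) (+ j)
          (≡.trans (ℤₚ.m-n≡m⊖n i N) (≡.trans e (≡.sym (ℤₚ.m-n≡m⊖n j N)))))) (Uniqueₚ.upTo⁺ _))
        outside′ total′) theta-sum
        where
        indices : List ℤ
        indices = map (_⊖ N) (upTo (suc (N ℕ.+ N)))
        member : ∀ k → k ℕ.≤ N ℕ.+ N → k ⊖ N ∈ indices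
        member k k≤ = ∈-map⁺ (_⊖ N) (∈-upTo⁺ (s≤s k≤))
        outside′ : ∀ m → m ∉ indices → mono x y m ≈ 0#
        outside′ (+ n) m∉ with suc D ℕ.≤? n
        ... | yes D<n = mono-vanish⁺ n D<n
        ... | no D≮n = ⊥-elim (m∉ (≡.subst (_∈ indices)
          (≡.trans (ℤₚ.⊖-≥ (ℕₚ.m≤n+m N n)) (≡.cong +_ (ℕₚ.m+n∸n≡m n N)))
          (member (n ℕ.+ N) (ℕₚ.+-monoˡ-≤ N (ℕₚ.≤-trans (ℕₚ.<⇒≤ (ℕₚ.≰⇒> D≮n)) (s≤s (ℕₚ.m≤m+n D D)))))))
        outside′ -[1+ n ] m∉ with D ℕ.≤? n
        ... | yes D≤n = mono-vanish⁻ n D≤n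
        ... | no D≰n = ⊥-elim (m∉ (≡.subst (_∈ indices) index (member (N ℕ.∸ suc n) (ℕₚ.≤-trans (ℕₚ.m∸n≤m N (suc n)) (ℕₚ.m≤m+n N N)))))
          where
          n<N : suc n ℕ.≤ N
          n<N = ℕₚ.≤-trans (ℕₚ.≰⇒> D≰n) (ℕₚ.≤-trans (ℕₚ.m≤m+n D D) (ℕₚ.n≤1+n _))
          index : (N ℕ.∸ suc n) ⊖ N ≡ -[1+ n ]
          index = ≡.trans (ℤₚ.⊖-≤ (ℕₚ.m∸n≤m N (suc n))) (≡.cong (λ k → ℤ.- + k) (ℕₚ.m∸[m∸n]≡n n<N))
        total′ : sumOver indices (mono x y) ≈ euler D p * jacobi D
        total′ = begin
          sumOver indices (mono x y)  ≡⟨ sum-map (_⊖ N) (upTo (suc (N ℕ.+ N))) (mono x y) ⟩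
          sumOver (upTo (suc (N ℕ.+ N))) (λ b → mono x y (b ⊖ N))  ≈⟨ antidiagonal-upTo (N ℕ.+ N) (λ b → mono x y (b ⊖ N)) ⟨
          antidiagonal (N ℕ.+ N) (λ a b → mono x y (b ⊖ N))
            ≈⟨ antidiagonal-cong (N ℕ.+ N) (λ a b e → trans (*-comm _ _) (term a b e)) ⟨
          antidiagonal (N ℕ.+ N) (λ a b → gauss p a b * mono x y (b ⊖ N) * euler D p)
            ≈⟨ antidiagonal-*ʳ (N ℕ.+ N) (λ a b → gauss p a b * mono x y (b ⊖ N)) (euler D p) ⟨
          antidiagonal (N ℕ.+ N) (λ a b → gauss p a b * mono x y (b ⊖ N)) * euler D p
            ≈⟨ *-congʳ (finite-triple-product N N) ⟩
          jacobi N * euler D p  ≈⟨ *-comm _ _ ⟩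
          euler D p * jacobi N
            ≈⟨ *-congˡ (jacobi-stable (ℕₚ.≤-trans (ℕₚ.m≤m+n D D) (ℕₚ.n≤1+n _))) ⟩
          euler D p * jacobi D  ∎

-- Cubes of theta series

-- For m = (ρ - a - b, a, b) with ρ = bal r, the value Q r (a , b) is the excess of |m|² / 2 over its minimum.
Q : Fin 3 → ℤ × ℤ → ℕ
Q 0F (a , b) = T (ℤ.- a ℤ.- b) ℕ.+ T a ℕ.+ T b
Q 1F (a , b) = T (a ℤ.+ b ℤ.- + 1) ℕ.+ T (ℤ.- a) ℕ.+ T (ℤ.- b)
Q 2F (a , b) = T (-[1+ 0 ] ℤ.- a ℤ.- b) ℕ.+ T a ℕ.+ T b

_≟²_ : DecidableEquality (ℤ × ℤ)
_≟²_ = ≡-dec ℤ._≟_ ℤ._≟_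

_≟³_ : DecidableEquality (ℤ × (ℤ × ℤ))
_≟³_ = ≡-dec ℤ._≟_ _≟²_

_≟⁴_ : DecidableEquality (Fin 3 × (ℤ × (ℤ × ℤ)))
_≟⁴_ = ≡-dec Finₚ._≟_ _≟³_

T-large : ∀ {D} n → suc D ℕ.≤ n → D ℕ.≤ T (+ n) × D ℕ.≤ T (ℤ.- + n)
T-large (suc n) (s≤s D≤n) = ℕₚ.≤-trans D≤n (ℕₚ.≤-trans (ℕₚ.n≤1+n n) (n≤tri (suc n))) , ℕₚ.≤-trans D≤n (n≤tri n)

T-large⁻ : ∀ {D} n → suc D ℕ.≤ n → D ℕ.≤ T -[1+ n ] × D ℕ.≤ T (ℤ.- -[1+ n ])
T-large⁻ n D<n = ℕₚ.≤-trans (ℕₚ.<⇒≤ D<n) (n≤tri n) , ℕₚ.≤-trans (ℕₚ.<⇒≤ D<n) (ℕₚ.≤-trans (ℕₚ.n≤1+n n) (n≤tri (suc n)))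

box : ℕ → List (ℤ × ℤ)
box D = cartesianProduct (interval (suc D)) (interval (suc D))

module Reindexing where
  open ℤSolver using (solve; _:=_; con; _:+_; _:*_; _:-_; :-_)

  Quadruple : Set
  Quadruple = Fin 3 × (ℤ × (ℤ × ℤ))

  Triple : Set
  Triple = ℤ × (ℤ × ℤ)

  private
    triple : ∀ {a b c a′ b′ c′} → a ≡ a′ → b ≡ b′ → c ≡ c′ → _≡_ {A = Triple} (a , b , c) (a′ , b′ , c′)
    triple ≡.refl ≡.refl ≡.refl = ≡.refl

    quadruple : ∀ {p q : Fin 3 × ℤ} {b c b′ c′} → p ≡ q → b ≡ b′ → c ≡ c′ →
                _≡_ {A = Quadruple} (proj₁ p , (proj₂ p , (b , c))) (proj₁ q , (proj₂ q , (b′ , c′)))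
    quadruple ≡.refl ≡.refl ≡.refl = ≡.refl

  -- Triples of integers, by their sum s = 3 t + bal r.
  cubeTo : Quadruple → Triple
  cubeTo (r , (t , (a , b))) = t ℤ.+ bal r ℤ.- a ℤ.- b , (t ℤ.+ a , t ℤ.+ b)

  cubeFrom : Triple → Quadruple
  cubeFrom (k , (l , m)) with split₃ (k ℤ.+ l ℤ.+ m)
  ... | r , t = r , (t , (l ℤ.- t , m ℤ.- t))

  cubeTo∘From : ∀ i → cubeTo (cubeFrom i) ≡ i
  cubeTo∘From (k , (l , m)) with split₃ (k ℤ.+ l ℤ.+ m) | join₃-split₃ (k ℤ.+ l ℤ.+ m)
  ... | r , t | e = triple
    (≡.trans (solve 4 (λ t r l m → t :+ r :- (l :- t) :- (m :- t) := con (+ 3) :* t :+ r :- l :- m) ≡.refl t (bal r) l m)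
      (≡.trans (≡.cong (λ s → s ℤ.- l ℤ.- m) e) (solve 3 (λ k l m → k :+ l :+ m :- l :- m := k) ≡.refl k l m)))
    (solve 2 (λ t l → t :+ (l :- t) := l) ≡.refl t l) (solve 2 (λ t l → t :+ (l :- t) := l) ≡.refl t m)

  cubeFrom∘To : ∀ j → cubeFrom (cubeTo j) ≡ j
  cubeFrom∘To (r , (t , (a , b))) with split₃ (t ℤ.+ bal r ℤ.- a ℤ.- b ℤ.+ (t ℤ.+ a) ℤ.+ (t ℤ.+ b))
    | ≡.trans (≡.cong split₃ {x = t ℤ.+ bal r ℤ.- a ℤ.- b ℤ.+ (t ℤ.+ a) ℤ.+ (t ℤ.+ b)} (solve 4 (λ t r a b → t :+ r :- a :- b :+ (t :+ a) :+ (t :+ b) := con (+ 3) :* t :+ r) ≡.refl t (bal r) a b))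
        (split₃-join₃ (r , t))
  ... | p | ≡.refl = quadruple {p = p} ≡.refl (solve 2 (λ t a → t :+ a :- t := a) ≡.refl t a)
                                 (solve 2 (λ t a → t :+ a :- t := a) ≡.refl t b)

  -- Triples of integers congruent modulo 3, by their mean M.
  meanTo : Triple → Quadruple
  meanTo (M , (k , l)) with split₃ (M ℤ.- k ℤ.+ l)
  ... | r , t = r , (t , (t ℤ.+ k , t ℤ.- l))

  meanFrom : Quadruple → Triple
  meanFrom (r , (t , (t₂ , t₃))) = join₃ (r , t) ℤ.+ (t₂ ℤ.- t) ℤ.- (t ℤ.- t₃) , (t₂ ℤ.- t , t ℤ.- t₃)

  meanTo∘From : ∀ i → meanTo (meanFrom i) ≡ i
  meanTo∘From (r , (t , (t₂ , t₃))) with split₃ (join₃ (r , t) ℤ.+ (t₂ ℤ.- t) ℤ.- (t ℤ.- t₃) ℤ.- (t₂ ℤ.- t) ℤ.+ (t ℤ.- t₃))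
    | ≡.trans (≡.cong split₃ {x = join₃ (r , t) ℤ.+ (t₂ ℤ.- t) ℤ.- (t ℤ.- t₃) ℤ.- (t₂ ℤ.- t) ℤ.+ (t ℤ.- t₃)} (solve 3 (λ j k l → j :+ k :- l :- k :+ l := j) ≡.refl (join₃ (r , t)) (t₂ ℤ.- t) (t ℤ.- t₃)))
        (split₃-join₃ (r , t))
  ... | p | ≡.refl = quadruple {p = p} ≡.refl (solve 2 (λ t a → t :+ (a :- t) := a) ≡.refl t t₂)
                                 (solve 2 (λ t a → t :- (t :- a) := a) ≡.refl t t₃)

  meanFrom∘To : ∀ j → meanFrom (meanTo j) ≡ j
  meanFrom∘To (M , (k , l)) with split₃ (M ℤ.- k ℤ.+ l) | join₃-split₃ (M ℤ.- k ℤ.+ l)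
  ... | r , t | e = triple
    (≡.trans (≡.cong (λ j → j ℤ.+ (t ℤ.+ k ℤ.- t) ℤ.- (t ℤ.- (t ℤ.- l))) e)
      (solve 4 (λ M k l t → M :- k :+ l :+ (t :+ k :- t) :- (t :- (t :- l)) := M) ≡.refl M k l t))
    (solve 2 (λ t a → t :+ a :- t := a) ≡.refl t k) (solve 2 (λ t a → t :- (t :- a) := a) ≡.refl t l)

  -- Pairs of integers, by the residue of a - b modulo 3.
  planeTo : Fin 3 × (ℤ × ℤ) → ℤ × ℤ
  planeTo (r , (s , k)) = s ℤ.+ (k ℤ.+ k) ℤ.+ bal r , s ℤ.- k

  planeFrom : ℤ × ℤ → Fin 3 × (ℤ × ℤ)
  planeFrom (a , b) with split₃ (a ℤ.- b)
  ... | r , k = r , (b ℤ.+ k , k)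

  planeTo∘From : ∀ i → planeTo (planeFrom i) ≡ i
  planeTo∘From (a , b) with split₃ (a ℤ.- b) | join₃-split₃ (a ℤ.- b)
  ... | r , k | e = ≡.cong₂ _,_
    (≡.trans (solve 3 (λ b k r → b :+ k :+ (k :+ k) :+ r := b :+ (con (+ 3) :* k :+ r)) ≡.refl b k (bal r))
      (≡.trans (≡.cong (λ j → b ℤ.+ j) e) (solve 2 (λ a b → b :+ (a :- b) := a) ≡.refl a b)))
    (solve 2 (λ b k → b :+ k :- k := b) ≡.refl b k)

  planeFrom∘To : ∀ j → planeFrom (planeTo j) ≡ j
  planeFrom∘To (r , (s , k)) with split₃ (s ℤ.+ (k ℤ.+ k) ℤ.+ bal r ℤ.- (s ℤ.- k))
    | ≡.trans (≡.cong split₃ {x = s ℤ.+ (k ℤ.+ k) ℤ.+ bal r ℤ.- (s ℤ.- k)} (solve 3 (λ s k r → s :+ (k :+ k) :+ r :- (s :- k) := con (+ 3) :* k :+ r) ≡.refl s k (bal r)))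
        (split₃-join₃ (r , k))
  ... | p | ≡.refl = ≡.cong (λ j → r , (j , k)) (solve 2 (λ s k → s :- k :+ k := s) ≡.refl s k)

module ThetaIdentities (R : Ring₀) (D : ℕ) where
  open CommutativeRing R
  open Solver R
  open Sums R
  open Products R
  open TripleProduct R
  open Reindexing
  open Triangular using (tr; #_; _⊞_; _⊠_; exponents)
  open Triangular using (var) renaming (_:+_ to _⊕_; _:-_ to _⊝_; :-_ to ⊝_; _:*_ to _⊗_; con to κ)
  open import Relation.Binary.Reasoning.Setoid setoid

  ^-≡ : ∀ x {m n} → m ≡ n → x ^ m ≈ x ^ n
  ^-≡ x ≡.refl = refl

  xy-≡ : ∀ x y {a b c d} → a ≡ c → b ≡ d → x ^ a * y ^ b ≈ x ^ c * y ^ d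
  xy-≡ x y ≡.refl ≡.refl = refl

  xy-* : ∀ x y a b c d → x ^ a * y ^ b * (x ^ c * y ^ d) ≈ x ^ (a ℕ.+ c) * y ^ (b ℕ.+ d)
  xy-* x y a b c d = trans (solve 4 (λ a b c d → a :* b :* (c :* d) := a :* c :* (b :* d)) refl _ _ _ _)
    (sym (*-cong (^-homo-* x a c) (^-homo-* y b d)))

  xy-^ : ∀ x y a b k → (x ^ a * y ^ b) ^ k ≈ x ^ (k ℕ.* a) * y ^ (k ℕ.* b)
  xy-^ x y a b k = trans (^-distrib-* (x ^ a) (y ^ b) k)
    (*-cong (trans (^-assocʳ x a k) (^-≡ x (ℕₚ.*-comm a k))) (trans (^-assocʳ y b k) (^-≡ y (ℕₚ.*-comm b k))))

  mono-xy : ∀ x y a b c d m → mono (x ^ a * y ^ b) (x ^ c * y ^ d) m ≈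
            x ^ (T m ℕ.* a ℕ.+ T (ℤ.- m) ℕ.* c) * y ^ (T m ℕ.* b ℕ.+ T (ℤ.- m) ℕ.* d)
  mono-xy x y a b c d m = trans (*-cong (xy-^ x y a b (T m)) (xy-^ x y c d (T (ℤ.- m)))) (xy-* x y (T m ℕ.* a) (T m ℕ.* b) (T (ℤ.- m) ℕ.* c) (T (ℤ.- m) ℕ.* d))

  hasSum-pairs : ∀ B {f : ℤ × ℤ → Carrier} →
    (∀ a b → a ∉ interval B → f (a , b) ≈ 0#) → (∀ a b → b ∉ interval B → f (a , b) ≈ 0#) →
    HasSum f (sumOver (cartesianProduct (interval B) (interval B)) f)
  hasSum-pairs B {f} p q = hasSum _ (Uniqueₚ.cartesianProduct⁺ u u) out refl
    where
    u = HasSum.unique (hasSum-interval B {λ _ → 0#} (λ _ _ → refl) (λ _ _ → refl))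
    out : ∀ ab → ab ∉ cartesianProduct (interval B) (interval B) → f ab ≈ 0#
    out (a , b) ∉ with DecMembership._∈?_ ℤ._≟_ a (interval B)
    ... | yes a∈ = q a b (λ b∈ → ∉ (∈-cartesianProduct⁺ a∈ b∈))
    ... | no a∉ = p a b a∉

  interval-large : ∀ m → m ∉ interval (suc D) → D ℕ.≤ T m × D ℕ.≤ T (ℤ.- m)
  interval-large (+ n) m∉ with n ℕ.<? suc D
  ... | yes n<B = ⊥-elim (m∉ (∈-++⁺ˡ (∈-map⁺ +_ (∈-upTo⁺ n<B))))
  ... | no n≮B = T-large n (ℕₚ.≮⇒≥ n≮B)
  interval-large -[1+ n ] m∉ with n ℕ.<? suc D
  ... | yes n<B = ⊥-elim (m∉ (∈-++⁺ʳ (map +_ (upTo (suc D))) (∈-map⁺ -[1+_] (∈-upTo⁺ n<B))))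
  ... | no n≮B = T-large⁻ n (ℕₚ.≮⇒≥ n≮B)

  quad : Fin 3 → Carrier → Carrier
  quad r p = sumOver (box D) (λ ab → p ^ Q r ab)

  quad-cong : ∀ r {p q} → p ≈ q → quad r p ≈ quad r q
  quad-cong r p≈q = sum-cong (box D) (λ ab → ^-congˡ (Q r ab) p≈q)

  quad-sum : ∀ {p} → p ^ D ≈ 0# → ∀ r → HasSum (λ ab → p ^ Q r ab) (quad r p)
  quad-sum {p} pᴰ r = hasSum-pairs (suc D)
    (λ a b a∉ → ^-vanish pᴰ (boundˡ r a b (interval-large a a∉)))
    (λ a b b∉ → ^-vanish pᴰ (boundʳ r a b (interval-large b b∉)))
    where
    boundˡ : ∀ r a b → D ℕ.≤ T a × D ℕ.≤ T (ℤ.- a) → D ℕ.≤ Q r (a , b)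
    boundˡ 0F a b (u , _) = ℕₚ.≤-trans u (ℕₚ.≤-trans (ℕₚ.m≤n+m (T a) _) (ℕₚ.m≤m+n _ (T b)))
    boundˡ 1F a b (_ , u) = ℕₚ.≤-trans u (ℕₚ.≤-trans (ℕₚ.m≤n+m (T (ℤ.- a)) _) (ℕₚ.m≤m+n _ (T (ℤ.- b))))
    boundˡ 2F a b (u , _) = ℕₚ.≤-trans u (ℕₚ.≤-trans (ℕₚ.m≤n+m (T a) _) (ℕₚ.m≤m+n _ (T b)))
    boundʳ : ∀ r a b → D ℕ.≤ T b × D ℕ.≤ T (ℤ.- b) → D ℕ.≤ Q r (a , b)
    boundʳ 0F a b (u , _) = ℕₚ.≤-trans u (ℕₚ.m≤n+m (T b) _)
    boundʳ 1F a b (_ , u) = ℕₚ.≤-trans u (ℕₚ.m≤n+m (T (ℤ.- b)) _)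
    boundʳ 2F a b (u , _) = ℕₚ.≤-trans u (ℕₚ.m≤n+m (T b) _)

  quad-1≈2 : ∀ {p} → p ^ D ≈ 0# → quad 1F p ≈ quad 2F p
  quad-1≈2 {p} pᴰ = hasSum-unique _≟²_ (quad-sum pᴰ 1F)
    (hasSum-cong (λ (a , b) → ^-≡ p (exponents (a ∷ b ∷ [])
        (tr (κ -[1+ 0 ] ⊝ ⊝ var 0F ⊝ ⊝ var 1F) ⊞ tr (⊝ var 0F) ⊞ tr (⊝ var 1F))
        (tr (var 0F ⊕ var 1F ⊝ κ (+ 1)) ⊞ tr (⊝ var 0F) ⊞ tr (⊝ var 1F)) ≡.refl)) refl
      (hasSum-reindex negate negate negate-negate negate-negate (quad-sum pᴰ 2F)))
    where
    negate : ℤ × ℤ → ℤ × ℤ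
    negate (a , b) = ℤ.- a , ℤ.- b
    negate-negate : ∀ i → negate (negate i) ≡ i
    negate-negate (a , b) = ≡.cong₂ _,_ (ℤₚ.neg-involutive a) (ℤₚ.neg-involutive b)

  nilpotent-^ : ∀ {p} k → p ^ D ≈ 0# → (p ^ suc k) ^ D ≈ 0#
  nilpotent-^ {p} k pᴰ = trans (^-assocʳ p (suc k) D) (^-vanish {p} {D} pᴰ (ℕₚ.m≤n*m D (suc k)))

  quad-dissection : ∀ {p} → p ^ D ≈ 0# →
    quad 0F p ≈ quad 0F (p ^ 3) + (p * quad 2F (p ^ 3) + p * quad 1F (p ^ 3))
  quad-dissection {p} pᴰ = hasSum-unique (≡-dec Finₚ._≟_ _≟²_)
    (hasSum-reindex planeTo planeFrom planeTo∘From planeFrom∘To (quad-sum pᴰ 0F))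
    (hasSum-Fin3
      (hasSum-cong (λ (s , k) → trans (^-assocʳ p 3 (Q 0F (s , k))) (^-≡ p (≡.trans (ℕₚ.*-comm 3 (Q 0F (s , k))) (≡.trans (ℕₚ.*-comm (Q 0F (s , k)) 3) (exponents (s ∷ k ∷ [])
          (3 ⊠ (tr (⊝ var 0F ⊝ var 1F) ⊞ tr (var 0F) ⊞ tr (var 1F))) (plane (κ (+ 0))) ≡.refl))))) refl
        (quad-sum p³ᴰ 0F))
      (hasSum-cong (λ (s , k) → shifted (Q 2F (s , k)) (exponents (s ∷ k ∷ [])
          (# 1 ⊞ 3 ⊠ (tr (κ -[1+ 0 ] ⊝ var 0F ⊝ var 1F) ⊞ tr (var 0F) ⊞ tr (var 1F))) (plane (κ (+ 1))) ≡.refl)) refl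
        (hasSum-*ˡ p (quad-sum p³ᴰ 2F)))
      (hasSum-cong (λ (s , k) → shifted (Q 1F (s , k)) (exponents (s ∷ k ∷ [])
          (# 1 ⊞ 3 ⊠ (tr (var 0F ⊕ var 1F ⊝ κ (+ 1)) ⊞ tr (⊝ var 0F) ⊞ tr (⊝ var 1F))) (plane (κ -[1+ 0 ])) ≡.refl)) refl
        (hasSum-*ˡ p (quad-sum p³ᴰ 1F))))
    where
    p³ᴰ : (p ^ 3) ^ D ≈ 0#
    p³ᴰ = nilpotent-^ 2 pᴰ
    plane : Triangular.Polynomial 2 → Triangular.Exponent 2
    plane ρ = tr (⊝ (var 0F ⊕ (var 1F ⊕ var 1F) ⊕ ρ) ⊝ (var 0F ⊝ var 1F)) ⊞ tr (var 0F ⊕ (var 1F ⊕ var 1F) ⊕ ρ) ⊞ tr (var 0F ⊝ var 1F)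
    shifted : ∀ n {m} → 1 ℕ.+ 3 ℕ.* n ≡ m → p * (p ^ 3) ^ n ≈ p ^ m
    shifted n e = trans (*-congˡ (^-assocʳ p 3 n)) (^-≡ p e)

  module _ (x y : Carrier) where
    private
      p : Carrier
      p = x * y

    mono-* : ∀ k l m → mono x y k * (mono x y l * mono x y m) ≈
             x ^ (T k ℕ.+ (T l ℕ.+ T m)) * y ^ (T (ℤ.- k) ℕ.+ (T (ℤ.- l) ℕ.+ T (ℤ.- m)))
    mono-* k l m = trans (*-congˡ (xy-* x y (T l) (T (ℤ.- l)) (T m) (T (ℤ.- m))))
      (xy-* x y (T k) (T (ℤ.- k)) (T l ℕ.+ T m) (T (ℤ.- l) ℕ.+ T (ℤ.- m)))

    xy-p : ∀ a b n → x ^ a * y ^ b * p ^ n ≈ x ^ (a ℕ.+ n) * y ^ (b ℕ.+ n)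
    xy-p a b n = trans (*-congˡ (^-distrib-* x y n)) (xy-* x y a b n n)

    -- The term of (t + bal r, t, t): the class s = 3 t + bal r of the cube is this times powers of p.
    base : Fin 3 → ℤ → Carrier
    base r t = x ^ (T (t ℤ.+ bal r) ℕ.+ 2 ℕ.* T t) * y ^ (T (ℤ.- (t ℤ.+ bal r)) ℕ.+ 2 ℕ.* T (ℤ.- t))

    part : Fin 3 → Carrier
    part r = sumOver (interval (suc D)) (base r)

    slice : Fin 3 → Carrier
    slice r = sumOver (interval (suc D)) (λ t → mono x y (join₃ (r , t)))

    module _ (nilpotent : p ^ D ≈ 0#) where
      xy-vanish : ∀ {a b} → D ℕ.≤ a → D ℕ.≤ b → x ^ a * y ^ b ≈ 0#
      xy-vanish {a} {b} D≤a D≤b = begin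
        x ^ a * y ^ b
          ≈⟨ xy-≡ x y (ℕₚ.m∸n+n≡m D≤a) (ℕₚ.m∸n+n≡m D≤b) ⟨
        x ^ (a ℕ.∸ D ℕ.+ D) * y ^ (b ℕ.∸ D ℕ.+ D)  ≈⟨ xy-p (a ℕ.∸ D) (b ℕ.∸ D) D ⟨
        x ^ (a ℕ.∸ D) * y ^ (b ℕ.∸ D) * p ^ D  ≈⟨ *-congˡ nilpotent ⟩
        x ^ (a ℕ.∸ D) * y ^ (b ℕ.∸ D) * 0#  ≈⟨ zeroʳ _ ⟩
        0#  ∎

      xy-sum : ∀ {f : ℤ → Carrier} (α β : ℤ → ℕ) → (∀ t → x ^ α t * y ^ β t ≈ f t) →
               (∀ t → D ℕ.≤ T t → D ℕ.≤ T (ℤ.- t) → D ℕ.≤ α t × D ℕ.≤ β t) →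
               HasSum f (sumOver (interval (suc D)) f)
      xy-sum {f} α β e bound = hasSum-interval (suc D)
        (λ n n≥ → vanish (+ n) (T-large n n≥)) (λ n n≥ → vanish -[1+ n ] (T-large⁻ n n≥))
        where
        vanish : ∀ t → D ℕ.≤ T t × D ℕ.≤ T (ℤ.- t) → f t ≈ 0#
        vanish t (u , v) with bound t u v
        ... | D≤α , D≤β = trans (sym (e t)) (xy-vanish {α t} {β t} D≤α D≤β)

      part-sum : ∀ r → HasSum (base r) (part r)
      part-sum r = xy-sum (λ t → T (t ℤ.+ bal r) ℕ.+ 2 ℕ.* T t) (λ t → T (ℤ.- (t ℤ.+ bal r)) ℕ.+ 2 ℕ.* T (ℤ.- t)) (λ t → refl) (λ t u v → twice (T (t ℤ.+ bal r)) (T t) u , twice (T (ℤ.- (t ℤ.+ bal r))) (T (ℤ.- t)) v)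
        where
        twice : ∀ m n → D ℕ.≤ n → D ℕ.≤ m ℕ.+ 2 ℕ.* n
        twice m n D≤n = ℕₚ.≤-trans D≤n (ℕₚ.≤-trans (ℕₚ.m≤m+n n _) (ℕₚ.m≤n+m _ m))

      slice-sum : ∀ r → HasSum (λ t → mono x y (join₃ (r , t))) (slice r)
      slice-sum 0F = xy-sum (λ t → 6 ℕ.* T t ℕ.+ 3 ℕ.* T (ℤ.- t)) (λ t → 3 ℕ.* T t ℕ.+ 6 ℕ.* T (ℤ.- t))
        (λ t → xy-≡ x y
          (exponents (t ∷ []) (6 ⊠ tr (var 0F) ⊞ 3 ⊠ tr (⊝ var 0F)) (tr (κ (+ 3) ⊗ var 0F ⊕ κ (+ 0))) ≡.refl)
          (exponents (t ∷ []) (3 ⊠ tr (var 0F) ⊞ 6 ⊠ tr (⊝ var 0F)) (tr (⊝ (κ (+ 3) ⊗ var 0F ⊕ κ (+ 0)))) ≡.refl))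
        (λ t u v → ℕₚ.≤-trans u (ℕₚ.≤-trans (ℕₚ.m≤n*m _ 6) (ℕₚ.m≤m+n _ _))
                 , ℕₚ.≤-trans u (ℕₚ.≤-trans (ℕₚ.m≤n*m _ 3) (ℕₚ.m≤m+n _ _)))
      slice-sum 1F = xy-sum (λ t → 9 ℕ.* T t ℕ.+ 1) (λ t → 6 ℕ.* T t ℕ.+ 3 ℕ.* T (ℤ.- t))
        (λ t → xy-≡ x y
          (exponents (t ∷ []) (9 ⊠ tr (var 0F) ⊞ # 1) (tr (κ (+ 3) ⊗ var 0F ⊕ κ (+ 1))) ≡.refl)
          (exponents (t ∷ []) (6 ⊠ tr (var 0F) ⊞ 3 ⊠ tr (⊝ var 0F)) (tr (⊝ (κ (+ 3) ⊗ var 0F ⊕ κ (+ 1)))) ≡.refl))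
        (λ t u v → ℕₚ.≤-trans u (ℕₚ.≤-trans (ℕₚ.m≤n*m _ 9) (ℕₚ.m≤m+n _ _))
                 , ℕₚ.≤-trans u (ℕₚ.≤-trans (ℕₚ.m≤n*m _ 6) (ℕₚ.m≤m+n _ _)))
      slice-sum 2F = xy-sum (λ t → 3 ℕ.* T t ℕ.+ 6 ℕ.* T (ℤ.- t)) (λ t → 9 ℕ.* T (ℤ.- t) ℕ.+ 1)
        (λ t → xy-≡ x y
          (exponents (t ∷ []) (3 ⊠ tr (var 0F) ⊞ 6 ⊠ tr (⊝ var 0F)) (tr (κ (+ 3) ⊗ var 0F ⊕ κ -[1+ 0 ])) ≡.refl)
          (exponents (t ∷ []) (9 ⊠ tr (⊝ var 0F) ⊞ # 1) (tr (⊝ (κ (+ 3) ⊗ var 0F ⊕ κ -[1+ 0 ]))) ≡.refl))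
        (λ t u v → ℕₚ.≤-trans u (ℕₚ.≤-trans (ℕₚ.m≤n*m _ 3) (ℕₚ.m≤m+n _ _))
                 , ℕₚ.≤-trans v (ℕₚ.≤-trans (ℕₚ.m≤n*m _ 9) (ℕₚ.m≤m+n _ _)))

      theta-slices : theta x y D ≈ slice 0F + (slice 1F + slice 2F)
      theta-slices = hasSum-unique (≡-dec Finₚ._≟_ ℤ._≟_)
        (hasSum-reindex join₃ split₃ join₃-split₃ split₃-join₃ (theta-sum x y {D} nilpotent))
        (hasSum-Fin3 (slice-sum 0F) (slice-sum 1F) (slice-sum 2F))

      private
        p^ : ∀ a b c d k → a ℕ.+ c ≡ suc k → b ℕ.+ d ≡ suc k → (x ^ a * y ^ b * (x ^ c * y ^ d)) ^ D ≈ 0#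
        p^ a b c d k e f = trans (^-congˡ D (trans (xy-* x y a b c d) (trans (xy-≡ x y e f) (sym (^-distrib-* x y (suc k))))))
          (nilpotent-^ k nilpotent)

      slice-0 : slice 0F ≈ theta (x ^ 6 * y ^ 3) (x ^ 3 * y ^ 6) D
      slice-0 = hasSum-unique ℤ._≟_ (slice-sum 0F) (hasSum-cong (λ t → trans (mono-xy x y 6 3 3 6 t) (xy-≡ x y
          (≡.trans (≡.cong₂ ℕ._+_ (ℕₚ.*-comm (T t) 6) (ℕₚ.*-comm (T (ℤ.- t)) 3))
            (exponents (t ∷ []) (6 ⊠ tr (var 0F) ⊞ 3 ⊠ tr (⊝ var 0F)) (tr (κ (+ 3) ⊗ var 0F ⊕ κ (+ 0))) ≡.refl))
          (≡.trans (≡.cong₂ ℕ._+_ (ℕₚ.*-comm (T t) 3) (ℕₚ.*-comm (T (ℤ.- t)) 6))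
            (exponents (t ∷ []) (3 ⊠ tr (var 0F) ⊞ 6 ⊠ tr (⊝ var 0F)) (tr (⊝ (κ (+ 3) ⊗ var 0F ⊕ κ (+ 0)))) ≡.refl))))
          refl (theta-sum _ _ {D} (p^ 6 3 3 6 8 ≡.refl ≡.refl)))

      slice-1 : slice 1F ≈ x * theta (x ^ 9 * y ^ 6) (x ^ 0 * y ^ 3) D
      slice-1 = hasSum-unique ℤ._≟_ (slice-sum 1F) (hasSum-cong (λ t → trans (*-congˡ (mono-xy x y 9 6 0 3 t))
          (trans (solve 3 (λ x a b → x :* (a :* b) := x :* con (+ 1) :* con (+ 1) :* (a :* b)) refl x _ _)
          (trans (xy-* x y 1 0 (T t ℕ.* 9 ℕ.+ T (ℤ.- t) ℕ.* 0) (T t ℕ.* 6 ℕ.+ T (ℤ.- t) ℕ.* 3)) (xy-≡ x y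
          (≡.trans (≡.cong suc (≡.trans (≡.cong₂ ℕ._+_ (ℕₚ.*-comm (T t) 9) (ℕₚ.*-zeroʳ (T (ℤ.- t)))) (ℕₚ.+-identityʳ _)))
            (exponents (t ∷ []) (# 1 ⊞ 9 ⊠ tr (var 0F)) (tr (κ (+ 3) ⊗ var 0F ⊕ κ (+ 1))) ≡.refl))
          (≡.trans (≡.cong₂ ℕ._+_ (ℕₚ.*-comm (T t) 6) (ℕₚ.*-comm (T (ℤ.- t)) 3))
            (exponents (t ∷ []) (6 ⊠ tr (var 0F) ⊞ 3 ⊠ tr (⊝ var 0F)) (tr (⊝ (κ (+ 3) ⊗ var 0F ⊕ κ (+ 1)))) ≡.refl))))))
          refl (hasSum-*ˡ x (theta-sum _ _ {D} (p^ 9 6 0 3 8 ≡.refl ≡.refl))))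

      slice-2 : slice 2F ≈ y * theta (x ^ 3 * y ^ 0) (x ^ 6 * y ^ 9) D
      slice-2 = hasSum-unique ℤ._≟_ (slice-sum 2F) (hasSum-cong (λ t → trans (*-congˡ (mono-xy x y 3 0 6 9 t))
          (trans (solve 3 (λ x a b → x :* (a :* b) := con (+ 1) :* (x :* con (+ 1)) :* (a :* b)) refl y _ _)
          (trans (xy-* x y 0 1 (T t ℕ.* 3 ℕ.+ T (ℤ.- t) ℕ.* 6) (T t ℕ.* 0 ℕ.+ T (ℤ.- t) ℕ.* 9)) (xy-≡ x y
          (≡.trans (≡.cong₂ ℕ._+_ (ℕₚ.*-comm (T t) 3) (ℕₚ.*-comm (T (ℤ.- t)) 6))
            (exponents (t ∷ []) (3 ⊠ tr (var 0F) ⊞ 6 ⊠ tr (⊝ var 0F)) (tr (κ (+ 3) ⊗ var 0F ⊕ κ -[1+ 0 ])) ≡.refl))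
          (≡.trans (≡.cong suc (≡.cong₂ ℕ._+_ (ℕₚ.*-zeroʳ (T t)) (ℕₚ.*-comm (T (ℤ.- t)) 9)))
            (exponents (t ∷ []) (# 1 ⊞ 9 ⊠ tr (⊝ var 0F)) (tr (⊝ (κ (+ 3) ⊗ var 0F ⊕ κ -[1+ 0 ]))) ≡.refl))))))
          refl (hasSum-*ˡ y (theta-sum _ _ {D} (p^ 3 0 6 9 8 ≡.refl ≡.refl))))

      theta-cube : theta x y D * (theta x y D * theta x y D) ≈
        part 0F * quad 0F p + (part 1F * quad 1F p + part 2F * quad 2F p)
      theta-cube = hasSum-unique _≟⁴_
        (hasSum-reindex cubeTo cubeFrom cubeTo∘From cubeFrom∘To (hasSum-× ℤ._≟_ θ (hasSum-× ℤ._≟_ θ θ)))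
        (hasSum-Fin3 (class 0F) (class 1F) (class 2F))
        where
        θ = theta-sum x y {D} nilpotent
        k l m t : Triangular.Polynomial 3
        t = var 0F
        l = var 0F ⊕ var 1F
        m = var 0F ⊕ var 2F
        k = var 0F
        first : Fin 3 → Triangular.Polynomial 3
        first r = var 0F ⊕ κ (bal r) ⊝ var 1F ⊝ var 2F
        Qₑ : Fin 3 → Triangular.Exponent 3
        Qₑ 0F = tr (⊝ var 1F ⊝ var 2F) ⊞ tr (var 1F) ⊞ tr (var 2F)
        Qₑ 1F = tr (var 1F ⊕ var 2F ⊝ κ (+ 1)) ⊞ tr (⊝ var 1F) ⊞ tr (⊝ var 2F)
        Qₑ 2F = tr (κ -[1+ 0 ] ⊝ var 1F ⊝ var 2F) ⊞ tr (var 1F) ⊞ tr (var 2F)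
        same : ∀ r t a b → base r t * p ^ Q r (a , b) ≈
          mono x y (t ℤ.+ bal r ℤ.- a ℤ.- b) * (mono x y (t ℤ.+ a) * mono x y (t ℤ.+ b))
        same r t a b = trans (xy-p (T (t ℤ.+ bal r) ℕ.+ 2 ℕ.* T t) (T (ℤ.- (t ℤ.+ bal r)) ℕ.+ 2 ℕ.* T (ℤ.- t)) (Q r (a , b))) (trans (go r) (sym (mono-* (t ℤ.+ bal r ℤ.- a ℤ.- b) (t ℤ.+ a) (t ℤ.+ b))))
          where
          go : ∀ r → x ^ (T (t ℤ.+ bal r) ℕ.+ 2 ℕ.* T t ℕ.+ Q r (a , b)) *
                     y ^ (T (ℤ.- (t ℤ.+ bal r)) ℕ.+ 2 ℕ.* T (ℤ.- t) ℕ.+ Q r (a , b)) ≈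
            x ^ (T (t ℤ.+ bal r ℤ.- a ℤ.- b) ℕ.+ (T (t ℤ.+ a) ℕ.+ T (t ℤ.+ b))) *
            y ^ (T (ℤ.- (t ℤ.+ bal r ℤ.- a ℤ.- b)) ℕ.+ (T (ℤ.- (t ℤ.+ a)) ℕ.+ T (ℤ.- (t ℤ.+ b))))
          go 0F = xy-≡ x y
            (exponents (t ∷ a ∷ b ∷ []) (tr (var 0F ⊕ κ (bal 0F)) ⊞ 2 ⊠ tr (var 0F) ⊞ Qₑ 0F)
              (tr (first 0F) ⊞ (tr l ⊞ tr m)) ≡.refl)
            (exponents (t ∷ a ∷ b ∷ []) (tr (⊝ (var 0F ⊕ κ (bal 0F))) ⊞ 2 ⊠ tr (⊝ var 0F) ⊞ Qₑ 0F)
              (tr (⊝ first 0F) ⊞ (tr (⊝ l) ⊞ tr (⊝ m))) ≡.refl)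
          go 1F = xy-≡ x y
            (exponents (t ∷ a ∷ b ∷ []) (tr (var 0F ⊕ κ (bal 1F)) ⊞ 2 ⊠ tr (var 0F) ⊞ Qₑ 1F)
              (tr (first 1F) ⊞ (tr l ⊞ tr m)) ≡.refl)
            (exponents (t ∷ a ∷ b ∷ []) (tr (⊝ (var 0F ⊕ κ (bal 1F))) ⊞ 2 ⊠ tr (⊝ var 0F) ⊞ Qₑ 1F)
              (tr (⊝ first 1F) ⊞ (tr (⊝ l) ⊞ tr (⊝ m))) ≡.refl)
          go 2F = xy-≡ x y
            (exponents (t ∷ a ∷ b ∷ []) (tr (var 0F ⊕ κ (bal 2F)) ⊞ 2 ⊠ tr (var 0F) ⊞ Qₑ 2F)
              (tr (first 2F) ⊞ (tr l ⊞ tr m)) ≡.refl)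
            (exponents (t ∷ a ∷ b ∷ []) (tr (⊝ (var 0F ⊕ κ (bal 2F))) ⊞ 2 ⊠ tr (⊝ var 0F) ⊞ Qₑ 2F)
              (tr (⊝ first 2F) ⊞ (tr (⊝ l) ⊞ tr (⊝ m))) ≡.refl)
        class : ∀ r → HasSum (λ (t , (a , b)) →
          mono x y (t ℤ.+ bal r ℤ.- a ℤ.- b) * (mono x y (t ℤ.+ a) * mono x y (t ℤ.+ b))) (part r * quad r p)
        class r = hasSum-cong (λ (t , (a , b)) → same r t a b) refl (hasSum-× ℤ._≟_ (part-sum r) (quad-sum nilpotent r))

      theta³ : Carrier
      theta³ = theta (x ^ 3) (y ^ 3) D

      nilpotent³ : (x ^ 3 * y ^ 3) ^ D ≈ 0#
      nilpotent³ = trans (^-congˡ D (sym (^-distrib-* x y 3))) (nilpotent-^ 2 nilpotent)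

      mono³ : ∀ m → mono (x ^ 3) (y ^ 3) m ≈ x ^ (3 ℕ.* T m) * y ^ (3 ℕ.* T (ℤ.- m))
      mono³ m = *-cong (^-assocʳ x 3 (T m)) (^-assocʳ y 3 (T (ℤ.- m)))

      part-0 : part 0F ≈ theta³
      part-0 = hasSum-unique ℤ._≟_ (part-sum 0F) (hasSum-cong (λ t → trans (mono³ t) (xy-≡ x y
        (exponents (t ∷ []) (3 ⊠ tr (var 0F)) (tr (var 0F ⊕ κ (+ 0)) ⊞ 2 ⊠ tr (var 0F)) ≡.refl)
        (exponents (t ∷ []) (3 ⊠ tr (⊝ var 0F)) (tr (⊝ (var 0F ⊕ κ (+ 0))) ⊞ 2 ⊠ tr (⊝ var 0F)) ≡.refl)))
        refl (theta-sum _ _ {D} nilpotent³))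

      slice-cubes : slice 0F * (slice 0F * slice 0F) + (slice 1F * (slice 1F * slice 1F) +
                    slice 2F * (slice 2F * slice 2F)) ≈ theta³ * quad 0F (p ^ 3)
      slice-cubes = hasSum-unique _≟³_
        (hasSum-cong (λ (M , (k , l)) → same M k l) refl
          (hasSum-reindex meanTo meanFrom meanTo∘From meanFrom∘To
            (hasSum-Fin3 {f = term} (cube 0F) (cube 1F) (cube 2F))))
        (hasSum-× ℤ._≟_ (theta-sum _ _ {D} nilpotent³) (quad-sum (nilpotent-^ 2 nilpotent) 0F))
        where
        term : Quadruple → Carrier
        term (r , (t₁ , (t₂ , t₃))) =
          mono x y (join₃ (r , t₁)) * (mono x y (join₃ (r , t₂)) * mono x y (join₃ (r , t₃)))
        cube : ∀ r → HasSum (λ t → term (r , t)) (slice r * (slice r * slice r))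
        cube r = hasSum-× ℤ._≟_ (slice-sum r) (hasSum-× ℤ._≟_ (slice-sum r) (slice-sum r))
        M k l : Triangular.Polynomial 3
        M = var 0F
        k = var 1F
        l = var 2F
        same : ∀ M k l → term (meanTo (M , (k , l))) ≈ mono (x ^ 3) (y ^ 3) M * (p ^ 3) ^ Q 0F (k , l)
        same μ κ′ l′ with split₃ (μ ℤ.- κ′ ℤ.+ l′) | join₃-split₃ (μ ℤ.- κ′ ℤ.+ l′)
        ... | r , t | e = begin
          mono x y (join₃ (r , t)) * (mono x y (join₃ (r , t ℤ.+ κ′)) * mono x y (join₃ (r , t ℤ.- l′)))
            ≡⟨ ≡.cong₂ (λ i jk → mono x y i * (mono x y (proj₁ jk) * mono x y (proj₂ jk))) e (≡.cong₂ _,_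
                 (≡.trans (ℤSolver.solve 3 (λ t k r → κ (+ 3) ⊗ (t ⊕ k) ⊕ r ℤSolver.:= κ (+ 3) ⊗ t ⊕ r ⊕ κ (+ 3) ⊗ k) ≡.refl t κ′ (bal r))
                   (≡.cong (λ j → j ℤ.+ + 3 ℤ.* κ′) e))
                 (≡.trans (ℤSolver.solve 3 (λ t k r → κ (+ 3) ⊗ (t ⊝ k) ⊕ r ℤSolver.:= κ (+ 3) ⊗ t ⊕ r ⊝ κ (+ 3) ⊗ k) ≡.refl t l′ (bal r))
                   (≡.cong (λ j → j ℤ.- + 3 ℤ.* l′) e))) ⟩
          mono x y m₁ * (mono x y (m₁ ℤ.+ + 3 ℤ.* κ′) * mono x y (m₁ ℤ.- + 3 ℤ.* l′))
            ≈⟨ mono-* m₁ (m₁ ℤ.+ + 3 ℤ.* κ′) (m₁ ℤ.- + 3 ℤ.* l′) ⟩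
          _ ≈⟨ xy-≡ x y
            (exponents (μ ∷ κ′ ∷ l′ ∷ []) (tr n₁ ⊞ (tr (n₁ ⊕ κ (+ 3) ⊗ k) ⊞ tr (n₁ ⊝ κ (+ 3) ⊗ l)))
              (3 ⊠ tr M ⊞ 3 ⊠ (tr (⊝ k ⊝ l) ⊞ tr k ⊞ tr l)) ≡.refl)
            (exponents (μ ∷ κ′ ∷ l′ ∷ []) (tr (⊝ n₁) ⊞ (tr (⊝ (n₁ ⊕ κ (+ 3) ⊗ k)) ⊞ tr (⊝ (n₁ ⊝ κ (+ 3) ⊗ l))))
              (3 ⊠ tr (⊝ M) ⊞ 3 ⊠ (tr (⊝ k ⊝ l) ⊞ tr k ⊞ tr l)) ≡.refl) ⟩
          x ^ (3 ℕ.* T μ ℕ.+ 3 ℕ.* Q 0F (κ′ , l′)) * y ^ (3 ℕ.* T (ℤ.- μ) ℕ.+ 3 ℕ.* Q 0F (κ′ , l′))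
            ≈⟨ xy-p (3 ℕ.* T μ) (3 ℕ.* T (ℤ.- μ)) (3 ℕ.* Q 0F (κ′ , l′)) ⟨
          x ^ (3 ℕ.* T μ) * y ^ (3 ℕ.* T (ℤ.- μ)) * p ^ (3 ℕ.* Q 0F (κ′ , l′))
            ≈⟨ *-cong (mono³ μ) (^-assocʳ p 3 (Q 0F (κ′ , l′))) ⟨
          mono (x ^ 3) (y ^ 3) μ * (p ^ 3) ^ Q 0F (κ′ , l′) ∎
          where
          m₁ = μ ℤ.- κ′ ℤ.+ l′
          n₁ = M ⊝ k ⊕ l

module CubeRoot (R : Ring₀) (z : CommutativeRing.Carrier R)
                (z³≈1 : CommutativeRing._≈_ R (CommutativeRing._*_ R z (CommutativeRing._*_ R z z)) (CommutativeRing.1# R)) where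
  open CommutativeRing R
  open Solver R
  open Products R
  open import Relation.Binary.Reasoning.Setoid setoid

  1^ : ∀ n → 1# ^ n ≈ 1#
  1^ zero = refl
  1^ (suc n) = trans (*-identityˡ _) (1^ n)

  z^ : ∀ r k → z ^ (r ℕ.+ 3 ℕ.* k) ≈ z ^ r
  z^ r k = begin
    z ^ (r ℕ.+ 3 ℕ.* k)  ≈⟨ ^-homo-* z r (3 ℕ.* k) ⟩
    z ^ r * z ^ (3 ℕ.* k)  ≈⟨ *-congˡ (^-assocʳ z 3 k) ⟨
    z ^ r * (z ^ 3) ^ k  ≈⟨ *-congˡ (^-congˡ k (trans (*-congˡ (*-congˡ (*-identityʳ z))) z³≈1)) ⟩
    z ^ r * 1# ^ k  ≈⟨ *-congˡ (1^ k) ⟩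
    z ^ r * 1#  ≈⟨ *-identityʳ _ ⟩
    z ^ r  ∎

  twist : ∀ a b m n r k → r ℕ.+ 3 ℕ.* k ≡ m ℕ.+ 2 ℕ.* n → (z * a) ^ m * (z * z * b) ^ n ≈ z ^ r * (a ^ m * b ^ n)
  twist a b m n r k e = begin
    (z * a) ^ m * (z * z * b) ^ n  ≈⟨ *-cong (^-distrib-* z a m) (trans (^-distrib-* (z * z) b n)
                                                     (*-congʳ (^-congˡ n (*-congˡ (sym (*-identityʳ z)))))) ⟩
    z ^ m * a ^ m * ((z ^ 2) ^ n * b ^ n)  ≈⟨ *-congˡ (*-congʳ (^-assocʳ z 2 n)) ⟩
    z ^ m * a ^ m * (z ^ (2 ℕ.* n) * b ^ n)  ≈⟨ solve 4 (λ s a t b → s :* a :* (t :* b) := s :* t :* (a :* b)) refl _ _ _ _ ⟩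
    z ^ m * z ^ (2 ℕ.* n) * (a ^ m * b ^ n)  ≈⟨ *-congʳ (^-homo-* z m (2 ℕ.* n)) ⟨
    z ^ (m ℕ.+ 2 ℕ.* n) * (a ^ m * b ^ n)  ≡⟨ ≡.cong (λ k → z ^ k * (a ^ m * b ^ n)) (≡.sym e) ⟩
    z ^ (r ℕ.+ 3 ℕ.* k) * (a ^ m * b ^ n)  ≈⟨ *-congʳ (z^ r k) ⟩
    z ^ r * (a ^ m * b ^ n)  ∎

  twist-product : ∀ a b → z * a * (z * z * b) ≈ a * b
  twist-product a b = trans (solve 3 (λ z a b → z :* a :* (z :* z :* b) := z :* (z :* z) :* (a :* b)) refl z a b)
    (trans (*-congʳ z³≈1) (*-identityˡ _))

module GroupRingTools (R : Ring₀) where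
  open CommutativeRing R
  open Solver R
  open GroupRing R public
  module 𝕂 = CommutativeRing groupRing
  private
    module S = Sums R
    module SK = Sums groupRing
    module P = Products R
    module PK = Products groupRing

  ι-cong : ∀ {a b} → a ≈ b → ι a 𝕂.≈ ι b
  ι-cong p = eq p refl refl

  ι-+ : ∀ a b → ι (a + b) 𝕂.≈ ι a 𝕂.+ ι b
  ι-+ a b = eq refl (sym (+-identityˡ 0#)) (sym (+-identityˡ 0#))

  ι-neg : ∀ a → ι (- a) 𝕂.≈ 𝕂.- ι a
  ι-neg a = eq refl (sym -0#≈0#) (sym -0#≈0#)
    where open import Algebra.Properties.Ring ring using (-0#≈0#)

  ι-scale : ∀ a k → ι a 𝕂.* k 𝕂.≈ ⟨ a * c₀ k , a * c₁ k , a * c₂ k ⟩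
  ι-scale a ⟨ x , y , z ⟩ = eq (drop x z y) (drop y x z) (drop z y x)
    where
    drop : ∀ x y z → a * x + (0# * y + 0# * z) ≈ a * x
    drop = solve 4 (λ a x y z → a :* x :+ (con (+ 0) :* y :+ con (+ 0) :* z) := a :* x) refl a

  ι-* : ∀ a b → ι (a * b) 𝕂.≈ ι a 𝕂.* ι b
  ι-* a b = 𝕂.sym (𝕂.trans (ι-scale a (ι b)) (eq refl (zeroʳ a) (zeroʳ a)))

  ι-^ : ∀ a n → ι (a P.^ n) 𝕂.≈ ι a PK.^ n
  ι-^ a zero = 𝕂.refl
  ι-^ a (suc n) = 𝕂.trans (ι-* a (a P.^ n)) (𝕂.*-congˡ (ι-^ a n))

  ι-prod : ∀ n {f g} → (∀ i → ι (f i) 𝕂.≈ g i) → ι (P.prod n f) 𝕂.≈ PK.prod n g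
  ι-prod zero p = 𝕂.refl
  ι-prod (suc n) p = 𝕂.trans (ι-* _ _) (𝕂.*-cong (ι-prod n p) (p n))

  ι-sum : ∀ {I : Set} xs {f : I → Carrier} {g} → (∀ i → ι (f i) 𝕂.≈ g i) → ι (S.sumOver xs f) 𝕂.≈ SK.sumOver xs g
  ι-sum [] p = 𝕂.refl
  ι-sum (x ∷ xs) p = 𝕂.trans (ι-+ _ _) (𝕂.+-cong (p x) (ι-sum xs p))

  ι-euler : ∀ n a → ι (P.euler n a) 𝕂.≈ PK.euler n (ι a)
  ι-euler n a = ι-prod n (λ i → 𝕂.trans (ι-+ 1# _) (𝕂.+-congˡ (𝕂.trans (ι-neg _) (𝕂.-‿cong (ι-^ a (suc i))))))

  ι-quad : ∀ D r a → ι (ThetaIdentities.quad R D r a) 𝕂.≈ ThetaIdentities.quad groupRing D r (ι a)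
  ι-quad D r a = ι-sum (box D) (λ ab → ι-^ a (Q r ab))

  ζ³≈1 : ζ 𝕂.* (ζ 𝕂.* ζ) 𝕂.≈ 𝕂.1#
  ζ³≈1 = eq
    (solve 0 (let o = con (+ 0) ; i = con (+ 1) in
       o :* (o :* o :+ (i :* o :+ o :* i)) :+ (i :* (o :* o :+ (i :* i :+ o :* o)) :+ o :* (o :* i :+ (i :* o :+ o :* o))) := i) refl)
    (solve 0 (let o = con (+ 0) ; i = con (+ 1) in
       o :* (o :* i :+ (i :* o :+ o :* o)) :+ (i :* (o :* o :+ (i :* o :+ o :* i)) :+ o :* (o :* o :+ (i :* i :+ o :* o))) := o) refl)
    (solve 0 (let o = con (+ 0) ; i = con (+ 1) in
       o :* (o :* o :+ (i :* i :+ o :* o)) :+ (i :* (o :* i :+ (i :* o :+ o :* o)) :+ o :* (o :* o :+ (i :* o :+ o :* i))) := o) refl)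

  ζ-shift : ∀ k → ζ 𝕂.* k 𝕂.≈ ⟨ c₂ k , c₀ k , c₁ k ⟩
  ζ-shift ⟨ x , y , z ⟩ = eq
    (solve 3 (λ x y z → con (+ 0) :* x :+ (con (+ 1) :* z :+ con (+ 0) :* y) := z) refl x y z)
    (solve 3 (λ x y z → con (+ 0) :* y :+ (con (+ 1) :* x :+ con (+ 0) :* z) := x) refl x y z)
    (solve 3 (λ x y z → con (+ 0) :* z :+ (con (+ 1) :* y :+ con (+ 0) :* x) := y) refl x y z)

  ζ² : K
  ζ² = ζ 𝕂.* ζ

  ζ²-shift : ∀ k → ζ² 𝕂.* k 𝕂.≈ ⟨ c₁ k , c₂ k , c₀ k ⟩
  ζ²-shift k = 𝕂.trans (𝕂.*-assoc ζ ζ k) (𝕂.trans (𝕂.*-congˡ (ζ-shift k)) (ζ-shift _))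

  norm-1 : norm 𝕂.1# ≈ 1#
  norm-1 = solve 0 (let o = con (+ 0) ; i = con (+ 1) in
    i :* i :* i :+ o :* o :* o :+ o :* o :* o :- con (+ 3) :* (i :* o :* o) := i) refl

  norm-prod : ∀ n {f g} → (∀ i → norm (f i) ≈ g i) → norm (PK.prod n f) ≈ P.prod n g
  norm-prod zero p = norm-1
  norm-prod (suc n) {f} p = trans (norm-* (PK.prod n f) (f n)) (*-cong (norm-prod n p) (p n))

  norm-ι : ∀ a → norm (ι a) ≈ a * (a * a)
  norm-ι = solve 1 (λ a → let o = con (+ 0) in
    a :* a :* a :+ o :* o :* o :+ o :* o :* o :- con (+ 3) :* (a :* o :* o) := a :* (a :* a)) refl

  norm-1+ζ : ∀ a {k} → k 𝕂.≈ ζ 𝕂.* ι a → norm (𝕂.1# 𝕂.+ k) ≈ 1# + a * (a * a)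
  norm-1+ζ a {k} e = trans (norm-cong {𝕂.1# 𝕂.+ k} (𝕂.+-congˡ {x = 𝕂.1#} (𝕂.trans e (ζ-shift (ι a)))))
    (solve 1 (λ a → let x = con (+ 1) :+ con (+ 0) ; y = con (+ 0) :+ a ; z = con (+ 0) :+ con (+ 0) in
      x :* x :* x :+ y :* y :* y :+ z :* z :* z :- con (+ 3) :* (x :* y :* z) := con (+ 1) :+ a :* (a :* a)) refl a)

  norm-1+ζ² : ∀ a {k} → k 𝕂.≈ ζ² 𝕂.* ι a → norm (𝕂.1# 𝕂.+ k) ≈ 1# + a * (a * a)
  norm-1+ζ² a {k} e = trans (norm-cong {𝕂.1# 𝕂.+ k} (𝕂.+-congˡ {x = 𝕂.1#} (𝕂.trans e (ζ²-shift (ι a)))))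
    (solve 1 (λ a → let x = con (+ 1) :+ con (+ 0) ; y = con (+ 0) :+ con (+ 0) ; z = con (+ 0) :+ a in
      x :* x :* x :+ y :* y :* y :+ z :* z :* z :- con (+ 3) :* (x :* y :* z) := con (+ 1) :+ a :* (a :* a)) refl a)

  cube-K : ∀ a b c → ⟨ a , b , c ⟩ 𝕂.* (⟨ a , b , c ⟩ 𝕂.* ⟨ a , b , c ⟩) 𝕂.≈
    ⟨ a * (a * a) + (b * (b * b) + c * (c * c)) + Integers.fromℤ R (+ 6) * (a * (b * c))
    , Integers.fromℤ R (+ 3) * (a * a * b + (b * b * c + c * c * a))
    , Integers.fromℤ R (+ 3) * (a * a * c + (b * b * a + c * c * b)) ⟩
  cube-K a b c = eq
    (solve 3 (λ a b c → let s = a :* a :+ (b :* c :+ c :* b) ; t = a :* b :+ (b :* a :+ c :* c) ; u = a :* c :+ (b :* b :+ c :* a) in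
      a :* s :+ (b :* u :+ c :* t) := a :* (a :* a) :+ (b :* (b :* b) :+ c :* (c :* c)) :+ con (+ 6) :* (a :* (b :* c))) refl a b c)
    (solve 3 (λ a b c → let s = a :* a :+ (b :* c :+ c :* b) ; t = a :* b :+ (b :* a :+ c :* c) ; u = a :* c :+ (b :* b :+ c :* a) in
      a :* t :+ (b :* s :+ c :* u) := con (+ 3) :* (a :* a :* b :+ (b :* b :* c :+ c :* c :* a))) refl a b c)
    (solve 3 (λ a b c → let s = a :* a :+ (b :* c :+ c :* b) ; t = a :* b :+ (b :* a :+ c :* c) ; u = a :* c :+ (b :* b :+ c :* a) in
      a :* u :+ (b :* t :+ c :* s) := con (+ 3) :* (a :* a :* c :+ (b :* b :* a :+ c :* c :* b))) refl a b c)

module ThetaRelations (R : Ring₀) (D : ℕ) (u v : CommutativeRing.Carrier R) where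
  open CommutativeRing R
  open Solver R
  open Sums R using (sumOver; sum-cong; sum-*ˡ)
  open Products R
  open TripleProduct R
  open ThetaIdentities R D
  open GroupRingTools R
  open Triangular using (tr; #_; _⊞_; _⊠_; exponents)
  open Triangular using (var) renaming (_:+_ to _⊕_; _:-_ to _⊝_; :-_ to ⊝_; _:*_ to _⊗_; con to κ)
  open import Relation.Binary.Reasoning.Setoid setoid
  private
    module PK = Products groupRing
    module TK = TripleProduct groupRing
    module IK = ThetaIdentities groupRing D
    module SK = Sums groupRing
    module ℤR = Integers R

  p : Carrier
  p = u * v

  uK vK : K
  uK = ζ 𝕂.* ι u
  vK = ζ² 𝕂.* ι v

  open CubeRoot groupRing ζ ζ³≈1 using (twist; twist-product)

  uK*vK : uK 𝕂.* vK 𝕂.≈ ι p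
  uK*vK = 𝕂.trans (twist-product (ι u) (ι v)) (𝕂.sym (ι-* u v))

  module _ (nilpotent : p ^ D ≈ 0#) where
    nilpotentᴷ : (uK 𝕂.* vK) PK.^ D 𝕂.≈ 𝕂.0#
    nilpotentᴷ = 𝕂.trans (PK.^-congˡ D uK*vK) (𝕂.trans (𝕂.sym (ι-^ p D)) (ι-cong nilpotent))

    private
      twisted : ∀ m n r k → r ℕ.+ 3 ℕ.* k ≡ m ℕ.+ 2 ℕ.* n → uK PK.^ m 𝕂.* vK PK.^ n 𝕂.≈ ζ PK.^ r 𝕂.* ι (u ^ m * v ^ n)
      twisted m n r k e = 𝕂.trans (twist (ι u) (ι v) m n r k e)
        (𝕂.*-congˡ {x = ζ PK.^ r} (𝕂.sym (𝕂.trans (ι-* (u ^ m) (v ^ n)) (𝕂.*-cong (ι-^ u m) (ι-^ v n)))))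

      ζ-sum : ∀ r {f : ℤ → Carrier} {g} → (∀ t → g t 𝕂.≈ ζ PK.^ r 𝕂.* ι (f t)) →
              SK.sumOver (interval (suc D)) g 𝕂.≈ ζ PK.^ r 𝕂.* ι (sumOver (interval (suc D)) f)
      ζ-sum r {f} p = 𝕂.trans (SK.sum-cong (interval (suc D)) p)
        (𝕂.trans (𝕂.sym (SK.sum-*ˡ (ζ PK.^ r) (interval (suc D)) (λ t → ι (f t))))
          (𝕂.*-congˡ {x = ζ PK.^ r} (𝕂.sym (ι-sum (interval (suc D)) (λ t → 𝕂.refl)))))

      at-ζ⁰ : ∀ a → ζ PK.^ 0 𝕂.* ι a 𝕂.≈ ⟨ a , 0# , 0# ⟩
      at-ζ⁰ a = 𝕂.*-identityˡ (ι a)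
      at-ζ¹ : ∀ a → ζ PK.^ 1 𝕂.* ι a 𝕂.≈ ⟨ 0# , a , 0# ⟩
      at-ζ¹ a = 𝕂.trans (𝕂.*-congʳ (𝕂.*-identityʳ ζ)) (ζ-shift (ι a))
      at-ζ² : ∀ a → ζ PK.^ 2 𝕂.* ι a 𝕂.≈ ⟨ 0# , 0# , a ⟩
      at-ζ² a = 𝕂.trans (𝕂.*-congʳ (𝕂.*-congˡ {x = ζ} (𝕂.*-identityʳ ζ))) (ζ²-shift (ι a))

      assemble : ∀ {k₀ k₁ k₂} a b c → k₀ 𝕂.≈ ζ PK.^ 0 𝕂.* ι a → k₁ 𝕂.≈ ζ PK.^ 1 𝕂.* ι b → k₂ 𝕂.≈ ζ PK.^ 2 𝕂.* ι c →
                 k₀ 𝕂.+ (k₁ 𝕂.+ k₂) 𝕂.≈ ⟨ a , b , c ⟩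
      assemble a b c p q r = 𝕂.trans (𝕂.+-cong (𝕂.trans p (at-ζ⁰ a)) (𝕂.+-cong (𝕂.trans q (at-ζ¹ b)) (𝕂.trans r (at-ζ² c))))
        (eq (solve 1 (λ a → a :+ (con (+ 0) :+ con (+ 0)) := a) refl a)
            (solve 1 (λ b → con (+ 0) :+ (b :+ con (+ 0)) := b) refl b)
            (solve 1 (λ c → con (+ 0) :+ (con (+ 0) :+ c) := c) refl c))

    θᴷ : K
    θᴷ = TK.theta uK vK D

    s₀ s₁ s₂ : Carrier
    s₀ = slice u v 0F
    s₁ = slice u v 1F
    s₂ = slice u v 2F

    private
      tr∓ : ∀ {n} → Triangular.Polynomial n → Triangular.Exponent n
      tr∓ e = tr e ⊞ 2 ⊠ tr (⊝ e)

    theta-K : θᴷ 𝕂.≈ ⟨ s₀ , s₁ , s₂ ⟩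
    theta-K = 𝕂.trans (IK.theta-slices uK vK nilpotentᴷ) (assemble s₀ s₁ s₂
      (ζ-sum 0 (λ t → twisted (T (join₃ (0F , t))) (T (ℤ.- join₃ (0F , t))) 0 (4 ℕ.* T t ℕ.+ 5 ℕ.* T (ℤ.- t))
        (exponents (t ∷ []) (# 0 ⊞ 3 ⊠ (4 ⊠ tr (var 0F) ⊞ 5 ⊠ tr (⊝ var 0F))) (tr∓ (κ (+ 3) ⊗ var 0F ⊕ κ (+ 0))) ≡.refl)))
      (ζ-sum 1 (λ t → twisted (T (join₃ (1F , t))) (T (ℤ.- join₃ (1F , t))) 1 (7 ℕ.* T t ℕ.+ 2 ℕ.* T (ℤ.- t))
        (exponents (t ∷ []) (# 1 ⊞ 3 ⊠ (7 ⊠ tr (var 0F) ⊞ 2 ⊠ tr (⊝ var 0F))) (tr∓ (κ (+ 3) ⊗ var 0F ⊕ κ (+ 1))) ≡.refl)))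
      (ζ-sum 2 (λ t → twisted (T (join₃ (2F , t))) (T (ℤ.- join₃ (2F , t))) 2 (1 ℕ.* T t ℕ.+ 8 ℕ.* T (ℤ.- t))
        (exponents (t ∷ []) (# 2 ⊞ 3 ⊠ (1 ⊠ tr (var 0F) ⊞ 8 ⊠ tr (⊝ var 0F))) (tr∓ (κ (+ 3) ⊗ var 0F ⊕ κ -[1+ 0 ])) ≡.refl))))

    private
      part-exponents : (r : Fin 3) → Triangular.Exponent 1
      part-exponents r = (tr (var 0F ⊕ κ (bal r)) ⊞ 2 ⊠ tr (var 0F)) ⊞ 2 ⊠ (tr (⊝ (var 0F ⊕ κ (bal r))) ⊞ 2 ⊠ tr (⊝ var 0F))

    theta-cube-K : θᴷ 𝕂.* (θᴷ 𝕂.* θᴷ) 𝕂.≈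
      ⟨ part u v 0F * quad 0F p , part u v 1F * quad 1F p , part u v 2F * quad 2F p ⟩
    theta-cube-K = 𝕂.trans (IK.theta-cube uK vK nilpotentᴷ) (assemble (part u v 0F * quad 0F p) (part u v 1F * quad 1F p) (part u v 2F * quad 2F p)
      (class 0 0F (ζ-sum 0 (λ t → twisted (α 0F t) (β 0F t) 0 (T t ℕ.+ 2 ℕ.* T (ℤ.- t))
        (exponents (t ∷ []) (# 0 ⊞ 3 ⊠ (tr (var 0F) ⊞ 2 ⊠ tr (⊝ var 0F))) (part-exponents 0F) ≡.refl))))
      (class 1 1F (ζ-sum 1 (λ t → twisted (α 1F t) (β 1F t) 1 (2 ℕ.* T t ℕ.+ T (ℤ.- t))
        (exponents (t ∷ []) (# 1 ⊞ 3 ⊠ (2 ⊠ tr (var 0F) ⊞ tr (⊝ var 0F))) (part-exponents 1F) ≡.refl))))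
      (class 2 2F (ζ-sum 2 (λ t → twisted (α 2F t) (β 2F t) 2 (3 ℕ.* T (ℤ.- t))
        (exponents (t ∷ []) (# 2 ⊞ 3 ⊠ (3 ⊠ tr (⊝ var 0F))) (part-exponents 2F) ≡.refl)))))
      where
      α β : Fin 3 → ℤ → ℕ
      α r t = T (t ℤ.+ bal r) ℕ.+ 2 ℕ.* T t
      β r t = T (ℤ.- (t ℤ.+ bal r)) ℕ.+ 2 ℕ.* T (ℤ.- t)
      class : ∀ n r → IK.part uK vK r 𝕂.≈ ζ PK.^ n 𝕂.* ι (part u v r) →
              IK.part uK vK r 𝕂.* IK.quad r (uK 𝕂.* vK) 𝕂.≈ ζ PK.^ n 𝕂.* ι (part u v r * quad r p)
      class n r e = 𝕂.trans (𝕂.*-cong e (𝕂.trans (IK.quad-cong r uK*vK) (𝕂.sym (ι-quad D r p))))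
        (𝕂.trans (𝕂.*-assoc (ζ PK.^ n) _ _) (𝕂.*-congˡ {x = ζ PK.^ n} (𝕂.sym (ι-* (part u v r) (quad r p)))))

    E₁ E₃ E₉ Θ e₁ e₃ : Carrier
    E₁ = euler D p
    E₃ = euler D (p ^ 3)
    E₉ = euler D (p ^ 9)
    Θ = theta (u ^ 3) (v ^ 3) D
    e₁ = s₀ * (s₀ * s₀) + (s₁ * (s₁ * s₁) + s₂ * (s₂ * s₂))
    e₃ = s₀ * (s₁ * s₂)

    slice-cubes-sum : e₁ ≈ Θ * quad 0F (p ^ 3)
    slice-cubes-sum = slice-cubes u v nilpotent

    cube-relation : e₁ + ℤR.fromℤ (+ 6) * e₃ ≈ Θ * quad 0F p
    cube-relation = trans
      (eq₀ (𝕂.trans (𝕂.sym (cube-K s₀ s₁ s₂))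
        (𝕂.trans (𝕂.sym (𝕂.*-cong theta-K (𝕂.*-cong theta-K theta-K))) theta-cube-K)))
      (*-congʳ (part-0 u v nilpotent))

    ninth-power : c₀ ((θᴷ 𝕂.* (θᴷ 𝕂.* θᴷ)) 𝕂.* ((θᴷ 𝕂.* (θᴷ 𝕂.* θᴷ)) 𝕂.* (θᴷ 𝕂.* (θᴷ 𝕂.* θᴷ)))) ≈
      (let a = part u v 0F * quad 0F p ; b = part u v 1F * quad 1F p ; c = part u v 2F * quad 2F p in
       a * (a * a) + (b * (b * b) + c * (c * c)) + ℤR.fromℤ (+ 6) * (a * (b * c)))
    ninth-power = eq₀ (𝕂.trans (𝕂.*-cong theta-cube-K (𝕂.*-cong theta-cube-K theta-cube-K)) (cube-K _ _ _))

    private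
      P : Carrier
      P = u ^ 3 * v ^ 3

      Pᴰ : P ^ D ≈ 0#
      Pᴰ = nilpotent³ u v nilpotent

      P≈p³ : P ≈ p ^ 3
      P≈p³ = sym (^-distrib-* u v 3)

    triple-product³ : E₃ * jacobi (u ^ 3) (v ^ 3) D ≈ Θ
    triple-product³ = trans (*-congʳ (euler-cong D (sym P≈p³))) (triple-product (u ^ 3) (v ^ 3) {D} Pᴰ)

    private
      norm-factor : ∀ w i → w * p ^ i * (w * p ^ i * (w * p ^ i)) ≈ w ^ 3 * P ^ i
      norm-factor w i = begin
        w * p ^ i * (w * p ^ i * (w * p ^ i))  ≈⟨ solve 2 (λ w x → w :* x :* (w :* x :* (w :* x)) := w :^ 3 :* x :^ 3) refl w (p ^ i) ⟩
        w ^ 3 * (p ^ i) ^ 3  ≈⟨ *-congˡ (trans (^-assocʳ p i 3) (^-≡ p (ℕₚ.*-comm i 3))) ⟩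
        w ^ 3 * p ^ (3 ℕ.* i)  ≈⟨ *-congˡ (^-assocʳ p 3 i) ⟨
        w ^ 3 * (p ^ 3) ^ i  ≈⟨ *-congˡ (^-congˡ i P≈p³) ⟨
        w ^ 3 * P ^ i  ∎

      twisted-power : ∀ z w i → (z 𝕂.* ι w) 𝕂.* (uK 𝕂.* vK) PK.^ i 𝕂.≈ z 𝕂.* ι (w * p ^ i)
      twisted-power z w i = 𝕂.trans (𝕂.*-assoc z (ι w) _) (𝕂.*-congˡ {x = z}
        (𝕂.trans (𝕂.*-congˡ {x = ι w} (𝕂.trans (PK.^-congˡ i uK*vK) (𝕂.sym (ι-^ p i)))) (𝕂.sym (ι-* w (p ^ i)))))

      norm-jacobi : norm (TK.jacobi uK vK D) ≈ jacobi (u ^ 3) (v ^ 3) D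
      norm-jacobi = trans (norm-* (TK.halfˣ uK vK D) (TK.halfʸ uK vK D)) (*-cong
        (norm-prod D (λ i → trans (norm-1+ζ (u * p ^ i) (twisted-power ζ u i)) (+-congˡ (norm-factor u i))))
        (norm-prod D (λ i → trans (norm-1+ζ² (v * p ^ i) (twisted-power ζ² v i)) (+-congˡ (norm-factor v i)))))

    norm-theta : norm θᴷ ≈ E₁ * (E₁ * E₁) * jacobi (u ^ 3) (v ^ 3) D
    norm-theta = begin
      norm θᴷ
        ≈⟨ norm-cong (TK.triple-product uK vK {D} nilpotentᴷ) ⟨
      norm (PK.euler D (uK 𝕂.* vK) 𝕂.* TK.jacobi uK vK D)
        ≈⟨ norm-* (PK.euler D (uK 𝕂.* vK)) (TK.jacobi uK vK D) ⟩
      norm (PK.euler D (uK 𝕂.* vK)) * norm (TK.jacobi uK vK D)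
        ≈⟨ *-cong (trans (norm-cong (𝕂.trans (PK.euler-cong D uK*vK) (𝕂.sym (ι-euler D p)))) (norm-ι E₁)) norm-jacobi ⟩
      E₁ * (E₁ * E₁) * jacobi (u ^ 3) (v ^ 3) D ∎

    norm-relation : E₃ * (e₁ - ℤR.fromℤ (+ 3) * e₃) ≈ E₁ * (E₁ * E₁) * Θ
    norm-relation = begin
      E₃ * (e₁ - ℤR.fromℤ (+ 3) * e₃)
        ≈⟨ solve 4 (λ E a b c → E :* (a :* (a :* a) :+ (b :* (b :* b) :+ c :* (c :* c)) :- con (+ 3) :* (a :* (b :* c))) :=
             E :* (a :* a :* a :+ b :* b :* b :+ c :* c :* c :- con (+ 3) :* (a :* b :* c))) refl E₃ s₀ s₁ s₂ ⟩
      E₃ * norm ⟨ s₀ , s₁ , s₂ ⟩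
        ≈⟨ *-congˡ (trans (sym (norm-cong theta-K)) norm-theta) ⟩
      E₃ * (E₁ * (E₁ * E₁) * jacobi (u ^ 3) (v ^ 3) D)
        ≈⟨ solve 3 (λ E F J → E :* (F :* J) := F :* (E :* J)) refl E₃ (E₁ * (E₁ * E₁)) (jacobi (u ^ 3) (v ^ 3) D) ⟩
      E₁ * (E₁ * E₁) * (E₃ * jacobi (u ^ 3) (v ^ 3) D)
        ≈⟨ *-congˡ triple-product³ ⟩
      E₁ * (E₁ * E₁) * Θ ∎

    private
      product : (a b c d : ℕ) → Carrier
      product a b c d = jacobi (u ^ a * v ^ b) (u ^ c * v ^ d) D

      slice-product : ∀ a b c d → u ^ a * v ^ b * (u ^ c * v ^ d) ≈ p ^ 9 →
                      theta (u ^ a * v ^ b) (u ^ c * v ^ d) D ≈ E₉ * product a b c d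
      slice-product a b c d e = sym (trans (*-congʳ (euler-cong D (sym e)))
        (triple-product (u ^ a * v ^ b) (u ^ c * v ^ d) {D} (trans (^-congˡ D e) (nilpotent-^ 8 nilpotent))))

      factors : Carrier → ℕ → Carrier
      factors w j = prod D (λ i → 1# + w * P ^ (j ℕ.+ i ℕ.* 3))

      factor : ∀ w j {a b} → a ≈ w * P ^ j → b ≈ P ^ 3 → prod D (λ i → 1# + a * b ^ i) ≈ factors w j
      factor w j {a} {b} e f = prod-cong D (λ i → +-congˡ (begin
        a * b ^ i  ≈⟨ *-cong e (trans (^-congˡ i f) (trans (^-assocʳ P 3 i) (^-≡ P (ℕₚ.*-comm 3 i)))) ⟩
        w * P ^ j * P ^ (i ℕ.* 3)  ≈⟨ *-assoc _ _ _ ⟩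
        w * (P ^ j * P ^ (i ℕ.* 3))  ≈⟨ *-congˡ (^-homo-* P j (i ℕ.* 3)) ⟨
        w * P ^ (j ℕ.+ i ℕ.* 3)  ∎))

      product-factors : ∀ a b c d j k → u ^ a * v ^ b ≈ u ^ 3 * P ^ j → u ^ c * v ^ d ≈ v ^ 3 * P ^ k →
                        u ^ a * v ^ b * (u ^ c * v ^ d) ≈ P ^ 3 → product a b c d ≈ factors (u ^ 3) j * factors (v ^ 3) k
      product-factors a b c d j k e f g = *-cong (factor (u ^ 3) j e g) (factor (v ^ 3) k f g)

      product-all : product 6 3 3 6 * (product 9 6 0 3 * product 3 0 6 9) ≈ jacobi (u ^ 3) (v ^ 3) D
      product-all = begin
        product 6 3 3 6 * (product 9 6 0 3 * product 3 0 6 9)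
          ≈⟨ *-cong
               (product-factors 6 3 3 6 1 1
                 (solve 2 (λ u v → u :^ 6 :* v :^ 3 := u :^ 3 :* (u :^ 3 :* v :^ 3) :^ 1) refl u v)
                 (solve 2 (λ u v → u :^ 3 :* v :^ 6 := v :^ 3 :* (u :^ 3 :* v :^ 3) :^ 1) refl u v)
                 (solve 2 (λ u v → u :^ 6 :* v :^ 3 :* (u :^ 3 :* v :^ 6) := (u :^ 3 :* v :^ 3) :^ 3) refl u v))
             (*-cong
               (product-factors 9 6 0 3 2 0
                 (solve 2 (λ u v → u :^ 9 :* v :^ 6 := u :^ 3 :* (u :^ 3 :* v :^ 3) :^ 2) refl u v)
                 (solve 2 (λ u v → u :^ 0 :* v :^ 3 := v :^ 3 :* (u :^ 3 :* v :^ 3) :^ 0) refl u v)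
                 (solve 2 (λ u v → u :^ 9 :* v :^ 6 :* (u :^ 0 :* v :^ 3) := (u :^ 3 :* v :^ 3) :^ 3) refl u v))
               (product-factors 3 0 6 9 0 2
                 (solve 2 (λ u v → u :^ 3 :* v :^ 0 := u :^ 3 :* (u :^ 3 :* v :^ 3) :^ 0) refl u v)
                 (solve 2 (λ u v → u :^ 6 :* v :^ 9 := v :^ 3 :* (u :^ 3 :* v :^ 3) :^ 2) refl u v)
                 (solve 2 (λ u v → u :^ 3 :* v :^ 0 :* (u :^ 6 :* v :^ 9) := (u :^ 3 :* v :^ 3) :^ 3) refl u v))) ⟩
        A 1 * B 1 * (A 2 * B 0 * (A 0 * B 2))
          ≈⟨ solve 6 (λ a b c x y z → b :* y :* (c :* x :* (a :* z)) := a :* (b :* c) :* (x :* (y :* z))) refl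
               (A 0) (A 1) (A 2) (B 0) (B 1) (B 2) ⟩
        A 0 * (A 1 * A 2) * (B 0 * (B 1 * B 2))
          ≈⟨ *-cong (prod-triple D (λ i → 1# + u ^ 3 * P ^ i)) (prod-triple D (λ i → 1# + v ^ 3 * P ^ i)) ⟨
        jacobi (u ^ 3) (v ^ 3) (D ℕ.* 3)
          ≈⟨ jacobi-stable (u ^ 3) (v ^ 3) {D} Pᴰ (ℕₚ.m≤m*n D 3) ⟩
        jacobi (u ^ 3) (v ^ 3) D ∎
        where
        A B : ℕ → Carrier
        A = factors (u ^ 3)
        B = factors (v ^ 3)

    slice-product-relation : E₃ * e₃ ≈ p * (E₉ * (E₉ * E₉)) * Θ
    slice-product-relation = begin
      E₃ * (s₀ * (s₁ * s₂))
        ≈⟨ *-congˡ (*-cong (trans (slice-0 u v nilpotent) (slice-product 6 3 3 6 (p⁹ (solve 2 (λ u v → u :^ 6 :* v :^ 3 :* (u :^ 3 :* v :^ 6) := u :^ 9 :* v :^ 9) refl u v))))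
             (*-cong (trans (slice-1 u v nilpotent) (*-congˡ (slice-product 9 6 0 3 (p⁹ (solve 2 (λ u v → u :^ 9 :* v :^ 6 :* (u :^ 0 :* v :^ 3) := u :^ 9 :* v :^ 9) refl u v)))))
               (trans (slice-2 u v nilpotent) (*-congˡ (slice-product 3 0 6 9 (p⁹ (solve 2 (λ u v → u :^ 3 :* v :^ 0 :* (u :^ 6 :* v :^ 9) := u :^ 9 :* v :^ 9) refl u v))))))) ⟩
      E₃ * (E₉ * product 6 3 3 6 * (u * (E₉ * product 9 6 0 3) * (v * (E₉ * product 3 0 6 9))))
        ≈⟨ solve 7 (λ E F u v a b c → E :* (F :* a :* (u :* (F :* b) :* (v :* (F :* c)))) := u :* v :* (F :* (F :* F)) :* (E :* (a :* (b :* c)))) refl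
             E₃ E₉ u v (product 6 3 3 6) (product 9 6 0 3) (product 3 0 6 9) ⟩
      p * (E₉ * (E₉ * E₉)) * (E₃ * (product 6 3 3 6 * (product 9 6 0 3 * product 3 0 6 9)))
        ≈⟨ *-congˡ (trans (*-congˡ product-all) triple-product³) ⟩
      p * (E₉ * (E₉ * E₉)) * Θ ∎
      where
      p⁹ : ∀ {a} → a ≈ u ^ 9 * v ^ 9 → a ≈ p ^ 9
      p⁹ e = trans e (sym (^-distrib-* u v 9))

-- From theta series to eta quotients

-- An additive map δ : S → R that turns multiplication by u v into multiplication by q and sends the theta
-- series of u³, v³ to 1: the model is the extraction of the diagonal coefficients.
record Extraction (S R : Ring₀) (D : ℕ) (u v : CommutativeRing.Carrier S) (q : CommutativeRing.Carrier R) : Set where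
  private
    module S = CommutativeRing S
    module R = CommutativeRing R
    module PS = Products S
    module PR = Products R
  field
    δ           : S.Carrier → R.Carrier
    δ-cong      : ∀ {a b} → a S.≈ b → δ a R.≈ δ b
    δ-+         : ∀ a b → δ (a S.+ b) R.≈ δ a R.+ δ b
    δ-neg       : ∀ a → δ (S.- a) R.≈ R.- δ a
    δ-0         : δ S.0# R.≈ R.0#
    δ-uv        : ∀ h → δ (u S.* v S.* h) R.≈ q R.* δ h
    uv-nilpotent : (u S.* v) PS.^ D S.≈ S.0#
    q-nilpotent  : q PR.^ D R.≈ R.0#
    δ-theta     : δ (TripleProduct.theta S (u PS.^ 3) (v PS.^ 3) D) R.≈ R.1#

module ExtractedRelations {S R : Ring₀} {D : ℕ} {u v : CommutativeRing.Carrier S} {q : CommutativeRing.Carrier R}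
                          (E : Extraction S R D u v q) where
  private
    module S = CommutativeRing S
    module PS = Products S
    module IS = ThetaIdentities S D
    module TS = ThetaRelations S D u v
  open CommutativeRing R
  open Solver R
  open Integers R
  open Sums R using (sumOver)
  open Products R
  open ThetaIdentities R D using (quad)
  open Extraction E
  open import Relation.Binary.Reasoning.Setoid setoid
  open import Algebra.Properties.Ring ring using (-‿distribˡ-*)
  open import Algebra.Properties.Ring S.ring using () renaming (-‿distribˡ-* to S-‿distribˡ-*)

  Linear : S.Carrier → Carrier → Set
  Linear c d = ∀ h → δ (c S.* h) ≈ d * δ h

  linear-1 : Linear S.1# 1#
  linear-1 h = trans (δ-cong (S.*-identityˡ h)) (sym (*-identityˡ _))

  linear-0 : Linear S.0# 0#
  linear-0 h = trans (δ-cong (S.zeroˡ h)) (trans δ-0 (sym (zeroˡ _)))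

  linear-+ : ∀ {c c′ d d′} → Linear c d → Linear c′ d′ → Linear (c S.+ c′) (d + d′)
  linear-+ l l′ h = trans (δ-cong (S.distribʳ h _ _)) (trans (δ-+ _ _) (trans (+-cong (l h) (l′ h)) (sym (distribʳ _ _ _))))

  linear-neg : ∀ {c d} → Linear c d → Linear (S.- c) (- d)
  linear-neg l h = trans (δ-cong (S.sym (S-‿distribˡ-* _ h))) (trans (δ-neg _) (trans (-‿cong (l h)) (-‿distribˡ-* _ _)))

  linear-* : ∀ {c c′ d d′} → Linear c d → Linear c′ d′ → Linear (c S.* c′) (d * d′)
  linear-* l l′ h = trans (δ-cong (S.*-assoc _ _ h)) (trans (l _) (trans (*-congˡ (l′ h)) (sym (*-assoc _ _ _))))

  linear-^ : ∀ {c d} → Linear c d → ∀ n → Linear (c PS.^ n) (d ^ n)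
  linear-^ l zero = linear-1
  linear-^ l (suc n) = linear-* l (linear-^ l n)

  linear-prod : ∀ n {f g} → (∀ i → Linear (f i) (g i)) → Linear (PS.prod n f) (prod n g)
  linear-prod zero p = linear-1
  linear-prod (suc n) p = linear-* (linear-prod n p) (p n)

  linear-sum : ∀ {I : Set} (xs : List I) {f g} → (∀ i → Linear (f i) (g i)) → Linear (Sums.sumOver S xs f) (sumOver xs g)
  linear-sum [] p = linear-0
  linear-sum (x ∷ xs) p = linear-+ (p x) (linear-sum xs p)

  linear-euler : ∀ n {c d} → Linear c d → Linear (PS.euler n c) (euler n d)
  linear-euler n l = linear-prod n (λ i → linear-+ linear-1 (linear-neg (linear-^ l (suc i))))

  linear-quad : ∀ r {c d} → Linear c d → Linear (IS.quad r c) (quad r d)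
  linear-quad r l = linear-sum (box D) (λ ab → linear-^ l (Q r ab))

  linear-uv : Linear TS.p q
  linear-uv = δ-uv

  linear-fromℕ : ∀ n → Linear (Integers.fromℕ S n) (fromℕ n)
  linear-fromℕ 0 = linear-0
  linear-fromℕ 1 = linear-1
  linear-fromℕ (suc (suc n)) = linear-+ linear-1 (linear-fromℕ (suc n))

  E₁ E₃ E₉ A₁ A₃ Y : Carrier
  E₁ = euler D q
  E₃ = euler D (q ^ 3)
  E₉ = euler D (q ^ 9)
  A₁ = quad 0F q
  A₃ = quad 0F (q ^ 3)
  Y = δ (TS.e₃ uv-nilpotent)

  δ-scaled-theta : ∀ {c d} → Linear c d → δ (c S.* TS.Θ uv-nilpotent) ≈ d
  δ-scaled-theta l = trans (l _) (trans (*-congˡ δ-theta) (*-identityʳ _))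

  δ-e₁ : δ (TS.e₁ uv-nilpotent) ≈ A₃
  δ-e₁ = trans (δ-cong (S.trans (TS.slice-cubes-sum uv-nilpotent) (S.*-comm _ _))) (δ-scaled-theta (linear-quad 0F (linear-^ linear-uv 3)))

  cubic-A : A₁ ≈ A₃ + fromℤ (+ 6) * Y
  cubic-A = sym (begin
    A₃ + fromℤ (+ 6) * Y
      ≈⟨ +-cong δ-e₁ (linear-fromℕ 6 _) ⟨
    δ (TS.e₁ uv-nilpotent) + δ (Integers.fromℤ S (+ 6) S.* TS.e₃ uv-nilpotent)
      ≈⟨ δ-+ _ _ ⟨
    δ (TS.e₁ uv-nilpotent S.+ Integers.fromℤ S (+ 6) S.* TS.e₃ uv-nilpotent)
      ≈⟨ δ-cong (S.trans (TS.cube-relation uv-nilpotent) (S.*-comm _ _)) ⟩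
    δ (IS.quad 0F TS.p S.* TS.Θ uv-nilpotent)
      ≈⟨ δ-scaled-theta (linear-quad 0F linear-uv) ⟩
    A₁ ∎)

  norm-E : E₃ * (A₃ - fromℤ (+ 3) * Y) ≈ E₁ * (E₁ * E₁)
  norm-E = begin
    E₃ * (A₃ - fromℤ (+ 3) * Y)
      ≈⟨ *-congˡ (+-cong δ-e₁ (-‿cong (linear-fromℕ 3 _))) ⟨
    E₃ * (δ (TS.e₁ uv-nilpotent) - δ (Integers.fromℤ S (+ 3) S.* TS.e₃ uv-nilpotent))
      ≈⟨ *-congˡ (trans (δ-+ _ _) (+-congˡ (δ-neg _))) ⟨
    E₃ * δ (TS.e₁ uv-nilpotent S.- Integers.fromℤ S (+ 3) S.* TS.e₃ uv-nilpotent)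
      ≈⟨ linear-euler D (linear-^ linear-uv 3) _ ⟨
    δ (TS.E₃ uv-nilpotent S.* (TS.e₁ uv-nilpotent S.- Integers.fromℤ S (+ 3) S.* TS.e₃ uv-nilpotent))
      ≈⟨ δ-cong (TS.norm-relation uv-nilpotent) ⟩
    δ (TS.E₁ uv-nilpotent S.* (TS.E₁ uv-nilpotent S.* TS.E₁ uv-nilpotent) S.* TS.Θ uv-nilpotent)
      ≈⟨ δ-scaled-theta (linear-* linear-E₁ (linear-* linear-E₁ linear-E₁)) ⟩
    E₁ * (E₁ * E₁) ∎
    where
    linear-E₁ = linear-euler D linear-uv

  product-Y : E₃ * Y ≈ q * (E₉ * (E₉ * E₉))
  product-Y = begin
    E₃ * Y
      ≈⟨ linear-euler D (linear-^ linear-uv 3) _ ⟨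
    δ (TS.E₃ uv-nilpotent S.* TS.e₃ uv-nilpotent)
      ≈⟨ δ-cong (TS.slice-product-relation uv-nilpotent) ⟩
    δ (TS.p S.* (TS.E₉ uv-nilpotent S.* (TS.E₉ uv-nilpotent S.* TS.E₉ uv-nilpotent)) S.* TS.Θ uv-nilpotent)
      ≈⟨ δ-scaled-theta (linear-* linear-uv (linear-* linear-E₉ (linear-* linear-E₉ linear-E₉))) ⟩
    q * (E₉ * (E₉ * E₉)) ∎
    where
    linear-E₉ = linear-euler D (linear-^ linear-uv 9)

  E₃A₃ : E₃ * A₃ ≈ E₁ * (E₁ * E₁) + fromℤ (+ 3) * (q * (E₉ * (E₉ * E₉)))
  E₃A₃ = begin
    E₃ * A₃
      ≈⟨ solve 3 (λ e a y → e :* a := e :* (a :- con (+ 3) :* y) :+ con (+ 3) :* (e :* y)) refl E₃ A₃ Y ⟩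
    E₃ * (A₃ - fromℤ (+ 3) * Y) + fromℤ (+ 3) * (E₃ * Y)
      ≈⟨ +-cong norm-E (*-congˡ product-Y) ⟩
    E₁ * (E₁ * E₁) + fromℤ (+ 3) * (q * (E₉ * (E₉ * E₉))) ∎

  E₃A₁ : E₃ * A₁ ≈ E₁ * (E₁ * E₁) + fromℤ (+ 9) * (q * (E₉ * (E₉ * E₉)))
  E₃A₁ = begin
    E₃ * A₁
      ≈⟨ *-congˡ cubic-A ⟩
    E₃ * (A₃ + fromℤ (+ 6) * Y)
      ≈⟨ solve 3 (λ e a y → e :* (a :+ con (+ 6) :* y) := e :* a :+ con (+ 6) :* (e :* y)) refl E₃ A₃ Y ⟩
    E₃ * A₃ + fromℤ (+ 6) * (E₃ * Y)
      ≈⟨ +-cong E₃A₃ (*-congˡ product-Y) ⟩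
    E₁ * (E₁ * E₁) + fromℤ (+ 3) * (q * (E₉ * (E₉ * E₉))) + fromℤ (+ 6) * (q * (E₉ * (E₉ * E₉)))
      ≈⟨ solve 2 (λ t g → t :+ con (+ 3) :* g :+ con (+ 6) :* g := t :+ con (+ 9) :* g) refl
           (E₁ * (E₁ * E₁)) (q * (E₉ * (E₉ * E₉))) ⟩
    E₁ * (E₁ * E₁) + fromℤ (+ 9) * (q * (E₉ * (E₉ * E₉))) ∎

module _ {S R : Ring₀} {D : ℕ} {u v : CommutativeRing.Carrier S} {q : CommutativeRing.Carrier R} where
  private
    module S = CommutativeRing S
    module R = CommutativeRing R
    module PS = Products S
    module GS = GroupRingTools S
    module GR = GroupRingTools R
    module PK = Products GS.groupRing
    module CS = CubeRoot GS.groupRing GS.ζ GS.ζ³≈1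
    module RK = Products GR.groupRing

  twist-extraction : Extraction S R D u v q →
    Extraction GS.groupRing GR.groupRing D (GS.ζ GS.𝕂.* GS.ι u) (GS.ι v) (GR.ζ GR.𝕂.* GR.ι q)
  twist-extraction E = record
    { δ = δK
    ; δ-cong = δK-cong
    ; δ-+ = λ { GS.⟨ _ , _ , _ ⟩ GS.⟨ _ , _ , _ ⟩ → GR.eq (δ-+ _ _) (δ-+ _ _) (δ-+ _ _) }
    ; δ-neg = λ { GS.⟨ _ , _ , _ ⟩ → GR.eq (δ-neg _) (δ-neg _) (δ-neg _) }
    ; δ-0 = GR.eq δ-0 δ-0 δ-0
    ; δ-uv = δK-uv
    ; uv-nilpotent = GS.𝕂.trans (PK.^-congˡ D ζuv) (GS.𝕂.trans (PK.^-distrib-* GS.ζ (GS.ι (u S.* v)) D)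
        (GS.𝕂.trans (GS.𝕂.*-congˡ {x = GS.ζ PK.^ D} (GS.𝕂.trans (GS.𝕂.sym (GS.ι-^ (u S.* v) D)) (GS.ι-cong uv-nilpotent)))
          (GS.𝕂.zeroʳ (GS.ζ PK.^ D))))
    ; q-nilpotent = GR.𝕂.trans (RK.^-distrib-* GR.ζ (GR.ι q) D)
        (GR.𝕂.trans (GR.𝕂.*-congˡ {x = GR.ζ RK.^ D} (GR.𝕂.trans (GR.𝕂.sym (GR.ι-^ q D)) (GR.ι-cong q-nilpotent)))
          (GR.𝕂.zeroʳ (GR.ζ RK.^ D)))
    ; δ-theta = GR.𝕂.trans (δK-cong θ-ι) (GR.eq δ-theta δ-0 δ-0)
    }
    where
    open Extraction E
    δK : GS.K → GR.K
    δK k = GR.⟨ δ (GS.c₀ k) , δ (GS.c₁ k) , δ (GS.c₂ k) ⟩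
    δK-cong : ∀ {a b} → a GS.𝕂.≈ b → δK a GR.𝕂.≈ δK b
    δK-cong (GS.eq a b c) = GR.eq (δ-cong a) (δ-cong b) (δ-cong c)
    ζuv : GS.ζ GS.𝕂.* GS.ι u GS.𝕂.* GS.ι v GS.𝕂.≈ GS.ζ GS.𝕂.* GS.ι (u S.* v)
    ζuv = GS.𝕂.trans (GS.𝕂.*-assoc GS.ζ (GS.ι u) (GS.ι v)) (GS.𝕂.*-congˡ {x = GS.ζ} (GS.𝕂.sym (GS.ι-* u v)))
    δK-uv : ∀ h → δK (GS.ζ GS.𝕂.* GS.ι u GS.𝕂.* GS.ι v GS.𝕂.* h) GR.𝕂.≈ GR.ζ GR.𝕂.* GR.ι q GR.𝕂.* δK h
    δK-uv h@(GS.⟨ a , b , c ⟩) = GR.𝕂.trans (δK-cong left)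
      (GR.𝕂.trans (GR.eq (δ-uv c) (δ-uv a) (δ-uv b)) (GR.𝕂.sym right))
      where
      left : GS.ζ GS.𝕂.* GS.ι u GS.𝕂.* GS.ι v GS.𝕂.* h GS.𝕂.≈ GS.⟨ u S.* v S.* c , u S.* v S.* a , u S.* v S.* b ⟩
      left = GS.𝕂.trans (GS.𝕂.*-congʳ {x = h} ζuv) (GS.𝕂.trans (GS.𝕂.*-assoc GS.ζ (GS.ι (u S.* v)) h)
        (GS.𝕂.trans (GS.𝕂.*-congˡ {x = GS.ζ} (GS.ι-scale (u S.* v) h)) (GS.ζ-shift _)))
      right : GR.ζ GR.𝕂.* GR.ι q GR.𝕂.* δK h GR.𝕂.≈ GR.⟨ q R.* δ c , q R.* δ a , q R.* δ b ⟩
      right = GR.𝕂.trans (GR.𝕂.*-assoc GR.ζ (GR.ι q) (δK h))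
        (GR.𝕂.trans (GR.𝕂.*-congˡ {x = GR.ζ} (GR.ι-scale q (δK h))) (GR.ζ-shift _))
    u³ : (GS.ζ GS.𝕂.* GS.ι u) PK.^ 3 GS.𝕂.≈ GS.ι (u PS.^ 3)
    u³ = GS.𝕂.trans (PK.^-distrib-* GS.ζ (GS.ι u) 3) (GS.𝕂.trans (GS.𝕂.*-cong (CS.z^ 0 1) (GS.𝕂.sym (GS.ι-^ u 3))) (GS.𝕂.*-identityˡ _))
    θ-ι : TripleProduct.theta GS.groupRing ((GS.ζ GS.𝕂.* GS.ι u) PK.^ 3) (GS.ι v PK.^ 3) D GS.𝕂.≈
          GS.ι (TripleProduct.theta S (u PS.^ 3) (v PS.^ 3) D)
    θ-ι = GS.𝕂.sym (GS.ι-sum (interval (suc D)) (λ m → GS.𝕂.trans (GS.ι-* _ _) (GS.𝕂.*-cong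
      (GS.𝕂.trans (GS.ι-^ (u PS.^ 3) (T m)) (PK.^-congˡ (T m) (GS.𝕂.sym u³)))
      (GS.𝕂.trans (GS.ι-^ (v PS.^ 3) (T (ℤ.- m))) (PK.^-congˡ (T (ℤ.- m)) (GS.ι-^ v 3))))))

cancel-right : (R : Ring₀) → let open CommutativeRing R in ∀ {a b c} → a ≈ b + c → b ≈ a - c
cancel-right R {a} {b} {c} p = trans (solve 2 (λ b c → b := b :+ c :- c) refl b c) (+-congʳ (sym p))
  where
  open CommutativeRing R
  open Solver R

-- With t = E₁³, e = E₃ and g = E₉³, the norm of E₁(ζ q)³ = e A₃ - 3 ζ q g gives e¹² = g ((t + 3 q g)³ - 27 q³ g³).
module NormIdentity {S R : Ring₀} {D : ℕ} {u v : CommutativeRing.Carrier S} {q : CommutativeRing.Carrier R}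
         (E : Extraction S R D u v q) where
  private
    module G = GroupRingTools R
    module X = ExtractedRelations E
    module XK = ExtractedRelations (twist-extraction E)
    module PK = Products G.groupRing
    module IK = ThetaIdentities G.groupRing D
    module CR = CubeRoot G.groupRing G.ζ G.ζ³≈1
  open CommutativeRing R
  open Solver R
  open Integers R
  open Products R
  open ThetaIdentities R D using (^-≡)
  open Extraction E using (q-nilpotent)
  open G using (K; ι; ζ; module 𝕂; norm)
  open import Relation.Binary.Reasoning.Setoid setoid
  open import Algebra.Properties.Ring 𝕂.ring using (-‿distribʳ-*)

  t g : Carrier
  t = X.E₁ * (X.E₁ * X.E₁)
  g = X.E₉ * (X.E₉ * X.E₉)

  private
    ζq : K
    ζq = ζ 𝕂.* ι q

    ζq^ : ∀ r k → ζq PK.^ (r ℕ.+ 3 ℕ.* k) 𝕂.≈ ζ PK.^ r 𝕂.* ι (q ^ (r ℕ.+ 3 ℕ.* k))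
    ζq^ r k = 𝕂.trans (PK.^-distrib-* ζ (ι q) (r ℕ.+ 3 ℕ.* k)) (𝕂.*-cong (CR.z^ r k) (𝕂.sym (G.ι-^ q (r ℕ.+ 3 ℕ.* k))))

    ζq^3k : ∀ k → ζq PK.^ (3 ℕ.* k) 𝕂.≈ ι (q ^ (3 ℕ.* k))
    ζq^3k k = 𝕂.trans (ζq^ 0 k) (𝕂.*-identityˡ (ι (q ^ (3 ℕ.* k))))

    E₃K : XK.E₃ 𝕂.≈ ι X.E₃
    E₃K = 𝕂.trans (PK.euler-cong D (ζq^3k 1)) (𝕂.sym (G.ι-euler D (q ^ 3)))

    E₉K : XK.E₉ 𝕂.≈ ι X.E₉
    E₉K = 𝕂.trans (PK.euler-cong D (ζq^3k 3)) (𝕂.sym (G.ι-euler D (q ^ 9)))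

    A₃K : XK.A₃ 𝕂.≈ ι X.A₃
    A₃K = 𝕂.trans (IK.quad-cong 0F (ζq^3k 1)) (𝕂.sym (G.ι-quad D 0F (q ^ 3)))

    ι-fromℕ : ∀ n → ι (fromℕ n) 𝕂.≈ Integers.fromℕ G.groupRing n
    ι-fromℕ 0 = 𝕂.refl
    ι-fromℕ 1 = 𝕂.refl
    ι-fromℕ (suc (suc n)) = 𝕂.trans (G.ι-+ 1# (fromℕ (suc n))) (𝕂.+-congˡ {x = 𝕂.1#} (ι-fromℕ (suc n)))

    gK : XK.E₉ 𝕂.* (XK.E₉ 𝕂.* XK.E₉) 𝕂.≈ ι g
    gK = 𝕂.trans (𝕂.*-cong E₉K (𝕂.*-cong E₉K E₉K))
      (𝕂.sym (𝕂.trans (G.ι-* X.E₉ (X.E₉ * X.E₉)) (𝕂.*-congˡ {x = ι X.E₉} (G.ι-* X.E₉ X.E₉))))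

    correction : Integers.fromℤ G.groupRing (+ 3) 𝕂.* (ζq 𝕂.* (XK.E₉ 𝕂.* (XK.E₉ 𝕂.* XK.E₉))) 𝕂.≈
                 G.⟨ 0# , fromℤ (+ 3) * (q * g) , 0# ⟩
    correction = 𝕂.trans (𝕂.*-cong (𝕂.sym (ι-fromℕ 3)) (𝕂.trans (𝕂.*-congˡ {x = ζq} gK)
      (𝕂.trans (𝕂.*-assoc ζ (ι q) (ι g)) (𝕂.trans (𝕂.*-congˡ {x = ζ} (𝕂.sym (G.ι-* q g))) (G.ζ-shift (ι (q * g)))))))
      (𝕂.trans (G.ι-scale (fromℤ (+ 3)) _) (G.eq (zeroʳ _) refl (zeroʳ _)))

    cubeK : XK.E₁ 𝕂.* (XK.E₁ 𝕂.* XK.E₁) 𝕂.≈ G.⟨ X.E₃ * X.A₃ , - (fromℤ (+ 3) * (q * g)) , 0# ⟩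
    cubeK = 𝕂.trans (cancel-right G.groupRing XK.E₃A₃) (𝕂.trans
      (𝕂.+-cong (𝕂.trans (𝕂.*-cong E₃K A₃K) (𝕂.sym (G.ι-* X.E₃ X.A₃))) (𝕂.-‿cong correction))
      (G.eq (solve 1 (λ a → a :+ :- con (+ 0) := a) refl (X.E₃ * X.A₃)) (+-identityˡ _)
            (solve 0 (con (+ 0) :+ :- con (+ 0) := con (+ 0)) refl)))

    n₁ : Carrier
    n₁ = norm XK.E₁

    norm-cube : n₁ * (n₁ * n₁) ≈ X.E₃ * X.A₃ * (X.E₃ * X.A₃) * (X.E₃ * X.A₃) -
                fromℤ (+ 27) * (q * g * (q * g) * (q * g))
    norm-cube = begin
      n₁ * (n₁ * n₁)  ≈⟨ trans (G.norm-* XK.E₁ (XK.E₁ 𝕂.* XK.E₁)) (*-congˡ (G.norm-* XK.E₁ XK.E₁)) ⟨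
      norm (XK.E₁ 𝕂.* (XK.E₁ 𝕂.* XK.E₁))  ≈⟨ G.norm-cong cubeK ⟩
      norm G.⟨ X.E₃ * X.A₃ , - (fromℤ (+ 3) * (q * g)) , 0# ⟩
        ≈⟨ solve 2 (λ a b → let y = :- (con (+ 3) :* b) ; z = con (+ 0) in
             a :* a :* a :+ y :* y :* y :+ z :* z :* z :- con (+ 3) :* (a :* y :* z) :=
             a :* a :* a :- con (+ 27) :* (b :* b :* b)) refl (X.E₃ * X.A₃) (q * g) ⟩
      _ ∎

    neg-ζ : ∀ z a → 𝕂.- (z 𝕂.* ι a) 𝕂.≈ z 𝕂.* ι (- a)
    neg-ζ z a = 𝕂.trans (-‿distribʳ-* z (ι a)) (𝕂.*-congˡ {x = z} (𝕂.sym (G.ι-neg a)))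

    index : ∀ j i → suc j ℕ.+ 3 ℕ.* i ≡ suc (j ℕ.+ i ℕ.* 3)
    index j i = ≡.cong (λ k → suc (j ℕ.+ k)) (ℕₚ.*-comm 3 i)

    cube-neg : ∀ n → 1# + - (q ^ n) * (- (q ^ n) * - (q ^ n)) ≈ 1# - (q ^ 3) ^ n
    cube-neg n = begin
      1# + - (q ^ n) * (- (q ^ n) * - (q ^ n))  ≈⟨ solve 1 (λ x → con (+ 1) :+ :- x :* (:- x :* :- x) := con (+ 1) :- x :^ 3) refl (q ^ n) ⟩
      1# - (q ^ n) ^ 3  ≈⟨ +-congˡ (-‿cong (trans (^-assocʳ q n 3) (trans (^-≡ q (ℕₚ.*-comm n 3)) (sym (^-assocʳ q 3 n))))) ⟩
      1# - (q ^ 3) ^ n  ∎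

    h : ℕ → Carrier
    h i = 1# - (q ^ 3) ^ suc i

    factor-1 : ∀ i → norm (𝕂.1# 𝕂.- ζq PK.^ suc (i ℕ.* 3)) ≈ h (i ℕ.* 3)
    factor-1 i = trans (G.norm-1+ζ (- (q ^ suc (i ℕ.* 3))) (𝕂.trans (𝕂.-‿cong (𝕂.trans
        (𝕂.reflexive (≡.cong (ζq PK.^_) (≡.sym (index 0 i)))) (𝕂.trans (ζq^ 1 i)
          (𝕂.*-cong (𝕂.*-identityʳ ζ) (G.ι-cong (^-≡ q (index 0 i)))))))
        (neg-ζ ζ (q ^ suc (i ℕ.* 3))))) (cube-neg (suc (i ℕ.* 3)))

    factor-2 : ∀ i → norm (𝕂.1# 𝕂.- ζq PK.^ suc (1 ℕ.+ i ℕ.* 3)) ≈ h (1 ℕ.+ i ℕ.* 3)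
    factor-2 i = trans (G.norm-1+ζ² (- (q ^ suc (1 ℕ.+ i ℕ.* 3))) (𝕂.trans (𝕂.-‿cong (𝕂.trans
        (𝕂.reflexive (≡.cong (ζq PK.^_) (≡.sym (index 1 i)))) (𝕂.trans (ζq^ 2 i)
          (𝕂.*-cong (𝕂.*-congˡ {x = ζ} (𝕂.*-identityʳ ζ)) (G.ι-cong (^-≡ q (index 1 i)))))))
        (neg-ζ G.ζ² (q ^ suc (1 ℕ.+ i ℕ.* 3))))) (cube-neg (suc (1 ℕ.+ i ℕ.* 3)))

    factor-3 : ∀ i → norm (𝕂.1# 𝕂.- ζq PK.^ suc (2 ℕ.+ i ℕ.* 3)) ≈ h i * (h i * h i)
    factor-3 i = trans (G.norm-cong (𝕂.trans (𝕂.+-congˡ {x = 𝕂.1#} (𝕂.-‿cong (𝕂.trans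
        (𝕂.reflexive (≡.cong (ζq PK.^_) (≡.sym power))) (𝕂.trans (ζq^3k (suc i)) (G.ι-cong (sym (^-assocʳ q 3 (suc i))))))))
        (𝕂.trans (𝕂.+-congˡ {x = 𝕂.1#} (𝕂.sym (G.ι-neg _))) (𝕂.sym (G.ι-+ 1# _))))) (G.norm-ι (h i))
      where
      power : 3 ℕ.* suc i ≡ suc (2 ℕ.+ i ℕ.* 3)
      power = ℕₚ.*-comm 3 (suc i)

    H₀ H₁ H₂ : Carrier
    H₀ = prod D (λ i → h (i ℕ.* 3))
    H₁ = prod D (λ i → h (1 ℕ.+ i ℕ.* 3))
    H₂ = prod D h

    norm-E₁ : n₁ ≈ H₀ * (H₁ * (H₂ * (H₂ * H₂)))
    norm-E₁ = begin
      norm XK.E₁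
        ≈⟨ G.norm-cong (PK.euler-stable {D} {D ℕ.* 3} {ζq} (Extraction.q-nilpotent (twist-extraction E)) (ℕₚ.m≤m*n D 3)) ⟨
      norm (PK.euler (D ℕ.* 3) ζq)
        ≈⟨ G.norm-prod (D ℕ.* 3) {λ i → 𝕂.1# 𝕂.- ζq PK.^ suc i} (λ i → refl) ⟩
      prod (D ℕ.* 3) (λ i → norm (𝕂.1# 𝕂.- ζq PK.^ suc i))
        ≈⟨ prod-triple D (λ i → norm (𝕂.1# 𝕂.- ζq PK.^ suc i)) ⟩
      _ ≈⟨ *-cong (prod-cong D factor-1) (*-cong (prod-cong D factor-2) (trans (prod-cong D factor-3)
             (trans (prod-* D h (λ i → h i * h i)) (*-congˡ (prod-* D h h))))) ⟩
      H₀ * (H₁ * (H₂ * (H₂ * H₂))) ∎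

    E₃-triple : H₀ * (H₁ * X.E₉) ≈ X.E₃
    E₃-triple = begin
      H₀ * (H₁ * X.E₉)
        ≈⟨ *-congˡ (*-congˡ (prod-cong D (λ i → +-congˡ (-‿cong (begin
             (q ^ 9) ^ suc i  ≈⟨ ^-assocʳ q 9 (suc i) ⟩
             q ^ (9 ℕ.* suc i)  ≈⟨ ^-≡ q (≡.trans (ℕₚ.*-assoc 3 3 (suc i)) (≡.cong (3 ℕ.*_) (ℕₚ.*-comm 3 (suc i)))) ⟩
             q ^ (3 ℕ.* (suc i ℕ.* 3)) ≈⟨ ^-assocʳ q 3 (suc i ℕ.* 3) ⟨
             (q ^ 3) ^ (suc i ℕ.* 3) ∎))))) ⟩
      H₀ * (H₁ * prod D (λ i → h (2 ℕ.+ i ℕ.* 3)))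
        ≈⟨ prod-triple D h ⟨
      euler (D ℕ.* 3) (q ^ 3)
        ≈⟨ euler-stable {D} {D ℕ.* 3} {q ^ 3} (trans (^-assocʳ q 3 D) (^-vanish {q} {D} q-nilpotent (ℕₚ.m≤n*m D 3))) (ℕₚ.m≤m*n D 3) ⟩
      X.E₃ ∎

  norm-identity : X.E₃ ^ 12 ≈ g * (t * (t * t + fromℤ (+ 9) * (q * g) * t + fromℤ (+ 27) * (q * g * (q * g))))
  norm-identity = begin
    X.E₃ ^ 12
      ≈⟨ solve 1 (λ e → e :^ 12 := (e :* (e :* (e :* e))) :^ 3) refl X.E₃ ⟩
    (X.E₃ * (X.E₃ * (X.E₃ * X.E₃))) ^ 3
      ≈⟨ ^-congˡ 3 (*-congʳ E₃-triple) ⟨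
    (H₀ * (H₁ * X.E₉) * (X.E₃ * (X.E₃ * X.E₃))) ^ 3
      ≈⟨ solve 4 (λ a b c e → (a :* (b :* c) :* (e :* (e :* e))) :^ 3 :=
           c :* (c :* c) :* (let n = a :* (b :* (e :* (e :* e))) in n :* (n :* n))) refl H₀ H₁ X.E₉ X.E₃ ⟩
    g * (N * (N * N))
      ≈⟨ *-congˡ (*-cong norm-E₁ (*-cong norm-E₁ norm-E₁)) ⟨
    g * (n₁ * (n₁ * n₁))
      ≈⟨ *-congˡ norm-cube ⟩
    g * (X.E₃ * X.A₃ * (X.E₃ * X.A₃) * (X.E₃ * X.A₃) - fromℤ (+ 27) * (q * g * (q * g) * (q * g)))
      ≈⟨ *-congˡ (+-congʳ (*-cong (*-cong X.E₃A₃ X.E₃A₃) X.E₃A₃)) ⟩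
    g * ((t + fromℤ (+ 3) * (q * g)) * (t + fromℤ (+ 3) * (q * g)) * (t + fromℤ (+ 3) * (q * g)) -
         fromℤ (+ 27) * (q * g * (q * g) * (q * g)))
      ≈⟨ solve 3 (λ g t x → let a = t :+ con (+ 3) :* x in
           g :* (a :* a :* a :- con (+ 27) :* (x :* x :* x)) :=
           g :* (t :* (t :* t :+ con (+ 9) :* x :* t :+ con (+ 27) :* (x :* x)))) refl g t (q * g) ⟩
    _ ∎
    where
    N : Carrier
    N = H₀ * (H₁ * (H₂ * (H₂ * H₂)))

module NinthPower (R : Ring₀) where
  open CommutativeRing R
  open Solver R

  cube nine : Carrier → Carrier
  cube a = a * (a * a)
  nine a = cube a * (cube a * cube a)

  nine-* : ∀ a b → nine (a * b) ≈ nine a * nine b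
  nine-* = solve 2 (λ a b → let C = λ x → x :* (x :* x) in
    C (a :* b) :* (C (a :* b) :* C (a :* b)) := C a :* (C a :* C a) :* (C b :* (C b :* C b))) refl

  cube-cong : ∀ {a b} → a ≈ b → cube a ≈ cube b
  cube-cong p = *-cong p (*-cong p p)

  nine-cong : ∀ {a b} → a ≈ b → nine a ≈ nine b
  nine-cong p = *-cong (cube-cong p) (*-cong (cube-cong p) (cube-cong p))

-- The ninth power of the theta series at q³, where the classes of its cube become the slices at q.
module DilatedTheta (R : Ring₀) (D : ℕ) (u v : CommutativeRing.Carrier R) where
  open CommutativeRing R
  open Solver R
  open Sums R
  open Products R
  open TripleProduct R
  open ThetaIdentities R D
  open GroupRingTools R
  open NinthPower R
  open Triangular using (tr; #_; _⊞_; _⊠_; exponents)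
  open Triangular using (var) renaming (_:+_ to _⊕_; _:-_ to _⊝_; :-_ to ⊝_; _:*_ to _⊗_; con to κ)
  open import Relation.Binary.Reasoning.Setoid setoid
  private
    module PK = Products groupRing
    module TK = TripleProduct groupRing
    module NK = NinthPower groupRing
    module T₁ = ThetaRelations R D u v

  x₃ y₃ : Carrier
  x₃ = u ^ 2 * v ^ 1
  y₃ = u ^ 1 * v ^ 2

  private
    module T₃ = ThetaRelations R D x₃ y₃

  J : K
  J = TK.jacobi T₃.uK T₃.vK D

  module _ (nilpotent : (u * v) ^ D ≈ 0#) where
    open T₁ using (p)

    x₃y₃ : x₃ * y₃ ≈ p ^ 3
    x₃y₃ = solve 2 (λ u v → u :^ 2 :* v :^ 1 :* (u :^ 1 :* v :^ 2) := (u :* v) :^ 3) refl u v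

    x₃y₃-nilpotent : (x₃ * y₃) ^ D ≈ 0#
    x₃y₃-nilpotent = trans (^-congˡ D x₃y₃) (nilpotent-^ 2 nilpotent)

    base-xy : ∀ a b c d r t → base (u ^ a * v ^ b) (u ^ c * v ^ d) r t ≈
      u ^ ((T (t ℤ.+ bal r) ℕ.+ 2 ℕ.* T t) ℕ.* a ℕ.+ (T (ℤ.- (t ℤ.+ bal r)) ℕ.+ 2 ℕ.* T (ℤ.- t)) ℕ.* c) *
      v ^ ((T (t ℤ.+ bal r) ℕ.+ 2 ℕ.* T t) ℕ.* b ℕ.+ (T (ℤ.- (t ℤ.+ bal r)) ℕ.+ 2 ℕ.* T (ℤ.- t)) ℕ.* d)
    base-xy a b c d r t = trans (*-cong (xy-^ u v a b α) (xy-^ u v c d β)) (xy-* u v (α ℕ.* a) (α ℕ.* b) (β ℕ.* c) (β ℕ.* d))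
      where
      α = T (t ℤ.+ bal r) ℕ.+ 2 ℕ.* T t
      β = T (ℤ.- (t ℤ.+ bal r)) ℕ.+ 2 ℕ.* T (ℤ.- t)

    private
      α β : Fin 3 → Triangular.Exponent 1
      α r = tr (var 0F ⊕ κ (bal r)) ⊞ 2 ⊠ tr (var 0F)
      β r = tr (⊝ (var 0F ⊕ κ (bal r))) ⊞ 2 ⊠ tr (⊝ var 0F)

      comm₂ : ∀ m n a b {k} → a ℕ.* m ℕ.+ b ℕ.* n ≡ k → m ℕ.* a ℕ.+ n ℕ.* b ≡ k
      comm₂ m n a b e = ≡.trans (≡.cong₂ ℕ._+_ (ℕₚ.*-comm m a) (ℕₚ.*-comm n b)) e

      m n : Fin 3 → ℤ → ℕ
      m r t = T (t ℤ.+ bal r) ℕ.+ 2 ℕ.* T t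
      n r t = T (ℤ.- (t ℤ.+ bal r)) ℕ.+ 2 ℕ.* T (ℤ.- t)

      shift-slice : ∀ r k →
        (∀ t → 2 ℕ.* m r t ℕ.+ 1 ℕ.* n r t ≡ T (join₃ (r , t)) ℕ.+ k) →
        (∀ t → 1 ℕ.* m r t ℕ.+ 2 ℕ.* n r t ≡ T (ℤ.- join₃ (r , t)) ℕ.+ k) →
        part x₃ y₃ r ≈ p ^ k * slice u v r
      shift-slice r k e f = trans (sum-cong (interval (suc D)) (λ t → trans (base-xy 2 1 1 2 r t)
          (trans (xy-≡ u v (comm₂ (m r t) (n r t) 2 1 (e t)) (comm₂ (m r t) (n r t) 1 2 (f t)))
            (trans (sym (xy-p u v (T (join₃ (r , t))) (T (ℤ.- join₃ (r , t))) k)) (*-comm _ _)))))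
        (sym (sum-*ˡ (p ^ k) (interval (suc D)) (λ t → mono u v (join₃ (r , t)))))

    part-slice₀ : part x₃ y₃ 0F ≈ p ^ 0 * slice u v 0F
    part-slice₀ = shift-slice 0F 0
      (λ t → exponents (t ∷ []) (2 ⊠ α 0F ⊞ 1 ⊠ β 0F) (tr (κ (+ 3) ⊗ var 0F ⊕ κ (bal 0F)) ⊞ # 0) ≡.refl)
      (λ t → exponents (t ∷ []) (1 ⊠ α 0F ⊞ 2 ⊠ β 0F) (tr (⊝ (κ (+ 3) ⊗ var 0F ⊕ κ (bal 0F))) ⊞ # 0) ≡.refl)

    part-slice₁ : part x₃ y₃ 1F ≈ p ^ 1 * slice u v 1F
    part-slice₁ = shift-slice 1F 1
      (λ t → exponents (t ∷ []) (2 ⊠ α 1F ⊞ 1 ⊠ β 1F) (tr (κ (+ 3) ⊗ var 0F ⊕ κ (bal 1F)) ⊞ # 1) ≡.refl)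
      (λ t → exponents (t ∷ []) (1 ⊠ α 1F ⊞ 2 ⊠ β 1F) (tr (⊝ (κ (+ 3) ⊗ var 0F ⊕ κ (bal 1F))) ⊞ # 1) ≡.refl)

    part-slice₂ : part x₃ y₃ 2F ≈ p ^ 1 * slice u v 2F
    part-slice₂ = shift-slice 2F 1
      (λ t → exponents (t ∷ []) (2 ⊠ α 2F ⊞ 1 ⊠ β 2F) (tr (κ (+ 3) ⊗ var 0F ⊕ κ (bal 2F)) ⊞ # 1) ≡.refl)
      (λ t → exponents (t ∷ []) (1 ⊠ α 2F ⊞ 2 ⊠ β 2F) (tr (⊝ (κ (+ 3) ⊗ var 0F ⊕ κ (bal 2F))) ⊞ # 1) ≡.refl)

    A C s₀³ : Carrier
    A = quad 0F (p ^ 3)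
    C = p * quad 1F (p ^ 3)
    s₀³ = slice u v 0F * (slice u v 0F * slice u v 0F)

    ninth-power-relation : nine (euler D (p ^ 3)) * c₀ (NK.nine J) ≈
      cube A * s₀³ + cube C * (T₁.e₁ nilpotent - s₀³) + Integers.fromℤ R (+ 6) * (A * (C * C)) * T₁.e₃ nilpotent
    ninth-power-relation = begin
      nine E₃ * c₀ (NK.nine J)
        ≈⟨ eq₀ (𝕂.trans (𝕂.sym (ι-scale (nine E₃) (NK.nine J))) (𝕂.trans (𝕂.*-congʳ {x = NK.nine J} ι-nine)
             (𝕂.trans (𝕂.sym (NK.nine-* (ι E₃) J)) (NK.nine-cong euler-J)))) ⟩
      c₀ (NK.nine (T₃.θᴷ x₃y₃-nilpotent))
        ≈⟨ T₃.ninth-power x₃y₃-nilpotent ⟩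
      (let a = part x₃ y₃ 0F * quad 0F (x₃ * y₃) ; b = part x₃ y₃ 1F * quad 1F (x₃ * y₃) ; c = part x₃ y₃ 2F * quad 2F (x₃ * y₃) in
       a * (a * a) + (b * (b * b) + c * (c * c)) + Integers.fromℤ R (+ 6) * (a * (b * c)))
        ≈⟨ +-cong (+-cong (cube-cong a≈) (+-cong (cube-cong b≈) (cube-cong c≈))) (*-congˡ (*-cong a≈ (*-cong b≈ c≈))) ⟩
      _ ≈⟨ solve 5 (λ A C a b c → let K = λ x → x :* (x :* x) in
             K (a :* A) :+ (K (b :* C) :+ K (c :* C)) :+ con (+ 6) :* (a :* A :* (b :* C :* (c :* C))) :=
             K A :* K a :+ K C :* (K a :+ (K b :+ K c) :- K a) :+ con (+ 6) :* (A :* (C :* C)) :* (a :* (b :* c))) refl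
             A C (slice u v 0F) (slice u v 1F) (slice u v 2F) ⟩
      _ ∎
      where
      E₃ : Carrier
      E₃ = euler D (p ^ 3)
      ι-nine : ι (nine E₃) 𝕂.≈ NK.nine (ι E₃)
      ι-nine = 𝕂.trans (ι-* (cube E₃) (cube E₃ * cube E₃)) (𝕂.*-cong ι-cube
        (𝕂.trans (ι-* (cube E₃) (cube E₃)) (𝕂.*-cong ι-cube ι-cube)))
        where
        ι-cube : ι (cube E₃) 𝕂.≈ NK.cube (ι E₃)
        ι-cube = 𝕂.trans (ι-* E₃ (E₃ * E₃)) (𝕂.*-congˡ {x = ι E₃} (ι-* E₃ E₃))
      euler-J : ι E₃ 𝕂.* J 𝕂.≈ T₃.θᴷ x₃y₃-nilpotent
      euler-J = 𝕂.trans (𝕂.*-congʳ {x = J} (𝕂.trans (ι-euler D (p ^ 3)) (PK.euler-cong D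
          (𝕂.trans (ι-cong (sym x₃y₃)) (𝕂.sym T₃.uK*vK)))))
        (TK.triple-product T₃.uK T₃.vK {D} (T₃.nilpotentᴷ x₃y₃-nilpotent))
      a≈ : part x₃ y₃ 0F * quad 0F (x₃ * y₃) ≈ slice u v 0F * A
      a≈ = *-cong (trans part-slice₀ (*-identityˡ _)) (quad-cong 0F x₃y₃)
      b≈ : part x₃ y₃ 1F * quad 1F (x₃ * y₃) ≈ slice u v 1F * C
      b≈ = trans (*-cong part-slice₁ (quad-cong 1F x₃y₃))
        (solve 3 (λ p s k → p :* con (+ 1) :* s :* k := s :* (p :* k)) refl p (slice u v 1F) (quad 1F (p ^ 3)))
      c≈ : part x₃ y₃ 2F * quad 2F (x₃ * y₃) ≈ slice u v 2F * C
      c≈ = trans (*-cong part-slice₂ (trans (quad-cong 2F x₃y₃) (sym (quad-1≈2 (nilpotent-^ 2 nilpotent)))))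
        (solve 3 (λ p s k → p :* con (+ 1) :* s :* k := s :* (p :* k)) refl p (slice u v 2F) (quad 1F (p ^ 3)))

    slice-0-cube : s₀³ ≈ part (u ^ 6 * v ^ 3) (u ^ 3 * v ^ 6) 0F * quad 0F (p ^ 9) +
      (part (u ^ 6 * v ^ 3) (u ^ 3 * v ^ 6) 1F * quad 1F (p ^ 9) + part (u ^ 6 * v ^ 3) (u ^ 3 * v ^ 6) 2F * quad 2F (p ^ 9))
    slice-0-cube = trans (cube-cong (slice-0 u v nilpotent)) (trans
      (theta-cube (u ^ 6 * v ^ 3) (u ^ 3 * v ^ 6) (trans (^-congˡ D p⁹) (nilpotent-^ 8 nilpotent)))
      (+-cong (*-congˡ (quad-cong 0F p⁹)) (+-cong (*-congˡ (quad-cong 1F p⁹)) (*-congˡ (quad-cong 2F p⁹)))))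
      where
      p⁹ : u ^ 6 * v ^ 3 * (u ^ 3 * v ^ 6) ≈ p ^ 9
      p⁹ = solve 2 (λ u v → u :^ 6 :* v :^ 3 :* (u :^ 3 :* v :^ 6) := (u :* v) :^ 9) refl u v

module NatSolver = Data.Nat.Solver.+-*-Solver

T-difference : ∀ m → T m ≡ T (ℤ.- m) → m ≡ + 0
T-difference m e = ℤₚ.*-cancelˡ-≡ (+ 2) m (+ 0) (begin
  + 2 ℤ.* m  ≡⟨ solve 1 (λ m → con (+ 2) :* m := m :* m :+ m :- (:- m :* :- m :+ :- m)) ≡.refl m ⟩
  m ℤ.* m ℤ.+ m ℤ.- (ℤ.- m ℤ.* ℤ.- m ℤ.+ ℤ.- m)  ≡⟨ ≡.cong₂ ℤ._-_ (2*T m) (2*T (ℤ.- m)) ⟨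
  + 2 ℤ.* + T m ℤ.- + 2 ℤ.* + T (ℤ.- m)  ≡⟨ ≡.cong (λ k → + 2 ℤ.* + k ℤ.- + 2 ℤ.* + T (ℤ.- m)) e ⟩
  + 2 ℤ.* + T (ℤ.- m) ℤ.- + 2 ℤ.* + T (ℤ.- m)  ≡⟨ ℤₚ.+-inverseʳ (+ 2 ℤ.* + T (ℤ.- m)) ⟩
  + 0  ∎)
  where
  open ≡.≡-Reasoning
  open ℤSolver using (solve; _:=_; con; _:+_; _:*_; _:-_; :-_)

ℤ-ring : Ring₀
ℤ-ring = ℤₚ.+-*-commutativeRing

module ℤ⟦X⟧ = PowerSeries ℤ-ring (λ _ → ⊤) (λ _ _ → tt)

module Truncated (R : Ring₀) (D : ℕ) where
  open PowerSeries R (ℕ._< D) (λ _ → ℕₚ.<⇒≤) public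
  private
    module R = CommutativeRing R
  open CommutativeRing psRing using (_≈_; 0#)
  open Products psRing using (_^_)

  X^-below : ∀ k i → i ℕ.< k → R._≈_ ((X ^ k) i) R.0#
  X^-below (suc k) zero _ = mul-X-zero (X ^ k)
  X^-below (suc k) (suc i) (s≤s i<k) = R.trans (mul-Xˡ (X ^ k) i) (X^-below k i i<k)

  X^-mul-below : ∀ k f i → i ℕ.< k → R._≈_ (mul (X ^ k) f i) R.0#
  X^-mul-below (suc k) f zero _ = R.trans (mul-assoc X (X ^ k) f 0) (mul-X-zero (mul (X ^ k) f))
  X^-mul-below (suc k) f (suc i) (s≤s i<k) = R.trans (mul-assoc X (X ^ k) f (suc i))
    (R.trans (mul-Xˡ (mul (X ^ k) f) i) (X^-mul-below k f i i<k))

  X^-diagonal : ∀ k → R._≈_ ((X ^ k) k) R.1#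
  X^-diagonal zero = R.refl
  X^-diagonal (suc k) = R.trans (mul-Xˡ (X ^ k) k) (X^-diagonal k)

  X^-above : ∀ k i → k ℕ.< i → R._≈_ ((X ^ k) i) R.0#
  X^-above zero (suc i) _ = R.refl
  X^-above (suc k) (suc i) (s≤s k<i) = R.trans (mul-Xˡ (X ^ k) i) (X^-above k i k<i)

  X-nilpotent : X ^ D ≈ 0#
  X-nilpotent = mk λ i i<D → X^-below D i i<D

-- Laurent series in z over ℤ[[q]] as power series in u = z q^{1/2}, v = z⁻¹ q^{1/2}, truncated at u^D; the
-- coefficient of z⁰ is the diagonal.
module Diagonal (D : ℕ) where
  module L = Truncated ℤ⟦X⟧.psRing D
  module W = Truncated ℤ-ring D
  module 𝕃 = CommutativeRing L.psRing
  module 𝕎 = CommutativeRing W.psRing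
  private
    module I = CommutativeRing ℤ⟦X⟧.psRing
    module PL = Products L.psRing
    module PW = Products W.psRing
    module IL = ThetaIdentities L.psRing D
    module TL = TripleProduct L.psRing
    module SL = Sums L.psRing
    module SW = Sums W.psRing
    module DL = DilatedTheta L.psRing D

  u v : L.PS
  u = L.X
  v zero = ℤ⟦X⟧.X
  v (suc n) = ℤ⟦X⟧.zeroS

  δ : L.PS → W.PS
  δ h n = h n n

  v-mul : ∀ g n → L.mul v g n I.≈ ℤ⟦X⟧.mul ℤ⟦X⟧.X (g n)
  v-mul g zero = I.refl
  v-mul g (suc n) = I.trans (I.+-congˡ {x = ℤ⟦X⟧.mul ℤ⟦X⟧.X (g (suc n))} (L.mul-zeroˡ g n)) (I.+-identityʳ _)

  δ-cong : ∀ {a b} → a 𝕃.≈ b → δ a 𝕎.≈ δ b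
  δ-cong p = W.mk λ n n<D → ℤ⟦X⟧._≋_.at (L._≋_.at p n n<D) n tt

  private
    pointwise : ∀ {f g} → f I.≈ g → ∀ n → f n ≡ g n
    pointwise p n = ℤ⟦X⟧._≋_.at p n tt

    uv-zero : ∀ h → L.mul (L.mul u v) h 0 I.≈ I.0#
    uv-zero h = I.trans (L.mul-assoc u v h 0) (L.mul-X-zero (L.mul v h))

    uv-suc : ∀ h n → L.mul (L.mul u v) h (suc n) I.≈ ℤ⟦X⟧.mul ℤ⟦X⟧.X (h n)
    uv-suc h n = I.trans (L.mul-assoc u v h (suc n)) (I.trans (L.mul-Xˡ (L.mul v h) n) (v-mul h n))

  δ-uv : ∀ h → δ (u 𝕃.* v 𝕃.* h) 𝕎.≈ W.X 𝕎.* δ h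
  δ-uv h = W.mk go
    where
    go : ∀ n → n ℕ.< D → δ (u 𝕃.* v 𝕃.* h) n ≡ W.mul W.X (δ h) n
    go zero _ = ≡.trans (pointwise (uv-zero h) 0) (≡.sym (W.mul-X-zero (δ h)))
    go (suc n) _ = ≡.trans (pointwise (uv-suc h n) (suc n))
      (≡.trans (ℤ⟦X⟧.mul-Xˡ (h n) n) (≡.sym (W.mul-Xˡ (δ h) n)))

  private
    v^-off : ∀ b i j → ¬ (0 ≡ i × b ≡ j) → (v PL.^ b) i j ≡ + 0
    v^-off zero zero zero ne = ⊥-elim (ne (≡.refl , ≡.refl))
    v^-off zero zero (suc j) ne = ≡.refl
    v^-off zero (suc i) j ne = ≡.refl
    v^-off (suc b) i j ne = ≡.trans (pointwise (v-mul (v PL.^ b) i) j) (go j ne)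
      where
      go : ∀ j → ¬ (0 ≡ i × suc b ≡ j) → ℤ⟦X⟧.mul ℤ⟦X⟧.X ((v PL.^ b) i) j ≡ + 0
      go zero ne = ℤ⟦X⟧.mul-X-zero ((v PL.^ b) i)
      go (suc j) ne = ≡.trans (ℤ⟦X⟧.mul-Xˡ ((v PL.^ b) i) j) (v^-off b i j (λ (p , r) → ne (p , ≡.cong suc r)))

    uv-off : ∀ a b i j → ¬ (a ≡ i × b ≡ j) → (u PL.^ a 𝕃.* v PL.^ b) i j ≡ + 0
    uv-off zero b i j ne = ≡.trans (pointwise (L.mul-oneˡ (v PL.^ b) i) j) (v^-off b i j ne)
    uv-off (suc a) b zero j ne = ≡.trans (pointwise (L.mul-assoc u (u PL.^ a) (v PL.^ b) 0) j)
      (pointwise (L.mul-X-zero (u PL.^ a 𝕃.* v PL.^ b)) j)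
    uv-off (suc a) b (suc i) j ne = ≡.trans (pointwise (L.mul-assoc u (u PL.^ a) (v PL.^ b) (suc i)) j)
      (≡.trans (pointwise (L.mul-Xˡ (u PL.^ a 𝕃.* v PL.^ b) i) j) (uv-off a b i j (λ (p , r) → ne (≡.cong suc p , r))))

  δ-monomial : ∀ a b → ¬ a ≡ b → δ (u PL.^ a 𝕃.* v PL.^ b) 𝕎.≈ 𝕎.0#
  δ-monomial a b a≢b = W.mk λ n _ → uv-off a b n n (λ (p , r) → a≢b (≡.trans p (≡.sym r)))

  δ-1 : δ 𝕃.1# 𝕎.≈ 𝕎.1#
  δ-1 = W.mk λ { zero _ → ≡.refl ; (suc n) _ → ≡.refl }

  δ-sum : ∀ {I : Set} (xs : List I) f → δ (SL.sumOver xs f) 𝕎.≈ SW.sumOver xs (λ i → δ (f i))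
  δ-sum [] f = 𝕎.refl
  δ-sum (x ∷ xs) f = 𝕎.+-congˡ {x = δ (f x)} (δ-sum xs f)

  δ-hasSum : ∀ {I : Set} {f : I → L.PS} {x} → SL.HasSum f x → SW.HasSum (λ i → δ (f i)) (δ x)
  δ-hasSum {f = f} (SL.hasSum xs un o t) =
    SW.hasSum xs un (λ i i∉ → δ-cong (o i i∉)) (𝕎.trans (𝕎.sym (δ-sum xs f)) (δ-cong t))

  δ-hasSum-1 : ∀ {f : ℤ → L.PS} {x} (a b : ℤ → ℕ) → (∀ t → f t 𝕃.≈ u PL.^ a t 𝕃.* v PL.^ b t) →
               (∀ t → a t ≡ b t → t ≡ + 0) → a (+ 0) ≡ 0 → b (+ 0) ≡ 0 → SL.HasSum f x → δ x 𝕎.≈ 𝕎.1#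
  δ-hasSum-1 {f} a b e diag a0 b0 s = 𝕎.trans (SW.hasSum-unique ℤ._≟_ (δ-hasSum s)
    (SW.hasSum-single (+ 0) (λ t t≢0 → 𝕎.trans (δ-cong (e t)) (δ-monomial (a t) (b t) (λ p → t≢0 (diag t p))))))
    (𝕎.trans (δ-cong (𝕃.trans (e (+ 0)) (𝕃.trans (𝕃.reflexive (≡.cong₂ (λ i j → u PL.^ i 𝕃.* v PL.^ j) a0 b0)) (𝕃.*-identityˡ 𝕃.1#)))) δ-1)

  δ-hasSum-0 : ∀ {f : ℤ → L.PS} {x} (a b : ℤ → ℕ) → (∀ t → f t 𝕃.≈ u PL.^ a t 𝕃.* v PL.^ b t) →
               (∀ t → ¬ a t ≡ b t) → SL.HasSum f x → δ x 𝕎.≈ 𝕎.0#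
  δ-hasSum-0 a b e off s = SW.hasSum-unique ℤ._≟_ (δ-hasSum s)
    (SW.hasSum-empty (λ t → 𝕎.trans (δ-cong (e t)) (δ-monomial (a t) (b t) (off t))))

  uv-nilpotent : (u 𝕃.* v) PL.^ D 𝕃.≈ 𝕃.0#
  uv-nilpotent = 𝕃.trans (PL.^-distrib-* u v D) (𝕃.trans (𝕃.*-congʳ {x = v PL.^ D} L.X-nilpotent) (𝕃.zeroˡ _))

  module _ (k : ℕ) (u′ v′ : L.PS) (u′≈ : u′ 𝕃.≈ u PL.^ suc k) (v′≈ : v′ 𝕃.≈ v PL.^ suc k) where
    private
      u′v′ : u′ 𝕃.* v′ 𝕃.≈ (u 𝕃.* v) PL.^ suc k
      u′v′ = 𝕃.trans (𝕃.*-cong u′≈ v′≈) (𝕃.sym (PL.^-distrib-* u v (suc k)))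

      δ-uv^ : ∀ n h → δ ((u 𝕃.* v) PL.^ n 𝕃.* h) 𝕎.≈ W.X PW.^ n 𝕎.* δ h
      δ-uv^ zero h = 𝕎.trans (δ-cong (𝕃.*-identityˡ h)) (𝕎.sym (𝕎.*-identityˡ (δ h)))
      δ-uv^ (suc n) h = 𝕎.trans (δ-cong (𝕃.*-assoc (u 𝕃.* v) ((u 𝕃.* v) PL.^ n) h)) (𝕎.trans (δ-uv ((u 𝕃.* v) PL.^ n 𝕃.* h))
        (𝕎.trans (𝕎.*-congˡ {x = W.X} (δ-uv^ n h)) (𝕎.sym (𝕎.*-assoc W.X (W.X PW.^ n) (δ h)))))

      power : ∀ {w w′ : L.PS} → w′ 𝕃.≈ w PL.^ suc k → ∀ n → (w′ PL.^ 3) PL.^ n 𝕃.≈ w PL.^ (suc k ℕ.* (3 ℕ.* n))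
      power {w} {w′} e n = 𝕃.trans (PL.^-assocʳ w′ 3 n) (𝕃.trans (PL.^-congˡ (3 ℕ.* n) e) (PL.^-assocʳ w (suc k) (3 ℕ.* n)))

      nilpotent′ : (u′ 𝕃.* v′) PL.^ D 𝕃.≈ 𝕃.0#
      nilpotent′ = 𝕃.trans (PL.^-congˡ D u′v′) (IL.nilpotent-^ k uv-nilpotent)

    extraction : Extraction L.psRing W.psRing D u′ v′ (W.X PW.^ suc k)
    extraction = record
      { δ = δ
      ; δ-cong = δ-cong
      ; δ-+ = λ _ _ → 𝕎.refl
      ; δ-neg = λ _ → 𝕎.refl
      ; δ-0 = 𝕎.refl
      ; δ-uv = λ h → 𝕎.trans (δ-cong (𝕃.*-congʳ {x = h} u′v′)) (δ-uv^ (suc k) h)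
      ; uv-nilpotent = nilpotent′
      ; q-nilpotent = ThetaIdentities.nilpotent-^ W.psRing D k W.X-nilpotent
      ; δ-theta = δ-hasSum-1 (λ m → suc k ℕ.* (3 ℕ.* T m)) (λ m → suc k ℕ.* (3 ℕ.* T (ℤ.- m)))
          (λ m → 𝕃.*-cong (power {u} u′≈ (T m)) (power {v} v′≈ (T (ℤ.- m))))
          (λ m e → T-difference m (ℕₚ.*-cancelˡ-≡ (T m) (T (ℤ.- m)) 3 (ℕₚ.*-cancelˡ-≡ (3 ℕ.* T m) (3 ℕ.* T (ℤ.- m)) (suc k) e)))
          (ℕₚ.*-zeroʳ (suc k)) (ℕₚ.*-zeroʳ (suc k))
          (TL.theta-sum (u′ PL.^ 3) (v′ PL.^ 3) {D} (IL.nilpotent³ u′ v′ nilpotent′))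
      }

  base-extraction : Extraction L.psRing W.psRing D u v (W.X PW.^ 1)
  base-extraction = extraction 0 u v (𝕃.sym (𝕃.*-identityʳ u)) (𝕃.sym (𝕃.*-identityʳ v))

  module X₁ = ExtractedRelations base-extraction

  private
    m n : Fin 3 → ℤ → ℕ
    m r t = T (t ℤ.+ bal r) ℕ.+ 2 ℕ.* T t
    n r t = T (ℤ.- (t ℤ.+ bal r)) ℕ.+ 2 ℕ.* T (ℤ.- t)

    m≡n⇒0 : ∀ r t → m r t ≡ n r t → (r , t) ≡ split₃ (+ 0)
    m≡n⇒0 r t e = ≡.trans (≡.sym (split₃-join₃ (r , t))) (≡.cong split₃ (T-difference (join₃ (r , t)) (≡.sym
        (ℕₚ.+-cancelˡ-≡ (n r t) (T (ℤ.- join₃ (r , t))) (T (join₃ (r , t))) (≡.trans (≡.cong (ℕ._+ T (ℤ.- join₃ (r , t))) (≡.sym e)) (balance r))))))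
      where
      open Triangular
      balance : ∀ r → m r t ℕ.+ T (ℤ.- join₃ (r , t)) ≡ n r t ℕ.+ T (join₃ (r , t))
      balance 0F = exponents (t ∷ []) (tr (var 0F :+ con (bal 0F)) ⊞ 2 ⊠ tr (var 0F) ⊞ tr (:- (con (+ 3) :* var 0F :+ con (bal 0F))))
        (tr (:- (var 0F :+ con (bal 0F))) ⊞ 2 ⊠ tr (:- var 0F) ⊞ tr (con (+ 3) :* var 0F :+ con (bal 0F))) ≡.refl
      balance 1F = exponents (t ∷ []) (tr (var 0F :+ con (bal 1F)) ⊞ 2 ⊠ tr (var 0F) ⊞ tr (:- (con (+ 3) :* var 0F :+ con (bal 1F))))
        (tr (:- (var 0F :+ con (bal 1F))) ⊞ 2 ⊠ tr (:- var 0F) ⊞ tr (con (+ 3) :* var 0F :+ con (bal 1F))) ≡.refl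
      balance 2F = exponents (t ∷ []) (tr (var 0F :+ con (bal 2F)) ⊞ 2 ⊠ tr (var 0F) ⊞ tr (:- (con (+ 3) :* var 0F :+ con (bal 2F))))
        (tr (:- (var 0F :+ con (bal 2F))) ⊞ 2 ⊠ tr (:- var 0F) ⊞ tr (con (+ 3) :* var 0F :+ con (bal 2F))) ≡.refl

    6+3 : ∀ a b → a ℕ.* 6 ℕ.+ b ℕ.* 3 ≡ a ℕ.* 3 ℕ.+ b ℕ.* 6 → a ≡ b
    6+3 a b e = ℕₚ.*-cancelʳ-≡ a b 3 (ℕₚ.+-cancelˡ-≡ (a ℕ.* 3 ℕ.+ b ℕ.* 3) (a ℕ.* 3) (b ℕ.* 3)
      (≡.trans (NatSolver.solve 2 (λ a b → a :* con 3 :+ b :* con 3 :+ a :* con 3 := a :* con 6 :+ b :* con 3) ≡.refl a b)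
        (≡.trans e (NatSolver.solve 2 (λ a b → a :* con 3 :+ b :* con 6 := a :* con 3 :+ b :* con 3 :+ b :* con 3) ≡.refl a b))))
      where open NatSolver using (_:=_; con; _:+_; _:*_)

    x₀ y₀ : L.PS
    x₀ = u PL.^ 6 𝕃.* v PL.^ 3
    y₀ = u PL.^ 3 𝕃.* v PL.^ 6

    part-hasSum : ∀ r → SL.HasSum (IL.base x₀ y₀ r) (IL.part x₀ y₀ r)
    part-hasSum = IL.part-sum x₀ y₀ (𝕃.trans (PL.^-congˡ D (𝕃.trans (IL.xy-* u v 6 3 3 6) (𝕃.sym (PL.^-distrib-* u v 9))))
      (IL.nilpotent-^ 8 uv-nilpotent))

    part-zero : ∀ r → ¬ r ≡ 0F → δ (IL.part x₀ y₀ r) 𝕎.≈ 𝕎.0#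
    part-zero r r≢0 = δ-hasSum-0 _ _ (DL.base-xy u v uv-nilpotent 6 3 3 6 r)
      (λ t e → r≢0 (≡.cong proj₁ (m≡n⇒0 r t (6+3 (m r t) (n r t) e)))) (part-hasSum r)

  δ-slice-cube : δ (DL.s₀³ u v uv-nilpotent) 𝕎.≈ ThetaIdentities.quad W.psRing D 0F ((W.X PW.^ 1) PW.^ 9)
  δ-slice-cube = 𝕎.trans (δ-cong (DL.slice-0-cube u v uv-nilpotent))
    (𝕎.trans (𝕎.+-cong
       (𝕎.trans (scaled 0F) (𝕎.trans (𝕎.*-congˡ {x = B 0F} (δ-hasSum-1 _ _ (DL.base-xy u v uv-nilpotent 6 3 3 6 0F)
           (λ t e → ≡.cong proj₂ (m≡n⇒0 0F t (6+3 (m 0F t) (n 0F t) e))) ≡.refl ≡.refl (part-hasSum 0F))) (𝕎.*-identityʳ (B 0F))))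
       (𝕎.+-cong (vanish 1F (λ ())) (vanish 2F (λ ()))))
     (𝕎.trans (𝕎.+-congˡ {x = B 0F} (𝕎.+-identityʳ 𝕎.0#)) (𝕎.+-identityʳ (B 0F))))
    where
    B : Fin 3 → W.PS
    B r = ThetaIdentities.quad W.psRing D r ((W.X PW.^ 1) PW.^ 9)
    scaled : ∀ r → δ (IL.part x₀ y₀ r 𝕃.* IL.quad r ((u 𝕃.* v) PL.^ 9)) 𝕎.≈ B r 𝕎.* δ (IL.part x₀ y₀ r)
    scaled r = 𝕎.trans (δ-cong (𝕃.*-comm (IL.part x₀ y₀ r) (IL.quad r ((u 𝕃.* v) PL.^ 9))))
      (X₁.linear-quad r (X₁.linear-^ X₁.linear-uv 9) (IL.part x₀ y₀ r))
    vanish : ∀ r → ¬ r ≡ 0F → δ (IL.part x₀ y₀ r 𝕃.* IL.quad r ((u 𝕃.* v) PL.^ 9)) 𝕎.≈ 𝕎.0#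
    vanish r r≢0 = 𝕎.trans (scaled r) (𝕎.trans (𝕎.*-congˡ {x = B r} (part-zero r r≢0)) (𝕎.zeroʳ (B r)))

module FrobeniusRelation (R : Ring₀) where
  open CommutativeRing R
  open Solver R
  open Integers R
  open Products R
  open NinthPower R
  open import Relation.Binary.Reasoning.Setoid setoid

  quadratic : Carrier → Carrier → Carrier
  quadratic t x = t * t + fromℤ (+ 9) * x * t + fromℤ (+ 27) * (x * x)

  quartic : Carrier → Carrier → Carrier
  quartic t x = cube (t + fromℤ (+ 9) * x) * (t + fromℤ (+ 3) * x) +
                fromℤ (+ 54) * (x * quadratic t x) * (t + fromℤ (+ 12) * x)

  quadratic-cong : ∀ {t t′ x x′} → t ≈ t′ → x ≈ x′ → quadratic t x ≈ quadratic t′ x′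
  quadratic-cong p r = +-cong (+-cong (*-cong p p) (*-cong (*-congˡ r) p)) (*-congˡ (*-cong r r))

  quartic-cong : ∀ {t t′ x x′} → t ≈ t′ → x ≈ x′ → quartic t x ≈ quartic t′ x′
  quartic-cong p r = +-cong (*-cong (cube-cong (+-cong p (*-congˡ r))) (+-cong p (*-congˡ r)))
    (*-cong (*-congˡ (*-cong r (quadratic-cong p r))) (+-cong p (*-congˡ r)))

  module _ {E₃ E₉ A B C Y q x G Ψ : Carrier} (unit : Unit (cube E₃))
           (hA : E₉ * A ≈ cube E₃ + fromℤ (+ 9) * x) (hB : E₉ * B ≈ cube E₃ + fromℤ (+ 3) * x)
           (hC : C ≈ fromℤ (+ 3) * Y) (hY : E₃ * Y ≈ q * cube E₉) (hx : x ≈ q ^ 3 * G)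
           (hN : E₉ ^ 12 ≈ G * (cube E₃ * quadratic (cube E₃) x))
           (hΨ : nine E₃ * Ψ ≈ cube A * B + cube C * (A - B) + fromℤ (+ 6) * (A * (C * C)) * Y) where
    private
      t M : Carrier
      t = cube E₃
      M = x * quadratic t x

      YE : cube Y * cube E₉ ≈ M
      YE = unit-cancel unit (begin
        t * (cube Y * cube E₉)
          ≈⟨ solve 3 (λ e y f → let K = λ a → a :* (a :* a) in K e :* (K y :* K f) := (e :* y) :^ 3 :* K f) refl E₃ Y E₉ ⟩
        (E₃ * Y) ^ 3 * cube E₉
          ≈⟨ *-congʳ (^-congˡ 3 hY) ⟩
        (q * cube E₉) ^ 3 * cube E₉
          ≈⟨ solve 2 (λ q f → let K = λ a → a :* (a :* a) in (q :* K f) :^ 3 :* K f := q :^ 3 :* f :^ 12) refl q E₉ ⟩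
        q ^ 3 * E₉ ^ 12
          ≈⟨ *-congˡ hN ⟩
        q ^ 3 * (G * (t * quadratic t x))
          ≈⟨ solve 4 (λ q g t k → q :* (g :* (t :* k)) := t :* (q :* g :* k)) refl (q ^ 3) G t (quadratic t x) ⟩
        t * (q ^ 3 * G * quadratic t x)
          ≈⟨ *-congˡ (*-congʳ hx) ⟨
        t * M ∎)

    frobenius-relation : E₉ ^ 4 * (cube (cube E₃) * Ψ) ≈ quartic (cube E₃) x
    frobenius-relation = begin
      E₉ ^ 4 * (cube t * Ψ)
        ≈⟨ *-congˡ hΨ ⟩
      E₉ ^ 4 * (cube A * B + cube C * (A - B) + fromℤ (+ 6) * (A * (C * C)) * Y)
        ≈⟨ *-congˡ (+-cong (+-congˡ (*-congʳ (cube-cong hC))) (*-congʳ (*-congˡ (*-congˡ (*-cong hC hC))))) ⟩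
      E₉ ^ 4 * (cube A * B + cube (fromℤ (+ 3) * Y) * (A - B) + fromℤ (+ 6) * (A * (fromℤ (+ 3) * Y * (fromℤ (+ 3) * Y))) * Y)
        ≈⟨ solve 4 (λ e a b y → let K = λ x → x :* (x :* x) ; d = con (+ 3) :* y in
             e :^ 4 :* (K a :* b :+ K d :* (a :- b) :+ con (+ 6) :* (a :* (d :* d)) :* y) :=
             K (e :* a) :* (e :* b) :+ con (+ 27) :* (K y :* K e) :* (e :* a :- e :* b) :+ con (+ 54) :* (e :* a) :* (K y :* K e)) refl
             E₉ A B Y ⟩
      cube (E₉ * A) * (E₉ * B) + fromℤ (+ 27) * (cube Y * cube E₉) * (E₉ * A - E₉ * B) + fromℤ (+ 54) * (E₉ * A) * (cube Y * cube E₉)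
        ≈⟨ +-cong (+-cong (*-cong (cube-cong hA) hB) (*-cong (*-congˡ YE) (+-cong hA (-‿cong hB)))) (*-cong (*-congˡ hA) YE) ⟩
      cube (t + fromℤ (+ 9) * x) * (t + fromℤ (+ 3) * x) +
        fromℤ (+ 27) * M * (t + fromℤ (+ 9) * x - (t + fromℤ (+ 3) * x)) + fromℤ (+ 54) * (t + fromℤ (+ 9) * x) * M
        ≈⟨ solve 3 (λ t x m → let K = λ x → x :* (x :* x) ; a = t :+ con (+ 9) :* x ; b = t :+ con (+ 3) :* x in
             K a :* b :+ con (+ 27) :* m :* (a :- b) :+ con (+ 54) :* a :* m :=
             K a :* b :+ con (+ 54) :* m :* (t :+ con (+ 12) :* x)) refl t x M ⟩
      quartic t x ∎

doubling : (R : Ring₀) → let open CommutativeRing R ; open Integers R in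
  ∀ a b y c → a ≈ b + (c + c) → a ≈ b + fromℤ (+ 6) * y → c + c ≈ fromℤ (+ 3) * y + fromℤ (+ 3) * y
doubling R a b y c p r = trans (solve 2 (λ b c → c :+ c := b :+ (c :+ c) :- b) refl b c)
  (trans (+-congʳ (trans (sym p) r)) (solve 2 (λ b y → b :+ con (+ 6) :* y :- b := con (+ 3) :* y :+ con (+ 3) :* y) refl b y))
  where
  open CommutativeRing R
  open Solver R

unit-cube : (R : Ring₀) → let open CommutativeRing R ; open NinthPower R using (cube) in
  ∀ x y → x * y ≈ 1# → cube x * cube y ≈ 1#
unit-cube R x y p = trans (solve 2 (λ x y → x :* (x :* x) :* (y :* (y :* y)) := x :* y :* (x :* y :* (x :* y))) refl x y)
  (trans (*-cong p (*-cong p p)) (solve 0 (con (+ 1) :* (con (+ 1) :* con (+ 1)) := con (+ 1)) refl))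
  where
  open CommutativeRing R
  open Solver R

module TruncatedRelations (D : ℕ) where
  open Diagonal D
  open W using (X)
  open CommutativeRing W.psRing
  open Products W.psRing
  open NinthPower W.psRing
  open Integers W.psRing
  open FrobeniusRelation W.psRing
  private
    module PL = Products L.psRing
    module DL = DilatedTheta L.psRing D
    module IW = ThetaIdentities W.psRing D
    module X₃ = ExtractedRelations (extraction 2 (u PL.^ 3) (v PL.^ 3) 𝕃.refl 𝕃.refl)
    module N₁ = NormIdentity base-extraction
    module N₃ = NormIdentity (extraction 2 (u PL.^ 3) (v PL.^ 3) 𝕃.refl 𝕃.refl)

  E : ℕ → W.PS
  E k = euler D (X ^ k)

  private
    E-* : ∀ a b → euler D ((X ^ a) ^ b) ≈ E (a ℕ.* b)
    E-* a b = euler-cong D (^-assocʳ X a b)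

  relation₁ : E 9 * (cube (E 1) + fromℤ (+ 3) * (X ^ 1 * cube (E 9))) ≈
              E 3 * (cube (E 3) + fromℤ (+ 9) * (X ^ 3 * cube (E 27)))
  relation₁ = trans (*-congˡ {x = E 9} (sym h₁)) (trans (trans (sym (*-assoc (E 9) (E 3) X₃.A₁))
    (trans (*-congʳ {x = X₃.A₁} (*-comm (E 9) (E 3))) (*-assoc (E 3) (E 9) X₃.A₁))) (*-congˡ {x = E 3} h₃))
    where
    h₁ : E 3 * X₃.A₁ ≈ cube (E 1) + fromℤ (+ 3) * (X ^ 1 * cube (E 9))
    h₁ = trans (*-cong (sym (E-* 1 3)) (IW.quad-cong 0F (sym (^-assocʳ X 1 3))))
      (trans X₁.E₃A₃ (+-congˡ {x = cube (E 1)} (*-congˡ {x = fromℤ (+ 3)} (*-congˡ {x = X ^ 1} (cube-cong (E-* 1 9))))))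
    h₃ : E 9 * X₃.A₁ ≈ cube (E 3) + fromℤ (+ 9) * (X ^ 3 * cube (E 27))
    h₃ = trans (*-congʳ {x = X₃.A₁} (sym (E-* 3 3)))
      (trans X₃.E₃A₁ (+-congˡ {x = cube (E 3)} (*-congˡ {x = fromℤ (+ 9)} (*-congˡ {x = X ^ 3} (cube-cong (E-* 3 9))))))

  relation₂ : E 3 ^ 12 ≈ cube (E 9) * (cube (E 1) * quadratic (cube (E 1)) (X ^ 1 * cube (E 9)))
  relation₂ = trans (^-congˡ 12 (sym (E-* 1 3))) (trans N₁.norm-identity
    (*-cong (cube-cong (E-* 1 9)) (*-congˡ {x = cube (E 1)} (quadratic-cong {cube (E 1)} refl (*-congˡ {x = X ^ 1} (cube-cong (E-* 1 9)))))))

  -- The diagonal of G(z)⁹ at q³, up to truncation.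
  Ψ : W.PS
  Ψ = δ (GroupRing.c₀ (NinthPower.nine (GroupRing.groupRing L.psRing) (DL.J u v)))

  private
    x A B C : W.PS
    x = X ^ 3 * cube (E 27)
    A = IW.quad 0F ((X ^ 1) ^ 3)
    B = IW.quad 0F ((X ^ 1) ^ 9)
    C = X ^ 1 * IW.quad 1F ((X ^ 1) ^ 3)

    hA : E 9 * A ≈ cube (E 3) + fromℤ (+ 9) * x
    hA = trans (*-cong (sym (E-* 3 3)) (IW.quad-cong 0F (^-assocʳ X 1 3)))
      (trans X₃.E₃A₁ (+-congˡ {x = cube (E 3)} (*-congˡ {x = fromℤ (+ 9)} (*-congˡ {x = X ^ 3} (cube-cong (E-* 3 9))))))

    hB : E 9 * B ≈ cube (E 3) + fromℤ (+ 3) * x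
    hB = trans (*-cong (sym (E-* 3 3)) (IW.quad-cong 0F (trans (^-assocʳ X 1 9) (sym (^-assocʳ X 3 3)))))
      (trans X₃.E₃A₃ (+-congˡ {x = cube (E 3)} (*-congˡ {x = fromℤ (+ 3)} (*-congˡ {x = X ^ 3} (cube-cong (E-* 3 9))))))

    halve : ∀ {f g : W.PS} → f + f ≈ g + g → f ≈ g
    halve {f} {g} p = W.mk λ n n<D → ℤₚ.*-cancelˡ-≡ (+ 2) (f n) (g n)
      (≡.trans (double (f n)) (≡.trans (W._≋_.at p n n<D) (≡.sym (double (g n)))))
      where
      double : ∀ a → + 2 ℤ.* a ≡ a ℤ.+ a
      double = ℤSolver.solve 1 (λ a → ℤSolver.con (+ 2) ℤSolver.:* a ℤSolver.:= a ℤSolver.:+ a) ≡.refl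

    q-nilpotent : (X ^ 1) ^ D ≈ 0#
    q-nilpotent = Extraction.q-nilpotent base-extraction

    hC : C ≈ fromℤ (+ 3) * X₁.Y
    hC = halve (double-C X₁.A₁ A X₁.Y C (trans (IW.quad-dissection q-nilpotent) (+-congˡ {x = A} (+-congʳ {x = C}
        (*-congˡ {x = X ^ 1} (sym (IW.quad-1≈2 (IW.nilpotent-^ 2 q-nilpotent))))))) X₁.cubic-A)
      where
      double-C : ∀ a b y c → a ≈ b + (c + c) → a ≈ b + fromℤ (+ 6) * y → c + c ≈ fromℤ (+ 3) * y + fromℤ (+ 3) * y
      double-C = doubling W.psRing

    hY : E 3 * X₁.Y ≈ X ^ 1 * cube (E 9)
    hY = trans (*-congʳ {x = X₁.Y} (sym (E-* 1 3))) (trans X₁.product-Y (*-congˡ {x = X ^ 1} (cube-cong (E-* 1 9))))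

    hN : E 9 ^ 12 ≈ cube (E 27) * (cube (E 3) * quadratic (cube (E 3)) x)
    hN = trans (^-congˡ 12 (sym (E-* 3 3))) (trans N₃.norm-identity
      (*-cong (cube-cong (E-* 3 9)) (*-congˡ {x = cube (E 3)} (quadratic-cong {cube (E 3)} refl (*-congˡ {x = X ^ 3} (cube-cong (E-* 3 9)))))))

    linear-cube : ∀ {c d} → X₁.Linear c d → X₁.Linear (NinthPower.cube L.psRing c) (cube d)
    linear-cube l = X₁.linear-* l (X₁.linear-* l l)

    linear-A : X₁.Linear (DL.A u v uv-nilpotent) A
    linear-A = X₁.linear-quad 0F (X₁.linear-^ X₁.linear-uv 3)

    linear-C : X₁.Linear (DL.C u v uv-nilpotent) C
    linear-C = X₁.linear-* X₁.linear-uv (X₁.linear-quad 1F (X₁.linear-^ X₁.linear-uv 3))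

    linear-nine : X₁.Linear (NinthPower.nine L.psRing (PL.euler D ((u 𝕃.* v) PL.^ 3))) (nine (euler D ((X ^ 1) ^ 3)))
    linear-nine = X₁.linear-* l (X₁.linear-* l l)
      where
      l = linear-cube (X₁.linear-euler D (X₁.linear-^ X₁.linear-uv 3))

    hΨ : nine (E 3) * Ψ ≈ cube A * B + cube C * (A - B) + fromℤ (+ 6) * (A * (C * C)) * X₁.Y
    hΨ = trans (*-congʳ {x = Ψ} (nine-cong (sym (E-* 1 3)))) (trans (sym (linear-nine _))
      (trans (δ-cong (DL.ninth-power-relation u v uv-nilpotent))
        (+-cong (+-cong (trans (linear-cube linear-A _) (*-congˡ {x = cube A} δ-slice-cube))
                        (trans (linear-cube linear-C _) (*-congˡ {x = cube C} (+-cong X₁.δ-e₁ (-‿cong δ-slice-cube)))))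
                (X₁.linear-* (X₁.linear-fromℕ 6) (X₁.linear-* linear-A (X₁.linear-* linear-C linear-C)) _))))

    unit-E₃ : Unit (cube (E 3))
    unit-E₃ with euler-unit D {D} {X ^ 3} (IW.nilpotent-^ 2 W.X-nilpotent)
    ... | y , e = cube y , unit-cube W.psRing (E 3) y e

  relation₃ : E 9 ^ 4 * (cube (cube (E 3)) * Ψ) ≈ quartic (cube (E 3)) (X ^ 3 * cube (E 27))
  relation₃ = frobenius-relation {E 3} {E 9} {A} {B} {C} {X₁.Y} {X ^ 1} {x} {cube (E 27)} {Ψ}
    unit-E₃ hA hB hC hY (*-congʳ {x = cube (E 27)} (sym (^-assocʳ X 1 3))) hN hΨ

-- Counting generalized Frobenius partitions

module _ (k m : ℕ) where
  colored-increasing : AllPairs _≺_ (concatMap (λ a → map (a ,_) (allFin k)) (upTo (suc m)))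
  colored-increasing = AllPairsₚ.concat⁺
    (Allₚ.map⁺ (All.tabulate (λ _ → AllPairsₚ.map⁺ (AllPairsₚ.tabulate⁺-< (λ i<j → inj₂ (≡.refl , i<j))))))
    (AllPairsₚ.map⁺ (AllPairsₚ.applyUpTo⁺₁ (λ i → i) (suc m) (λ i<j _ → All.tabulate (λ x∈ → All.tabulate (λ y∈ → less i<j x∈ y∈)))))
    where
    less : ∀ {i j x y} → i ℕ.< j → x ∈ map (i ,_) (allFin k) → y ∈ map (j ,_) (allFin k) → x ≺ y
    less i<j x∈ y∈ with ∈-map⁻ _ x∈ | ∈-map⁻ _ y∈
    ... | _ , _ , ≡.refl | _ , _ , ≡.refl = inj₁ i<j

  module _ {A : Set} {P : A → A → Set} where
    reverse-allPairs : ∀ {xs : List A} → AllPairs P xs → AllPairs (λ x y → P y x) (reverse xs)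
    reverse-allPairs [] = []
    reverse-allPairs {x ∷ xs} (px ∷ pxs) = ≡.subst (AllPairs (λ x y → P y x)) (≡.sym (Listₚ.unfold-reverse x xs))
      (AllPairsₚ.++⁺ (reverse-allPairs pxs) ([] ∷ []) (All.map (λ p → p ∷ []) (All.tabulate (λ y∈ → All.lookup px (Anyₚ.reverse⁻ y∈)))))

    sublists-all : ∀ {Q : A → Set} xs {as} → as ∈ sublists xs → All Q xs → All Q as
    sublists-all [] (here ≡.refl) [] = []
    sublists-all (x ∷ xs) as∈ (q ∷ qs) with ∈-++⁻ (map (x ∷_) (sublists xs)) as∈
    ... | inj₂ as∈′ = sublists-all xs as∈′ qs
    ... | inj₁ as∈′ with ∈-map⁻ (x ∷_) as∈′
    ...   | bs , bs∈ , ≡.refl = q ∷ sublists-all xs bs∈ qs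

    sublists-allPairs : ∀ xs {as} → as ∈ sublists xs → AllPairs P xs → AllPairs P as
    sublists-allPairs [] (here ≡.refl) [] = []
    sublists-allPairs (x ∷ xs) as∈ (q ∷ qs) with ∈-++⁻ (map (x ∷_) (sublists xs)) as∈
    ... | inj₂ as∈′ = sublists-allPairs xs as∈′ qs
    ... | inj₁ as∈′ with ∈-map⁻ (x ∷_) as∈′
    ...   | bs , bs∈ , ≡.refl = sublists-all xs bs∈ q ∷ sublists-allPairs xs bs∈ qs

  candidates-decreasing : ∀ {as} → as ∈ candidates k m → Decreasing as
  candidates-decreasing as∈ = Linkedₚ.AllPairs⇒Linked (sublists-allPairs (colored≤ k m) as∈ (reverse-allPairs colored-increasing))

  candidatePairs-rows : ∀ {as bs} → (as , bs) ∈ candidatePairs k m → as ∈ candidates k m × bs ∈ candidates k m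
  candidatePairs-rows p∈ with ∈-concatMap⁻ (λ as → map (as ,_) (candidates k m)) {xs = candidates k m} p∈
  ... | any with find any
  ...   | cs , cs∈ , p∈′ with ∈-map⁻ (cs ,_) p∈′
  ...     | ds , ds∈ , ≡.refl = cs∈ , ds∈

module RowGeneratingFunction (R : Ring₀) where
  open CommutativeRing R
  open Solver R
  open Sums R
  open Products R
  open TripleProduct R using (halfˣ; halfʸ)
  open NinthPower R
  open import Relation.Binary.Reasoning.Setoid setoid

  listProd : ∀ {I : Set} → List I → (I → Carrier) → Carrier
  listProd [] f = 1#
  listProd (x ∷ xs) f = f x * listProd xs f

  listProd-++ : ∀ {I : Set} xs ys (f : I → Carrier) → listProd (xs ++ ys) f ≈ listProd xs f * listProd ys f
  listProd-++ [] ys f = sym (*-identityˡ _)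
  listProd-++ (x ∷ xs) ys f = trans (*-congˡ (listProd-++ xs ys f)) (sym (*-assoc _ _ _))

  listProd-cong : ∀ {I : Set} xs {f g : I → Carrier} → (∀ i → f i ≈ g i) → listProd xs f ≈ listProd xs g
  listProd-cong [] p = refl
  listProd-cong (x ∷ xs) p = *-cong (p x) (listProd-cong xs p)

  listProd-reverse : ∀ {I : Set} xs (f : I → Carrier) → listProd (reverse xs) f ≈ listProd xs f
  listProd-reverse [] f = refl
  listProd-reverse (x ∷ xs) f = begin
    listProd (reverse (x ∷ xs)) f  ≡⟨ ≡.cong (λ l → listProd l f) (Listₚ.unfold-reverse x xs) ⟩
    listProd (reverse xs ++ x ∷ []) f  ≈⟨ listProd-++ (reverse xs) (x ∷ []) f ⟩
    listProd (reverse xs) f * (f x * 1#)  ≈⟨ *-congʳ (listProd-reverse xs f) ⟩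
    listProd xs f * (f x * 1#)  ≈⟨ solve 2 (λ a b → a :* (b :* con (+ 1)) := b :* a) refl _ _ ⟩
    f x * listProd xs f  ∎

  listProd-concatMap : ∀ {I J : Set} (h : I → List J) xs (f : J → Carrier) →
                       listProd (concatMap h xs) f ≈ listProd xs (λ i → listProd (h i) f)
  listProd-concatMap h [] f = refl
  listProd-concatMap h (x ∷ xs) f = trans (listProd-++ (h x) (concatMap h xs) f) (*-congˡ (listProd-concatMap h xs f))

  listProd-upTo : ∀ n f → listProd (upTo n) f ≈ prod n f
  listProd-upTo zero f = refl
  listProd-upTo (suc n) f = begin
    listProd (upTo (suc n)) f  ≡⟨ ≡.cong (λ l → listProd l f) (≡.sym (Listₚ.upTo-∷ʳ n)) ⟩
    listProd (upTo n ++ n ∷ []) f  ≈⟨ listProd-++ (upTo n) (n ∷ []) f ⟩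
    listProd (upTo n) f * (f n * 1#)  ≈⟨ *-cong (listProd-upTo n f) (*-identityʳ _) ⟩
    prod n f * f n  ∎

  prod-nine : ∀ n f → prod n (λ i → nine (f i)) ≈ nine (prod n f)
  prod-nine zero f = solve 0 (con (+ 1) := let c = con (+ 1) :* (con (+ 1) :* con (+ 1)) in c :* (c :* c)) refl
  prod-nine (suc n) f = trans (*-congʳ (prod-nine n f)) (sym (nine-* _ _))

  sum-sublists : ∀ {I : Set} (xs : List I) g →
                 sumOver (sublists xs) (λ s → listProd s g) ≈ listProd xs (λ x → 1# + g x)
  sum-sublists [] g = +-identityʳ 1#
  sum-sublists (x ∷ xs) g = begin
    sumOver (map (x ∷_) (sublists xs) ++ sublists xs) (λ s → listProd s g)
      ≈⟨ sum-++ (map (x ∷_) (sublists xs)) (sublists xs) _ ⟩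
    sumOver (map (x ∷_) (sublists xs)) (λ s → listProd s g) + S
      ≈⟨ +-congʳ (trans (reflexive (sum-map (x ∷_) (sublists xs) _)) (sym (sum-*ˡ (g x) (sublists xs) _))) ⟩
    g x * S + S
      ≈⟨ solve 2 (λ a s → a :* s :+ s := (con (+ 1) :+ a) :* s) refl (g x) S ⟩
    (1# + g x) * S
      ≈⟨ *-congˡ (sum-sublists xs g) ⟩
    listProd (x ∷ xs) (λ x → 1# + g x) ∎
    where
    S : Carrier
    S = sumOver (sublists xs) (λ s → listProd s g)

  sum-concatMap : ∀ {I J : Set} (h : I → List J) xs (f : J → Carrier) →
                  sumOver (concatMap h xs) f ≈ sumOver xs (λ i → sumOver (h i) f)
  sum-concatMap h [] f = refl
  sum-concatMap h (x ∷ xs) f = trans (sum-++ (h x) (concatMap h xs) f) (+-congˡ (sum-concatMap h xs f))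

  row-product : ∀ z p (as : List (ColInt 9)) → listProd as (λ (a , _) → z * p ^ a) ≈ z ^ length as * p ^ weight as
  row-product z p [] = sym (*-identityˡ 1#)
  row-product z p ((a , c) ∷ as) = begin
    z * p ^ a * listProd as (λ (a , _) → z * p ^ a)  ≈⟨ *-congˡ (row-product z p as) ⟩
    z * p ^ a * (z ^ length as * p ^ weight as)  ≈⟨ solve 4 (λ z a b c → z :* a :* (b :* c) := z :* b :* (a :* c)) refl _ _ _ _ ⟩
    z * z ^ length as * (p ^ a * p ^ weight as)  ≈⟨ *-congˡ (^-homo-* p a (weight as)) ⟨
    z ^ suc (length as) * p ^ (a ℕ.+ weight as)  ∎

  sum-rows : ∀ m z p → sumOver (candidates 9 m) (λ as → z ^ length as * p ^ weight as) ≈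
                       nine (prod (suc m) (λ i → 1# + z * p ^ i))
  sum-rows m z p = begin
    sumOver (candidates 9 m) (λ as → z ^ length as * p ^ weight as)
      ≈⟨ sum-cong (candidates 9 m) (row-product z p) ⟨
    sumOver (candidates 9 m) (λ as → listProd as (λ (a , _) → z * p ^ a))
      ≈⟨ sum-sublists (colored≤ 9 m) (λ (a , _) → z * p ^ a) ⟩
    listProd (colored≤ 9 m) F
      ≈⟨ listProd-reverse (concatMap row (upTo (suc m))) F ⟩
    listProd (concatMap row (upTo (suc m))) F
      ≈⟨ listProd-concatMap row (upTo (suc m)) F ⟩
    listProd (upTo (suc m)) (λ a → listProd (row a) F)
      ≈⟨ listProd-cong (upTo (suc m)) (λ a → colours (1# + z * p ^ a)) ⟩
    listProd (upTo (suc m)) (λ a → nine (1# + z * p ^ a))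
      ≈⟨ listProd-upTo (suc m) _ ⟩
    prod (suc m) (λ a → nine (1# + z * p ^ a))
      ≈⟨ prod-nine (suc m) _ ⟩
    nine (prod (suc m) (λ i → 1# + z * p ^ i)) ∎
    where
    row : ℕ → List (ColInt 9)
    row a = map (a ,_) (allFin 9)
    F : ColInt 9 → Carrier
    F (a , _) = 1# + z * p ^ a
    colours : ∀ f → f * (f * (f * (f * (f * (f * (f * (f * (f * 1#)))))))) ≈ nine f
    colours = solve 1 (λ f → f :* (f :* (f :* (f :* (f :* (f :* (f :* (f :* (f :* con (+ 1))))))))) :=
      let c = f :* (f :* f) in c :* (c :* c)) refl

  pairTerm : Carrier → Carrier → List (ColInt 9) × List (ColInt 9) → Carrier
  pairTerm x y (as , bs) = x ^ length as * (x * y) ^ weight as * (y ^ length bs * (x * y) ^ weight bs)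

  sum-pairs : ∀ m x y → sumOver (candidatePairs 9 m) (pairTerm x y) ≈ nine (halfˣ x y (suc m) * halfʸ x y (suc m))
  sum-pairs m x y = begin
    sumOver (candidatePairs 9 m) (pairTerm x y)
      ≈⟨ sum-concatMap (λ as → map (as ,_) cs) cs (pairTerm x y) ⟩
    sumOver cs (λ as → sumOver (map (as ,_) cs) (pairTerm x y))
      ≈⟨ sum-cong cs (λ as → trans (reflexive (sum-map (as ,_) cs (pairTerm x y))) (trans (sym (sum-*ˡ (a as) cs b)) (*-comm _ _))) ⟩
    sumOver cs (λ as → sumOver cs b * a as)
      ≈⟨ sum-*ˡ (sumOver cs b) cs a ⟨
    sumOver cs b * sumOver cs a
      ≈⟨ *-comm _ _ ⟩
    sumOver cs a * sumOver cs b
      ≈⟨ *-cong (sum-rows m x (x * y)) (sum-rows m y (x * y)) ⟩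
    nine (halfˣ x y (suc m)) * nine (halfʸ x y (suc m))
      ≈⟨ nine-* _ _ ⟨
    nine (halfˣ x y (suc m) * halfʸ x y (suc m)) ∎
    where
    cs : List (List (ColInt 9))
    cs = candidates 9 m
    a b : List (ColInt 9) → Carrier
    a as = x ^ length as * (x * y) ^ weight as
    b bs = y ^ length bs * (x * y) ^ weight bs

  Congruent : Carrier → Carrier → Carrier → Set
  Congruent w a b = ∃ λ h → a ≈ b + w * h

  congruent-* : ∀ {w a b c d} → Congruent w a b → Congruent w c d → Congruent w (a * c) (b * d)
  congruent-* {w} {a} {b} {c} {d} (h , p) (k , q) = h * d + b * k + w * h * k , trans (*-cong p q)
    (solve 5 (λ w b d h k → (b :+ w :* h) :* (d :+ w :* k) := b :* d :+ w :* (h :* d :+ b :* k :+ w :* h :* k)) refl w b d h k)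

  congruent-refl : ∀ {w a} → Congruent w a a
  congruent-refl {w} {a} = 0# , solve 2 (λ w a → a := a :+ w :* con (+ 0)) refl w a

  congruent-nine : ∀ {w a b} → Congruent w a b → Congruent w (nine a) (nine b)
  congruent-nine p = congruent-* c (congruent-* c c)
    where
    c = congruent-* p (congruent-* p p)

  half-congruent : ∀ z p {N n} → N ℕ.≤ n → Congruent (p ^ N) (prod n (λ i → 1# + z * p ^ i)) (prod N (λ i → 1# + z * p ^ i))
  half-congruent z p {N} N≤n = go (ℕₚ.≤⇒≤′ N≤n)
    where
    go : ∀ {n} → N ℕ.≤′ n → Congruent (p ^ N) (prod n (λ i → 1# + z * p ^ i)) (prod N (λ i → 1# + z * p ^ i))
    go ℕ.≤′-refl = congruent-refl
    go (ℕ.≤′-step {n} N≤′n) = absorb (congruent-* (go N≤′n) (z * p ^ (n ℕ.∸ N) , +-congˡ (begin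
      z * p ^ n  ≡⟨ ≡.cong (λ k → z * p ^ k) (≡.sym (ℕₚ.m+[n∸m]≡n (ℕₚ.≤′⇒≤ N≤′n))) ⟩
      z * p ^ (N ℕ.+ (n ℕ.∸ N))  ≈⟨ *-congˡ (^-homo-* p N (n ℕ.∸ N)) ⟩
      z * (p ^ N * p ^ (n ℕ.∸ N))  ≈⟨ solve 3 (λ z a b → z :* (a :* b) := a :* (z :* b)) refl _ _ _ ⟩
      p ^ N * (z * p ^ (n ℕ.∸ N))  ∎)))
      where
      absorb : ∀ {a b} → Congruent (p ^ N) a (b * 1#) → Congruent (p ^ N) a b
      absorb (h , e) = h , trans e (+-congʳ (*-identityʳ _))

interchange : (R : Ring₀) → let open CommutativeRing R in ∀ a b c d → a * b * (c * d) ≈ a * c * (b * d)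
interchange R = solve 4 (λ a b c d → a :* b :* (c :* d) := a :* c :* (b :* d)) refl
  where
  open CommutativeRing R
  open Solver R

length-filter-sum : ∀ {A : Set} {P : A → Set} (P? : ∀ x → Dec (P x)) xs (F : A → ℤ) →
  (∀ x → x ∈ xs → P x → F x ≡ + 1) → (∀ x → x ∈ xs → ¬ P x → F x ≡ + 0) →
  Sums.sumOver ℤ-ring xs F ≡ + length (filter P? xs)
length-filter-sum P? [] F p q = ≡.refl
length-filter-sum P? (x ∷ xs) F p q with P? x | length-filter-sum P? xs F (λ y y∈ → p y (there y∈)) (λ y y∈ → q y (there y∈))
... | yes Px | ih rewrite ih = ≡.cong (ℤ._+ + length (filter P? xs)) (p x (here ≡.refl) Px)
... | no ¬Px | ih rewrite ih = ≡.cong (ℤ._+ + length (filter P? xs)) (q x (here ≡.refl) ¬Px)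

module FrobeniusCoefficient (D m : ℕ) (3m<D : 3 ℕ.* m ℕ.< D) where
  open Diagonal D
  open TruncatedRelations D using (Ψ)
  open GroupRingTools L.psRing
  private
    module PL = Products L.psRing
    module PW = Products W.psRing
    module PK = Products groupRing
    module IL = ThetaIdentities L.psRing D
    module TK = TripleProduct groupRing
    module RK = RowGeneratingFunction groupRing
    module SK = Sums groupRing
    module Sℤ = Sums ℤ-ring
    module DL = DilatedTheta L.psRing D u v
    module T₃ = ThetaRelations L.psRing D DL.x₃ DL.y₃
    module CR = CubeRoot groupRing ζ ζ³≈1
    module NK = NinthPower groupRing

    φ : K → ℤ
    φ k = δ (c₀ k) (3 ℕ.* m)

    φ-cong : ∀ {a b} → a 𝕂.≈ b → φ a ≡ φ b
    φ-cong (eq p _ _) = W._≋_.at (δ-cong p) (3 ℕ.* m) 3m<D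

    φ-+ : ∀ a b → φ (a 𝕂.+ b) ≡ φ a ℤ.+ φ b
    φ-+ ⟨ _ , _ , _ ⟩ ⟨ _ , _ , _ ⟩ = ≡.refl

    φ-sum : ∀ {I : Set} (xs : List I) f → φ (SK.sumOver xs f) ≡ Sℤ.sumOver xs (λ i → φ (f i))
    φ-sum [] f = ≡.refl
    φ-sum (x ∷ xs) f = ≡.trans (φ-+ (f x) (SK.sumOver xs f)) (≡.cong (λ s → φ (f x) ℤ.+ s) (φ-sum xs f))

    x y p : K
    x = T₃.uK
    y = T₃.vK
    p = x 𝕂.* y

    p^ : ∀ n → p PK.^ n 𝕂.≈ ι ((u 𝕃.* v) PL.^ (3 ℕ.* n))
    p^ n = 𝕂.trans (PK.^-congˡ n (𝕂.trans T₃.uK*vK (ι-cong (DL.x₃y₃ uv-nilpotent))))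
      (𝕂.trans (𝕂.sym (ι-^ ((u 𝕃.* v) PL.^ 3) n)) (ι-cong (PL.^-assocʳ (u 𝕃.* v) 3 n)))

    δ-power : ∀ n h → δ ((u 𝕃.* v) PL.^ n 𝕃.* h) 𝕎.≈ W.X PW.^ n 𝕎.* δ h
    δ-power n h = 𝕎.trans (X₁.linear-^ X₁.linear-uv n h) (𝕎.*-congʳ {x = δ h}
      (𝕎.trans (PW.^-assocʳ W.X 1 n) (𝕎.reflexive (≡.cong (W.X PW.^_) (ℕₚ.+-identityʳ n)))))

    δ-p^ : ∀ n → φ (p PK.^ n) ≡ (W.X PW.^ (3 ℕ.* n)) (3 ℕ.* m)
    δ-p^ n = ≡.trans (φ-cong (p^ n)) (W._≋_.at {f = δ ((u 𝕃.* v) PL.^ (3 ℕ.* n))} {g = W.X PW.^ (3 ℕ.* n)}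
      (𝕎.trans (δ-cong (𝕃.sym (𝕃.*-identityʳ ((u 𝕃.* v) PL.^ (3 ℕ.* n))))) (𝕎.trans (δ-power (3 ℕ.* n) 𝕃.1#)
        (𝕎.trans (𝕎.*-congˡ {x = W.X PW.^ (3 ℕ.* n)} δ-1) (𝕎.*-identityʳ (W.X PW.^ (3 ℕ.* n)))))) (3 ℕ.* m) 3m<D)

    φ-p^-1 : ∀ n → n ≡ m → φ (p PK.^ n) ≡ + 1
    φ-p^-1 n ≡.refl = ≡.trans (δ-p^ n) (W.X^-diagonal (3 ℕ.* n))

    φ-p^-0 : ∀ n → ¬ n ≡ m → φ (p PK.^ n) ≡ + 0
    φ-p^-0 n n≢m = ≡.trans (δ-p^ n) (go (ℕₚ.<-cmp n m))
      where
      go : Tri (n ℕ.< m) (n ≡ m) (m ℕ.< n) → (W.X PW.^ (3 ℕ.* n)) (3 ℕ.* m) ≡ + 0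
      go (tri< n<m _ _) = W.X^-above (3 ℕ.* n) (3 ℕ.* m) (ℕₚ.*-monoʳ-< 3 n<m)
      go (tri≈ _ n≡m _) = ⊥-elim (n≢m n≡m)
      go (tri> _ _ m<n) = W.X^-below (3 ℕ.* n) (3 ℕ.* m) (ℕₚ.*-monoʳ-< 3 m<n)

    φ-multiple : ∀ h → φ (p PK.^ suc m 𝕂.* h) ≡ + 0
    φ-multiple h = ≡.trans (φ-cong (𝕂.trans (𝕂.*-congʳ {x = h} (p^ (suc m))) (ι-scale ((u 𝕃.* v) PL.^ (3 ℕ.* suc m)) h)))
      (≡.trans (W._≋_.at (δ-power (3 ℕ.* suc m) (c₀ h)) (3 ℕ.* m) 3m<D)
        (W.X^-mul-below (3 ℕ.* suc m) (δ (c₀ h)) (3 ℕ.* m) (ℕₚ.*-monoʳ-< 3 (ℕₚ.n<1+n m))))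

    record Null (k : K) : Set where
      constructor null
      field
        null₀ : δ (c₀ k) 𝕎.≈ 𝕎.0#
        null₁ : δ (c₁ k) 𝕎.≈ 𝕎.0#
        null₂ : δ (c₂ k) 𝕎.≈ 𝕎.0#

    null-cong : ∀ {a b} → a 𝕂.≈ b → Null a → Null b
    null-cong (eq p q r) (null i j k) = null (𝕎.trans (δ-cong (𝕃.sym p)) i) (𝕎.trans (δ-cong (𝕃.sym q)) j) (𝕎.trans (δ-cong (𝕃.sym r)) k)

    null-ζ : ∀ n k → Null k → Null (ζ PK.^ n 𝕂.* k)
    null-ζ zero k z = null-cong (𝕂.sym (𝕂.*-identityˡ k)) z
    null-ζ (suc n) k z = null-cong (𝕂.sym (𝕂.trans (𝕂.*-assoc ζ (ζ PK.^ n) k) (ζ-shift (ζ PK.^ n 𝕂.* k)))) (rotate (null-ζ n k z))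
      where
      rotate : ∀ {k} → Null k → Null ⟨ c₂ k , c₀ k , c₁ k ⟩
      rotate (null i j l) = null l i j

    off-diagonal : ∀ r s c → ¬ r ≡ s → δ (DL.x₃ PL.^ r 𝕃.* DL.y₃ PL.^ s 𝕃.* (u 𝕃.* v) PL.^ c) 𝕎.≈ 𝕎.0#
    off-diagonal r s c r≢s = 𝕎.trans (δ-cong (𝕃.trans (𝕃.*-congʳ {x = (u 𝕃.* v) PL.^ c} (𝕃.trans
        (𝕃.*-cong (IL.xy-^ u v 2 1 r) (IL.xy-^ u v 1 2 s)) (IL.xy-* u v (r ℕ.* 2) (r ℕ.* 1) (s ℕ.* 1) (s ℕ.* 2))))
        (IL.xy-p u v (r ℕ.* 2 ℕ.+ s ℕ.* 1) (r ℕ.* 1 ℕ.+ s ℕ.* 2) c)))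
      (δ-monomial _ _ (λ e → r≢s (ℕₚ.+-cancelˡ-≡ (r ℕ.+ s) r s
        (≡.trans (NatSolver.solve 2 (λ r s → r :+ s :+ r := r :* con 2 :+ s :* con 1) ≡.refl r s)
          (≡.trans (ℕₚ.+-cancelʳ-≡ c _ _ e) (NatSolver.solve 2 (λ r s → r :* con 1 :+ s :* con 2 := r :+ s :+ s) ≡.refl r s))))))
      where open NatSolver using (_:=_; con; _:+_; _:*_)

    φ-unequal : ∀ r s c → ¬ r ≡ s → φ (x PK.^ r 𝕂.* y PK.^ s 𝕂.* p PK.^ c) ≡ + 0
    φ-unequal r s c r≢s = W._≋_.at (Null.null₀ (null-cong (𝕂.sym monomial) (null-ζ (r ℕ.+ 2 ℕ.* s) (ι f) (null (off-diagonal r s (3 ℕ.* c) r≢s) 𝕎.refl 𝕎.refl))))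
      (3 ℕ.* m) 3m<D
      where
      f : L.PS
      f = DL.x₃ PL.^ r 𝕃.* DL.y₃ PL.^ s 𝕃.* (u 𝕃.* v) PL.^ (3 ℕ.* c)
      z : K
      z = ζ PK.^ (r ℕ.+ 2 ℕ.* s)
      monomial : x PK.^ r 𝕂.* y PK.^ s 𝕂.* p PK.^ c 𝕂.≈ z 𝕂.* ι f
      monomial = 𝕂.trans (𝕂.*-cong
          (𝕂.trans (CR.twist (ι DL.x₃) (ι DL.y₃) r s (r ℕ.+ 2 ℕ.* s) 0 (ℕₚ.+-identityʳ _))
            (𝕂.*-congˡ {x = z} (𝕂.trans (𝕂.*-cong (𝕂.sym (ι-^ DL.x₃ r)) (𝕂.sym (ι-^ DL.y₃ s))) (𝕂.sym (ι-* (DL.x₃ PL.^ r) (DL.y₃ PL.^ s))))))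
          (p^ c))
        (𝕂.trans (𝕂.*-assoc z (ι (DL.x₃ PL.^ r 𝕃.* DL.y₃ PL.^ s)) (ι ((u 𝕃.* v) PL.^ (3 ℕ.* c))))
          (𝕂.*-congˡ {x = z} (𝕂.sym (ι-* (DL.x₃ PL.^ r 𝕃.* DL.y₃ PL.^ s) ((u 𝕃.* v) PL.^ (3 ℕ.* c))))))

    term-form : ∀ r a s b → x PK.^ r 𝕂.* p PK.^ a 𝕂.* (y PK.^ s 𝕂.* p PK.^ b) 𝕂.≈ x PK.^ r 𝕂.* y PK.^ s 𝕂.* p PK.^ (a ℕ.+ b)
    term-form r a s b = 𝕂.trans (interchange groupRing (x PK.^ r) (p PK.^ a) (y PK.^ s) (p PK.^ b))
      (𝕂.*-congˡ {x = x PK.^ r 𝕂.* y PK.^ s} (𝕂.sym (PK.^-homo-* p a b)))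

    balanced : ∀ r a b → x PK.^ r 𝕂.* y PK.^ r 𝕂.* p PK.^ (a ℕ.+ b) 𝕂.≈ p PK.^ (r ℕ.+ (a ℕ.+ b))
    balanced r a b = 𝕂.trans (𝕂.*-congʳ {x = p PK.^ (a ℕ.+ b)} (𝕂.sym (PK.^-distrib-* x y r))) (𝕂.sym (PK.^-homo-* p r (a ℕ.+ b)))

    counted : ∀ r a s b → r ≡ s → m ≡ r ℕ.+ (a ℕ.+ b) → φ (x PK.^ r 𝕂.* p PK.^ a 𝕂.* (y PK.^ s 𝕂.* p PK.^ b)) ≡ + 1
    counted r a .r b ≡.refl e = ≡.trans (φ-cong (𝕂.trans (term-form r a r b) (balanced r a b))) (φ-p^-1 _ (≡.sym e))

    uncounted : ∀ r a s b → ¬ (r ≡ s × m ≡ r ℕ.+ (a ℕ.+ b)) → φ (x PK.^ r 𝕂.* p PK.^ a 𝕂.* (y PK.^ s 𝕂.* p PK.^ b)) ≡ + 0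
    uncounted r a s b ne = go (r ℕ.≟ s)
      where
      go : Dec (r ≡ s) → φ (x PK.^ r 𝕂.* p PK.^ a 𝕂.* (y PK.^ s 𝕂.* p PK.^ b)) ≡ + 0
      go (no r≢s) = ≡.trans (φ-cong (term-form r a s b)) (φ-unequal r s (a ℕ.+ b) r≢s)
      go (yes ≡.refl) = ≡.trans (φ-cong (𝕂.trans (term-form r a r b) (balanced r a b))) (φ-p^-0 _ (λ e → ne (≡.refl , ≡.sym e)))

    m<D : suc m ℕ.≤ D
    m<D = ℕₚ.≤-trans (s≤s (ℕₚ.m≤n*m m 3)) 3m<D

  frobenius-coefficient : Ψ (3 ℕ.* m) ≡ + cφ 9 m
  frobenius-coefficient = extract (RK.congruent-nine (RK.congruent-* (RK.half-congruent x p m<D) (RK.half-congruent y p m<D)))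
    where
    open ≡.≡-Reasoning
    extract : RK.Congruent (p PK.^ suc m) (NK.nine DL.J) (NK.nine (TK.halfˣ x y (suc m) 𝕂.* TK.halfʸ x y (suc m))) → Ψ (3 ℕ.* m) ≡ + cφ 9 m
    extract (h , e) = begin
      φ (NK.nine DL.J)
        ≡⟨ φ-cong e ⟩
      φ (NK.nine (TK.halfˣ x y (suc m) 𝕂.* TK.halfʸ x y (suc m)) 𝕂.+ p PK.^ suc m 𝕂.* h)
        ≡⟨ φ-+ (NK.nine (TK.halfˣ x y (suc m) 𝕂.* TK.halfʸ x y (suc m))) (p PK.^ suc m 𝕂.* h) ⟩
      φ (NK.nine (TK.halfˣ x y (suc m) 𝕂.* TK.halfʸ x y (suc m))) ℤ.+ φ (p PK.^ suc m 𝕂.* h)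
        ≡⟨ ≡.cong₂ ℤ._+_ (φ-cong (𝕂.sym (RK.sum-pairs m x y))) (φ-multiple h) ⟩
      φ (SK.sumOver (candidatePairs 9 m) (RK.pairTerm x y)) ℤ.+ + 0
        ≡⟨ ℤₚ.+-identityʳ _ ⟩
      φ (SK.sumOver (candidatePairs 9 m) (RK.pairTerm x y))
        ≡⟨ φ-sum (candidatePairs 9 m) (RK.pairTerm x y) ⟩
      Sℤ.sumOver (candidatePairs 9 m) (λ i → φ (RK.pairTerm x y i))
        ≡⟨ length-filter-sum (isCGFP? 9 m) (candidatePairs 9 m) (λ i → φ (RK.pairTerm x y i))
             (λ { (as , bs) _ (_ , _ , r≡s , m≡) → counted (length as) (weight as) (length bs) (weight bs) r≡s m≡ })
             (λ { (as , bs) p∈ ¬cgfp → uncounted (length as) (weight as) (length bs) (weight bs) (λ (r≡s , m≡) → ¬cgfp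
               ( candidates-decreasing 9 m (proj₁ (candidatePairs-rows 9 m p∈))
               , candidates-decreasing 9 m (proj₂ (candidatePairs-rows 9 m p∈)) , r≡s , m≡)) }) ⟩
      + cφ 9 m ∎

-- Identities between power series in q

record Hom (R S : Ring₀) : Set where
  private
    module R = CommutativeRing R
    module S = CommutativeRing S
  field
    ⟦_⟧   : R.Carrier → S.Carrier
    cong  : ∀ {a b} → a R.≈ b → ⟦ a ⟧ S.≈ ⟦ b ⟧
    +-hom : ∀ a b → ⟦ a R.+ b ⟧ S.≈ ⟦ a ⟧ S.+ ⟦ b ⟧
    *-hom : ∀ a b → ⟦ a R.* b ⟧ S.≈ ⟦ a ⟧ S.* ⟦ b ⟧
    neg-hom : ∀ a → ⟦ R.- a ⟧ S.≈ S.- ⟦ a ⟧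
    0-hom : ⟦ R.0# ⟧ S.≈ S.0#
    1-hom : ⟦ R.1# ⟧ S.≈ S.1#

module HomProperties {R S : Ring₀} (h : Hom R S) where
  private
    module R = CommutativeRing R
    module S = CommutativeRing S
    module PR = Products R
    module PS = Products S
    module NR = NinthPower R
    module NS = NinthPower S
    module FR = FrobeniusRelation R
    module FS = FrobeniusRelation S
    module IR = Integers R
    module IS = Integers S
  open Hom h

  ^-hom : ∀ a n → ⟦ a PR.^ n ⟧ S.≈ ⟦ a ⟧ PS.^ n
  ^-hom a zero = 1-hom
  ^-hom a (suc n) = S.trans (*-hom a (a PR.^ n)) (S.*-congˡ (^-hom a n))

  prod-hom : ∀ n f → ⟦ PR.prod n f ⟧ S.≈ PS.prod n (λ i → ⟦ f i ⟧)
  prod-hom zero f = 1-hom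
  prod-hom (suc n) f = S.trans (*-hom _ _) (S.*-congʳ (prod-hom n f))

  euler-hom : ∀ n a → ⟦ PR.euler n a ⟧ S.≈ PS.euler n ⟦ a ⟧
  euler-hom n a = S.trans (prod-hom n _) (PS.prod-cong n (λ i → S.trans (+-hom _ _)
    (S.+-cong 1-hom (S.trans (neg-hom _) (S.-‿cong (^-hom a (suc i)))))))

  cube-hom : ∀ a → ⟦ NR.cube a ⟧ S.≈ NS.cube ⟦ a ⟧
  cube-hom a = S.trans (*-hom _ _) (S.*-congˡ (*-hom _ _))

  fromℕ-hom : ∀ n → ⟦ IR.fromℕ n ⟧ S.≈ IS.fromℕ n
  fromℕ-hom 0 = 0-hom
  fromℕ-hom 1 = 1-hom
  fromℕ-hom (suc (suc n)) = S.trans (+-hom _ _) (S.+-cong 1-hom (fromℕ-hom (suc n)))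

  quadratic-hom : ∀ t x → ⟦ FR.quadratic t x ⟧ S.≈ FS.quadratic ⟦ t ⟧ ⟦ x ⟧
  quadratic-hom t x = S.trans (+-hom _ _) (S.+-cong
    (S.trans (+-hom _ _) (S.+-cong (*-hom t t) (S.trans (*-hom _ _) (S.*-congʳ (S.trans (*-hom _ _) (S.*-congʳ (fromℕ-hom 9)))))))
    (S.trans (*-hom _ _) (S.*-cong (fromℕ-hom 27) (*-hom x x))))

  linear-hom : ∀ n t x → ⟦ t R.+ IR.fromℕ n R.* x ⟧ S.≈ ⟦ t ⟧ S.+ IS.fromℕ n S.* ⟦ x ⟧
  linear-hom n t x = S.trans (+-hom _ _) (S.+-congˡ (S.trans (*-hom _ _) (S.*-congʳ (fromℕ-hom n))))

  quartic-hom : ∀ t x → ⟦ FR.quartic t x ⟧ S.≈ FS.quartic ⟦ t ⟧ ⟦ x ⟧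
  quartic-hom t x = S.trans (+-hom _ _) (S.+-cong
    (S.trans (*-hom _ _) (S.*-cong (S.trans (cube-hom _) (NS.cube-cong (linear-hom 9 t x))) (linear-hom 3 t x)))
    (S.trans (*-hom _ _) (S.*-cong (S.trans (*-hom _ _) (S.*-cong (fromℕ-hom 54)
      (S.trans (*-hom _ _) (S.*-congˡ (quadratic-hom t x))))) (linear-hom 12 t x))))

-- The substitution Δ : q ↦ q³ and the extraction U r of the coefficients with index congruent to r modulo 3.
module Dissection (R : Ring₀) where
  open PowerSeries R (λ _ → ⊤) (λ _ _ → tt)
  private module R = CommutativeRing R
  open R using () renaming (_+_ to _⊕_; _*_ to _⊛_; _≈_ to _∼_)
  open Solver R
  open CommutativeRing psRing using (_≈_; _*_)
  open Products psRing using (_^_)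

  Δ : PS → PS
  Δ f 0 = f 0
  Δ f 1 = R.0#
  Δ f 2 = R.0#
  Δ f (suc (suc (suc n))) = Δ (tail f) n

  U : ℕ → PS → PS
  U r f n = f (n ℕ.* 3 ℕ.+ r)

  Δ-local : ∀ n {f g} → (∀ i → i ℕ.≤ n → f i ∼ g i) → Δ f n ∼ Δ g n
  Δ-local 0 p = p 0 z≤n
  Δ-local 1 p = R.refl
  Δ-local 2 p = R.refl
  Δ-local (suc (suc (suc n))) p = Δ-local n (λ i i≤n → p (suc i) (s≤s (ℕₚ.m≤n⇒m≤1+n (ℕₚ.m≤n⇒m≤1+n i≤n))))

  Δ-add : ∀ f g n → Δ (add f g) n ∼ Δ f n ⊕ Δ g n
  Δ-add f g 0 = R.refl
  Δ-add f g 1 = R.sym (R.+-identityˡ R.0#)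
  Δ-add f g 2 = R.sym (R.+-identityˡ R.0#)
  Δ-add f g (suc (suc (suc n))) = Δ-add (tail f) (tail g) n

  Δ-scale : ∀ c f n → Δ (λ i → c ⊛ f i) n ∼ c ⊛ Δ f n
  Δ-scale c f 0 = R.refl
  Δ-scale c f 1 = R.sym (R.zeroʳ c)
  Δ-scale c f 2 = R.sym (R.zeroʳ c)
  Δ-scale c f (suc (suc (suc n))) = Δ-scale c (tail f) n

  Δ-zero : ∀ n → Δ zeroS n ∼ R.0#
  Δ-zero 0 = R.refl
  Δ-zero 1 = R.refl
  Δ-zero 2 = R.refl
  Δ-zero (suc (suc (suc n))) = Δ-zero n

  Δ-neg : ∀ f n → Δ (neg f) n ∼ R.- Δ f n
  Δ-neg f 0 = R.refl
  Δ-neg f 1 = R.sym -0#≈0#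
    where open import Algebra.Properties.Ring R.ring using (-0#≈0#)
  Δ-neg f 2 = R.sym -0#≈0#
    where open import Algebra.Properties.Ring R.ring using (-0#≈0#)
  Δ-neg f (suc (suc (suc n))) = Δ-neg (tail f) n

  mul-Δ-step : ∀ f g k → mul (Δ f) g (suc (suc (suc k))) ∼ f 0 ⊛ g (suc (suc (suc k))) ⊕ mul (Δ (tail f)) g k
  mul-Δ-step f g k = solve 5 (λ a b c d e → a :* b :+ (con (+ 0) :* c :+ (con (+ 0) :* d :+ e)) := a :* b :+ e) R.refl
    (f 0) (g (suc (suc (suc k)))) (g (suc (suc k))) (g (suc k)) (mul (Δ (tail f)) g k)

  Δ-mul : ∀ f g n → Δ (mul f g) n ∼ mul (Δ f) (Δ g) n
  Δ-mul f g 0 = R.refl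
  Δ-mul f g 1 = solve 2 (λ a b → con (+ 0) := a :* con (+ 0) :+ con (+ 0) :* b) R.refl (f 0) (g 0)
  Δ-mul f g 2 = solve 2 (λ a b → con (+ 0) := a :* con (+ 0) :+ (con (+ 0) :* con (+ 0) :+ con (+ 0) :* b)) R.refl (f 0) (g 0)
  Δ-mul f g (suc (suc (suc n))) = R.trans (Δ-add (λ i → f 0 ⊛ tail g i) (mul (tail f) g) n)
    (R.trans (R.+-cong (Δ-scale (f 0) (tail g) n) (Δ-mul (tail f) g n)) (R.sym (mul-Δ-step f (Δ g) n)))

  Δ-hom : Hom psRing psRing
  Δ-hom = record
    { ⟦_⟧ = Δ
    ; cong = λ p → mk λ n _ → Δ-local n (λ i _ → at p i tt)
    ; +-hom = λ f g → mk λ n _ → Δ-add f g n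
    ; *-hom = λ f g → mk λ n _ → Δ-mul f g n
    ; neg-hom = λ f → mk λ n _ → Δ-neg f n
    ; 0-hom = mk λ n _ → Δ-zero n
    ; 1-hom = mk λ { 0 _ → R.refl ; 1 _ → R.refl ; 2 _ → R.refl ; (suc (suc (suc n))) _ → Δ-zero n } }

  Δ-X : Δ X ≈ X ^ 3
  Δ-X = mk λ { 0 _ → R.sym (mul-X-zero (X ^ 2))
             ; 1 _ → R.sym (R.trans (mul-Xˡ (X ^ 2) 0) (mul-X-zero (X ^ 1)))
             ; 2 _ → R.sym (R.trans (mul-Xˡ (X ^ 2) 1) (R.trans (mul-Xˡ (X ^ 1) 0) (mul-X-zero oneS)))
             ; (suc (suc (suc n))) _ → R.trans (Δ-one n) (R.sym (R.trans (mul-Xˡ (X ^ 2) (suc (suc n)))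
                 (R.trans (mul-Xˡ (X ^ 1) (suc n)) (mul-Xˡ oneS n)))) }
    where
    Δ-one : ∀ n → Δ oneS n ∼ oneS n
    Δ-one n = at (Hom.1-hom Δ-hom) n tt

  Δ-multiple : ∀ f n → Δ f (n ℕ.* 3 ℕ.+ 0) ∼ f n
  Δ-multiple f zero = R.refl
  Δ-multiple f (suc n) = Δ-multiple (tail f) n

  U-Δ : ∀ r → r ℕ.< 3 → ∀ f g n → mul (Δ f) g (n ℕ.* 3 ℕ.+ r) ∼ mul f (U r g) n
  U-Δ 0 _ f g zero = R.refl
  U-Δ 1 _ f g zero = solve 3 (λ a b c → a :* b :+ con (+ 0) :* c := a :* b) R.refl (f 0) (g 1) (g 0)
  U-Δ 2 _ f g zero = solve 4 (λ a b c d → a :* b :+ (con (+ 0) :* c :+ con (+ 0) :* d) := a :* b) R.refl (f 0) (g 2) (g 1) (g 0)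
  U-Δ (suc (suc (suc r))) (s≤s (s≤s (s≤s ())))
  U-Δ r r<3 f g (suc n) = R.trans (mul-Δ-step f g (n ℕ.* 3 ℕ.+ r)) (R.+-congˡ (U-Δ r r<3 (tail f) g n))

module FullRelations where
  open Dissection ℤ-ring
  open ℤ⟦X⟧ using (PS; mul; X; mk; at)
  F : Ring₀
  F = ℤ⟦X⟧.psRing
  open CommutativeRing F
  open Products F
  open NinthPower F
  open Integers F
  open FrobeniusRelation F

  truncate : ∀ D → Hom F (Truncated.psRing ℤ-ring D)
  truncate D = record
    { ⟦_⟧ = λ f → f
    ; cong = λ p → W.mk λ n _ → at p n tt
    ; +-hom = λ f g → W.mk λ n _ → ≡.refl
    ; *-hom = λ f g → W.mk λ n _ → same n f g
    ; neg-hom = λ f → W.mk λ n _ → ≡.refl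
    ; 0-hom = W.mk λ n _ → ≡.refl
    ; 1-hom = W.mk λ { zero _ → ≡.refl ; (suc n) _ → ≡.refl } }
    where
    module W = Truncated ℤ-ring D
    same : ∀ n f g → mul f g n ≡ W.mul f g n
    same zero f g = ≡.refl
    same (suc n) f g = ≡.cong (λ k → f 0 ℤ.* g (suc n) ℤ.+ k) (same n (ℤ⟦X⟧.tail f) g)

  -- The infinite product (q; q)_∞: its coefficient of q^n is that of (q; q)_{n + 1}.
  ε : PS
  ε n = euler (suc n) X n

  ε₃ ε₉ ε₂₇ : PS
  ε₃ = Δ ε
  ε₉ = Δ ε₃
  ε₂₇ = Δ ε₉

  cφ-series : PS
  cφ-series n = + cφ 9 n

  module _ (D : ℕ) where
    private
      module W = Truncated ℤ-ring D
      module 𝕎 = CommutativeRing W.psRing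
      module PW = Products W.psRing
      open Hom (truncate D) using (⟦_⟧)
      open HomProperties (truncate D)

    truncate-X : ∀ k → ⟦ X ^ k ⟧ 𝕎.≈ W.X PW.^ k
    truncate-X k = 𝕎.trans (^-hom X k) (PW.^-congˡ k (W.mk λ { zero _ → ≡.refl ; (suc zero) _ → ≡.refl ; (suc (suc n)) _ → ≡.refl }))

  ε-euler : ∀ D n → n ℕ.< D → ε n ≡ euler D X n
  ε-euler D n n<D = ≡.trans (W.at (HomProperties.euler-hom (truncate (suc n)) (suc n) X) n ℕₚ.≤-refl)
    (≡.trans (≡.sym (W.at stable n ℕₚ.≤-refl)) (≡.sym (W.at (HomProperties.euler-hom (truncate (suc n)) D X) n ℕₚ.≤-refl)))
    where
    module W = Truncated ℤ-ring (suc n)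
    module 𝕎 = CommutativeRing W.psRing
    module PW = Products W.psRing
    nilpotent : X PW.^ suc n 𝕎.≈ 𝕎.0#
    nilpotent = 𝕎.trans (PW.^-congˡ (suc n) {X} {W.X} (𝕎.trans (𝕎.sym (𝕎.*-identityʳ X))
      (𝕎.trans (𝕎.sym (HomProperties.^-hom (truncate (suc n)) X 1)) (𝕎.trans (truncate-X (suc n) 1) (𝕎.*-identityʳ W.X))))) W.X-nilpotent
    stable : PW.euler D X 𝕎.≈ PW.euler (suc n) X
    stable = PW.euler-stable {suc n} {D} {X} nilpotent n<D

  Approximates : ℕ → PS → Set
  Approximates k f = ∀ D n → n ℕ.< D → f n ≡ euler D (X ^ k) n

  approximates-Δ : ∀ k {f} → Approximates k f → Approximates (3 ℕ.* k) (Δ f)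
  approximates-Δ k {f} p D n n<D = ≡.trans (Δ-local n (λ i i≤n → p D i (ℕₚ.≤-<-trans i≤n n<D)))
    (at (trans (HomProperties.euler-hom Δ-hom D (X ^ k)) (euler-cong D
      (trans (HomProperties.^-hom Δ-hom X k) (trans (^-congˡ k Δ-X) (^-assocʳ X 3 k))))) n tt)

  approximates-ε : Approximates 1 ε
  approximates-ε D n n<D = ≡.trans (ε-euler D n n<D) (at (euler-cong D (sym (*-identityʳ X))) n tt)

  approximates-ε₃ : Approximates 3 ε₃
  approximates-ε₃ = approximates-Δ 1 approximates-ε

  approximates-ε₉ : Approximates 9 ε₉
  approximates-ε₉ = approximates-Δ 3 approximates-ε₃

  approximates-ε₂₇ : Approximates 27 ε₂₇
  approximates-ε₂₇ = approximates-Δ 9 approximates-ε₉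

  private
    module InTruncation (D : ℕ) where
      module W = Truncated ℤ-ring D
      module 𝕎 = CommutativeRing W.psRing
      module PW = Products W.psRing
      module NW = NinthPower W.psRing
      module IW = Integers W.psRing
      module FW = FrobeniusRelation W.psRing
      module TR = TruncatedRelations D
      open HomProperties (truncate D) public
      open Hom (truncate D) public

      in-W : ∀ k {f} → Approximates k f → f 𝕎.≈ TR.E k
      in-W k {f} p = 𝕎.trans {f} {euler D (X ^ k)} (W.mk λ n n<D → p D n n<D)
        (𝕎.trans (euler-hom D (X ^ k)) (PW.euler-cong D (truncate-X D k)))

      cube-W : ∀ {f g} → f 𝕎.≈ g → cube f 𝕎.≈ NW.cube g
      cube-W {f} p = 𝕎.trans (cube-hom f) (NW.cube-cong p)

      term-W : ∀ k {f g} → f 𝕎.≈ g → (X ^ k * cube f) 𝕎.≈ W.X PW.^ k 𝕎.* NW.cube g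
      term-W k {f} p = 𝕎.trans (*-hom (X ^ k) (cube f)) (𝕎.*-cong (truncate-X D k) (cube-W p))

      linear-W : ∀ n k {f f′ g g′} → f 𝕎.≈ f′ → g 𝕎.≈ g′ →
                 (cube f + fromℕ n * (X ^ k * cube g)) 𝕎.≈ NW.cube f′ 𝕎.+ IW.fromℕ n 𝕎.* (W.X PW.^ k 𝕎.* NW.cube g′)
      linear-W n k {f} {g = g} p r = 𝕎.trans (linear-hom n (cube f) (X ^ k * cube g))
        (𝕎.+-cong (cube-W p) (𝕎.*-congˡ {x = IW.fromℕ n} (term-W k r)))

      ^-W : ∀ n {f g} → f 𝕎.≈ g → (f ^ n) 𝕎.≈ g PW.^ n
      ^-W n {f} p = 𝕎.trans (^-hom f n) (PW.^-congˡ n p)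

    full : ∀ {f g} → (∀ D → CommutativeRing._≈_ (Truncated.psRing ℤ-ring D) f g) → f ≈ g
    full p = mk λ n _ → PowerSeries._≋_.at (p (suc n)) n ℕₚ.≤-refl

  full-relation₁ : ε₉ * (cube ε + fromℕ 3 * (X ^ 1 * cube ε₉)) ≈ ε₃ * (cube ε₃ + fromℕ 9 * (X ^ 3 * cube ε₂₇))
  full-relation₁ = full λ D → let open InTruncation D in
    𝕎.trans (𝕎.trans (*-hom ε₉ _) (𝕎.*-cong (in-W 9 approximates-ε₉) (linear-W 3 1 (in-W 1 approximates-ε) (in-W 9 approximates-ε₉))))
      (𝕎.trans TR.relation₁ (𝕎.sym (𝕎.trans (*-hom ε₃ _)
        (𝕎.*-cong (in-W 3 approximates-ε₃) (linear-W 9 3 (in-W 3 approximates-ε₃) (in-W 27 approximates-ε₂₇))))))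

  full-relation₂ : ε₃ ^ 12 ≈ cube ε₉ * (cube ε * quadratic (cube ε) (X ^ 1 * cube ε₉))
  full-relation₂ = full λ D → let open InTruncation D in
    𝕎.trans (^-W 12 (in-W 3 approximates-ε₃)) (𝕎.trans TR.relation₂ (𝕎.sym (𝕎.trans (*-hom (cube ε₉) _)
      (𝕎.*-cong (cube-W (in-W 9 approximates-ε₉)) (𝕎.trans (*-hom (cube ε) _) (𝕎.*-cong (cube-W (in-W 1 approximates-ε))
        (𝕎.trans (quadratic-hom (cube ε) (X ^ 1 * cube ε₉))
          (FW.quadratic-cong (cube-W (in-W 1 approximates-ε)) (term-W 1 (in-W 9 approximates-ε₉))))))))))

  FrobeniusRelationFor : PS → Set
  FrobeniusRelationFor C = ε₃ ^ 4 * cube (cube ε) * C ≈ quartic (cube ε) (X ^ 1 * cube ε₉)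

  full-relation₃ : FrobeniusRelationFor cφ-series
  full-relation₃ = mk λ n _ → coefficient n
    where
    K Q₄ : PS
    K = ε₃ ^ 4 * cube (cube ε)
    Q₄ = quartic (cube ε) (X ^ 1 * cube ε₉)
    module H = HomProperties Δ-hom
    open Hom Δ-hom using () renaming (*-hom to Δ-*)

    ΔK : Δ K ≈ ε₉ ^ 4 * cube (cube ε₃)
    ΔK = trans (Δ-* (ε₃ ^ 4) (cube (cube ε))) (*-cong (H.^-hom ε₃ 4) (trans (H.cube-hom (cube ε)) (cube-cong (H.cube-hom ε))))

    ΔQ₄ : Δ Q₄ ≈ quartic (cube ε₃) (X ^ 3 * cube ε₂₇)
    ΔQ₄ = trans (H.quartic-hom (cube ε) (X ^ 1 * cube ε₉)) (quartic-cong (H.cube-hom ε)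
      (trans (Δ-* (X ^ 1) (cube ε₉)) (*-cong (trans (H.^-hom X 1) (trans (*-identityʳ (Δ X)) Δ-X)) (H.cube-hom ε₉))))

    dilated : ∀ D → let open InTruncation D in (ε₉ ^ 4 * cube (cube ε₃) * TR.Ψ) 𝕎.≈ quartic (cube ε₃) (X ^ 3 * cube ε₂₇)
    dilated D = 𝕎.trans (*-hom (ε₉ ^ 4 * cube (cube ε₃)) TR.Ψ) (𝕎.trans (𝕎.*-congʳ {x = TR.Ψ} (𝕎.trans (*-hom (ε₉ ^ 4) (cube (cube ε₃)))
        (𝕎.*-cong (^-W 4 (in-W 9 approximates-ε₉)) (cube-W (cube-W (in-W 3 approximates-ε₃))))))
      (𝕎.trans (𝕎.*-assoc _ _ TR.Ψ) (𝕎.trans TR.relation₃ (𝕎.sym (𝕎.trans (quartic-hom (cube ε₃) (X ^ 3 * cube ε₂₇))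
        (FW.quartic-cong (cube-W (in-W 3 approximates-ε₃)) (term-W 3 (in-W 27 approximates-ε₂₇))))))))
      where open InTruncation D

    coefficient : ∀ n → mul K cφ-series n ≡ Q₄ n
    coefficient n = begin
      mul K cφ-series n
        ≡⟨ ℤ⟦X⟧.mul-local n {K} {K} (λ _ _ → ≡.refl) (λ i i≤n → ≡.sym (known i i≤n)) ⟩
      mul K (U 0 Ψ) n
        ≡⟨ U-Δ 0 (s≤s z≤n) K Ψ n ⟨
      mul (Δ K) Ψ (n ℕ.* 3 ℕ.+ 0)
        ≡⟨ at (*-congʳ {x = Ψ} ΔK) (n ℕ.* 3 ℕ.+ 0) tt ⟩
      mul (ε₉ ^ 4 * cube (cube ε₃)) Ψ (n ℕ.* 3 ℕ.+ 0)
        ≡⟨ PowerSeries._≋_.at (dilated D) (n ℕ.* 3 ℕ.+ 0) ℕₚ.≤-refl ⟩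
      quartic (cube ε₃) (X ^ 3 * cube ε₂₇) (n ℕ.* 3 ℕ.+ 0)
        ≡⟨ at ΔQ₄ (n ℕ.* 3 ℕ.+ 0) tt ⟨
      Δ Q₄ (n ℕ.* 3 ℕ.+ 0)
        ≡⟨ Δ-multiple Q₄ n ⟩
      Q₄ n ∎
      where
      open ≡.≡-Reasoning
      D : ℕ
      D = suc (n ℕ.* 3 ℕ.+ 0)
      Ψ : PS
      Ψ = TruncatedRelations.Ψ D
      index : ∀ i → i ℕ.* 3 ℕ.+ 0 ≡ 3 ℕ.* i
      index i = ≡.trans (ℕₚ.+-identityʳ (i ℕ.* 3)) (ℕₚ.*-comm i 3)
      known : ∀ i → i ℕ.≤ n → U 0 Ψ i ≡ cφ-series i
      known i i≤n = ≡.trans (≡.cong Ψ (index i)) (FrobeniusCoefficient.frobenius-coefficient D i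
        (s≤s (ℕₚ.≤-trans (ℕₚ.≤-reflexive (ℕₚ.*-comm 3 i)) (ℕₚ.≤-trans (ℕₚ.*-monoˡ-≤ 3 i≤n) (ℕₚ.m≤m+n (n ℕ.* 3) 0)))))

-- Dissection modulo 3

-- The hauptmodul s = q g / t on Γ₀(9), with t = E₁³, e = E₃, g = E₉³, and its dissection modulo 3.
module Hauptmodul (R : Ring₀) (X ε εi e ei g : CommutativeRing.Carrier R) where
  open CommutativeRing R
  open Solver R
  open Integers R
  open Products R
  open NinthPower R
  open FrobeniusRelation R
  open import Relation.Binary.Reasoning.Setoid setoid

  t ti x s κ w z α γ b₁ b₂ : Carrier
  t = cube ε
  ti = cube εi
  x = X ^ 1 * g
  s = x * ti
  κ = 1# + fromℤ (+ 9) * s + fromℤ (+ 27) * (s * s)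
  γ = cube e
  w = X ^ 3 * (g ^ 4 * ei ^ 12)
  z = X * (γ ^ 4 * εi ^ 12)
  α = t + fromℤ (+ 3) * x
  b₁ = g * g * ei ^ 12 * (α * α)
  b₂ = g * g * g * ei ^ 12 * α

  module _ (ε-inverse : ε * εi ≈ 1#) (e-inverse : e * ei ≈ 1#)
           (norm-relation : e ^ 12 ≈ g * (t * quadratic t x)) where
    t-inverse : t * ti ≈ 1#
    t-inverse = unit-cube R ε εi ε-inverse

    e¹²-inverse : e ^ 12 * ei ^ 12 ≈ 1#
    e¹²-inverse = trans (sym (^-distrib-* e ei 12)) (trans (^-congˡ 12 e-inverse) (one-^ 12))
      where
      one-^ : ∀ n → 1# ^ n ≈ 1#
      one-^ zero = refl
      one-^ (suc n) = trans (*-identityˡ _) (one-^ n)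

    st≈x : s * t ≈ x
    st≈x = trans (solve 3 (λ x i t → x :* i :* t := x :* (t :* i)) refl x ti t) (trans (*-congˡ t-inverse) (*-identityʳ x))

    e¹² : e ^ 12 ≈ g * (cube t * κ)
    e¹² = trans norm-relation (*-congˡ (trans (*-congˡ (quadratic-cong {t} refl (sym st≈x)))
      (solve 2 (λ t s → let x = s :* t in t :* (t :* t :+ con (+ 9) :* x :* t :+ con (+ 27) :* (x :* x)) :=
        t :* (t :* t) :* (con (+ 1) :+ con (+ 9) :* s :+ con (+ 27) :* (s :* s))) refl t s)))

    ti³ : cube ti ≈ g * ei ^ 12 * κ
    ti³ = begin
      cube ti  ≈⟨ *-identityʳ _ ⟨
      cube ti * 1#  ≈⟨ *-congˡ (trans (*-congʳ (sym e¹²)) e¹²-inverse) ⟨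
      cube ti * (g * (cube t * κ) * ei ^ 12)  ≈⟨ solve 5 (λ a t g k i → let K = λ y → y :* (y :* y) in
                                                           K a :* (g :* (K t :* k) :* i) := K (t :* a) :* (g :* i :* k)) refl ti t g κ (ei ^ 12) ⟩
      cube (t * ti) * (g * ei ^ 12 * κ)  ≈⟨ *-congʳ (cube-cong t-inverse) ⟩
      cube 1# * (g * ei ^ 12 * κ)  ≈⟨ solve 1 (λ y → con (+ 1) :* (con (+ 1) :* con (+ 1)) :* y := y) refl _ ⟩
      g * ei ^ 12 * κ  ∎

    s³ : s * (s * s) ≈ w * κ
    s³ = begin
      s * (s * s)  ≈⟨ solve 3 (λ X g i → let y = X :^ 1 :* g :* i in y :* (y :* y) := X :^ 3 :* (g :* (g :* g)) :* (i :* (i :* i))) refl X g ti ⟩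
      X ^ 3 * cube g * cube ti  ≈⟨ *-congˡ ti³ ⟩
      X ^ 3 * cube g * (g * ei ^ 12 * κ)  ≈⟨ solve 4 (λ X g i k → X :* (g :* (g :* g)) :* (g :* i :* k) := X :* (g :^ 4 :* i) :* k) refl (X ^ 3) g (ei ^ 12) κ ⟩
      w * κ  ∎

    z≈sκ : z ≈ s * κ
    z≈sκ = begin
      X * (γ ^ 4 * εi ^ 12)  ≈⟨ solve 3 (λ X e i → X :* ((e :* (e :* e)) :^ 4 :* i :^ 12) := X :* (e :^ 12 :* (i :* (i :* i)) :^ 4)) refl X e εi ⟩
      X * (e ^ 12 * ti ^ 4)  ≈⟨ *-congˡ (*-congʳ e¹²) ⟩
      X * (g * (cube t * κ) * ti ^ 4)  ≈⟨ solve 5 (λ X g t k a → X :* (g :* (t :* (t :* t) :* k) :* a :^ 4) :=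
                                                  (t :* a) :^ 3 :* (X :^ 1 :* g :* a :* k)) refl X g t κ ti ⟩
      (t * ti) ^ 3 * (s * κ)  ≈⟨ *-congʳ (^-congˡ 3 t-inverse) ⟩
      1# ^ 3 * (s * κ)  ≈⟨ solve 1 (λ y → con (+ 1) :^ 3 :* y := y) refl (s * κ) ⟩
      s * κ  ∎

    s-dissection : s ≈ fromℤ (+ 9) * w + (X * b₁ + X ^ 2 * (fromℤ (+ 3) * b₂))
    s-dissection = begin
      x * ti
        ≈⟨ *-congˡ ti≈ ⟩
      x * (g * ei ^ 12 * quadratic t x)
        ≈⟨ solve 4 (λ X g t i → let x = X :^ 1 :* g ; a = t :+ con (+ 3) :* x in
             x :* (g :* i :* (t :* t :+ con (+ 9) :* x :* t :+ con (+ 27) :* (x :* x))) :=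
             con (+ 9) :* (X :^ 3 :* (g :^ 4 :* i)) :+ (X :* (g :* g :* i :* (a :* a)) :+ X :^ 2 :* (con (+ 3) :* (g :* g :* g :* i :* a)))) refl
             X g t (ei ^ 12) ⟩
      fromℤ (+ 9) * w + (X * b₁ + X ^ 2 * (fromℤ (+ 3) * b₂)) ∎
      where
      ti≈ : ti ≈ g * ei ^ 12 * quadratic t x
      ti≈ = begin
        ti  ≈⟨ *-identityʳ ti ⟨
        ti * 1#  ≈⟨ *-congˡ (trans (*-congʳ (sym norm-relation)) e¹²-inverse) ⟨
        ti * (g * (t * quadratic t x) * ei ^ 12)  ≈⟨ solve 5 (λ a g t k i → a :* (g :* (t :* k) :* i) := t :* a :* (g :* i :* k)) refl ti g t (quadratic t x) (ei ^ 12) ⟩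
        t * ti * (g * ei ^ 12 * quadratic t x)  ≈⟨ *-congʳ t-inverse ⟩
        1# * (g * ei ^ 12 * quadratic t x)  ≈⟨ *-identityˡ _ ⟩
        g * ei ^ 12 * quadratic t x  ∎

    α³ : g * ei ^ 12 * (α * (α * α)) ≈ 1# + fromℤ (+ 27) * w
    α³ = begin
      g * ei ^ 12 * (α * (α * α))
        ≈⟨ solve 4 (λ X g t i → let x = X :^ 1 :* g ; a = t :+ con (+ 3) :* x in
             g :* i :* (a :* (a :* a)) := g :* (t :* (t :* t :+ con (+ 9) :* x :* t :+ con (+ 27) :* (x :* x))) :* i :+
               con (+ 27) :* (X :^ 3 :* (g :^ 4 :* i))) refl X g t (ei ^ 12) ⟩
      g * (t * quadratic t x) * ei ^ 12 + fromℤ (+ 27) * w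
        ≈⟨ +-congʳ (trans (*-congʳ (sym norm-relation)) e¹²-inverse) ⟩
      1# + fromℤ (+ 27) * w ∎

    s²-dissection : s * s ≈ fromℤ (+ 6) * w + fromℤ (+ 243) * (w * w) +
                    (X * (fromℤ (+ 27) * w * b₁) + X ^ 2 * ((1# + fromℤ (+ 81) * w) * b₂))
    s²-dissection = begin
      s * s
        ≈⟨ *-cong s-dissection s-dissection ⟩
      _ ≈⟨ solve 4 (λ X g i a → let w = X :^ 3 :* (g :^ 4 :* i) ; b₁ = g :* g :* i :* (a :* a) ; b₂ = g :* g :* g :* i :* a
                                    v = con (+ 9) :* w :+ (X :* b₁ :+ X :^ 2 :* (con (+ 3) :* b₂)) in
             v :* v := con (+ 81) :* (w :* w) :+ con (+ 6) :* w :* (g :* i :* (a :* (a :* a))) :+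
               (X :* (con (+ 27) :* w :* b₁) :+ X :^ 2 :* ((g :* i :* (a :* (a :* a)) :+ con (+ 54) :* w) :* b₂))) refl X g (ei ^ 12) α ⟩
      fromℤ (+ 81) * (w * w) + fromℤ (+ 6) * w * (g * ei ^ 12 * (α * (α * α))) +
        (X * (fromℤ (+ 27) * w * b₁) + X ^ 2 * ((g * ei ^ 12 * (α * (α * α)) + fromℤ (+ 54) * w) * b₂))
        ≈⟨ +-cong (+-congˡ (*-congˡ α³)) (+-congˡ (*-congˡ (*-congʳ (+-congʳ α³)))) ⟩
      _ ≈⟨ solve 4 (λ X w b₁ b₂ → con (+ 81) :* (w :* w) :+ con (+ 6) :* w :* (con (+ 1) :+ con (+ 27) :* w) :+
               (X :* (con (+ 27) :* w :* b₁) :+ X :^ 2 :* ((con (+ 1) :+ con (+ 27) :* w :+ con (+ 54) :* w) :* b₂)) :=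
             con (+ 6) :* w :+ con (+ 243) :* (w :* w) :+ (X :* (con (+ 27) :* w :* b₁) :+ X :^ 2 :* ((con (+ 1) :+ con (+ 81) :* w) :* b₂))) refl
             X w b₁ b₂ ⟩
      _ ∎

    α′ β₂ : Carrier
    α′ = ε * (t + fromℤ (+ 9) * x) * ei
    β₂ = γ * γ * γ * εi ^ 12 * α′

    private
      α′≈ : α′ ≈ ε * (t * ((1# + fromℤ (+ 9) * s) * ei))
      α′≈ = trans (*-congʳ (*-congˡ (+-congˡ (*-congˡ (sym st≈x)))))
        (solve 4 (λ ε t s i → ε :* (t :+ con (+ 9) :* (s :* t)) :* i := ε :* (t :* ((con (+ 1) :+ con (+ 9) :* s) :* i))) refl ε t s ei)

      ones : ∀ m n k y → (ε * εi) ^ m * (e * ei) ^ n * (t * ti) ^ k * y ≈ y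
      ones m n k y = trans (*-congʳ (*-cong (*-cong (power m ε-inverse) (power n e-inverse)) (power k t-inverse)))
        (solve 1 (λ y → con (+ 1) :* con (+ 1) :* con (+ 1) :* y := y) refl y)
        where
        power : ∀ n {a} → a ≈ 1# → a ^ n ≈ 1#
        power zero _ = refl
        power (suc n) p = trans (*-cong p (power n p)) (*-identityˡ 1#)

    step-0 : ∀ P → εi ^ 4 * α′ * P ≈ ei * ((1# + fromℤ (+ 9) * s) * P)
    step-0 P = begin
      εi ^ 4 * α′ * P
        ≈⟨ *-congʳ (*-congˡ α′≈) ⟩
      εi ^ 4 * (ε * (t * ((1# + fromℤ (+ 9) * s) * ei))) * P
        ≈⟨ solve 5 (λ ε i y e P → i :^ 4 :* (ε :* (ε :* (ε :* ε) :* (y :* e))) :* P := (ε :* i) :^ 4 :* (e :* (y :* P))) refl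
             ε εi (1# + fromℤ (+ 9) * s) ei P ⟩
      (ε * εi) ^ 4 * (ei * ((1# + fromℤ (+ 9) * s) * P))
        ≈⟨ solve 2 (λ a y → a :* y := a :* con (+ 1) :* con (+ 1) :* y) refl _ _ ⟩
      (ε * εi) ^ 4 * (e * ei) ^ 0 * (t * ti) ^ 0 * (ei * ((1# + fromℤ (+ 9) * s) * P))
        ≈⟨ ones 4 0 0 _ ⟩
      ei * ((1# + fromℤ (+ 9) * s) * P) ∎

    step-A : ∀ P → εi * β₂ * P ≈ ei ^ 4 * g * (κ * ((1# + fromℤ (+ 9) * s) * P))
    step-A P = begin
      εi * (γ * γ * γ * εi ^ 12 * α′) * P
        ≈⟨ *-congʳ (*-congˡ (*-congˡ α′≈)) ⟩
      εi * (γ * γ * γ * εi ^ 12 * (ε * (t * ((1# + fromℤ (+ 9) * s) * ei)))) * P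
        ≈⟨ solve 6 (λ ε i e f y P → let K = λ a → a :* (a :* a) in
             i :* (K e :* K e :* K e :* i :^ 12 :* (ε :* (K ε :* (y :* f)))) :* P :=
             (ε :* i) :^ 1 :* (e :* f) :^ 0 :* (K ε :* K i) :^ 1 :* (e :^ 9 :* f :* K (K i) :* (y :* P))) refl
             ε εi e ei (1# + fromℤ (+ 9) * s) P ⟩
      (ε * εi) ^ 1 * (e * ei) ^ 0 * (t * ti) ^ 1 * (e ^ 9 * ei * cube ti * ((1# + fromℤ (+ 9) * s) * P))
        ≈⟨ ones 1 0 1 _ ⟩
      e ^ 9 * ei * cube ti * ((1# + fromℤ (+ 9) * s) * P)
        ≈⟨ *-congʳ (*-congˡ ti³) ⟩
      e ^ 9 * ei * (g * ei ^ 12 * κ) * ((1# + fromℤ (+ 9) * s) * P)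
        ≈⟨ solve 5 (λ e f g k y → e :^ 9 :* f :* (g :* f :^ 12 :* k) :* y :=
             con (+ 1) :* (e :* f) :^ 9 :* con (+ 1) :* (f :^ 4 :* g :* (k :* y))) refl e ei g κ _ ⟩
      (ε * εi) ^ 0 * (e * ei) ^ 9 * (t * ti) ^ 0 * (ei ^ 4 * g * (κ * ((1# + fromℤ (+ 9) * s) * P)))
        ≈⟨ ones 0 9 0 _ ⟩
      ei ^ 4 * g * (κ * ((1# + fromℤ (+ 9) * s) * P)) ∎

    step-B : ∀ P → X * (εi ^ 4 * γ * β₂ * P) ≈ ei * (z * ((1# + fromℤ (+ 9) * s) * P))
    step-B P = begin
      X * (εi ^ 4 * γ * (γ * γ * γ * εi ^ 12 * α′) * P)
        ≈⟨ *-congˡ (*-congʳ (*-congˡ (*-congˡ α′≈))) ⟩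
      X * (εi ^ 4 * γ * (γ * γ * γ * εi ^ 12 * (ε * (t * ((1# + fromℤ (+ 9) * s) * ei)))) * P)
        ≈⟨ solve 7 (λ X ε i c f y P →
             X :* (i :^ 4 :* c :* (c :* c :* c :* i :^ 12 :* (ε :* (ε :* (ε :* ε) :* (y :* f)))) :* P) :=
             (ε :* i) :^ 4 :* con (+ 1) :* con (+ 1) :* (f :* (X :* (c :^ 4 :* i :^ 12) :* (y :* P)))) refl
             X ε εi γ ei (1# + fromℤ (+ 9) * s) P ⟩
      (ε * εi) ^ 4 * (e * ei) ^ 0 * (t * ti) ^ 0 * (ei * (z * ((1# + fromℤ (+ 9) * s) * P)))
        ≈⟨ ones 4 0 0 _ ⟩
      ei * (z * ((1# + fromℤ (+ 9) * s) * P)) ∎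

    frobenius-hauptmodul : ∀ {C} → e ^ 4 * cube t * C ≈ quartic t x → C ≈ ei ^ 4 * (t * quartic 1# s)
    frobenius-hauptmodul {C} p = begin
      C
        ≈⟨ ones 0 4 3 C ⟨
      (ε * εi) ^ 0 * (e * ei) ^ 4 * (t * ti) ^ 3 * C
        ≈⟨ solve 5 (λ e f t i c → con (+ 1) :* (e :* f) :^ 4 :* (t :* i) :^ 3 :* c := f :^ 4 :* i :^ 3 :* (e :^ 4 :* (t :* (t :* t)) :* c)) refl e ei t ti C ⟩
      ei ^ 4 * ti ^ 3 * (e ^ 4 * cube t * C)
        ≈⟨ *-congˡ (trans p (quartic-cong refl (sym st≈x))) ⟩
      ei ^ 4 * ti ^ 3 * quartic t (s * t)
        ≈⟨ solve 4 (λ f t i s → let K = λ a → a :* (a :* a)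
                                    q = λ t x → K (t :+ con (+ 9) :* x) :* (t :+ con (+ 3) :* x) :+
                                      con (+ 54) :* (x :* (t :* t :+ con (+ 9) :* x :* t :+ con (+ 27) :* (x :* x))) :* (t :+ con (+ 12) :* x) in
             f :^ 4 :* i :^ 3 :* q t (s :* t) := con (+ 1) :* con (+ 1) :* (t :* i) :^ 3 :* (f :^ 4 :* (t :* q (con (+ 1)) s))) refl ei t ti s ⟩
      (ε * εi) ^ 0 * (e * ei) ^ 0 * (t * ti) ^ 3 * (ei ^ 4 * (t * quartic 1# s))
        ≈⟨ ones 0 0 3 _ ⟩
      ei ^ 4 * (t * quartic 1# s) ∎

    t*-dissection : ∀ d₀ d₁ d₂ → t * (d₀ + (s * d₁ + s * s * d₂)) ≈
      α * (d₀ + fromℤ (+ 3) * w * d₂) + (X * (g * (d₁ - fromℤ (+ 3) * d₀ + fromℤ (+ 9) * w * d₂)) + X ^ 2 * (g * b₁ * d₂))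
    t*-dissection d₀ d₁ d₂ = begin
      t * (d₀ + (s * d₁ + s * s * d₂))
        ≈⟨ solve 5 (λ t s a b c → t :* (a :+ (s :* b :+ s :* s :* c)) := t :* a :+ s :* t :* (b :+ s :* c)) refl t s d₀ d₁ d₂ ⟩
      t * d₀ + s * t * (d₁ + s * d₂)
        ≈⟨ +-congˡ (*-cong st≈x (+-congˡ (*-congʳ s-dissection))) ⟩
      t * d₀ + x * (d₁ + (fromℤ (+ 9) * w + (X * b₁ + X ^ 2 * (fromℤ (+ 3) * b₂))) * d₂)
        ≈⟨ solve 7 (λ t X g i a b c → let x = X :^ 1 :* g ; α = t :+ con (+ 3) :* x ; w = X :^ 3 :* (g :^ 4 :* i)
                                          b₁ = g :* g :* i :* (α :* α) ; b₂ = g :* g :* g :* i :* α in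
             t :* a :+ x :* (b :+ (con (+ 9) :* w :+ (X :* b₁ :+ X :^ 2 :* (con (+ 3) :* b₂))) :* c) :=
             α :* (a :+ con (+ 3) :* w :* c) :+ (X :* (g :* (b :- con (+ 3) :* a :+ con (+ 9) :* w :* c)) :+ X :^ 2 :* (g :* b₁ :* c))) refl
             t X g (ei ^ 12) d₀ d₁ d₂ ⟩
      _ ∎

    reduced-dissection : ∀ d₀ d₁ d₂ → d₀ + (s * d₁ + s * s * d₂) ≈
      d₀ + fromℤ (+ 9) * (w * d₁) + (fromℤ (+ 6) * (w * d₂) + fromℤ (+ 243) * (w * (w * d₂))) +
      (X * (b₁ * (d₁ + fromℤ (+ 27) * (w * d₂))) + X ^ 2 * (b₂ * (fromℤ (+ 3) * d₁ + (d₂ + fromℤ (+ 81) * (w * d₂)))))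
    reduced-dissection d₀ d₁ d₂ = trans (+-congˡ (+-cong (*-congʳ s-dissection) (*-congʳ s²-dissection)))
      (solve 7 (λ X w b₁ b₂ a b c →
         a :+ ((con (+ 9) :* w :+ (X :* b₁ :+ X :^ 2 :* (con (+ 3) :* b₂))) :* b :+
               (con (+ 6) :* w :+ con (+ 243) :* (w :* w) :+ (X :* (con (+ 27) :* w :* b₁) :+ X :^ 2 :* ((con (+ 1) :+ con (+ 81) :* w) :* b₂))) :* c) :=
         a :+ con (+ 9) :* (w :* b) :+ (con (+ 6) :* (w :* c) :+ con (+ 243) :* (w :* (w :* c))) :+
         (X :* (b₁ :* (b :+ con (+ 27) :* (w :* c))) :+ X :^ 2 :* (b₂ :* (con (+ 3) :* b :+ (c :+ con (+ 81) :* (w :* c)))))) refl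
         X w b₁ b₂ d₀ d₁ d₂)

-- Polynomials with coefficients in ℕ modulo M, constant term first and without trailing zeros.
module Polynomials (M : ℕ) .{{_ : ℕ.NonZero M}} where
  Poly : Set
  Poly = List ℕ

  cons : ℕ → Poly → Poly
  cons zero [] = []
  cons zero (a ∷ p) = zero ∷ a ∷ p
  cons (suc c) p = suc c ∷ p

  infixl 6 _⊕_
  infixl 7 _⊛_

  _⊕_ : Poly → Poly → Poly
  [] ⊕ q = q
  (a ∷ p) ⊕ [] = a ∷ p
  (a ∷ p) ⊕ (b ∷ q) = cons ((a ℕ.+ b) DivMod.% M) (p ⊕ q)

  _⊛_ : ℕ → Poly → Poly
  c ⊛ [] = []
  c ⊛ (a ∷ p) = cons ((c ℕ.* a) DivMod.% M) (c ⊛ p)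

  shift : Poly → Poly
  shift = cons 0

  -- (d₀ , d₁ , d₂) stands for d₀(w) + d₁(w) s + d₂(w) s², where s³ = w (1 + 9 s + 27 s²).
  Reduced : Set
  Reduced = Poly × (Poly × Poly)

  infixl 6 _⊞_
  infixl 7 _⊠_

  _⊞_ : Reduced → Reduced → Reduced
  (a , (b , c)) ⊞ (a′ , (b′ , c′)) = a ⊕ a′ , (b ⊕ b′ , c ⊕ c′)

  _⊠_ : ℕ → Reduced → Reduced
  k ⊠ (a , (b , c)) = k ⊛ a , (k ⊛ b , k ⊛ c)

  times-s : Reduced → Reduced
  times-s (a , (b , c)) = shift c , (a ⊕ 9 ⊛ shift c , b ⊕ 27 ⊛ shift c)

  constant : ℕ → Reduced
  constant c = c ∷ [] , ([] , [])

  times-κ times-1+9s times-z : Reduced → Reduced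
  times-κ d = d ⊞ (9 ⊠ times-s d ⊞ 27 ⊠ times-s (times-s d))
  times-1+9s d = d ⊞ 9 ⊠ times-s d
  times-z d = times-s (times-κ d)

  horner-s horner-z : Poly → Reduced
  horner-s [] = [] , ([] , [])
  horner-s (c ∷ p) = constant c ⊞ times-s (horner-s p)
  horner-z [] = [] , ([] , [])
  horner-z (c ∷ p) = constant c ⊞ times-z (horner-z p)

  residue : Fin 3 → Reduced → Poly
  residue 0F (a , (b , c)) = a ⊕ 9 ⊛ shift b ⊕ (6 ⊛ shift c ⊕ 243 ⊛ shift (shift c))
  residue 1F (a , (b , c)) = b ⊕ 27 ⊛ shift c
  residue 2F (a , (b , c)) = 3 ⊛ b ⊕ (c ⊕ 81 ⊛ shift c)

  quartic-coefficients : Poly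
  quartic-coefficients = 1 ∷ 84 ∷ 1458 ∷ 8748 ∷ 19683 ∷ []

  -- The polynomials p₀, …, p₄ describing the five successive dissections.
  record Certificate : Set where
    field
      d₀ d₁ d₂ d₃ d₄ d₅ : Reduced
      p₀ p₁ p₂ p₃ p₄ : Poly
      d₀≡ : d₀ ≡ horner-s quartic-coefficients
      p₀≡ : p₀ ≡ proj₁ d₀ ⊕ 3 ⊛ shift (proj₂ (proj₂ d₀))
      d₁≡ : d₁ ≡ times-1+9s (horner-z p₀)
      p₁≡ : p₁ ≡ residue 2F d₁
      d₂≡ : d₂ ≡ times-κ (times-1+9s (horner-z p₁))
      p₂≡ : p₂ ≡ residue 2F d₂
      d₃≡ : d₃ ≡ times-z (times-1+9s (horner-z p₂))
      p₃≡ : p₃ ≡ residue 2F d₃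
      d₄≡ : d₄ ≡ times-κ (times-1+9s (horner-z p₃))
      p₄≡ : p₄ ≡ residue 2F d₄
      d₅≡ : d₅ ≡ times-z (times-1+9s (horner-z p₄))

  module Evaluation (R : Ring₀) (M≈0 : CommutativeRing._≈_ R (Integers.fromℕ R M) (CommutativeRing.0# R)) where
    open CommutativeRing R
    open Solver R
    open Integers R
    open import Relation.Binary.Reasoning.Setoid setoid

    eval : Poly → Carrier → Carrier
    eval [] x = 0#
    eval (c ∷ p) x = fromℕ c + x * eval p x

    fromℕ-% : ∀ n → fromℕ (n DivMod.% M) ≈ fromℕ n
    fromℕ-% n = sym (begin
      fromℕ n  ≡⟨ ≡.cong fromℕ (DivMod.m≡m%n+[m/n]*n n M) ⟩
      fromℕ (n DivMod.% M ℕ.+ n DivMod./ M ℕ.* M)  ≈⟨ fromℕ-+ (n DivMod.% M) _ ⟩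
      fromℕ (n DivMod.% M) + fromℕ (n DivMod./ M ℕ.* M)  ≈⟨ +-congˡ (trans (fromℕ-* (n DivMod./ M) M) (trans (*-congˡ M≈0) (zeroʳ _))) ⟩
      fromℕ (n DivMod.% M) + 0#  ≈⟨ +-identityʳ _ ⟩
      fromℕ (n DivMod.% M)  ∎)

    eval-cons : ∀ c p x → eval (cons c p) x ≈ fromℕ c + x * eval p x
    eval-cons zero [] x = solve 1 (λ x → con (+ 0) := con (+ 0) :+ x :* con (+ 0)) refl x
    eval-cons zero (a ∷ p) x = refl
    eval-cons (suc c) p x = refl

    eval-⊕ : ∀ p q x → eval (p ⊕ q) x ≈ eval p x + eval q x
    eval-⊕ [] q x = sym (+-identityˡ _)
    eval-⊕ (a ∷ p) [] x = sym (+-identityʳ _)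
    eval-⊕ (a ∷ p) (b ∷ q) x = begin
      eval (cons ((a ℕ.+ b) DivMod.% M) (p ⊕ q)) x  ≈⟨ eval-cons ((a ℕ.+ b) DivMod.% M) (p ⊕ q) x ⟩
      fromℕ ((a ℕ.+ b) DivMod.% M) + x * eval (p ⊕ q) x  ≈⟨ +-cong (trans (fromℕ-% (a ℕ.+ b)) (fromℕ-+ a b)) (*-congˡ (eval-⊕ p q x)) ⟩
      fromℕ a + fromℕ b + x * (eval p x + eval q x)  ≈⟨ solve 5 (λ a b x p q → a :+ b :+ x :* (p :+ q) := a :+ x :* p :+ (b :+ x :* q)) refl _ _ x _ _ ⟩
      eval (a ∷ p) x + eval (b ∷ q) x  ∎

    eval-⊛ : ∀ c p x → eval (c ⊛ p) x ≈ fromℕ c * eval p x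
    eval-⊛ c [] x = sym (zeroʳ _)
    eval-⊛ c (a ∷ p) x = begin
      eval (cons ((c ℕ.* a) DivMod.% M) (c ⊛ p)) x  ≈⟨ eval-cons ((c ℕ.* a) DivMod.% M) (c ⊛ p) x ⟩
      fromℕ ((c ℕ.* a) DivMod.% M) + x * eval (c ⊛ p) x  ≈⟨ +-cong (trans (fromℕ-% (c ℕ.* a)) (fromℕ-* c a)) (*-congˡ (eval-⊛ c p x)) ⟩
      fromℕ c * fromℕ a + x * (fromℕ c * eval p x)  ≈⟨ solve 4 (λ c a x p → c :* a :+ x :* (c :* p) := c :* (a :+ x :* p)) refl _ _ x _ ⟩
      fromℕ c * eval (a ∷ p) x  ∎

    eval-shift : ∀ p x → eval (shift p) x ≈ x * eval p x
    eval-shift p x = trans (eval-cons 0 p x) (+-identityˡ _)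

    eval-⊛-shift : ∀ c p x → eval (c ⊛ shift p) x ≈ fromℕ c * (x * eval p x)
    eval-⊛-shift c p x = trans (eval-⊛ c (shift p) x) (*-congˡ (eval-shift p x))

    module _ (w s : Carrier) where
      value : Reduced → Carrier
      value (a , (b , c)) = eval a w + (s * eval b w + s * s * eval c w)

      value-⊞ : ∀ d d′ → value (d ⊞ d′) ≈ value d + value d′
      value-⊞ (a , (b , c)) (a′ , (b′ , c′)) = trans (+-cong (eval-⊕ a a′ w) (+-cong (*-congˡ (eval-⊕ b b′ w)) (*-congˡ (eval-⊕ c c′ w))))
        (solve 7 (λ s a b c x y z → a :+ x :+ (s :* (b :+ y) :+ s :* s :* (c :+ z)) :=
          a :+ (s :* b :+ s :* s :* c) :+ (x :+ (s :* y :+ s :* s :* z))) refl s _ _ _ _ _ _)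

      value-⊠ : ∀ k d → value (k ⊠ d) ≈ fromℕ k * value d
      value-⊠ k (a , (b , c)) = trans (+-cong (eval-⊛ k a w) (+-cong (*-congˡ (eval-⊛ k b w)) (*-congˡ (eval-⊛ k c w))))
        (solve 5 (λ s k a b c → k :* a :+ (s :* (k :* b) :+ s :* s :* (k :* c)) := k :* (a :+ (s :* b :+ s :* s :* c))) refl s _ _ _ _)

      value-constant : ∀ c → value (constant c) ≈ fromℕ c
      value-constant c = solve 3 (λ c w s → c :+ w :* con (+ 0) :+ (s :* con (+ 0) :+ s :* s :* con (+ 0)) := c) refl (fromℕ c) w s

      value-[] : value ([] , ([] , [])) ≈ 0#
      value-[] = solve 1 (λ s → con (+ 0) :+ (s :* con (+ 0) :+ s :* s :* con (+ 0)) := con (+ 0)) refl s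

      module _ (cubic : s * (s * s) ≈ w * (1# + fromℤ (+ 9) * s + fromℤ (+ 27) * (s * s))) where
        value-s : ∀ d → value (times-s d) ≈ s * value d
        value-s (a , (b , c)) = begin
          eval (shift c) w + (s * eval (a ⊕ 9 ⊛ shift c) w + s * s * eval (b ⊕ 27 ⊛ shift c) w)
            ≈⟨ +-cong (eval-shift c w) (+-cong (*-congˡ (trans (eval-⊕ a _ w) (+-congˡ (eval-⊛-shift 9 c w))))
                 (*-congˡ (trans (eval-⊕ b _ w) (+-congˡ (eval-⊛-shift 27 c w))))) ⟩
          _ ≈⟨ solve 5 (λ w s a b c → w :* c :+ (s :* (a :+ con (+ 9) :* (w :* c)) :+ s :* s :* (b :+ con (+ 27) :* (w :* c))) :=
                 s :* a :+ s :* s :* b :+ w :* (con (+ 1) :+ con (+ 9) :* s :+ con (+ 27) :* (s :* s)) :* c) refl w s (eval a w) (eval b w) (eval c w) ⟩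
          s * eval a w + s * s * eval b w + w * (1# + fromℤ (+ 9) * s + fromℤ (+ 27) * (s * s)) * eval c w
            ≈⟨ +-congˡ (*-congʳ cubic) ⟨
          s * eval a w + s * s * eval b w + s * (s * s) * eval c w
            ≈⟨ solve 4 (λ s a b c → s :* a :+ s :* s :* b :+ s :* (s :* s) :* c := s :* (a :+ (s :* b :+ s :* s :* c))) refl s _ _ _ ⟩
          s * value (a , (b , c)) ∎

        value-κ : ∀ d → value (times-κ d) ≈ (1# + fromℤ (+ 9) * s + fromℤ (+ 27) * (s * s)) * value d
        value-κ d = begin
          value (d ⊞ (9 ⊠ times-s d ⊞ 27 ⊠ times-s (times-s d)))
            ≈⟨ trans (value-⊞ d (9 ⊠ times-s d ⊞ 27 ⊠ times-s (times-s d))) (+-congˡ (trans (value-⊞ (9 ⊠ times-s d) (27 ⊠ times-s (times-s d))) (+-cong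
                 (trans (value-⊠ 9 (times-s d)) (*-congˡ (value-s d)))
                 (trans (value-⊠ 27 (times-s (times-s d))) (*-congˡ (trans (value-s (times-s d)) (*-congˡ (value-s d)))))))) ⟩
          _ ≈⟨ solve 2 (λ s d → d :+ (con (+ 9) :* (s :* d) :+ con (+ 27) :* (s :* (s :* d))) :=
                 (con (+ 1) :+ con (+ 9) :* s :+ con (+ 27) :* (s :* s)) :* d) refl s (value d) ⟩
          _ ∎

        value-1+9s : ∀ d → value (times-1+9s d) ≈ (1# + fromℤ (+ 9) * s) * value d
        value-1+9s d = trans (value-⊞ d (9 ⊠ times-s d)) (trans (+-congˡ (trans (value-⊠ 9 (times-s d)) (*-congˡ (value-s d))))
          (solve 2 (λ s d → d :+ con (+ 9) :* (s :* d) := (con (+ 1) :+ con (+ 9) :* s) :* d) refl s (value d)))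

        value-z : ∀ d → value (times-z d) ≈ s * (1# + fromℤ (+ 9) * s + fromℤ (+ 27) * (s * s)) * value d
        value-z d = trans (value-s (times-κ d)) (trans (*-congˡ (value-κ d)) (sym (*-assoc _ _ _)))

        value-horner-s : ∀ p → value (horner-s p) ≈ eval p s
        value-horner-s [] = value-[]
        value-horner-s (c ∷ p) = trans (value-⊞ (constant c) (times-s (horner-s p)))
          (+-cong (value-constant c) (trans (value-s (horner-s p)) (*-congˡ (value-horner-s p))))

        value-horner-z : ∀ {z} → z ≈ s * (1# + fromℤ (+ 9) * s + fromℤ (+ 27) * (s * s)) → ∀ p → value (horner-z p) ≈ eval p z
        value-horner-z z≈ [] = value-[]
        value-horner-z z≈ (c ∷ p) = trans (value-⊞ (constant c) (times-z (horner-z p)))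
          (+-cong (value-constant c) (trans (value-z (horner-z p)) (*-cong (sym z≈) (value-horner-z z≈ p))))

module Stages (B : Ring₀) (M : ℕ) .{{_ : ℕ.NonZero M}} where
  open Dissection B
  open PowerSeries B (λ _ → ⊤) (λ _ _ → tt) using (PS; psRing; X; mk; at; oneS; zeroS; mul-comm; mul-local; mul-oneˡ; mul-Xˡ; mul-X-zero; module _≋_)
  private module B = CommutativeRing B
  open CommutativeRing psRing
  open Solver psRing
  open Integers psRing
  open Products psRing
  open NinthPower psRing
  open FrobeniusRelation psRing
  open Hom Δ-hom using () renaming (cong to Δ-cong; +-hom to Δ-+; *-hom to Δ-*; 1-hom to Δ-1)
  open HomProperties Δ-hom using (^-hom; cube-hom; fromℕ-hom; linear-hom)
  open Polynomials M
  open import Relation.Binary.Reasoning.Setoid setoid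

  three : PS → PS → PS → PS
  three a₀ a₁ a₂ = Δ a₀ + (X * Δ a₁ + X ^ 2 * Δ a₂)

  private
    X² : PS
    X² zero = B.0#
    X² (suc zero) = B.0#
    X² (suc (suc n)) = oneS n

    X^2≈X² : X ^ 2 ≈ X²
    X^2≈X² = mk λ { 0 _ → mul-X-zero (X ^ 1)
                  ; 1 _ → B.trans (mul-Xˡ (X ^ 1) 0) (mul-X-zero oneS)
                  ; (suc (suc n)) _ → B.trans (mul-Xˡ (X ^ 1) (suc n)) (mul-Xˡ oneS n) }

    U-part : ∀ r → r ℕ.< 3 → ∀ a h {k} → (∀ n → B._≈_ (U r h n) (k n)) → ∀ n → B._≈_ ((h * Δ a) (n ℕ.* 3 ℕ.+ r)) ((a * k) n)
    U-part r r<3 a h {k} p n = B.trans (mul-comm h (Δ a) (n ℕ.* 3 ℕ.+ r)) (B.trans (U-Δ r r<3 a h n)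
      (mul-local n {a} {a} {U r h} {k} (λ _ _ → B.refl) (λ i _ → p i)))

    U-three : ∀ r → r ℕ.< 3 → ∀ {k₀ k₁ k₂} → (∀ n → B._≈_ (U r oneS n) (k₀ n)) → (∀ n → B._≈_ (U r X n) (k₁ n)) → (∀ n → B._≈_ (U r X² n) (k₂ n)) →
              ∀ a₀ a₁ a₂ → U r (three a₀ a₁ a₂) ≈ a₀ * k₀ + (a₁ * k₁ + a₂ * k₂)
    U-three r r<3 {k₀} {k₁} {k₂} p₀ p₁ p₂ a₀ a₁ a₂ = mk λ n _ →
      B.+-cong (B.trans (B.sym (mul-oneˡ (Δ a₀) (n ℕ.* 3 ℕ.+ r))) (U-part r r<3 a₀ oneS {k₀} p₀ n))
        (B.+-cong (U-part r r<3 a₁ X {k₁} p₁ n)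
          (B.trans (at (*-congʳ {x = Δ a₂} X^2≈X²) (n ℕ.* 3 ℕ.+ r) tt) (U-part r r<3 a₂ X² {k₂} p₂ n)))

  pick : Fin 3 → PS → PS → PS → PS
  pick 0F a b c = a
  pick 1F a b c = b
  pick 2F a b c = c

  U-extract : ∀ r a₀ a₁ a₂ → U (Fin.toℕ r) (three a₀ a₁ a₂) ≈ pick r a₀ a₁ a₂
  U-extract 0F a₀ a₁ a₂ = trans (U-three 0 (s≤s z≤n) {oneS} {zeroS} {zeroS}
    (λ { zero → B.refl ; (suc n) → B.refl }) (λ { zero → B.refl ; (suc n) → B.refl }) (λ { zero → B.refl ; (suc n) → B.refl }) a₀ a₁ a₂)
    (solve 3 (λ a b c → a :* con (+ 1) :+ (b :* con (+ 0) :+ c :* con (+ 0)) := a) refl a₀ a₁ a₂)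
  U-extract 1F a₀ a₁ a₂ = trans (U-three 1 (s≤s (s≤s z≤n)) {zeroS} {oneS} {zeroS}
    (λ { zero → B.refl ; (suc n) → B.refl }) (λ { zero → B.refl ; (suc n) → B.refl }) (λ { zero → B.refl ; (suc n) → B.refl }) a₀ a₁ a₂)
    (solve 3 (λ a b c → a :* con (+ 0) :+ (b :* con (+ 1) :+ c :* con (+ 0)) := b) refl a₀ a₁ a₂)
  U-extract 2F a₀ a₁ a₂ = trans (U-three 2 (s≤s (s≤s (s≤s z≤n))) {zeroS} {zeroS} {oneS}
    (λ { zero → B.refl ; (suc n) → B.refl }) (λ { zero → B.refl ; (suc n) → B.refl }) (λ { zero → B.refl ; (suc n) → B.refl }) a₀ a₁ a₂)
    (solve 3 (λ a b c → a :* con (+ 0) :+ (b :* con (+ 0) :+ c :* con (+ 1)) := c) refl a₀ a₁ a₂)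

  U-cong : ∀ r {f h} → f ≈ h → U r f ≈ U r h
  U-cong r p = mk λ n _ → at p (n ℕ.* 3 ℕ.+ r) tt

  three-cong : ∀ {a₀ a₁ a₂ x₀ x₁ x₂} → Δ a₀ ≈ x₀ → Δ a₁ ≈ x₁ → Δ a₂ ≈ x₂ → x₀ + (X * x₁ + X ^ 2 * x₂) ≈ three a₀ a₁ a₂
  three-cong p q r = +-cong (sym p) (+-cong (*-congˡ {x = X} (sym q)) (*-congˡ {x = X ^ 2} (sym r)))

  three-* : ∀ c a₀ a₁ a₂ → Δ c * three a₀ a₁ a₂ ≈ three (c * a₀) (c * a₁) (c * a₂)
  three-* c a₀ a₁ a₂ = trans (solve 5 (λ c X a b d → c :* (a :+ (X :* b :+ X :^ 2 :* d)) := c :* a :+ (X :* (c :* b) :+ X :^ 2 :* (c :* d))) refl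
      (Δ c) X (Δ a₀) (Δ a₁) (Δ a₂))
    (three-cong (Δ-* c a₀) (Δ-* c a₁) (Δ-* c a₂))

  Divisible : ℕ → PS → Set
  Divisible k f = ∃ λ h → f ≈ fromℕ k * h

  -- For C = Σ cφ₉(n) qⁿ these are the series of cφ₉ at 3 n, 9 n + 6, 27 n + 24, 81 n + 51, 243 n + 213.
  F₁ F₂ F₃ F₄ F₅ : PS → PS
  F₁ C = U 0 C
  F₂ C = U 2 (F₁ C)
  F₃ C = U 2 (F₂ C)
  F₄ C = U 2 (X * F₃ C)
  F₅ C = U 2 (F₄ C)

  module _ (M≈0 : fromℕ M ≈ 0#) (ε εi C : PS) (ε-inverse : ε * εi ≈ 1#) where
    private
      e ei ε₉ g : PS
      e = Δ ε
      ei = Δ εi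
      ε₉ = Δ e
      g = cube ε₉

    open Hauptmodul psRing X ε εi e ei g
    open Evaluation psRing M≈0

    module _ (relation₁ : ε₉ * (cube ε + fromℕ 3 * (X ^ 1 * cube ε₉)) ≈ e * (cube e + fromℕ 9 * (X ^ 3 * cube (Δ ε₉))))
             (relation₂ : e ^ 12 ≈ cube ε₉ * (cube ε * quadratic (cube ε) (X ^ 1 * cube ε₉)))
             (relation₃ : e ^ 4 * cube (cube ε) * C ≈ quartic (cube ε) (X ^ 1 * cube ε₉)) where
      private
        Δ-inverse : ∀ {a b} → a * b ≈ 1# → Δ a * Δ b ≈ 1#
        Δ-inverse {a} {b} p = trans (sym (Δ-* a b)) (trans (Δ-cong p) Δ-1)

        e-inverse : e * ei ≈ 1#
        e-inverse = Δ-inverse ε-inverse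

        Δγ : Δ γ ≈ g
        Δγ = cube-hom e

        Δz : Δ z ≈ w
        Δz = trans (Δ-* X (γ ^ 4 * εi ^ 12)) (*-cong Δ-X (trans (Δ-* (γ ^ 4) (εi ^ 12))
          (*-cong (trans (^-hom γ 4) (^-congˡ 4 Δγ)) (^-hom εi 12))))

        α″ : PS
        α″ = α′ ε-inverse e-inverse relation₂

        β₁ β : PS
        β₁ = γ * γ * εi ^ 12 * (α″ * α″)
        β = β₂ ε-inverse e-inverse relation₂

        Δα : Δ α″ ≈ α
        Δα = begin
          Δ (ε * (t + fromℕ 9 * x) * ei)
            ≈⟨ trans (Δ-* (ε * (t + fromℕ 9 * x)) ei) (*-congʳ {x = Δ ei} (trans (Δ-* ε (t + fromℕ 9 * x)) (*-congˡ {x = e} expand))) ⟩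
          e * (cube e + fromℕ 9 * (X ^ 3 * cube (Δ ε₉))) * Δ ei
            ≈⟨ *-congʳ {x = Δ ei} relation₁ ⟨
          ε₉ * α * Δ ei
            ≈⟨ solve 3 (λ a b c → a :* b :* c := a :* c :* b) refl ε₉ α (Δ ei) ⟩
          ε₉ * Δ ei * α
            ≈⟨ *-congʳ {x = α} (Δ-inverse e-inverse) ⟩
          1# * α
            ≈⟨ *-identityˡ α ⟩
          α ∎
          where
          expand : Δ (t + fromℕ 9 * x) ≈ cube e + fromℕ 9 * (X ^ 3 * cube (Δ ε₉))
          expand = trans (linear-hom 9 t x) (+-cong (cube-hom ε) (*-congˡ {x = fromℕ 9}
            (trans (Δ-* (X ^ 1) g) (*-cong (trans (^-hom X 1) (trans (*-identityʳ (Δ X)) Δ-X)) (cube-hom ε₉)))))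

        Δβ₁ : Δ β₁ ≈ b₁
        Δβ₁ = trans (Δ-* (γ * γ * εi ^ 12) (α″ * α″)) (*-cong (trans (Δ-* (γ * γ) (εi ^ 12)) (*-cong (trans (Δ-* γ γ) (*-cong Δγ Δγ)) (^-hom εi 12)))
          (trans (Δ-* α″ α″) (*-cong Δα Δα)))

        Δβ : Δ β ≈ b₂
        Δβ = trans (Δ-* (γ * γ * γ * εi ^ 12) α″) (*-cong (trans (Δ-* (γ * γ * γ) (εi ^ 12)) (*-cong
          (trans (Δ-* (γ * γ) γ) (*-cong (trans (Δ-* γ γ) (*-cong Δγ Δγ)) Δγ)) (^-hom εi 12))) Δα)

        Δ-eval : ∀ p → Δ (eval p z) ≈ eval p w
        Δ-eval [] = Hom.0-hom Δ-hom
        Δ-eval (c ∷ p) = trans (Δ-+ (fromℕ c) (z * eval p z)) (+-cong (fromℕ-hom c) (trans (Δ-* z (eval p z)) (*-cong Δz (Δ-eval p))))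

        cubic : s * (s * s) ≈ w * κ
        cubic = s³ ε-inverse e-inverse relation₂

        z≈ : z ≈ s * κ
        z≈ = z≈sκ ε-inverse e-inverse relation₂

        weighted : Fin 3 → Reduced → PS
        weighted r d = pick r 1# β₁ β * eval (residue r d) z

        value-three : ∀ d → value w s d ≈ three (weighted 0F d) (weighted 1F d) (weighted 2F d)
        value-three d@(a , (b , c)) = trans (reduced-dissection ε-inverse e-inverse relation₂ (eval a w) (eval b w) (eval c w))
          (three-cong
            (trans (Δ-* 1# (eval (residue 0F d) z)) (trans (*-cong Δ-1 (Δ-eval (residue 0F d))) (trans (*-identityˡ _)
              (trans (eval-⊕ (a ⊕ 9 ⊛ shift b) (6 ⊛ shift c ⊕ 243 ⊛ shift (shift c)) w)
                (+-cong (trans (eval-⊕ a (9 ⊛ shift b) w) (+-congˡ {x = eval a w} (eval-⊛-shift 9 b w)))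
                  (trans (eval-⊕ (6 ⊛ shift c) (243 ⊛ shift (shift c)) w) (+-cong (eval-⊛-shift 6 c w)
                    (trans (eval-⊛-shift 243 (shift c) w) (*-congˡ {x = fromℕ 243} (*-congˡ {x = w} (eval-shift c w)))))))))))
            (trans (Δ-* β₁ (eval (residue 1F d) z)) (*-cong Δβ₁ (trans (Δ-eval (residue 1F d))
              (trans (eval-⊕ b (27 ⊛ shift c) w) (+-congˡ {x = eval b w} (eval-⊛-shift 27 c w))))))
            (trans (Δ-* β (eval (residue 2F d) z)) (*-cong Δβ (trans (Δ-eval (residue 2F d))
              (trans (eval-⊕ (3 ⊛ b) (c ⊕ 81 ⊛ shift c) w) (+-cong (eval-⊛ 3 b w)
                (trans (eval-⊕ c (81 ⊛ shift c) w) (+-congˡ {x = eval c w} (eval-⊛-shift 81 c w)))))))))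

        factor : Fin 3 → PS
        factor r = pick r 1# β₁ β

        stage : ∀ r {f} c d → f ≈ Δ c * value w s d → U (Fin.toℕ r) f ≈ c * (factor r * eval (residue r d) z)
        stage r {f} c d p = trans (U-cong (Fin.toℕ r) (trans p (trans (*-congˡ {x = Δ c} (value-three d))
            (three-* c (weighted 0F d) (weighted 1F d) (weighted 2F d)))))
          (trans (U-extract r (c * weighted 0F d) (c * weighted 1F d) (c * weighted 2F d)) (picked r))
          where
          picked : ∀ r → pick r (c * weighted 0F d) (c * weighted 1F d) (c * weighted 2F d) ≈ c * (factor r * eval (residue r d) z)
          picked 0F = refl
          picked 1F = refl
          picked 2F = refl

        stage-divisible : ∀ r {f} c d k q → residue r d ≡ k ⊛ q → f ≈ Δ c * value w s d → Divisible k (U (Fin.toℕ r) f)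
        stage-divisible r c d k q e p = c * (factor r * eval q z) , trans (stage r c d p)
          (trans (*-congˡ {x = c} (*-congˡ {x = factor r} (trans (reflexive (≡.cong (λ l → eval l z) e)) (eval-⊛ k q z))))
            (solve 4 (λ c b k y → c :* (b :* (k :* y)) := k :* (c :* (b :* y))) refl c (factor r) (fromℕ k) (eval q z)))

        horner : ∀ p → value w s (times-1+9s (horner-z p)) ≈ (1# + fromℤ (+ 9) * s) * eval p z
        horner p = trans (value-1+9s w s cubic (horner-z p)) (*-congˡ {x = 1# + fromℤ (+ 9) * s} (value-horner-z w s cubic z≈ p))

        from-A : ∀ p d {f} → d ≡ times-1+9s (horner-z p) → f ≈ ei * ((1# + fromℤ (+ 9) * s) * eval p z) → f ≈ Δ εi * value w s d
        from-A p d ≡.refl h = trans h (*-congˡ {x = ei} (sym (horner p)))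

        from-zA : ∀ p d {f} → d ≡ times-z (times-1+9s (horner-z p)) → f ≈ ei * (z * ((1# + fromℤ (+ 9) * s) * eval p z)) → f ≈ Δ εi * value w s d
        from-zA p d ≡.refl h = trans h (*-congˡ {x = ei} (sym (trans (value-z w s cubic (times-1+9s (horner-z p)))
          (*-cong (sym z≈) (horner p)))))

        c-B : PS
        c-B = εi ^ 4 * γ

        from-B : ∀ p d {f} → d ≡ times-κ (times-1+9s (horner-z p)) → f ≈ εi * (β * eval p z) → f ≈ Δ c-B * value w s d
        from-B p d ≡.refl h = trans h (trans (sym (*-assoc εi β (eval p z))) (trans (step-A ε-inverse e-inverse relation₂ (eval p z))
          (*-cong (sym (trans (Δ-* (εi ^ 4) γ) (*-cong (^-hom εi 4) Δγ)))
            (sym (trans (value-κ w s cubic (times-1+9s (horner-z p))) (*-congˡ {x = κ} (horner p)))))))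

        to-zA : ∀ p {f} → f ≈ c-B * (β * eval p z) → X * f ≈ ei * (z * ((1# + fromℤ (+ 9) * s) * eval p z))
        to-zA p h = trans (*-congˡ {x = X} (trans h (sym (*-assoc c-B β (eval p z))))) (step-B ε-inverse e-inverse relation₂ (eval p z))

        C≈ : ∀ d₀ → d₀ ≡ horner-s quartic-coefficients → C ≈ Δ (εi ^ 4) * (t * value w s d₀)
        C≈ d₀ ≡.refl = trans (frobenius-hauptmodul ε-inverse e-inverse relation₂ relation₃)
          (*-cong (sym (^-hom εi 4)) (*-congˡ {x = t} (trans quartic-1 (sym (value-horner-s w s cubic quartic-coefficients)))))
          where
          quartic-1 : quartic 1# s ≈ eval quartic-coefficients s
          quartic-1 = solve 1 (λ x → let K = λ a → a :* (a :* a) ; t = con (+ 1) in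
            K (t :+ con (+ 9) :* x) :* (t :+ con (+ 3) :* x) :+
              con (+ 54) :* (x :* (t :* t :+ con (+ 9) :* x :* t :+ con (+ 27) :* (x :* x))) :* (t :+ con (+ 12) :* x) :=
            con (+ 1) :+ x :* (con (+ 84) :+ x :* (con (+ 1458) :+ x :* (con (+ 8748) :+ x :* (con (+ 19683) :+ x :* con (+ 0)))))) refl s

        U₀C : ∀ d₀ p₀ → d₀ ≡ horner-s quartic-coefficients → p₀ ≡ proj₁ d₀ ⊕ 3 ⊛ shift (proj₂ (proj₂ d₀)) →
              U 0 C ≈ εi ^ 4 * (α″ * eval p₀ z)
        U₀C d₀@(D₀ , (D₁ , D₂)) p₀ d₀≡ p₀≡ = trans (U-cong 0 (trans (C≈ d₀ d₀≡) (trans (*-congˡ {x = Δ (εi ^ 4)} t*d₀) (three-* (εi ^ 4) (α″ * eval p₀ z) B₁ B₂))))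
          (U-extract 0F (εi ^ 4 * (α″ * eval p₀ z)) (εi ^ 4 * B₁) (εi ^ 4 * B₂))
          where
          B₁ B₂ : PS
          B₁ = γ * (eval D₁ z - fromℤ (+ 3) * eval D₀ z + fromℤ (+ 9) * z * eval D₂ z)
          B₂ = γ * β₁ * eval D₂ z
          t*d₀ : t * value w s d₀ ≈ three (α″ * eval p₀ z) B₁ B₂
          t*d₀ = trans (t*-dissection ε-inverse e-inverse relation₂ (eval D₀ w) (eval D₁ w) (eval D₂ w)) (three-cong
            (trans (Δ-* α″ (eval p₀ z)) (*-cong Δα (trans (Δ-eval p₀) (trans (reflexive (≡.cong (λ l → eval l w) p₀≡)) (trans (eval-⊕ D₀ (3 ⊛ shift D₂) w)
              (+-congˡ {x = eval D₀ w} (trans (eval-⊛-shift 3 D₂ w) (sym (*-assoc (fromℕ 3) w (eval D₂ w))))))))))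
            (trans (Δ-* γ _) (*-cong Δγ (trans (Δ-+ _ _) (+-cong (trans (Δ-+ _ _) (+-cong (Δ-eval D₁)
              (trans (Hom.neg-hom Δ-hom _) (-‿cong (trans (Δ-* (fromℕ 3) (eval D₀ z)) (*-cong (fromℕ-hom 3) (Δ-eval D₀)))))))
              (trans (Δ-* (fromℕ 9 * z) (eval D₂ z)) (*-cong (trans (Δ-* (fromℕ 9) z) (*-cong (fromℕ-hom 9) Δz)) (Δ-eval D₂)))))))
            (trans (Δ-* (γ * β₁) (eval D₂ z)) (*-cong (trans (Δ-* γ β₁) (*-cong Δγ Δβ₁)) (Δ-eval D₂))))

      module _ (certificate : Certificate) where
        open Certificate certificate
        private
          via : ∀ {c k} b p r d → p ≡ residue r d → k ≈ c * (b * eval (residue r d) z) → k ≈ c * (b * eval p z)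
          via b p r d ≡.refl h = h

          form₁ : F₁ C ≈ Δ εi * value w s d₁
          form₁ = from-A p₀ d₁ d₁≡ (trans (U₀C d₀ p₀ d₀≡ p₀≡)
            (trans (sym (*-assoc (εi ^ 4) α″ (eval p₀ z))) (step-0 ε-inverse e-inverse relation₂ (eval p₀ z))))

          form₂ : F₂ C ≈ Δ c-B * value w s d₂
          form₂ = from-B p₁ d₂ d₂≡ (via β p₁ 2F d₁ p₁≡ (stage 2F εi d₁ form₁))

          form₃ : X * F₃ C ≈ Δ εi * value w s d₃
          form₃ = from-zA p₂ d₃ d₃≡ (to-zA p₂ (via β p₂ 2F d₂ p₂≡ (stage 2F c-B d₂ form₂)))

          form₄ : F₄ C ≈ Δ c-B * value w s d₄
          form₄ = from-B p₃ d₄ d₄≡ (via β p₃ 2F d₃ p₃≡ (stage 2F εi d₃ form₃))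

          form₅ : X * F₅ C ≈ Δ εi * value w s d₅
          form₅ = from-zA p₄ d₅ d₅≡ (to-zA p₄ (via β p₄ 2F d₄ p₄≡ (stage 2F c-B d₄ form₄)))

        divisible₁ : ∀ r k q → residue r d₁ ≡ k ⊛ q → Divisible k (U (Fin.toℕ r) (F₁ C))
        divisible₁ r k q e = stage-divisible r εi d₁ k q e form₁

        divisible₂ : ∀ r k q → residue r d₂ ≡ k ⊛ q → Divisible k (U (Fin.toℕ r) (F₂ C))
        divisible₂ r k q e = stage-divisible r c-B d₂ k q e form₂

        divisible₃ : ∀ r k q → residue r d₃ ≡ k ⊛ q → Divisible k (U (Fin.toℕ r) (X * F₃ C))
        divisible₃ r k q e = stage-divisible r εi d₃ k q e form₃

        divisible₄ : ∀ r k q → residue r d₄ ≡ k ⊛ q → Divisible k (U (Fin.toℕ r) (F₄ C))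
        divisible₄ r k q e = stage-divisible r c-B d₄ k q e form₄

        divisible₅ : ∀ r k q → residue r d₅ ≡ k ⊛ q → Divisible k (U (Fin.toℕ r) (X * F₅ C))
        divisible₅ r k q e = stage-divisible r εi d₅ k q e form₅

module Inverse (B : Ring₀) where
  open PowerSeries B (λ _ → ⊤) (λ _ _ → tt)
  private module B = CommutativeRing B
  open CommutativeRing psRing
  open Products psRing
  open import Relation.Binary.Reasoning.Setoid B.setoid
  open import Algebra.Properties.Ring B.ring using (-0#≈0#)

  module _ (f : PS) (f₀≈1 : B._≈_ (f 0) B.1#) where
    private
      h x : PS
      h n = B.- f (suc n)
      x = X * h

      f≈1-x : f ≈ 1# - x
      f≈1-x = mk λ { zero _ → B.trans f₀≈1 (B.sym (B.trans (B.+-congˡ (B.trans (B.-‿cong (mul-X-zero h)) -0#≈0#)) (B.+-identityʳ B.1#)))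
                   ; (suc n) _ → B.sym (B.trans (B.+-identityˡ _) (B.trans (B.-‿cong (mul-Xˡ h n)) (-‿involutive (f (suc n))))) }
        where open import Algebra.Properties.Ring B.ring using (-‿involutive)

      mul-x-suc : ∀ k n → B._≈_ ((x * k) (suc n)) ((h * k) n)
      mul-x-suc k n = B.trans (mul-assoc X h k (suc n)) (mul-Xˡ (h * k) n)

      geometric-stable : ∀ N N′ i → i ℕ.< N → i ℕ.< N′ → B._≈_ (geometric N x i) (geometric N′ x i)
      geometric-stable (suc N) (suc N′) zero _ _ = B.+-congˡ (B.trans (low (geometric N x)) (B.sym (low (geometric N′ x))))
        where
        low : ∀ k → B._≈_ ((x * k) 0) B.0#
        low k = B.trans (mul-assoc X h k 0) (mul-X-zero (h * k))
      geometric-stable (suc N) (suc N′) (suc i) (s≤s i<N) (s≤s i<N′) = B.+-congˡ (B.trans (mul-x-suc (geometric N x) i)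
        (B.trans (mul-local i {h} {h} (λ _ _ → B.refl) (λ j j≤i → geometric-stable N N′ j (ℕₚ.≤-<-trans j≤i i<N) (ℕₚ.≤-<-trans j≤i i<N′)))
          (B.sym (mul-x-suc (geometric N′ x) i))))

      power-below : ∀ k n → n ℕ.< k → B._≈_ ((x ^ k) n) B.0#
      power-below (suc k) zero _ = B.trans (mul-assoc X h (x ^ k) 0) (mul-X-zero (h * x ^ k))
      power-below (suc k) (suc n) (s≤s n<k) = B.trans (mul-x-suc (x ^ k) n)
        (B.trans (mul-local n {h} {h} {x ^ k} {zeroS} (λ _ _ → B.refl) (λ i i≤n → power-below k i (ℕₚ.≤-<-trans i≤n n<k)))
          (B.trans (mul-comm h zeroS n) (mul-zeroˡ h n)))

    inverse : PS
    inverse n = geometric (suc n) x n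

    inverseʳ : f * inverse ≈ 1#
    inverseʳ = mk λ n _ → begin
      (f * inverse) n
        ≈⟨ mul-local n {f} {f} (λ _ _ → B.refl) (λ i i≤n → geometric-stable (suc i) (suc n) i ℕₚ.≤-refl (s≤s i≤n)) ⟩
      (f * geometric (suc n) x) n
        ≈⟨ at (trans (*-congʳ f≈1-x) (geometric-sum (suc n) x)) n tt ⟩
      1# n B.- (x ^ suc n) n
        ≈⟨ B.trans (B.+-congˡ (B.trans (B.-‿cong (power-below (suc n) n ℕₚ.≤-refl)) -0#≈0#)) (B.+-identityʳ _) ⟩
      1# n ∎

module Modular (M : ℕ) where
  infix 4 _≈ₘ_
  record _≈ₘ_ (a b : ℤ) : Set where
    constructor modulo
    field
      quotient : ℤ
      equation : a ≡ b ℤ.+ quotient ℤ.* + M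

  private
    open ℤSolver using (solve; _:=_; con; _:+_; _:*_; :-_)
    m : ℤ
    m = + M

    reflₘ : ∀ {a} → a ≈ₘ a
    reflₘ {a} = modulo (+ 0) (solve 2 (λ a m → a := a :+ con (+ 0) :* m) ≡.refl a m)

    symₘ : ∀ {a b} → a ≈ₘ b → b ≈ₘ a
    symₘ {a} {b} (modulo k ≡.refl) = modulo (ℤ.- k) (solve 3 (λ b k m → b := b :+ k :* m :+ :- k :* m) ≡.refl b k m)

    transₘ : ∀ {a b c} → a ≈ₘ b → b ≈ₘ c → a ≈ₘ c
    transₘ {c = c} (modulo k ≡.refl) (modulo l ≡.refl) =
      modulo (l ℤ.+ k) (solve 4 (λ c k l m → c :+ l :* m :+ k :* m := c :+ (l :+ k) :* m) ≡.refl c k l m)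

    +-congₘ : ∀ {a b c d} → a ≈ₘ b → c ≈ₘ d → a ℤ.+ c ≈ₘ b ℤ.+ d
    +-congₘ {b = b} {d = d} (modulo k ≡.refl) (modulo l ≡.refl) =
      modulo (k ℤ.+ l) (solve 5 (λ b d k l m → b :+ k :* m :+ (d :+ l :* m) := b :+ d :+ (k :+ l) :* m) ≡.refl b d k l m)

    *-congₘ : ∀ {a b c d} → a ≈ₘ b → c ≈ₘ d → a ℤ.* c ≈ₘ b ℤ.* d
    *-congₘ {b = b} {d = d} (modulo k ≡.refl) (modulo l ≡.refl) = modulo (b ℤ.* l ℤ.+ k ℤ.* d ℤ.+ k ℤ.* l ℤ.* m)
      (solve 5 (λ b d k l m → (b :+ k :* m) :* (d :+ l :* m) := b :* d :+ (b :* l :+ k :* d :+ k :* l :* m) :* m) ≡.refl b d k l m)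

    neg-congₘ : ∀ {a b} → a ≈ₘ b → ℤ.- a ≈ₘ ℤ.- b
    neg-congₘ {b = b} (modulo k ≡.refl) = modulo (ℤ.- k) (solve 3 (λ b k m → :- (b :+ k :* m) := :- b :+ :- k :* m) ≡.refl b k m)

  ≡⇒≈ₘ : ∀ {a b} → a ≡ b → a ≈ₘ b
  ≡⇒≈ₘ ≡.refl = reflₘ

  ℤ-mod : Ring₀
  ℤ-mod = record
    { Carrier = ℤ ; _≈_ = _≈ₘ_ ; _+_ = ℤ._+_ ; _*_ = ℤ._*_ ; -_ = ℤ.-_ ; 0# = + 0 ; 1# = + 1
    ; isCommutativeRing = record
      { isRing = record
        { +-isAbelianGroup = record
          { isGroup = record
            { isMonoid = record
              { isSemigroup = record
                { isMagma = record
                  { isEquivalence = record { refl = reflₘ ; sym = symₘ ; trans = transₘ }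
                  ; ∙-cong = +-congₘ }
                ; assoc = λ a b c → ≡⇒≈ₘ (ℤₚ.+-assoc a b c) }
              ; identity = (λ a → ≡⇒≈ₘ (ℤₚ.+-identityˡ a)) , (λ a → ≡⇒≈ₘ (ℤₚ.+-identityʳ a)) }
            ; inverse = (λ a → ≡⇒≈ₘ (ℤₚ.+-inverseˡ a)) , (λ a → ≡⇒≈ₘ (ℤₚ.+-inverseʳ a))
            ; ⁻¹-cong = neg-congₘ }
          ; comm = λ a b → ≡⇒≈ₘ (ℤₚ.+-comm a b) }
        ; *-cong = *-congₘ
        ; *-assoc = λ a b c → ≡⇒≈ₘ (ℤₚ.*-assoc a b c)
        ; *-identity = (λ a → ≡⇒≈ₘ (ℤₚ.*-identityˡ a)) , (λ a → ≡⇒≈ₘ (ℤₚ.*-identityʳ a))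
        ; distrib = (λ a b c → ≡⇒≈ₘ (ℤₚ.*-distribˡ-+ a b c)) , (λ a b c → ≡⇒≈ₘ (ℤₚ.*-distribʳ-+ a b c)) }
      ; *-comm = λ a b → ≡⇒≈ₘ (ℤₚ.*-comm a b) } }

-- The counting function is a parameter here so that its definition is never unfolded.
module ModularSeries (M : ℕ) .{{_ : ℕ.NonZero M}} (c : ℕ → ℕ) (generating : FullRelations.FrobeniusRelationFor (λ n → + c n)) where
  open Modular M
  open FullRelations using (F; ε; ε₃; ε₉; ε₂₇; full-relation₁; full-relation₂)
  private
    module F = CommutativeRing F
    module P = PowerSeries ℤ-mod (λ _ → ⊤) (λ _ _ → tt)
    module DF = Dissection ℤ-ring
    module DM = Dissection ℤ-mod
    module NF = NinthPower F
    module PF = Products F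
    module IF = Integers F
    module Inv = Inverse ℤ-ring
  open CommutativeRing P.psRing
  open Products P.psRing
  open NinthPower P.psRing
  open Integers P.psRing
  open FrobeniusRelation P.psRing
  open Stages ℤ-mod M
  open Polynomials M

  C : P.PS
  C n = + c n

  private
    pointwise : ∀ {f g : P.PS} → (∀ n → f n ≡ g n) → f ≈ g
    pointwise p = P.mk λ n _ → ≡⇒≈ₘ (p n)

    same-mul : ∀ n f g → ℤ⟦X⟧.mul f g n ≡ P.mul f g n
    same-mul zero f g = ≡.refl
    same-mul (suc n) f g = ≡.cong (λ k → f 0 ℤ.* g (suc n) ℤ.+ k) (same-mul n (λ i → f (suc i)) g)

    same-Δ : ∀ n f → DF.Δ f n ≡ DM.Δ f n
    same-Δ 0 f = ≡.refl
    same-Δ 1 f = ≡.refl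
    same-Δ 2 f = ≡.refl
    same-Δ (suc (suc (suc n))) f = same-Δ n (λ i → f (suc i))

    reduction : Hom F P.psRing
    reduction = record
      { ⟦_⟧ = λ f → f
      ; cong = λ p → pointwise (λ n → ℤ⟦X⟧.at p n tt)
      ; +-hom = λ _ _ → refl
      ; *-hom = λ f g → pointwise (λ n → same-mul n f g)
      ; neg-hom = λ _ → refl
      ; 0-hom = refl
      ; 1-hom = pointwise λ { zero → ≡.refl ; (suc n) → ≡.refl } }

    open Hom reduction using (*-hom)
    open HomProperties reduction

    X-hom : ∀ k → (ℤ⟦X⟧.X PF.^ k) ≈ P.X ^ k
    X-hom k = trans (^-hom ℤ⟦X⟧.X k) (^-congˡ k (pointwise λ { 0 → ≡.refl ; 1 → ≡.refl ; (suc (suc n)) → ≡.refl }))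

    Δ-reduction : ∀ {f g} → f ≈ g → DF.Δ f ≈ DM.Δ g
    Δ-reduction {f} p = trans (pointwise (λ n → same-Δ n f)) (Hom.cong DM.Δ-hom p)

    h₃ : ε₃ ≈ DM.Δ ε
    h₃ = Δ-reduction refl
    h₉ : ε₉ ≈ DM.Δ (DM.Δ ε)
    h₉ = Δ-reduction h₃
    h₂₇ : ε₂₇ ≈ DM.Δ (DM.Δ (DM.Δ ε))
    h₂₇ = Δ-reduction h₉

    cube-to : ∀ {f g} → f ≈ g → NF.cube f ≈ cube g
    cube-to {f} p = trans (cube-hom f) (cube-cong p)

    term-to : ∀ k {f g} → f ≈ g → (ℤ⟦X⟧.X PF.^ k F.* NF.cube f) ≈ P.X ^ k * cube g
    term-to k {f} p = trans (*-hom (ℤ⟦X⟧.X PF.^ k) (NF.cube f)) (*-cong (X-hom k) (cube-to p))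

    linear-to : ∀ n k {f f′ g g′} → f ≈ f′ → g ≈ g′ →
      (NF.cube f F.+ IF.fromℕ n F.* (ℤ⟦X⟧.X PF.^ k F.* NF.cube g)) ≈ cube f′ + fromℕ n * (P.X ^ k * cube g′)
    linear-to n k {f} {g = g} p r = trans (linear-hom n (NF.cube f) (ℤ⟦X⟧.X PF.^ k F.* NF.cube g))
      (+-cong (cube-to p) (*-congˡ {x = fromℕ n} (term-to k r)))

    relation₁ = trans (sym (trans (*-hom ε₉ _) (*-cong h₉ (linear-to 3 1 {ε} {ε} {ε₉} refl h₉))))
      (trans (Hom.cong reduction full-relation₁) (trans (*-hom ε₃ _) (*-cong h₃ (linear-to 9 3 {ε₃} h₃ h₂₇))))

    relation₂ = trans (sym (trans (^-hom ε₃ 12) (^-congˡ 12 h₃))) (trans (Hom.cong reduction full-relation₂)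
      (trans (*-hom (NF.cube ε₉) _) (*-cong (cube-to h₉) (trans (*-hom (NF.cube ε) _) (*-cong (cube-hom ε)
        (trans (quadratic-hom (NF.cube ε) (ℤ⟦X⟧.X PF.^ 1 F.* NF.cube ε₉)) (quadratic-cong (cube-hom ε) (term-to 1 h₉))))))))

    relation₃ = trans (sym (trans (*-hom (ε₃ PF.^ 4 F.* NF.cube (NF.cube ε)) C) (*-congʳ {x = C}
        (trans (*-hom (ε₃ PF.^ 4) (NF.cube (NF.cube ε))) (*-cong (trans (^-hom ε₃ 4) (^-congˡ 4 h₃)) (cube-to (cube-hom ε)))))))
      (trans (Hom.cong reduction generating) (trans (quartic-hom (NF.cube ε) (ℤ⟦X⟧.X PF.^ 1 F.* NF.cube ε₉))
        (quartic-cong (cube-hom ε) (term-to 1 h₉))))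

    εi : P.PS
    εi = Inv.inverse ε ≡.refl

    ε-inverse : ε * εi ≈ 1#
    ε-inverse = trans (sym (*-hom ε εi)) (trans (Hom.cong reduction (Inv.inverseʳ ε ≡.refl)) (Hom.1-hom reduction))

    mul-fromℕ : ∀ k h n → (fromℕ k * h) n ≈ₘ + k ℤ.* h n
    mul-fromℕ 0 h n = P.mul-zeroˡ h n
    mul-fromℕ 1 h n = Modular-trans (P.mul-oneˡ h n) (≡⇒≈ₘ (≡.sym (ℤₚ.*-identityˡ (h n))))
      where Modular-trans = CommutativeRing.trans ℤ-mod
    mul-fromℕ (suc (suc k)) h n = transₘ (P.mul-distribʳ h oneS′ (fromℕ (suc k)) n)
      (transₘ (CommutativeRing.+-cong ℤ-mod (P.mul-oneˡ h n) (mul-fromℕ (suc k) h n))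
        (≡⇒≈ₘ (≡.sym (≡.trans (ℤₚ.*-distribʳ-+ (h n) (+ 1) (+ suc k)) (≡.cong (ℤ._+ + suc k ℤ.* h n) (ℤₚ.*-identityˡ (h n)))))))
      where
      transₘ = CommutativeRing.trans ℤ-mod
      oneS′ = P.oneS

    M≈0 : fromℕ M ≈ 0#
    M≈0 = trans (sym (*-identityʳ (fromℕ M))) (P.mk λ n _ → CommutativeRing.trans ℤ-mod (mul-fromℕ M 1# n)
      (modulo (1# n) (≡.trans (ℤₚ.*-comm (+ M) (1# n)) (≡.sym (ℤₚ.+-identityˡ _)))))

  conclude : ∀ {k f} l → M ≡ k ℕ.* l → Divisible k f → ∀ n m → f n ≈ₘ + c m → k ∣ c m
  conclude {k} {f} l e (h , p) n m f≈c = divisor (CommutativeRing.trans ℤ-mod (CommutativeRing.sym ℤ-mod f≈c)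
    (CommutativeRing.trans ℤ-mod (P.at p n tt) (mul-fromℕ k h n)))
    where
    open ℤSolver using (solve; _:=_; _:+_; _:*_)
    divisor : + c m ≈ₘ + k ℤ.* h n → k ∣ c m
    divisor (modulo j q) = divides ℤ.∣ h n ℤ.+ j ℤ.* + l ∣ (≡.trans (≡.cong ℤ.∣_∣ (≡.trans q (≡.trans
        (≡.cong (λ z → + k ℤ.* h n ℤ.+ j ℤ.* z) (≡.trans (≡.cong +_ e) (ℤₚ.pos-* k l)))
        (solve 4 (λ k h j l → k :* h :+ j :* (k :* l) := (h :+ j :* l) :* k) ≡.refl (+ k) (h n) j (+ l)))))
      (ℤₚ.abs-* (h n ℤ.+ j ℤ.* + l) (+ k)))

  shifted : ∀ f n → (P.X * f) (n ℕ.* 3 ℕ.+ 2) ≈ₘ f (n ℕ.* 3 ℕ.+ 1)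
  shifted f n = CommutativeRing.trans ℤ-mod (≡⇒≈ₘ (≡.cong (P.X * f) (ℕₚ.+-suc (n ℕ.* 3) 1))) (P.mul-Xˡ f (n ℕ.* 3 ℕ.+ 1))

  shifted₀ : ∀ f n → DM.U 0 (P.X * f) (suc n) ≈ₘ f (n ℕ.* 3 ℕ.+ 2)
  shifted₀ f n = CommutativeRing.trans ℤ-mod (P.mul-Xˡ f (2 ℕ.+ (n ℕ.* 3 ℕ.+ 0)))
    (≡⇒≈ₘ (≡.cong f (≡.trans (≡.cong (2 ℕ.+_) (ℕₚ.+-identityʳ (n ℕ.* 3))) (ℕₚ.+-comm 2 (n ℕ.* 3)))))

  private
    at-index : ∀ {a b} → a ≡ b → + c a ≈ₘ + c b
    at-index ≡.refl = CommutativeRing.refl ℤ-mod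

    open NatSolver using (solve; _:=_; _:+_; _:*_; con)

    index₃ : ∀ n → ((n ℕ.* 3 ℕ.+ 2) ℕ.* 3 ℕ.+ 2) ℕ.* 3 ℕ.+ 0 ≡ 27 ℕ.* n ℕ.+ 24
    index₃ = solve 1 (λ n → ((n :* con 3 :+ con 2) :* con 3 :+ con 2) :* con 3 :+ con 0 := con 27 :* n :+ con 24) ≡.refl

    F₃-coefficient : ∀ n → F₃ C n ≈ₘ + c (27 ℕ.* n ℕ.+ 24)
    F₃-coefficient n = at-index (index₃ n)

    F₄-coefficient : ∀ n → F₄ C n ≈ₘ + c (81 ℕ.* n ℕ.+ 51)
    F₄-coefficient n = CommutativeRing.trans ℤ-mod (shifted (F₃ C) n) (CommutativeRing.trans ℤ-mod (F₃-coefficient (n ℕ.* 3 ℕ.+ 1))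
      (at-index (solve 1 (λ n → con 27 :* (n :* con 3 :+ con 1) :+ con 24 := con 81 :* n :+ con 51) ≡.refl n)))

    F₅-coefficient : ∀ n → F₅ C n ≈ₘ + c (243 ℕ.* n ℕ.+ 213)
    F₅-coefficient n = CommutativeRing.trans ℤ-mod (F₄-coefficient (n ℕ.* 3 ℕ.+ 2))
      (at-index (solve 1 (λ n → con 81 :* (n :* con 3 :+ con 2) :+ con 51 := con 243 :* n :+ con 213) ≡.refl n))

  module _ (certificate : Certificate) where
    open Certificate certificate

    congruence-9n+3 : ∀ k q l → residue 1F d₁ ≡ k ⊛ q → M ≡ k ℕ.* l → ∀ n → k ∣ c (9 ℕ.* n ℕ.+ 3)
    congruence-9n+3 k q l e M≡ n = conclude l M≡ (divisible₁ M≈0 ε εi C ε-inverse relation₁ relation₂ relation₃ certificate 1F k q e) n (9 ℕ.* n ℕ.+ 3)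
      (at-index (solve 1 (λ n → (n :* con 3 :+ con 1) :* con 3 :+ con 0 := con 9 :* n :+ con 3) ≡.refl n))

    congruence-9n+6 : ∀ k q l → residue 2F d₁ ≡ k ⊛ q → M ≡ k ℕ.* l → ∀ n → k ∣ c (9 ℕ.* n ℕ.+ 6)
    congruence-9n+6 k q l e M≡ n = conclude l M≡ (divisible₁ M≈0 ε εi C ε-inverse relation₁ relation₂ relation₃ certificate 2F k q e) n (9 ℕ.* n ℕ.+ 6)
      (at-index (solve 1 (λ n → (n :* con 3 :+ con 2) :* con 3 :+ con 0 := con 9 :* n :+ con 6) ≡.refl n))

    congruence-27n+15 : ∀ k q l → residue 1F d₂ ≡ k ⊛ q → M ≡ k ℕ.* l → ∀ n → k ∣ c (27 ℕ.* n ℕ.+ 15)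
    congruence-27n+15 k q l e M≡ n = conclude l M≡ (divisible₂ M≈0 ε εi C ε-inverse relation₁ relation₂ relation₃ certificate 1F k q e) n (27 ℕ.* n ℕ.+ 15)
      (at-index (solve 1 (λ n → ((n :* con 3 :+ con 1) :* con 3 :+ con 2) :* con 3 :+ con 0 := con 27 :* n :+ con 15) ≡.refl n))

    congruence-27n+24 : ∀ k q l → residue 2F d₂ ≡ k ⊛ q → M ≡ k ℕ.* l → ∀ n → k ∣ c (27 ℕ.* n ℕ.+ 24)
    congruence-27n+24 k q l e M≡ n = conclude l M≡ (divisible₂ M≈0 ε εi C ε-inverse relation₁ relation₂ relation₃ certificate 2F k q e) n (27 ℕ.* n ℕ.+ 24)
      (F₃-coefficient n)

    congruence-81n+51 : ∀ k q l → residue 2F d₃ ≡ k ⊛ q → M ≡ k ℕ.* l → ∀ n → k ∣ c (81 ℕ.* n ℕ.+ 51)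
    congruence-81n+51 k q l e M≡ n = conclude l M≡ (divisible₃ M≈0 ε εi C ε-inverse relation₁ relation₂ relation₃ certificate 2F k q e) n (81 ℕ.* n ℕ.+ 51)
      (F₄-coefficient n)

    congruence-81n+78 : ∀ k q l → residue 0F d₃ ≡ k ⊛ q → M ≡ k ℕ.* l → ∀ n → k ∣ c (81 ℕ.* n ℕ.+ 78)
    congruence-81n+78 k q l e M≡ n = conclude l M≡ (divisible₃ M≈0 ε εi C ε-inverse relation₁ relation₂ relation₃ certificate 0F k q e) (suc n) (81 ℕ.* n ℕ.+ 78)
      (CommutativeRing.trans ℤ-mod (shifted₀ (F₃ C) n) (CommutativeRing.trans ℤ-mod (F₃-coefficient (n ℕ.* 3 ℕ.+ 2))
        (at-index (solve 1 (λ n → con 27 :* (n :* con 3 :+ con 2) :+ con 24 := con 81 :* n :+ con 78) ≡.refl n))))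

    congruence-243n+132 : ∀ k q l → residue 1F d₄ ≡ k ⊛ q → M ≡ k ℕ.* l → ∀ n → k ∣ c (243 ℕ.* n ℕ.+ 132)
    congruence-243n+132 k q l e M≡ n = conclude l M≡ (divisible₄ M≈0 ε εi C ε-inverse relation₁ relation₂ relation₃ certificate 1F k q e) n (243 ℕ.* n ℕ.+ 132)
      (CommutativeRing.trans ℤ-mod (F₄-coefficient (n ℕ.* 3 ℕ.+ 1))
        (at-index (solve 1 (λ n → con 81 :* (n :* con 3 :+ con 1) :+ con 51 := con 243 :* n :+ con 132) ≡.refl n)))

    congruence-243n+213 : ∀ k q l → residue 2F d₄ ≡ k ⊛ q → M ≡ k ℕ.* l → ∀ n → k ∣ c (243 ℕ.* n ℕ.+ 213)
    congruence-243n+213 k q l e M≡ n = conclude l M≡ (divisible₄ M≈0 ε εi C ε-inverse relation₁ relation₂ relation₃ certificate 2F k q e) n (243 ℕ.* n ℕ.+ 213)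
      (F₅-coefficient n)

    congruence-729n+456 : ∀ k q l → residue 2F d₅ ≡ k ⊛ q → M ≡ k ℕ.* l → ∀ n → k ∣ c (729 ℕ.* n ℕ.+ 456)
    congruence-729n+456 k q l e M≡ n = conclude l M≡ (divisible₅ M≈0 ε εi C ε-inverse relation₁ relation₂ relation₃ certificate 2F k q e) n (729 ℕ.* n ℕ.+ 456)
      (CommutativeRing.trans ℤ-mod (shifted (F₅ C) n) (CommutativeRing.trans ℤ-mod (F₅-coefficient (n ℕ.* 3 ℕ.+ 1))
        (at-index (solve 1 (λ n → con 243 :* (n :* con 3 :+ con 1) :+ con 213 := con 729 :* n :+ con 456) ≡.refl n))))

    congruence-729n+699 : ∀ k q l → residue 0F d₅ ≡ k ⊛ q → M ≡ k ℕ.* l → ∀ n → k ∣ c (729 ℕ.* n ℕ.+ 699)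
    congruence-729n+699 k q l e M≡ n = conclude l M≡ (divisible₅ M≈0 ε εi C ε-inverse relation₁ relation₂ relation₃ certificate 0F k q e) (suc n) (729 ℕ.* n ℕ.+ 699)
      (CommutativeRing.trans ℤ-mod (shifted₀ (F₅ C) n) (CommutativeRing.trans ℤ-mod (F₅-coefficient (n ℕ.* 3 ℕ.+ 2))
        (at-index (solve 1 (λ n → con 243 :* (n :* con 3 :+ con 2) :+ con 213 := con 729 :* n :+ con 699) ≡.refl n))))

modulus : ℕ
modulus = 4782969 -- 3¹⁴

module Residues = Polynomials modulus
module Congruences = ModularSeries modulus (cφ 9) FullRelations.full-relation₃

certificate : Residues.Certificate
certificate = record
  { d₀ = horner-s quartic-coefficients
  ; p₀ = 1 ∷ 13122 ∷ 1771470 ∷ []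
  ; d₁ = times-1+9s (horner-z (1 ∷ 13122 ∷ 1771470 ∷ []))
  ; p₁ = 2047059 ∷ []
  ; d₂ = times-κ (times-1+9s (horner-z (2047059 ∷ [])))
  ; p₂ = 1598697 ∷ 590490 ∷ []
  ; d₃ = times-z (times-1+9s (horner-z (1598697 ∷ 590490 ∷ [])))
  ; p₃ = 682344 ∷ 1594323 ∷ []
  ; d₄ = times-κ (times-1+9s (horner-z (682344 ∷ 1594323 ∷ [])))
  ; p₄ = 531441 ∷ []
  ; d₅ = times-z (times-1+9s (horner-z (531441 ∷ [])))
  ; d₀≡ = ≡.refl ; p₀≡ = ≡.refl ; d₁≡ = ≡.refl ; p₁≡ = ≡.refl ; d₂≡ = ≡.refl ; p₂≡ = ≡.refl
  ; d₃≡ = ≡.refl ; p₃≡ = ≡.refl ; d₄≡ = ≡.refl ; p₄≡ = ≡.refl ; d₅≡ = ≡.refl }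
  where open Residues

open import Data.Nat using (_+_; _*_; _^_)

theorem1p3 : (n : ℕ) →
    (3 ^ 2 ∣ cφ 9 (9 * n + 3)) × (3 ^ 3 ∣ cφ 9 (9 * n + 6))
    × (3 ^ 5 ∣ cφ 9 (27 * n + 15)) × (3 ^ 7 ∣ cφ 9 (27 * n + 24))
    × (3 ^ 8 ∣ cφ 9 (81 * n + 51)) × (3 ^ 9 ∣ cφ 9 (81 * n + 78))
    × (3 ^ 10 ∣ cφ 9 (243 * n + 132)) × (3 ^ 12 ∣ cφ 9 (243 * n + 213))
    × (3 ^ 13 ∣ cφ 9 (729 * n + 456)) × (3 ^ 14 ∣ cφ 9 (729 * n + 699))
theorem1p3 n =
    congruence-9n+3 certificate (3 ^ 2) (1459 ∷ 354294 ∷ []) (3 ^ 12) ≡.refl ≡.refl n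
  , congruence-9n+6 certificate (3 ^ 3) (75817 ∷ []) (3 ^ 11) ≡.refl ≡.refl n
  , congruence-27n+15 certificate (3 ^ 5) (13853 ∷ 567 ∷ []) (3 ^ 9) ≡.refl ≡.refl n
  , congruence-27n+24 certificate (3 ^ 7) (731 ∷ 270 ∷ []) (3 ^ 7) ≡.refl ≡.refl n
  , congruence-81n+51 certificate (3 ^ 8) (104 ∷ 243 ∷ []) (3 ^ 6) ≡.refl ≡.refl n
  , congruence-81n+78 certificate (3 ^ 9) (0 ∷ 68 ∷ []) (3 ^ 5) ≡.refl ≡.refl n
  , congruence-243n+132 certificate (3 ^ 10) (73 ∷ []) (3 ^ 4) ≡.refl ≡.refl n
  , congruence-243n+213 certificate (3 ^ 12) (1 ∷ []) (3 ^ 2) ≡.refl ≡.refl n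
  , congruence-729n+456 certificate (3 ^ 13) (1 ∷ []) (3 ^ 1) ≡.refl ≡.refl n
  , congruence-729n+699 certificate (3 ^ 14) [] (3 ^ 0) ≡.refl ≡.refl n
  where open Congruences
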